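{- Let $k,\ell\ge1$, $\lambda\in\mathrm{Par}^k_\ell$, $\Phi=\Delta^k(\lambda)$, and let $d\ge0$ and $m\in[\ell]$ be integers. Then $$\sum_{S\subset[m],\,|S|=d}H(\Phi;\lambda-\epsilon_S)=\sum_{T\in\mathrm{VSMT}^k_{(d)}(\lambda),\ \mathrm{marks}(T)\subset[m]}t^{\mathrm{spin}(T)}\,\mathfrak s^{(k)}_{\mathrm{inside}(T)},$$ $$\sum_{S\subset[\ell],\,|S|=d,\,\max(S)=m}H(\Phi;\lambda-\epsilon_S)=\sum_{T\in\mathrm{VSMT}^k_{(d)}(\lambda),\ \max(\mathrm{marks}(T))=m}t^{\mathrm{spin}(T)}\,\mathfrak s^{(k)}_{\mathrm{inside}(T)}.$$
   Context: $[a,b]=\{i\in\mathbb Z:a\le i\le b\}$, $[n]=[1,n]$; $\epsilon_i\in\mathbb Z^\ell$ standard basis vectors, $\epsilon_S=\sum_{i\in S}\epsilon_i$. For $\gamma\in\mathbb Z^\ell$, $s_\gamma=\det(h_{\gamma_i+j-i})_{1\le i,j\le\ell}$. $\Delta^+_\ell=\{(i,j):1\le i<j\le\ell\}$. For $\Psi\subset\Delta^+_\ell$ and $\gamma\in\mathbb Z^\ell$, $H(\Psi;\gamma)$ is obtained by expanding $\prod_{(i,j)\in\Psi}(1-tz_i/z_j)^{ -1}z^\gamma$ as a power series in $t$ and applying coefficientwise the linear map $z^\beta\mapsto s_\beta$. $\mathrm{Par}^k_\ell=\{\mu\in\mathbb Z^\ell:k\ge\mu_1\ge\dots\ge\mu_\ell\ge0\}$,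 $\mathrm{Par}^k$ the partitions with largest part $\le k$ (identified with their zero-paddings). $\Delta^k(\mu)=\{(i,j)\in\Delta^+_\ell:k-\mu_i+i<j\}$ and $\mathfrak s^{(k)}_\mu=H(\Delta^k(\mu);\mu)$. Hook length of a box (English notation): boxes below it in its column plus those weakly to its right in its row. A $(k+1)$-core is a partition with no box of hook length $k+1$; $\mathfrak p(\kappa)$ has $r$-th part the number of boxes in row $r$ of $\kappa$ with hook length $\le k$ (a bijection from $(k+1)$-cores to $\mathrm{Par}^k$). A strong cover $\tau\Rightarrow\kappa$: $(k+1)$-cores, $\tau\subset\kappa$, $|\mathfrak p(\tau)|+1=|\mathfrak p(\kappa)|$; a strong marked cover $\tau\xRightarrow{r}\kappa$ adds a positive integer $r$ equal to the smallest row index of some connected component of $\kappa/\tau$; its spin is $c(h-1)+N$ with $c$ the number of components of $\kappa/\tau$, $h$ the common height of each component, $N$ the number of components entirely in rows $>r$. A vertical strong marked tableau of weight $(d)$ is a chain $T=(\kappa^{(0)}\xRightarrow{r_1}\cdots\xRightarrow{r_d}\kappa^{(d)})$ of strong marked covers with $r_1<r_2<\dots<r_d$; $\mathrm{spin}(T)$ is the sum of spins, $\mathrm{inside}(T)=\mathfrak p(\kappa^{(0)})$, $\mathrm{marks}(T)=\{r_1,\dots,r_d\}$; $\mathrm{VSMT}^k_{(d)}(\lambda)$ is the set of these with $\mathfrak p(\kappa^{(d)})=\lambda$. -}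

module Defs where

open import Level using (0ℓ)
open import Data.Bool using (Bool; true; false; _∧_; _∨_; not; if_then_else_)
open import Data.Nat as ℕ using (ℕ; zero; suc; _+_; _∸_; _≡ᵇ_; _<ᵇ_; _≤ᵇ_)
open import Data.Nat.Properties using ()
open import Data.Integer as ℤ using (ℤ; +_; -[1+_])
open import Data.Fin using (Fin; toℕ; punchIn) renaming (zero to fzero; suc to fsuc)
open import Data.Vec as Vec using (Vec; []; _∷_; lookup; tabulate; updateAt)
open import Data.List as List using (List; []; _∷_; length; map; concat; filterᵇ; upTo; drop; allFin; replicate; _++_)
open import Data.Bool.ListAction using (and; or)
open import Data.Nat.ListAction using (sum)
open import Data.Product using (_×_; _,_; proj₁; proj₂)
open import Algebra.Bundles using (CommutativeRing)
open import Relation.Binary.PropositionalEquality using (_≡_)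
open import Data.List.Membership.Propositional using (_∈_)
open import Data.List.Relation.Unary.Unique.Propositional using (Unique)

allᵇ : {A : Set} → (A → Bool) → List A → Bool
allᵇ p xs = and (map p xs)

anyᵇ : {A : Set} → (A → Bool) → List A → Bool
anyᵇ p xs = or (map p xs)

countᵇ : {A : Set} → (A → Bool) → List A → ℕ
countᵇ p xs = length (filterᵇ p xs)

listEqᵇ : List ℕ → List ℕ → Bool
listEqᵇ []       []       = true
listEqᵇ (x ∷ xs) (y ∷ ys) = (x ≡ᵇ y) ∧ listEqᵇ xs ys
listEqᵇ _        _        = false

iterN : {A : Set} → ℕ → (A → A) → A → A
iterN zero    f a = a
iterN (suc n) f a = iterN n f (f a)

-- The ring of symmetric functions Λ is the free commutative ring
-- ℤ[h₁,h₂,…].  An identity in Λ (resp. in Λ[[t]], coefficientwise)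
-- is stated as: it holds after evaluating at an arbitrary sequence
-- h : ℕ → R (h n playing the role of hₙ for n ≥ 1; h 0 is ignored)
-- in an arbitrary commutative ring R.  Conventions h₀ = 1, hₙ = 0 for n < 0.

module Sym (R : CommutativeRing 0ℓ 0ℓ) (h : ℕ → CommutativeRing.Carrier R) where
  open CommutativeRing R using (Carrier; 0#; 1#) renaming (_+_ to _+R_; _*_ to _*R_; -_ to -R_)

  hZ : ℤ → Carrier
  hZ (+ zero)   = 1#
  hZ (+ suc n)  = h (suc n)
  hZ -[1+ n ]   = 0#

  sumFin : ∀ n → (Fin n → Carrier) → Carrier
  sumFin zero    f = 0#
  sumFin (suc n) f = f fzero +R sumFin n (λ i → f (fsuc i))

  sumRange : ℕ → (ℕ → Carrier) → Carrier
  sumRange zero    f = 0#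
  sumRange (suc n) f = sumRange n f +R f n

  sumList : List Carrier → Carrier
  sumList = List.foldr _+R_ 0#

  signFin : ∀ {n} → Fin n → Carrier
  signFin fzero          = 1#
  signFin (fsuc fzero)   = -R 1#
  signFin (fsuc (fsuc i)) = signFin i

  det : ∀ n → (Fin n → Fin n → Carrier) → Carrier
  det zero    M = 1#
  det (suc n) M =
    sumFin (suc n) (λ j → signFin j *R (M fzero j *R det n (λ a b → M (fsuc a) (punchIn j b))))

  s : ∀ {ℓ} → Vec ℤ ℓ → Carrier
  s {ℓ} γ = det ℓ (λ i j → hZ ((lookup γ i ℤ.+ + toℕ j) ℤ.- + toℕ i))

  shift : ∀ {ℓ} → ℕ → Fin ℓ → Fin ℓ → Vec ℤ ℓ → Vec ℤ ℓ
  shift a i j γ = updateAt (updateAt γ i (λ x → x ℤ.+ + a)) j (λ x → x ℤ.- + a)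

  -- Hc Ψ n γ = coefficient of t^n in H(Ψ;γ), i.e. of
  -- ∏_{(i,j)∈Ψ} (1 - t z_i/z_j)^{-1} z^γ, with z^β ↦ s_β
  Hc : ∀ {ℓ} → List (Fin ℓ × Fin ℓ) → ℕ → Vec ℤ ℓ → Carrier
  Hc []             zero    γ = s γ
  Hc []             (suc n) γ = 0#
  Hc ((i , j) ∷ Ψ)  n       γ = sumRange (suc n) (λ a → Hc Ψ (n ∸ a) (shift a i j γ))

-- Root ideals.  Indices are 0-based Fin ℓ (the conditions i<j and
-- k - μ_i + i < j are invariant under shifting i,j by 1).

allPairs : ∀ ℓ → List (Fin ℓ × Fin ℓ)
allPairs ℓ = concat (map (λ i → map (λ j → (i , j)) (allFin ℓ)) (allFin ℓ))

Δk : ∀ {ℓ} → ℕ → Vec ℕ ℓ → List (Fin ℓ × Fin ℓ)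
Δk {ℓ} k μ = filterᵇ (λ p → (toℕ (proj₁ p) <ᵇ toℕ (proj₂ p)) ∧
                             ((k + toℕ (proj₁ p)) <ᵇ (lookup μ (proj₁ p) + toℕ (proj₂ p))))
                     (allPairs ℓ)

toℤVec : ∀ {ℓ} → Vec ℕ ℓ → Vec ℤ ℓ
toℤVec = Vec.map (λ x → + x)

kSchurCoeff : (R : CommutativeRing 0ℓ 0ℓ) (h : ℕ → CommutativeRing.Carrier R) →
              ∀ {ℓ} → ℕ → Vec ℕ ℓ → ℕ → CommutativeRing.Carrier R
kSchurCoeff R h k μ n = Sym.Hc R h (Δk k μ) n (toℤVec μ)

-- Subsets S ⊆ [ℓ] as Bool vectors (entry i, 0-based, ↔ element i+1)

allSubsets : ∀ ℓ → List (Vec Bool ℓ)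
allSubsets zero    = [] ∷ []
allSubsets (suc ℓ) = map (true ∷_) (allSubsets ℓ) ++ map (false ∷_) (allSubsets ℓ)

card : ∀ {ℓ} → Vec Bool ℓ → ℕ
card S = countᵇ (λ b → b) (Vec.toList S)

subsetOfᵇ : ∀ {ℓ} → ℕ → Vec Bool ℓ → Bool
subsetOfᵇ {ℓ} m S = allᵇ (λ i → not (lookup S i) ∨ (suc (toℕ i) ≤ᵇ m)) (allFin ℓ)

-- max(S) = m  (false for S = ∅)
maxIsᵇ : ∀ {ℓ} → ℕ → Vec Bool ℓ → Bool
maxIsᵇ {ℓ} m S = anyᵇ (λ i → lookup S i ∧ (suc (toℕ i) ≡ᵇ m)) (allFin ℓ) ∧ subsetOfᵇ m S

minusEps : ∀ {ℓ} → Vec ℕ ℓ → Vec Bool ℓ → Vec ℤ ℓ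
minusEps λ′ S = Vec.zipWith (λ x b → if b then + x ℤ.- + 1 else + x) λ′ S

-- Partitions as lists of parts, rows and columns 0-based.

part : List ℕ → ℕ → ℕ
part []       r       = 0
part (x ∷ xs) zero    = x
part (x ∷ xs) (suc r) = part xs r

isPartitionᵇ : List ℕ → Bool
isPartitionᵇ []           = true
isPartitionᵇ (x ∷ [])     = 1 ≤ᵇ x
isPartitionᵇ (x ∷ y ∷ xs) = (y ≤ᵇ x) ∧ isPartitionᵇ (y ∷ xs)

Box : Set
Box = ℕ × ℕ

boxes : List ℕ → List Box
boxes κ = concat (map (λ r → map (λ c → (r , c)) (upTo (part κ r))) (upTo (length κ)))

hook : List ℕ → ℕ → ℕ → ℕ
hook κ r c = countᵇ (λ x → c <ᵇ x) (drop (suc r) κ) + (part κ r ∸ c)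

isCoreᵇ : ℕ → List ℕ → Bool
isCoreᵇ k κ = isPartitionᵇ κ ∧ allᵇ (λ b → not (hook κ (proj₁ b) (proj₂ b) ≡ᵇ suc k)) (boxes κ)

pmap : ℕ → List ℕ → List ℕ
pmap k κ = map (λ r → countᵇ (λ c → hook κ r c ≤ᵇ k) (upTo (part κ r))) (upTo (length κ))

sizeP : ℕ → List ℕ → ℕ
sizeP k κ = sum (pmap k κ)

containedᵇ : List ℕ → List ℕ → Bool
containedᵇ τ κ = (length τ ≤ᵇ length κ) ∧ allᵇ (λ r → part τ r ≤ᵇ part κ r) (upTo (length τ))

skew : List ℕ → List ℕ → List Box
skew κ τ = filterᵇ (λ b → part τ (proj₁ b) ≤ᵇ proj₂ b) (boxes κ)

boxEqᵇ : Box → Box → Bool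
boxEqᵇ (r , c) (r′ , c′) = (r ≡ᵇ r′) ∧ (c ≡ᵇ c′)

adjᵇ : Box → Box → Bool
adjᵇ (r , c) (r′ , c′) =
  ((r ≡ᵇ r′) ∧ ((suc c ≡ᵇ c′) ∨ (suc c′ ≡ᵇ c))) ∨ ((c ≡ᵇ c′) ∧ ((suc r ≡ᵇ r′) ∨ (suc r′ ≡ᵇ r)))

stepᵇ : List Box → List Box → List Box
stepᵇ B S = filterᵇ (λ b → anyᵇ (λ x → boxEqᵇ x b ∨ adjᵇ x b) S) B

-- connected component of b in B (listed in the order of B);
-- |B| closure steps suffice since any path has length < |B|
comp : List Box → Box → List Box
comp B b = iterN (length B) (stepᵇ B) (b ∷ [])

firstIsᵇ : List Box → Box → Bool
firstIsᵇ []      b = false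
firstIsᵇ (x ∷ _) b = boxEqᵇ x b

-- the connected components of B (each represented by its B-first box)
components : List Box → List (List Box)
components B = map (comp B) (filterᵇ (λ b → firstIsᵇ (comp B b) b) B)

minRow : List Box → ℕ
minRow []       = 0
minRow (x ∷ xs) = List.foldr (λ b m → ℕ._⊓_ (proj₁ b) m) (proj₁ x) xs

maxRow : List Box → ℕ
maxRow []       = 0
maxRow (x ∷ xs) = List.foldr (λ b m → ℕ._⊔_ (proj₁ b) m) (proj₁ x) xs

height : List Box → ℕ
height C = suc (maxRow C) ∸ minRow C

-- strong marked cover τ =r=> κ  (r is a 1-based row index)
strongMarkedCoverᵇ : ℕ → List ℕ → ℕ → List ℕ → Bool
strongMarkedCoverᵇ k τ r κ =
  isCoreᵇ k τ ∧ isCoreᵇ k κ ∧ containedᵇ τ κ ∧ (suc (sizeP k τ) ≡ᵇ sizeP k κ) ∧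
  anyᵇ (λ C → suc (minRow C) ≡ᵇ r) (components (skew κ τ))

-- spin = Σ_C (height C - 1) + N  (= c(h-1)+N since all components have common height h)
spin : List ℕ → ℕ → List ℕ → ℕ
spin τ r κ = sum (map (λ C → height C ∸ 1) (components (skew κ τ)))
           + countᵇ (λ C → r ≤ᵇ minRow C) (components (skew κ τ))

-- Vertical strong marked tableaux: (κ⁽⁰⁾ , [(r₁,κ⁽¹⁾), …, (r_d,κ⁽ᵈ⁾)])

Tab : Set
Tab = List ℕ × List (ℕ × List ℕ)

chainOKᵇ : ℕ → List ℕ → List (ℕ × List ℕ) → Bool
chainOKᵇ k κ []               = true
chainOKᵇ k κ ((r , κ′) ∷ st)  = strongMarkedCoverᵇ k κ r κ′ ∧ chainOKᵇ k κ′ st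

finalShape : List ℕ → List (ℕ × List ℕ) → List ℕ
finalShape κ []              = κ
finalShape κ ((_ , κ′) ∷ st) = finalShape κ′ st

spinChain : List ℕ → List (ℕ × List ℕ) → ℕ
spinChain κ []              = 0
spinChain κ ((r , κ′) ∷ st) = spin κ r κ′ + spinChain κ′ st

strictIncᵇ : List ℕ → Bool
strictIncᵇ []           = true
strictIncᵇ (x ∷ [])     = true
strictIncᵇ (x ∷ y ∷ xs) = (x <ᵇ y) ∧ strictIncᵇ (y ∷ xs)

marks : Tab → List ℕ
marks T = map proj₁ (proj₂ T)

spinT : Tab → ℕ
spinT T = spinChain (proj₁ T) (proj₂ T)

padEqᵇ : ∀ {ℓ} → List ℕ → Vec ℕ ℓ → Bool
padEqᵇ {ℓ} μ λ′ = listEqᵇ (μ ++ replicate (ℓ ∸ length μ) 0) (Vec.toList λ′)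

isVSMTᵇ : ∀ {ℓ} → ℕ → ℕ → Vec ℕ ℓ → Tab → Bool
isVSMTᵇ k d λ′ T =
  (length (proj₂ T) ≡ᵇ d) ∧ isCoreᵇ k (proj₁ T) ∧ chainOKᵇ k (proj₁ T) (proj₂ T) ∧
  strictIncᵇ (marks T) ∧ padEqᵇ (pmap k (finalShape (proj₁ T) (proj₂ T))) λ′

insideV : ∀ ℓ → ℕ → Tab → Vec ℕ ℓ
insideV ℓ k T = tabulate (λ i → part (pmap k (proj₁ T)) (toℕ i))

marksInᵇ : ℕ → Tab → Bool
marksInᵇ m T = allᵇ (λ r → r ≤ᵇ m) (marks T)

-- max(marks(T)) = m  (false when marks are empty)
marksMaxᵇ : ℕ → Tab → Bool
marksMaxᵇ m T = anyᵇ (λ r → r ≡ᵇ m) (marks T) ∧ marksInᵇ m T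

EnumVSMT : ∀ {ℓ} → ℕ → ℕ → Vec ℕ ℓ → List Tab → Set
EnumVSMT k d λ′ L = Unique L × (∀ T → (T ∈ L → isVSMTᵇ k d λ′ T ≡ true) × (isVSMTᵇ k d λ′ T ≡ true → T ∈ L))

module Sides (R : CommutativeRing 0ℓ 0ℓ) (h : ℕ → CommutativeRing.Carrier R) where
  open CommutativeRing R using (Carrier; 0#; 1#) renaming (_+_ to _+R_; _*_ to _*R_; -_ to -R_)
  open Sym R h

  rhsTerm : ∀ ℓ → ℕ → ℕ → Tab → Carrier
  rhsTerm ℓ k n T = if spinT T ≤ᵇ n then kSchurCoeff R h k (insideV ℓ k T) (n ∸ spinT T) else 0#

  lhs1 : ∀ {ℓ} → ℕ → Vec ℕ ℓ → ℕ → ℕ → ℕ → Carrier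
  lhs1 {ℓ} k λ′ d m n = sumList (map (λ S → Hc (Δk k λ′) n (minusEps λ′ S))
                          (filterᵇ (λ S → (card S ≡ᵇ d) ∧ subsetOfᵇ m S) (allSubsets ℓ)))

  lhs2 : ∀ {ℓ} → ℕ → Vec ℕ ℓ → ℕ → ℕ → ℕ → Carrier
  lhs2 {ℓ} k λ′ d m n = sumList (map (λ S → Hc (Δk k λ′) n (minusEps λ′ S))
                          (filterᵇ (λ S → (card S ≡ᵇ d) ∧ maxIsᵇ m S) (allSubsets ℓ)))

  rhs1 : ℕ → ℕ → List Tab → ℕ → ℕ → Carrier
  rhs1 ℓ k L m n = sumList (map (rhsTerm ℓ k n) (filterᵇ (marksInᵇ m) L))

  rhs2 : ℕ → ℕ → List Tab → ℕ → ℕ → Carrier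
  rhs2 ℓ k L m n = sumList (map (rhsTerm ℓ k n) (filterᵇ (marksMaxᵇ m) L))

{-# OPTIONS --safe #-}
-- The sum over S is absorbed into the linear functional z^β ↦ s_β.  By induction on d it is enough to treat
-- the sets with maximum m, that is H(Φ;λ-ε_m) for the functional summed over the remaining elements < m;
-- it still alternates under the exchange of rows x, x+1 when both are < m or both are ≥ m.
-- Write down r = r + k+1 - λ_r for the first column of row r of Δᵏ(λ).
--
-- Algebra.  Removing the first root of row z gives
-- H(Φ;λ-ε_z) = H(Φ∖(z,down z);λ-ε_z) + t H(Φ;λ-ε_{down z}), so the rows m, down m, down² m, … are visited.
-- If λ_z = λ_{z+1}, the first term is straightened by climbing the bounce graph from z: each step exchanges
-- a mirror for a factor t, and the climb either meets a ceiling, giving 0 by antisymmetry, or the path of z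
-- ends while that of z + 1 goes on to one more row w.  In the latter case λ - ε_z becomes
-- λ - ε_z - ε_{z+1} + ε_w and the argument is repeated with z + 1.
--
-- Combinatorics.  If K is the (k+1)-core of λ, then K_r = λ_r + K_{down r}; the bead K_r - r of row r is moved by
-- down to the bead k+1 below, so bounce paths are runners of the abacus.  The data collected by a
-- successful straightening say exactly that a core is obtained by removing a ribbon of the same height at every row
-- of the climb, and the power of t is the spin.  That every strong cover arises in this way is shown by finding,
-- for any two cores T ⊊ K, such a cover of K that still contains T: one compares the numbers of beads above each
-- position, starting at the first row in which T and K differ and moving down by k+1 until a runner
-- of K starts inside the window where K is strictly ahead.
--
-- The second identity is the difference of two instances of the first.
module Submission where

open import Defs
open import Level using (0ℓ)
open import Data.Fin as Fin using (Fin; toℕ; punchIn) renaming (zero to fzero; suc to fsuc; _≤_ to _≤ᶠ_)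
open import Function using (_∘_; mk⇔; id)
open import Relation.Binary.PropositionalEquality as ≡ using (_≡_; _≢_; refl)
import Data.Nat.Properties as ℕₚ
open import Data.Product using (_×_; _,_; proj₁; proj₂; ∃; ∃₂)
open import Data.Sum using (_⊎_; inj₁; inj₂; [_,_]′)
open import Data.Empty using (⊥-elim; ⊥)
open import Data.List using (List; []; _∷_; map; filter; upTo; _++_; cartesianProduct; filterᵇ; applyUpTo; length; foldr; concat; allFin; replicate; _∷ʳ_; initLast; _∷ʳ′_)
open import Data.List.Membership.Propositional using (_∈_)
open import Data.List.Membership.Propositional.Properties
open import Data.List.Relation.Binary.Permutation.Propositional.Properties using (↭-length; ∈-resp-↭)
open import Data.List.Relation.Unary.All as All using (All; []; _∷_)
open import Data.List.Relation.Unary.Unique.Propositional using (Unique)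
import Data.List.Relation.Unary.Unique.Propositional.Properties as Uniqueₚ
open import Relation.Nullary using (¬_; Dec; yes; no; ¬?; does)
open import Relation.Nullary.Decidable using (_⊎-dec_; map′; dec-true)
import Data.Integer.Properties as ℤₚ
open import Data.Bool using (Bool; true; false; _∧_; _∨_; not; T; T?; if_then_else_)
import Data.Bool.Properties as Boolₚ
import Data.List.Properties as Listₚ
open import Data.Nat.ListAction using (sum)
import Data.List.Relation.Unary.All.Properties as Allₚ
import Data.List.Relation.Unary.AllPairs.Properties as AllPairsₚ
import Data.Fin.Properties as Finₚ
import Data.Vec.Properties as Vecₚ

-- Treating the maximum m separately costs the functional one exchange, that of rows m - 1 and m,
-- and it must be shown that straightening never asks for it. It does not, because every path that
-- is climbed passes through m: the levels up to that of m use rows from m on, the later levels only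
-- rows before m. Hence the algebra is done for an arbitrary functional with prescribed alternation,
-- over a ring in which 2 may be a zero divisor. A cover is recorded by the top row z of its lowest
-- ribbon, the mark by the level at which the path of z meets m. Reaching z from m takes as many
-- factors t as there are ribbons below the mark, and each of the g straightenings climbs all C + 1
-- levels; together this is the spin. The definition of a strong cover asks only for containment and
-- for sizes differing by one, and says nothing about ribbons. The existence of an intermediate
-- cover for every proper containment first shows that size is strictly monotone on cores, and then
-- that τ itself is the intermediate cover.

-- Determinants: exchange of adjacent rows, equal rows, zero rows.

module Determinants where
  open import Algebra.Bundles using (CommutativeRing)
  open import Data.Nat as ℕ using (ℕ; zero; suc; s≤s; s≤s⁻¹)

  module Determinant (R : CommutativeRing 0ℓ 0ℓ) (h : ℕ → CommutativeRing.Carrier R) where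
    open CommutativeRing R renaming (refl to ≈-refl; sym to ≈-sym; trans to ≈-trans)
    open Sym R h
    open import Algebra.Properties.Ring ring
    open import Relation.Binary.Reasoning.Setoid setoid
    open import Algebra.Properties.CommutativeSemigroup *-commutativeSemigroup
      using () renaming (x∙yz≈y∙xz to *-swap)
    open import Algebra.Properties.CommutativeSemigroup +-commutativeSemigroup
      using () renaming (interchange to +-interchange)

    sumFin-cong : ∀ n f g → (∀ i → f i ≈ g i) → sumFin n f ≈ sumFin n g
    sumFin-cong zero    f g e = ≈-refl
    sumFin-cong (suc n) f g e = +-cong (e fzero) (sumFin-cong n _ _ (λ i → e (fsuc i)))

    sumFin-0 : ∀ n f → (∀ i → f i ≈ 0#) → sumFin n f ≈ 0#
    sumFin-0 zero    f e = ≈-refl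
    sumFin-0 (suc n) f e = ≈-trans (+-cong (e fzero) (sumFin-0 n _ (λ i → e (fsuc i)))) (+-identityˡ 0#)

    sumFin-+ : ∀ n f g → sumFin n (λ i → f i + g i) ≈ sumFin n f + sumFin n g
    sumFin-+ zero    f g = ≈-sym (+-identityˡ 0#)
    sumFin-+ (suc n) f g = ≈-trans (+-congˡ (sumFin-+ n _ _)) (+-interchange _ _ _ _)

    sumFin-neg : ∀ n f → sumFin n (λ i → - f i) ≈ - sumFin n f
    sumFin-neg zero    f = ≈-sym -0#≈0#
    sumFin-neg (suc n) f = ≈-trans (+-congˡ (sumFin-neg n _)) (-‿+-comm _ _)

    sumFin-*ˡ : ∀ n c f → sumFin n (λ i → c * f i) ≈ c * sumFin n f
    sumFin-*ˡ zero    c f = ≈-sym (zeroʳ c)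
    sumFin-*ˡ (suc n) c f = ≈-trans (+-congˡ (sumFin-*ˡ n c _)) (≈-sym (distribˡ _ _ _))

    signFin-suc : ∀ {n} (i : Fin n) → signFin (fsuc i) ≈ - signFin i
    signFin-suc fzero           = ≈-refl
    signFin-suc (fsuc fzero)    = ≈-sym (-‿involutive 1#)
    signFin-suc (fsuc (fsuc i)) = signFin-suc i

    det-cong : ∀ n (M M′ : Fin n → Fin n → Carrier) → (∀ i j → M i j ≈ M′ i j) → det n M ≈ det n M′
    det-cong zero    M M′ e = ≈-refl
    det-cong (suc n) M M′ e = sumFin-cong (suc n)
      (λ j → signFin j * (M fzero j * det n (λ a b → M (fsuc a) (punchIn j b))))
      (λ j → signFin j * (M′ fzero j * det n (λ a b → M′ (fsuc a) (punchIn j b)))) λ j →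
      *-congˡ (*-cong (e fzero j) (det-cong n _ _ λ a b → e (fsuc a) (punchIn j b)))

    -- Rows are indexed by natural numbers, so that rows `z` and `suc z` can be named without bounds
    -- and stay nameable after the first row is deleted.
    rowDet : ∀ n → (ℕ → Fin n → Carrier) → Carrier
    rowDet n M = det n (λ i → M (toℕ i))

    lift : ∀ {m n} → (Fin m → Fin n) → Fin (suc m) → Fin (suc n)
    lift φ fzero    = fzero
    lift φ (fsuc x) = fsuc (φ x)

    -- Deleting columns in different orders gives column maps that agree only pointwise, so a family
    -- of minors has to respect pointwise equality.
    Cong : ∀ {m n} → ((Fin m → Fin n) → Carrier) → Set
    Cong N = ∀ {φ φ′} → (∀ x → φ x ≡ φ′ x) → N φ ≈ N φ′

    -- The Laplace expansion along two rows u, v, with N the complementary minors.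
    expand₂ : ∀ n → (u v : Fin (suc (suc n)) → Carrier) → ((Fin n → Fin (suc (suc n))) → Carrier) → Carrier
    expand₂ n u v N = sumFin (suc (suc n)) λ j → signFin j * (u j *
      sumFin (suc n) (λ b → signFin b * (v (punchIn j b) * N (punchIn j ∘ punchIn b))))

    private
      -- The contribution of one row when the other row has taken column 0; `tail` collects the
      -- terms in which neither row takes column 0.
      restricted : ∀ n → (u : Fin (suc (suc n)) → Carrier) → ((Fin n → Fin (suc (suc n))) → Carrier) → Carrier
      restricted n u N = sumFin (suc n) λ b → signFin b * (u (fsuc b) * N (fsuc ∘ punchIn b))

      tail : ∀ n → (u v : Fin (suc (suc n)) → Carrier) → ((Fin n → Fin (suc (suc n))) → Carrier) → Carrier
      tail zero    u v N = 0#
      tail (suc n) u v N = expand₂ n (u ∘ fsuc) (v ∘ fsuc) (N ∘ lift)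

      c*x*-y : ∀ c x y → c * (x * - y) ≈ - (c * (x * y))
      c*x*-y c x y = ≈-trans (*-congˡ (≈-sym (-‿distribʳ-* x y))) (≈-sym (-‿distribʳ-* c _))

      -- Only the index `b` carries a shifted sign on the left, hence a single minus;
      -- `expand₂-split` supplies the second one from the sign of `j`.
      split : ∀ n u v N → Cong N →
        sumFin (suc n) (λ j → signFin j * (u (fsuc j) *
          sumFin n (λ b → signFin (fsuc b) * (v (punchIn (fsuc j) (fsuc b)) * N (punchIn (fsuc j) ∘ punchIn (fsuc b))))))
        ≈ - tail n u v N
      split zero u v N Nc = ≈-trans (+-identityʳ _) (≈-trans (*-congˡ (zeroʳ _)) (≈-trans (zeroʳ _) (≈-sym -0#≈0#)))
      split (suc n) u v N Nc = ≈-trans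
        (sumFin-cong (suc (suc n)) F (λ j → - G j) step)
        (sumFin-neg (suc (suc n)) G)
        where
        f g : Fin (suc (suc n)) → Fin (suc n) → Carrier
        f j b = signFin (fsuc b) * (v (punchIn (fsuc j) (fsuc b)) * N (punchIn (fsuc j) ∘ punchIn (fsuc b)))
        g j b = signFin b * (v (fsuc (punchIn j b)) * N (lift (punchIn j ∘ punchIn b)))
        F G : Fin (suc (suc n)) → Carrier
        F j = signFin j * (u (fsuc j) * sumFin (suc n) (f j))
        G j = signFin j * (u (fsuc j) * sumFin (suc n) (g j))
        lift-punch : ∀ j b x → punchIn (fsuc j) (punchIn (fsuc b) x) ≡ lift (punchIn j ∘ punchIn b) x
        lift-punch j b fzero    = refl
        lift-punch j b (fsuc x) = refl
        f≈-g : ∀ j b → f j b ≈ - g j b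
        f≈-g j b = ≈-trans (*-cong (signFin-suc b) (*-congˡ (Nc (lift-punch j b)))) (≈-sym (-‿distribˡ-* _ _))
        step : ∀ j → F j ≈ - G j
        step j = ≈-trans
          (*-congˡ (*-congˡ (≈-trans (sumFin-cong (suc n) (f j) (λ b → - g j b) (f≈-g j)) (sumFin-neg (suc n) (g j)))))
          (c*x*-y _ _ _)

      -- The terms are sorted by the row that takes column 0, if any. The two mixed contributions
      -- enter with opposite signs, so exchange and equality of rows reduce to `tail`, which has one
      -- column fewer.
      expand₂-split : ∀ n u v N → Cong N →
        expand₂ n u v N ≈ (u fzero * restricted n v N + - (v fzero * restricted n u N)) + tail n u v N
      expand₂-split n u v N Nc = ≈-trans (+-cong (*-identityˡ _) rest) (≈-sym (+-assoc _ _ _))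
        where
        f : Fin (suc n) → Fin n → Carrier
        f j b = signFin (fsuc b) * (v (punchIn (fsuc j) (fsuc b)) * N (punchIn (fsuc j) ∘ punchIn (fsuc b)))
        a c F : Fin (suc n) → Carrier
        a j = signFin j * (u (fsuc j) * N (fsuc ∘ punchIn j))
        c j = signFin j * (u (fsuc j) * sumFin n (f j))
        F j = signFin (fsuc j) * (u (fsuc j) *
                sumFin (suc n) (λ b → signFin b * (v (punchIn (fsuc j) b) * N (punchIn (fsuc j) ∘ punchIn b))))
        step : ∀ j → F j ≈ - (v fzero * a j + c j)
        step j = begin
          signFin (fsuc j) * (u (fsuc j) * (1# * (v fzero * N (fsuc ∘ punchIn j)) + sumFin n (f j)))
            ≈⟨ *-cong (signFin-suc j) (≈-trans (*-congˡ (+-congʳ (*-identityˡ _))) (distribˡ _ _ _)) ⟩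
          - signFin j * (u (fsuc j) * (v fzero * N (fsuc ∘ punchIn j)) + u (fsuc j) * sumFin n (f j))
            ≈⟨ ≈-trans (≈-sym (-‿distribˡ-* _ _)) (-‿cong (distribˡ _ _ _)) ⟩
          - (signFin j * (u (fsuc j) * (v fzero * N (fsuc ∘ punchIn j))) + c j)
            ≈⟨ -‿cong (+-congʳ (≈-trans (*-congˡ (*-swap _ _ _)) (*-swap _ _ _))) ⟩
          - (v fzero * a j + c j) ∎
        rest : sumFin (suc n) F ≈ - (v fzero * restricted n u N) + tail n u v N
        rest = begin
          sumFin (suc n) F
            ≈⟨ sumFin-cong (suc n) F (λ j → - (v fzero * a j + c j)) step ⟩
          sumFin (suc n) (λ j → - (v fzero * a j + c j))
            ≈⟨ sumFin-neg (suc n) (λ j → v fzero * a j + c j) ⟩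
          - sumFin (suc n) (λ j → v fzero * a j + c j)
            ≈⟨ -‿cong (sumFin-+ (suc n) (λ j → v fzero * a j) c) ⟩
          - (sumFin (suc n) (λ j → v fzero * a j) + sumFin (suc n) c)
            ≈⟨ -‿cong (+-cong (sumFin-*ˡ (suc n) _ a) (split n u v N Nc)) ⟩
          - (v fzero * sumFin (suc n) a + - tail n u v N)
            ≈⟨ ≈-sym (-‿+-comm _ _) ⟩
          - (v fzero * sumFin (suc n) a) + - - tail n u v N
            ≈⟨ +-congˡ (-‿involutive _) ⟩
          - (v fzero * restricted n u N) + tail n u v N ∎

      lift-cong : ∀ {m n} {N : (Fin (suc m) → Fin (suc n)) → Carrier} → Cong N → Cong (N ∘ lift)
      lift-cong Nc e = Nc λ { fzero → refl ; (fsuc x) → ≡.cong fsuc (e x) }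

    -- Antisymmetry would give only that twice the expansion is zero, and 2 may be a zero divisor;
    -- hence a separate induction.
    expand₂-equal : ∀ n u N → Cong N → expand₂ n u u N ≈ 0#
    expand₂-equal n u N Nc = begin
      expand₂ n u u N ≈⟨ expand₂-split n u u N Nc ⟩
      _ ≈⟨ +-cong (-‿inverseʳ _) (tail0 n u N Nc) ⟩
      0# + 0# ≈⟨ +-identityˡ 0# ⟩
      0# ∎
      where
      tail0 : ∀ n u N → Cong N → tail n u u N ≈ 0#
      tail0 zero    u N Nc = ≈-refl
      tail0 (suc n) u N Nc = expand₂-equal n (u ∘ fsuc) (N ∘ lift) (lift-cong {N = N} Nc)

    cancel-cross : ∀ x y a b → (x + - y + a) + (y + - x + b) ≈ a + b
    cancel-cross x y a b = begin
      (x + - y + a) + (y + - x + b) ≈⟨ +-interchange _ _ _ _ ⟩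
      (x + - y + (y + - x)) + (a + b) ≈⟨ +-congʳ (+-congˡ (+-comm y (- x))) ⟩
      (x + - y + (- x + y)) + (a + b) ≈⟨ +-congʳ (+-interchange _ _ _ _) ⟩
      (x + - x + (- y + y)) + (a + b) ≈⟨ +-congʳ (+-cong (-‿inverseʳ x) (-‿inverseˡ y)) ⟩
      0# + 0# + (a + b) ≈⟨ +-congʳ (+-identityˡ 0#) ⟩
      0# + (a + b) ≈⟨ +-identityˡ _ ⟩
      a + b ∎

    expand₂-swap : ∀ n u v N → Cong N → expand₂ n u v N + expand₂ n v u N ≈ 0#
    expand₂-swap n u v N Nc = begin
      expand₂ n u v N + expand₂ n v u N ≈⟨ +-cong (expand₂-split n u v N Nc) (expand₂-split n v u N Nc) ⟩
      _ ≈⟨ cancel-cross _ _ _ _ ⟩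
      tail n u v N + tail n v u N ≈⟨ tail0 n u v N Nc ⟩
      0# ∎
      where
      tail0 : ∀ n u v N → Cong N → tail n u v N + tail n v u N ≈ 0#
      tail0 zero    u v N Nc = +-identityˡ 0#
      tail0 (suc n) u v N Nc = expand₂-swap n (u ∘ fsuc) (v ∘ fsuc) (N ∘ lift) (lift-cong {N = N} Nc)

    private
      minors : ∀ n → (ℕ → Fin (suc (suc n)) → Carrier) → (Fin n → Fin (suc (suc n))) → Carrier
      minors n M φ = rowDet n (λ a x → M (suc (suc a)) (φ x))

      minors-cong : ∀ n M → Cong (minors n M)
      minors-cong n M {φ} {φ′} e = det-cong n _ _ λ a x → reflexive (≡.cong (M (suc (suc (toℕ a)))) (e x))

      rowDet-expand₂ : ∀ n M u v N → (∀ b → M 0 b ≈ u b) → (∀ b → M 1 b ≈ v b) → (∀ φ → minors n M φ ≈ N φ) →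
        rowDet (suc (suc n)) M ≈ expand₂ n u v N
      rowDet-expand₂ n M u v N e₀ e₁ eN = sumFin-cong (suc (suc n))
        (λ j → signFin j * (M 0 j * sumFin (suc n) (λ b → signFin b * (M 1 (punchIn j b) * minors n M (punchIn j ∘ punchIn b)))))
        (λ j → signFin j * (u j * sumFin (suc n) (λ b → signFin b * (v (punchIn j b) * N (punchIn j ∘ punchIn b)))))
        λ j → *-congˡ (*-cong (e₀ j) (sumFin-cong (suc n)
          (λ b → signFin b * (M 1 (punchIn j b) * minors n M (punchIn j ∘ punchIn b)))
          (λ b → signFin b * (v (punchIn j b) * N (punchIn j ∘ punchIn b)))
          λ b → *-congˡ (*-cong (e₁ _) (eN _))))

      term : ∀ n → (ℕ → Fin (suc n) → Carrier) → Fin (suc n) → Carrier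
      term n M j = signFin j * (M 0 j * rowDet n (λ a b → M (suc a) (punchIn j b)))

    -- Expanding `z` times along the first row, which both matrices share, brings the exchanged rows
    -- to the top.
    rowDet-swap : ∀ z n M M′ → suc z ℕ.< n →
      (∀ b → M z b ≈ M′ (suc z) b) → (∀ b → M (suc z) b ≈ M′ z b) →
      (∀ i → i ≢ z → i ≢ suc z → ∀ b → M i b ≈ M′ i b) → rowDet n M + rowDet n M′ ≈ 0#
    rowDet-swap zero (suc (suc n)) M M′ _ e₀ e₁ e = begin
      rowDet (suc (suc n)) M + rowDet (suc (suc n)) M′
        ≈⟨ +-cong (rowDet-expand₂ n M (M 0) (M 1) (minors n M) (λ _ → ≈-refl) (λ _ → ≈-refl) (λ _ → ≈-refl))
                  (rowDet-expand₂ n M′ (M 1) (M 0) (minors n M) (λ b → ≈-sym (e₁ b)) (λ b → ≈-sym (e₀ b))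
                    (λ φ → det-cong n _ _ λ a x → ≈-sym (e (suc (suc (toℕ a))) (λ ()) (λ ()) (φ x)))) ⟩
      expand₂ n (M 0) (M 1) (minors n M) + expand₂ n (M 1) (M 0) (minors n M)
        ≈⟨ expand₂-swap n (M 0) (M 1) (minors n M) (minors-cong n M) ⟩
      0# ∎
    rowDet-swap zero (suc zero) M M′ (s≤s ())
    rowDet-swap (suc z) (suc n) M M′ lt e₀ e₁ e = begin
      rowDet (suc n) M + rowDet (suc n) M′ ≈⟨ ≈-sym (sumFin-+ (suc n) (term n M) (term n M′)) ⟩
      sumFin (suc n) (λ j → term n M j + term n M′ j) ≈⟨ sumFin-0 (suc n) (λ j → term n M j + term n M′ j) step ⟩
      0# ∎
      where
      step : ∀ j → term n M j + term n M′ j ≈ 0#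
      step j = begin
        term n M j + term n M′ j
          ≈⟨ +-congˡ (*-congˡ (*-congʳ (≈-sym (e 0 (λ ()) (λ ()) j)))) ⟩
        signFin j * (M 0 j * _) + signFin j * (M 0 j * _)
          ≈⟨ ≈-trans (≈-sym (distribˡ _ _ _)) (*-congˡ (≈-sym (distribˡ _ _ _))) ⟩
        signFin j * (M 0 j * (rowDet n (λ a b → M (suc a) (punchIn j b)) + rowDet n (λ a b → M′ (suc a) (punchIn j b))))
          ≈⟨ *-congˡ (*-congˡ (rowDet-swap z n _ _ (s≤s⁻¹ lt) (λ b → e₀ _) (λ b → e₁ _)
               (λ i i≢z i≢sz b → e (suc i) (i≢z ∘ ≡.cong ℕ.pred) (i≢sz ∘ ≡.cong ℕ.pred) _))) ⟩
        signFin j * (M 0 j * 0#) ≈⟨ ≈-trans (*-congˡ (zeroʳ _)) (zeroʳ _) ⟩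
        0# ∎

    rowDet-equal : ∀ z n M → suc z ℕ.< n → (∀ b → M z b ≈ M (suc z) b) → rowDet n M ≈ 0#
    rowDet-equal zero (suc (suc n)) M _ e = ≈-trans
      (rowDet-expand₂ n M (M 0) (M 0) (minors n M) (λ _ → ≈-refl) (λ b → ≈-sym (e b)) (λ _ → ≈-refl))
      (expand₂-equal n (M 0) (minors n M) (minors-cong n M))
    rowDet-equal zero (suc zero) M (s≤s ())
    rowDet-equal (suc z) (suc n) M lt e = sumFin-0 (suc n) (term n M) λ j →
      ≈-trans (*-congˡ (≈-trans (*-congˡ (rowDet-equal z n _ (s≤s⁻¹ lt) (λ b → e _))) (zeroʳ _))) (zeroʳ _)

    rowDet-zero : ∀ z n M → z ℕ.< n → (∀ b → M z b ≈ 0#) → rowDet n M ≈ 0#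
    rowDet-zero zero    (suc n) M lt e = sumFin-0 (suc n) (term n M) λ j →
      ≈-trans (*-congˡ (≈-trans (*-congʳ (e j)) (zeroˡ _))) (zeroʳ _)
    rowDet-zero (suc z) (suc n) M lt e = sumFin-0 (suc n) (term n M) λ j →
      ≈-trans (*-congˡ (≈-trans (*-congˡ (rowDet-zero z n _ (s≤s⁻¹ lt) (λ b → e _))) (zeroʳ _))) (zeroʳ _)

-- Raising operators applied to a functional, and when they preserve antisymmetry.

module RaisingOperators where
  open import Algebra.Bundles using (CommutativeRing)
  open import Data.Nat as ℕ using (ℕ; zero; suc; _≟_)
  open import Data.Integer as ℤ using (ℤ; +_)
  open import Data.Integer.Tactic.RingSolver using (solve-∀)
  open import Data.List.Membership.Propositional.Properties.WithK using (unique∧set⇒bag)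
  open import Data.List.Relation.Binary.BagAndSetEquality using (∼bag⇒↭)
  open import Data.List.Relation.Binary.Permutation.Propositional using (_↭_; ↭-sym; prep; swap; trans; refl)
  open import Data.List.Relation.Binary.Permutation.Propositional.Properties using (shift)
  open import Data.List.Relation.Unary.Any using (here; there)
  open import Data.List.Relation.Unary.AllPairs using ([]; _∷_)
  open Determinants

  -- The tool for reindexing: where order is irrelevant, two lists without repetitions need only be
  -- compared by membership.
  unique-set⇒↭ : ∀ {A : Set} {xs ys : List A} → Unique xs → Unique ys →
    (∀ {x} → x ∈ xs → x ∈ ys) → (∀ {x} → x ∈ ys → x ∈ xs) → xs ↭ ys
  unique-set⇒↭ u v f g = ∼bag⇒↭ (unique∧set⇒bag u v (mk⇔ f g))

  -- Weights are defined on all of ℕ, so that rows need no bounds; the determinant reads only the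
  -- entries below ℓ.
  Weight : Set
  Weight = ℕ → ℤ

  Root : Set
  Root = ℕ × ℕ

  infix 4 _≗_
  _≗_ : Weight → Weight → Set
  γ ≗ γ′ = ∀ r → γ r ≡ γ′ r

  δ : ℕ → ℕ → ℤ
  δ i r with i ≟ r
  ... | yes _ = + 1
  ... | no  _ = + 0

  δ-≡ : ∀ {i r} → i ≡ r → δ i r ≡ + 1
  δ-≡ {i} {r} e with i ≟ r
  ... | yes _ = refl
  ... | no ne = ⊥-elim (ne e)

  δ-≢ : ∀ {i r} → i ≢ r → δ i r ≡ + 0
  δ-≢ {i} {r} ne with i ≟ r
  ... | yes e = ⊥-elim (ne e)
  ... | no  _ = refl

  infixl 6 _⊕_ _⊖ε_
  _⊕_ : Weight → Root → Weight
  (γ ⊕ (i , j)) r = γ r ℤ.+ δ i r ℤ.- δ j r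

  _⊖ε_ : Weight → ℕ → Weight
  (γ ⊖ε i) r = γ r ℤ.- δ i r

  ⊕-cong : ∀ {γ γ′} α → γ ≗ γ′ → γ ⊕ α ≗ γ′ ⊕ α
  ⊕-cong (i , j) e r = ≡.cong (λ x → x ℤ.+ δ i r ℤ.- δ j r) (e r)

  ⊖ε-cong : ∀ {γ γ′} i → γ ≗ γ′ → γ ⊖ε i ≗ γ′ ⊖ε i
  ⊖ε-cong i e r = ≡.cong (λ x → x ℤ.- δ i r) (e r)

  ⊕-comm : ∀ γ α β → γ ⊕ α ⊕ β ≗ γ ⊕ β ⊕ α
  ⊕-comm γ (i , j) (i′ , j′) r = identity (γ r) (δ i r) (δ j r) (δ i′ r) (δ j′ r)
    where
    identity : ∀ g a b c d → g ℤ.+ a ℤ.- b ℤ.+ c ℤ.- d ≡ g ℤ.+ c ℤ.- d ℤ.+ a ℤ.- b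
    identity = solve-∀

  ⊕-⊖ε : ∀ γ α k → γ ⊕ α ⊖ε k ≗ γ ⊖ε k ⊕ α
  ⊕-⊖ε γ (i , j) k r = identity (γ r) (δ i r) (δ j r) (δ k r)
    where
    identity : ∀ g a b c → g ℤ.+ a ℤ.- b ℤ.- c ≡ g ℤ.- c ℤ.+ a ℤ.- b
    identity = solve-∀

  ⊖ε-comm : ∀ γ i j → γ ⊖ε i ⊖ε j ≗ γ ⊖ε j ⊖ε i
  ⊖ε-comm γ i j r = identity (γ r) (δ i r) (δ j r)
    where
    identity : ∀ g a b → g ℤ.- a ℤ.- b ≡ g ℤ.- b ℤ.- a
    identity = solve-∀

  -- Since s_γ has rows h_{γ_i + j - i}, exchanging rows z and z+1 of the
  -- determinant replaces (γ_z , γ_{z+1}) by (γ_{z+1} - 1 , γ_z + 1).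
  record Swap (z : ℕ) (γ γ′ : Weight) : Set where
    constructor mkSwap
    field
      lower : γ′ z ℤ.+ + 1 ≡ γ (suc z)
      upper : γ′ (suc z) ≡ γ z ℤ.+ + 1
      other : ∀ r → r ≢ z → r ≢ suc z → γ′ r ≡ γ r

  record Fixed (z : ℕ) (γ : Weight) : Set where
    constructor mkFixed
    field
      fixes : γ z ℤ.+ + 1 ≡ γ (suc z)

  σ : ℕ → ℕ → ℕ
  σ z i with i ≟ z | i ≟ suc z
  ... | yes _ | _     = suc z
  ... | no _  | yes _ = z
  ... | no _  | no _  = i

  σ-lower : ∀ z → σ z z ≡ suc z
  σ-lower z with z ≟ z
  ... | yes _ = refl
  ... | no ne = ⊥-elim (ne refl)

  σ-upper : ∀ z → σ z (suc z) ≡ z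
  σ-upper z with suc z ≟ z | suc z ≟ suc z
  ... | yes () | _
  ... | no _ | yes _ = refl
  ... | no _ | no ne = ⊥-elim (ne refl)

  σ-other : ∀ z {i} → i ≢ z → i ≢ suc z → σ z i ≡ i
  σ-other z {i} a b with i ≟ z | i ≟ suc z
  ... | yes e | _     = ⊥-elim (a e)
  ... | no _  | yes e = ⊥-elim (b e)
  ... | no _  | no _  = refl

  σ-involutive : ∀ z i → σ z (σ z i) ≡ i
  σ-involutive z i with i ≟ z | i ≟ suc z
  ... | yes e | _     = ≡.trans (σ-upper z) (≡.sym e)
  ... | no _  | yes e = ≡.trans (σ-lower z) (≡.sym e)
  ... | no a  | no b  = σ-other z a b

  σ-injective : ∀ z {i j} → σ z i ≡ σ z j → i ≡ j
  σ-injective z {i} {j} e = ≡.trans (≡.sym (σ-involutive z i)) (≡.trans (≡.cong (σ z) e) (σ-involutive z j))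

  δ-σ : ∀ z i r → δ (σ z i) (σ z r) ≡ δ i r
  δ-σ z i r = go (i ≟ r)
    where
    go : Dec (i ≡ r) → _
    go (yes e) = ≡.trans (δ-≡ (≡.cong (σ z) e)) (≡.sym (δ-≡ e))
    go (no ne) = ≡.trans (δ-≢ (ne ∘ σ-injective z)) (≡.sym (δ-≢ ne))

  σ² : ℕ → Root → Root
  σ² z (i , j) = σ z i , σ z j

  Swap-⊕ : ∀ {z γ γ′} α → Swap z γ γ′ → Swap z (γ ⊕ α) (γ′ ⊕ σ² z α)
  Swap-⊕ {z} {γ} {γ′} (i , j) (mkSwap l u o) = mkSwap
    (≡.trans (id₁ (γ′ z) _ _) (≡.cong₂ ℤ._-_ (≡.cong₂ ℤ._+_ l (shiftδ i)) (shiftδ j)))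
    (≡.trans (≡.cong₂ ℤ._-_ (≡.cong₂ ℤ._+_ u (shiftδ′ i)) (shiftδ′ j)) (id₂ (γ z) _ _))
    (λ r r≢z r≢sz → ≡.cong₂ ℤ._-_ (≡.cong₂ ℤ._+_ (o r r≢z r≢sz) (otherδ i r≢z r≢sz)) (otherδ j r≢z r≢sz))
    where
    shiftδ : ∀ i → δ (σ z i) z ≡ δ i (suc z)
    shiftδ i = ≡.trans (≡.cong (δ (σ z i)) (≡.sym (σ-upper z))) (δ-σ z i (suc z))
    shiftδ′ : ∀ i → δ (σ z i) (suc z) ≡ δ i z
    shiftδ′ i = ≡.trans (≡.cong (δ (σ z i)) (≡.sym (σ-lower z))) (δ-σ z i z)
    otherδ : ∀ i {r} → r ≢ z → r ≢ suc z → δ (σ z i) r ≡ δ i r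
    otherδ i {r} a b = ≡.trans (≡.cong (δ (σ z i)) (≡.sym (σ-other z a b))) (δ-σ z i r)
    id₁ : ∀ g a b → g ℤ.+ a ℤ.- b ℤ.+ + 1 ≡ g ℤ.+ + 1 ℤ.+ a ℤ.- b
    id₁ = solve-∀
    id₂ : ∀ g a b → g ℤ.+ + 1 ℤ.+ a ℤ.- b ≡ g ℤ.+ a ℤ.- b ℤ.+ + 1
    id₂ = solve-∀

  Swap-⊖ε : ∀ {z γ γ′} i → Swap z γ γ′ → Swap z (γ ⊖ε i) (γ′ ⊖ε σ z i)
  Swap-⊖ε {z} {γ} {γ′} i (mkSwap l u o) = mkSwap
    (≡.trans (id₁ (γ′ z) _) (≡.cong₂ ℤ._-_ l
      (≡.trans (≡.cong (δ (σ z i)) (≡.sym (σ-upper z))) (δ-σ z i (suc z)))))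
    (≡.trans (≡.cong₂ ℤ._-_ u (≡.trans (≡.cong (δ (σ z i)) (≡.sym (σ-lower z))) (δ-σ z i z))) (id₂ (γ z) _))
    (λ r a b → ≡.cong₂ ℤ._-_ (o r a b)
      (≡.trans (≡.cong (δ (σ z i)) (≡.sym (σ-other z a b))) (δ-σ z i r)))
    where
    id₁ : ∀ g a → g ℤ.- a ℤ.+ + 1 ≡ g ℤ.+ + 1 ℤ.- a
    id₁ = solve-∀
    id₂ : ∀ g a → g ℤ.+ + 1 ℤ.- a ≡ g ℤ.- a ℤ.+ + 1
    id₂ = solve-∀

  Fixed⇒Swap : ∀ {z γ} → Fixed z γ → Swap z γ γ
  Fixed⇒Swap (mkFixed f) = mkSwap f (≡.sym f) (λ _ _ _ → refl)

  Swap⇒Fixed : ∀ {z γ} → Swap z γ γ → Fixed z γ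
  Swap⇒Fixed (mkSwap l _ _) = mkFixed l

  Swap-cong : ∀ {z γ γ′ γ″} → Swap z γ γ′ → γ′ ≗ γ″ → Swap z γ γ″
  Swap-cong {z} (mkSwap l u o) e = mkSwap
    (≡.trans (≡.cong (ℤ._+ + 1) (≡.sym (e z))) l) (≡.trans (≡.sym (e (suc z))) u)
    (λ r a b → ≡.trans (≡.sym (e r)) (o r a b))

  module Functional (R : CommutativeRing 0ℓ 0ℓ) where
    open CommutativeRing R hiding (zero) renaming (refl to ≈-refl; sym to ≈-sym; trans to ≈-trans)
    open import Algebra.Properties.Ring ring
    open import Relation.Binary.Reasoning.Setoid setoid
    open import Algebra.Properties.CommutativeSemigroup +-commutativeSemigroup
      using () renaming (interchange to +-interchange; xy∙z≈xz∙y to +-right-swap)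

    Fun : Set
    Fun = Weight → Carrier

    Ext : Fun → Set
    Ext F = ∀ {γ γ′} → γ ≗ γ′ → F γ ≈ F γ′

    -- H F Ψ n γ is the coefficient of tⁿ in H(Ψ;γ), with the linear map z^β ↦ s_β
    -- replaced by z^β ↦ F β; the recursion is (1 - t z_i/z_j) H(α∷Ψ;γ) = H(Ψ;γ).
    H : Fun → List Root → ℕ → Fun
    H F []      zero    γ = F γ
    H F []      (suc n) γ = 0#
    H F (α ∷ Ψ) zero    γ = H F Ψ zero γ
    H F (α ∷ Ψ) (suc n) γ = H F Ψ (suc n) γ + H F (α ∷ Ψ) n (γ ⊕ α)

    module _ {F : Fun} (F-ext : Ext F) where
      H-ext : ∀ Ψ n → Ext (H F Ψ n)
      H-ext []      zero    e = F-ext e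
      H-ext []      (suc n) e = ≈-refl
      H-ext (α ∷ Ψ) zero    e = H-ext Ψ zero e
      H-ext (α ∷ Ψ) (suc n) e = +-cong (H-ext Ψ (suc n) e) (H-ext (α ∷ Ψ) n (⊕-cong α e))

      -- Each recursion sees only its first factor. Two steps expose `γ ⊕ α`, `γ ⊕ β` and the common
      -- weight `γ ⊕ α ⊕ β`, so the induction hypothesis is needed both one and two degrees lower.
      H-swap : ∀ α β Ψ n γ → H F (α ∷ β ∷ Ψ) n γ ≈ H F (β ∷ α ∷ Ψ) n γ
      H-swap α β Ψ zero          γ = ≈-refl
      H-swap α β Ψ (suc zero)    γ = +-right-swap _ _ _
      H-swap α β Ψ (suc (suc n)) γ = begin
        (a + b) + H F (α ∷ β ∷ Ψ) (suc n) (γ ⊕ α)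
          ≈⟨ +-congˡ (H-swap α β Ψ (suc n) _) ⟩
        (a + b) + (c + H F (β ∷ α ∷ Ψ) n (γ ⊕ α ⊕ β))
          ≈⟨ +-interchange _ _ _ _ ⟩
        (a + c) + (b + H F (β ∷ α ∷ Ψ) n (γ ⊕ α ⊕ β))
          ≈⟨ +-congˡ (+-congˡ (≈-sym (H-swap α β Ψ n _))) ⟩
        (a + c) + (b + H F (α ∷ β ∷ Ψ) n (γ ⊕ α ⊕ β))
          ≈⟨ +-congˡ (+-congˡ (H-ext (α ∷ β ∷ Ψ) n (⊕-comm γ α β))) ⟩
        (a + c) + H F (α ∷ β ∷ Ψ) (suc n) (γ ⊕ β)
          ≈⟨ +-congˡ (H-swap α β Ψ (suc n) _) ⟩
        (a + c) + H F (β ∷ α ∷ Ψ) (suc n) (γ ⊕ β) ∎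
        where
        a = H F Ψ (suc (suc n)) γ
        b = H F (β ∷ Ψ) (suc n) (γ ⊕ β)
        c = H F (α ∷ Ψ) (suc n) (γ ⊕ α)

      H-prep : ∀ α {Ψ Ψ′} → (∀ n γ → H F Ψ n γ ≈ H F Ψ′ n γ) → ∀ n γ → H F (α ∷ Ψ) n γ ≈ H F (α ∷ Ψ′) n γ
      H-prep α e zero    γ = e zero γ
      H-prep α e (suc n) γ = +-cong (e (suc n) γ) (H-prep α e n _)

      H-↭ : ∀ {Ψ Ψ′} → Ψ ↭ Ψ′ → ∀ n γ → H F Ψ n γ ≈ H F Ψ′ n γ
      H-↭ refl         n γ = ≈-refl
      H-↭ (prep α p)   n γ = H-prep α (H-↭ p) n γ
      H-↭ (swap α β p) n γ = ≈-trans (H-swap α β _ n γ) (H-prep β (H-prep α (H-↭ p)) n γ)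
      H-↭ (trans p q)  n γ = ≈-trans (H-↭ p n γ) (H-↭ q n γ)

    H-cong : ∀ {F G} → (∀ γ → F γ ≈ G γ) → ∀ Ψ n γ → H F Ψ n γ ≈ H G Ψ n γ
    H-cong e []      zero    γ = e γ
    H-cong e []      (suc n) γ = ≈-refl
    H-cong e (α ∷ Ψ) zero    γ = H-cong e Ψ zero γ
    H-cong e (α ∷ Ψ) (suc n) γ = +-cong (H-cong e Ψ (suc n) γ) (H-cong e (α ∷ Ψ) n _)

    H-0 : ∀ Ψ n γ → H (λ _ → 0#) Ψ n γ ≈ 0#
    H-0 []      zero    γ = ≈-refl
    H-0 []      (suc n) γ = ≈-refl
    H-0 (α ∷ Ψ) zero    γ = H-0 Ψ zero γ
    H-0 (α ∷ Ψ) (suc n) γ = ≈-trans (+-cong (H-0 Ψ (suc n) γ) (H-0 (α ∷ Ψ) n _)) (+-identityˡ 0#)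

    -- Raising operators commute with the translation by -ε_i; applied once for each index, this
    -- gives `H-E`.
    H-+ : ∀ {F G} → Ext G → ∀ i Ψ n γ → H (λ γ → F γ + G (γ ⊖ε i)) Ψ n γ ≈ H F Ψ n γ + H G Ψ n (γ ⊖ε i)
    H-+ Ge i []      zero    γ = ≈-refl
    H-+ Ge i []      (suc n) γ = ≈-sym (+-identityˡ 0#)
    H-+ Ge i (α ∷ Ψ) zero    γ = H-+ Ge i Ψ zero γ
    H-+ Ge i (α ∷ Ψ) (suc n) γ = ≈-trans
      (+-cong (H-+ Ge i Ψ (suc n) γ)
        (≈-trans (H-+ Ge i (α ∷ Ψ) n _) (+-congˡ (H-ext Ge (α ∷ Ψ) n (⊕-⊖ε γ α i)))))
      (+-interchange _ _ _ _)

    -- `fixed` is an axiom of its own, because `anti` at a fixed weight says only that twice the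
    -- value is zero.
    record Alt (z : ℕ) (F : Fun) : Set where
      constructor mkAlt
      field
        anti  : ∀ {γ γ′} → Swap z γ γ′ → F γ + F γ′ ≈ 0#
        fixed : ∀ {γ} → Fixed z γ → F γ ≈ 0#
    open Alt public

    0+0 : ∀ {a b} → a ≈ 0# → b ≈ 0# → a + b ≈ 0#
    0+0 e f = ≈-trans (+-cong e f) (+-identityˡ 0#)

    module _ {z : ℕ} {F : Fun} (F-ext : Ext F) where

      -- A factor that the exchange leaves alone commutes with it, so both terms of the recursion
      -- for `H` alternate.
      alt-untouched : ∀ α Ψ → σ² z α ≡ α → (∀ n → Alt z (H F Ψ n)) → ∀ n → Alt z (H F (α ∷ Ψ) n)
      alt-untouched α Ψ e A zero    = A zero
      alt-untouched α Ψ e A (suc n) = mkAlt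
        (λ {γ} {γ′} s → ≈-trans (+-interchange _ _ _ _) (0+0 (anti (A (suc n)) s) (anti (alt-untouched α Ψ e A n) (step s))))
        (λ f → 0+0 (fixed (A (suc n)) f) (fixed (alt-untouched α Ψ e A n) (Swap⇒Fixed (step (Fixed⇒Swap f)))))
        where
        step : ∀ {γ γ′} → Swap z γ γ′ → Swap z (γ ⊕ α) (γ′ ⊕ α)
        step {γ} {γ′} s = ≡.subst (λ β → Swap z (γ ⊕ α) (γ′ ⊕ β)) e (Swap-⊕ α s)

      -- For β the mirror image of α and G, H the functionals before and after including both factors,
      -- H_{n+2}(γ) + H_n(γ+α+β) = G_{n+2}(γ) + H_{n+1}(γ+β) + H_{n+1}(γ+α): each side is invariant under γ ↦ sγ.
      alt-pair-step : ∀ α Ψ n → Alt z (H F Ψ (suc (suc n))) →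
        Alt z (H F (α ∷ σ² z α ∷ Ψ) n) → Alt z (H F (α ∷ σ² z α ∷ Ψ) (suc n)) → Alt z (H F (α ∷ σ² z α ∷ Ψ) (suc (suc n)))
      alt-pair-step α Ψ n A IH₀ IH₁ = mkAlt anti′ fixed′
        where
        β = σ² z α
        P = α ∷ β ∷ Ψ
        Swap-β : ∀ {γ γ′} → Swap z γ γ′ → Swap z (γ ⊕ β) (γ′ ⊕ α)
        Swap-β {γ} {γ′} s = ≡.subst (λ a → Swap z (γ ⊕ β) (γ′ ⊕ a))
          (≡.cong₂ _,_ (σ-involutive z _) (σ-involutive z _)) (Swap-⊕ β s)
        Swap-αβ : ∀ {γ γ′} → Swap z γ γ′ → Swap z (γ ⊕ β ⊕ α) (γ′ ⊕ β ⊕ α)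
        Swap-αβ {γ} {γ′} s = Swap-cong (Swap-⊕ α (Swap-β s)) (⊕-comm γ′ α β)
        balance : ∀ γ → H F P (suc (suc n)) γ + H F P n (γ ⊕ β ⊕ α)
                        ≈ H F Ψ (suc (suc n)) γ + (H F P (suc n) (γ ⊕ β) + H F P (suc n) (γ ⊕ α))
        balance γ = begin
          ((g + l) + p) + q ≈⟨ +-assoc _ _ _ ⟩
          (g + l) + (p + q) ≈⟨ +-assoc _ _ _ ⟩
          g + (l + (p + q)) ≈⟨ +-congˡ (≈-trans (+-congˡ (+-comm p q)) (≈-sym (+-assoc l q p))) ⟩
          g + ((l + q) + p) ∎
          where
          g = H F Ψ (suc (suc n)) γ
          l = H F (β ∷ Ψ) (suc n) (γ ⊕ β)
          p = H F P (suc n) (γ ⊕ α)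
          q = H F P n (γ ⊕ β ⊕ α)
        anti′ : ∀ {γ γ′} → Swap z γ γ′ → H F P (suc (suc n)) γ + H F P (suc (suc n)) γ′ ≈ 0#
        anti′ {γ} {γ′} s = begin
          x + x′ ≈⟨ +-identityʳ _ ⟨
          (x + x′) + 0# ≈⟨ +-congˡ (anti IH₀ (Swap-αβ s)) ⟨
          (x + x′) + (y + y′) ≈⟨ +-interchange _ _ _ _ ⟩
          (x + y) + (x′ + y′) ≈⟨ +-cong (balance γ) (balance γ′) ⟩
          (g + (b + a)) + (g′ + (b′ + a′)) ≈⟨ +-interchange _ _ _ _ ⟩
          (g + g′) + ((b + a) + (b′ + a′)) ≈⟨ +-congˡ (≈-trans (+-congˡ (+-comm _ _)) (+-interchange _ _ _ _)) ⟩
          (g + g′) + ((b + a′) + (a + b′))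
            ≈⟨ 0+0 (anti A s) (0+0 (anti IH₁ (Swap-β s)) (anti IH₁ (Swap-⊕ α s))) ⟩
          0# ∎
          where
          x = H F P (suc (suc n)) γ
          x′ = H F P (suc (suc n)) γ′
          y = H F P n (γ ⊕ β ⊕ α)
          y′ = H F P n (γ′ ⊕ β ⊕ α)
          g = H F Ψ (suc (suc n)) γ
          g′ = H F Ψ (suc (suc n)) γ′
          a = H F P (suc n) (γ ⊕ α)
          a′ = H F P (suc n) (γ′ ⊕ α)
          b = H F P (suc n) (γ ⊕ β)
          b′ = H F P (suc n) (γ′ ⊕ β)
        fixed′ : ∀ {γ} → Fixed z γ → H F P (suc (suc n)) γ ≈ 0#
        fixed′ {γ} f = begin
          H F P (suc (suc n)) γ ≈⟨ +-identityʳ _ ⟨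
          H F P (suc (suc n)) γ + 0# ≈⟨ +-congˡ (fixed IH₀ (Swap⇒Fixed (Swap-αβ s))) ⟨
          H F P (suc (suc n)) γ + H F P n (γ ⊕ β ⊕ α) ≈⟨ balance γ ⟩
          H F Ψ (suc (suc n)) γ + (H F P (suc n) (γ ⊕ β) + H F P (suc n) (γ ⊕ α))
            ≈⟨ 0+0 (fixed A f) (anti IH₁ (Swap-β s)) ⟩
          0# ∎
          where s = Fixed⇒Swap f

      alt-pair : ∀ α Ψ → (∀ n → Alt z (H F Ψ n)) → ∀ n → Alt z (H F (α ∷ σ² z α ∷ Ψ) n)
      alt-pair α Ψ A zero = A zero
      alt-pair α Ψ A (suc zero) = mkAlt
        (λ {γ} {γ′} s → begin
          ((H F Ψ 1 γ + H F Ψ 0 (γ ⊕ β)) + H F Ψ 0 (γ ⊕ α)) + ((H F Ψ 1 γ′ + H F Ψ 0 (γ′ ⊕ β)) + H F Ψ 0 (γ′ ⊕ α))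
            ≈⟨ ≈-trans (+-cong (+-assoc _ _ _) (+-assoc _ _ _)) (+-interchange _ _ _ _) ⟩
          (H F Ψ 1 γ + H F Ψ 1 γ′) + ((H F Ψ 0 (γ ⊕ β) + H F Ψ 0 (γ ⊕ α)) + (H F Ψ 0 (γ′ ⊕ β) + H F Ψ 0 (γ′ ⊕ α)))
            ≈⟨ +-cong (anti (A 1) s) (≈-trans (+-congˡ (+-comm _ _)) (+-interchange _ _ _ _)) ⟩
          0# + ((H F Ψ 0 (γ ⊕ β) + H F Ψ 0 (γ′ ⊕ α)) + (H F Ψ 0 (γ ⊕ α) + H F Ψ 0 (γ′ ⊕ β)))
            ≈⟨ 0+0 ≈-refl (0+0 (anti (A 0) (Swap-β s)) (anti (A 0) (Swap-⊕ α s))) ⟩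
          0# ∎)
        (λ {γ} f → ≈-trans (+-assoc _ _ _) (0+0 (fixed (A 1) f) (≈-trans (+-comm _ _) (anti (A 0) (Swap-⊕ α (Fixed⇒Swap f))))))
        where
        β = σ² z α
        Swap-β : ∀ {γ γ′} → Swap z γ γ′ → Swap z (γ ⊕ β) (γ′ ⊕ α)
        Swap-β {γ} {γ′} s = ≡.subst (λ a → Swap z (γ ⊕ β) (γ′ ⊕ a))
          (≡.cong₂ _,_ (σ-involutive z _) (σ-involutive z _)) (Swap-⊕ β s)
      alt-pair α Ψ A (suc (suc n)) = alt-pair-step α Ψ n (A (suc (suc n))) (alt-pair α Ψ A n) (alt-pair α Ψ A (suc n))

      alt-↭ : ∀ {Ψ Ψ′} → Ψ ↭ Ψ′ → (∀ n → Alt z (H F Ψ n)) → ∀ n → Alt z (H F Ψ′ n)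
      alt-↭ p A n = mkAlt
        (λ s → ≈-trans (≈-sym (+-cong (H-↭ F-ext p n _) (H-↭ F-ext p n _))) (anti (A n) s))
        (λ f → ≈-trans (≈-sym (H-↭ F-ext p n _)) (fixed (A n) f))

      alt-all-untouched : Alt z F → ∀ Ψ → (∀ {α} → α ∈ Ψ → σ² z α ≡ α) → ∀ n → Alt z (H F Ψ n)
      alt-all-untouched A []      e zero    = A
      alt-all-untouched A []      e (suc n) = mkAlt (λ _ → +-identityˡ 0#) (λ _ → ≈-refl)
      alt-all-untouched A (α ∷ Ψ) e n =
        alt-untouched α Ψ (e (here refl)) (alt-all-untouched A Ψ (e ∘ there)) n

      alt-pairs : ∀ As Θ → (∀ n → Alt z (H F Θ n)) → ∀ n → Alt z (H F (As ++ map (σ² z) As ++ Θ) n)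
      alt-pairs []       Θ A = A
      alt-pairs (α ∷ As) Θ A = alt-↭ (prep α (↭-sym (shift (σ² z α) As (map (σ² z) As ++ Θ))))
        (alt-pair α (As ++ map (σ² z) As ++ Θ) (alt-pairs As Θ A))

      private
        Touches : ℕ → Root → Set
        Touches r (i , j) = i ≡ r ⊎ j ≡ r

        touches? : ∀ r α → Dec (Touches r α)
        touches? r (i , j) = (i ≟ r) ⊎-dec (j ≟ r)

      -- The product over Ψ is symmetric in the variables `z` and `suc z`, and multiplying by a
      -- symmetric factor preserves antisymmetry. The roots touching `z` are paired with their
      -- mirror images, which touch `suc z`; `indep` keeps the two classes disjoint.
      alt-roots : Alt z F → ∀ Ψ → Unique Ψ → (∀ {α} → α ∈ Ψ → σ² z α ∈ Ψ) →
        (∀ {α} → α ∈ Ψ → ¬ (Touches z α × Touches (suc z) α)) → ∀ n → Alt z (H F Ψ n)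
      alt-roots A Ψ u closed indep = alt-↭ perm (alt-pairs As Θ (alt-all-untouched A Θ Θ-fixed))
        where
        As = filter (touches? z) Ψ
        B = map (σ² z) As
        Θ₁ = filter (¬? ∘ touches? z) Ψ
        Θ = filter (¬? ∘ touches? (suc z)) Θ₁
        Θ-fixed : ∀ {α} → α ∈ Θ → σ² z α ≡ α
        Θ-fixed m with ∈-filter⁻ (¬? ∘ touches? (suc z)) {xs = Θ₁} m
        ... | m₁ , ¬sz with ∈-filter⁻ (¬? ∘ touches? z) {xs = Ψ} m₁
        ... | _ , ¬z = ≡.cong₂ _,_ (σ-other z (¬z ∘ inj₁) (¬sz ∘ inj₁)) (σ-other z (¬z ∘ inj₂) (¬sz ∘ inj₂))
        σ²-touches : ∀ {α} → Touches z α → Touches (suc z) (σ² z α)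
        σ²-touches (inj₁ refl) = inj₁ (σ-lower z)
        σ²-touches (inj₂ refl) = inj₂ (σ-lower z)
        σ²-touches′ : ∀ {α} → Touches (suc z) α → Touches z (σ² z α)
        σ²-touches′ (inj₁ refl) = inj₁ (σ-upper z)
        σ²-touches′ (inj₂ refl) = inj₂ (σ-upper z)
        B⁻ : ∀ {α} → α ∈ B → α ∈ Ψ × Touches (suc z) α
        B⁻ m with ∈-map⁻ (σ² z) m
        ... | β , m′ , refl with ∈-filter⁻ (touches? z) {xs = Ψ} m′
        ... | m″ , t = closed m″ , σ²-touches t
        σ²-inj : ∀ {α β} → σ² z α ≡ σ² z β → α ≡ β
        σ²-inj e = ≡.cong₂ _,_ (σ-injective z (≡.cong proj₁ e)) (σ-injective z (≡.cong proj₂ e))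
        perm : As ++ B ++ Θ ↭ Ψ
        perm = unique-set⇒↭
          (Uniqueₚ.++⁺ (Uniqueₚ.filter⁺ (touches? z) u)
            (Uniqueₚ.++⁺ (Uniqueₚ.map⁺ σ²-inj (Uniqueₚ.filter⁺ (touches? z) u))
              (Uniqueₚ.filter⁺ (¬? ∘ touches? (suc z)) (Uniqueₚ.filter⁺ (¬? ∘ touches? z) u))
              (λ (b , t) → proj₂ (∈-filter⁻ (¬? ∘ touches? (suc z)) {xs = Θ₁} t) (proj₂ (B⁻ b))))
            (λ { (a , m) → disj a (∈-++⁻ B m) }))
          u to from
          where
          disj : ∀ {α} → α ∈ As → ¬ (α ∈ B ⊎ α ∈ Θ)
          disj a (inj₁ b) with ∈-filter⁻ (touches? z) {xs = Ψ} a
          ... | m , t = indep m (t , proj₂ (B⁻ b))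
          disj a (inj₂ t) = proj₂ (∈-filter⁻ (¬? ∘ touches? z) {xs = Ψ}
            (proj₁ (∈-filter⁻ (¬? ∘ touches? (suc z)) {xs = Θ₁} t))) (proj₂ (∈-filter⁻ (touches? z) {xs = Ψ} a))
          to : ∀ {α} → α ∈ As ++ B ++ Θ → α ∈ Ψ
          to m with ∈-++⁻ As m
          ... | inj₁ a = proj₁ (∈-filter⁻ (touches? z) a)
          ... | inj₂ m′ with ∈-++⁻ B m′
          ... | inj₁ b = proj₁ (B⁻ b)
          ... | inj₂ t = proj₁ (∈-filter⁻ (¬? ∘ touches? z) {xs = Ψ}
                           (proj₁ (∈-filter⁻ (¬? ∘ touches? (suc z)) {xs = Θ₁} t)))
          from : ∀ {α} → α ∈ Ψ → α ∈ As ++ B ++ Θ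
          from {α} m with touches? z α
          ... | yes t = ∈-++⁺ˡ (∈-filter⁺ (touches? z) m t)
          ... | no ¬z with touches? (suc z) α
          ... | yes t = ∈-++⁺ʳ As (∈-++⁺ˡ (≡.subst (_∈ B) (≡.cong₂ _,_ (σ-involutive z _) (σ-involutive z _))
                          (∈-map⁺ (σ² z) (∈-filter⁺ (touches? z) (closed m) (σ²-touches′ t)))))
          ... | no ¬sz = ∈-++⁺ʳ As (∈-++⁺ʳ B (∈-filter⁺ (¬? ∘ touches? (suc z)) (∈-filter⁺ (¬? ∘ touches? z) m ¬z) ¬sz))

    -- E is d F γ = Σ F(γ - ε_S) over the d-element subsets S of is.
    E : List ℕ → ℕ → Fun → Fun
    E []       zero    F γ = F γ
    E []       (suc d) F γ = 0#
    E (i ∷ is) zero    F γ = E is zero F γ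
    E (i ∷ is) (suc d) F γ = E is (suc d) F γ + E is d F (γ ⊖ε i)

    E-ext : ∀ is d {F} → Ext F → Ext (E is d F)
    E-ext []       zero    F-ext e = F-ext e
    E-ext []       (suc d) F-ext e = ≈-refl
    E-ext (i ∷ is) zero    F-ext e = E-ext is zero F-ext e
    E-ext (i ∷ is) (suc d) F-ext e = +-cong (E-ext is (suc d) F-ext e) (E-ext is d F-ext (⊖ε-cong i e))

    E-zero : ∀ is F γ → E is zero F γ ≈ F γ
    E-zero []       F γ = ≈-refl
    E-zero (i ∷ is) F γ = E-zero is F γ

    E-prep : ∀ i {is is′ F} → (∀ d γ → E is d F γ ≈ E is′ d F γ) → ∀ d γ → E (i ∷ is) d F γ ≈ E (i ∷ is′) d F γ
    E-prep i e zero    γ = e zero γ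
    E-prep i e (suc d) γ = +-cong (e (suc d) γ) (e d _)

    E-↭ : ∀ {is is′ F} → Ext F → is ↭ is′ → ∀ d γ → E is d F γ ≈ E is′ d F γ
    E-↭ Fe refl         d γ = ≈-refl
    E-↭ Fe (prep i p)   d γ = E-prep i (E-↭ Fe p) d γ
    E-↭ Fe (trans p q)  d γ = ≈-trans (E-↭ Fe p d γ) (E-↭ Fe q d γ)
    E-↭ {F = F} Fe (swap {is} {is′} i j p) d γ =
      ≈-trans (E-prep i {j ∷ is} {j ∷ is′} (E-prep j {is} {is′} (E-↭ Fe p)) d γ) (E-swap d γ)
      where
      E-swap : ∀ d γ → E (i ∷ j ∷ is′) d F γ ≈ E (j ∷ i ∷ is′) d F γ
      E-swap zero          γ = ≈-refl
      E-swap (suc zero)    γ = +-right-swap _ _ _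
      E-swap (suc (suc d)) γ = ≈-trans (+-interchange _ _ _ _)
        (+-congˡ (+-congˡ (E-ext is′ d Fe (⊖ε-comm γ i j))))

    -- This takes the sum over subsets into the functional, where removals of roots no longer see
    -- it.
    H-E : ∀ {F} → Ext F → ∀ is d Ψ n γ → H (E is d F) Ψ n γ ≈ E is d (H F Ψ n) γ
    H-E Fe []       zero    Ψ n γ = ≈-refl
    H-E Fe []       (suc d) Ψ n γ = H-0 Ψ n γ
    H-E Fe (i ∷ is) zero    Ψ n γ = H-E Fe is zero Ψ n γ
    H-E Fe (i ∷ is) (suc d) Ψ n γ = ≈-trans
      (H-+ (E-ext is d Fe) i Ψ n γ) (+-cong (H-E Fe is (suc d) Ψ n γ) (H-E Fe is d Ψ n _))

    module _ {z : ℕ} {F : Fun} (A : Alt z F) where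
      alt-E-untouched : ∀ is → (∀ {i} → i ∈ is → σ z i ≡ i) → ∀ d → Alt z (E is d F)
      alt-E-untouched []       e zero    = A
      alt-E-untouched []       e (suc d) = mkAlt (λ _ → +-identityˡ 0#) (λ _ → ≈-refl)
      alt-E-untouched (i ∷ is) e zero    = alt-E-untouched is (e ∘ there) zero
      alt-E-untouched (i ∷ is) e (suc d) = mkAlt
        (λ s → ≈-trans (+-interchange _ _ _ _) (0+0 (anti (IH (suc d)) s) (anti (IH d) (step s))))
        (λ f → 0+0 (fixed (IH (suc d)) f) (fixed (IH d) (Swap⇒Fixed (step (Fixed⇒Swap f)))))
        where
        IH = alt-E-untouched is (e ∘ there)
        step : ∀ {γ γ′} → Swap z γ γ′ → Swap z (γ ⊖ε i) (γ′ ⊖ε i)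
        step {γ} {γ′} s = ≡.subst (λ k → Swap z (γ ⊖ε i) (γ′ ⊖ε k)) (e (here refl)) (Swap-⊖ε i s)

      -- Choosing neither or both of `z`, `suc z` is symmetric, and the two ways of choosing exactly
      -- one are exchanged with each other.
      alt-E-pair : ∀ is → (∀ d → Alt z (E is d F)) → ∀ d → Alt z (E (z ∷ suc z ∷ is) d F)
      alt-E-pair is A zero = A zero
      alt-E-pair is A (suc zero) = mkAlt
        (λ s → ≈-trans (+-cong (+-assoc _ _ _) (+-assoc _ _ _)) (≈-trans (+-interchange _ _ _ _)
          (0+0 (anti (A 1) s) (≈-trans (+-congˡ (+-comm _ _)) (≈-trans (+-interchange _ _ _ _)
            (0+0 (anti (A 0) (Swap-⊖-upper s)) (anti (A 0) (Swap-⊖-lower s))))))))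
        (λ f → ≈-trans (+-assoc _ _ _) (0+0 (fixed (A 1) f) (≈-trans (+-comm _ _) (anti (A 0) (Swap-⊖-lower (Fixed⇒Swap f))))))
        where
        Swap-⊖-lower : ∀ {γ γ′} → Swap z γ γ′ → Swap z (γ ⊖ε z) (γ′ ⊖ε suc z)
        Swap-⊖-lower {γ} {γ′} s = ≡.subst (λ k → Swap z (γ ⊖ε z) (γ′ ⊖ε k)) (σ-lower z) (Swap-⊖ε z s)
        Swap-⊖-upper : ∀ {γ γ′} → Swap z γ γ′ → Swap z (γ ⊖ε suc z) (γ′ ⊖ε z)
        Swap-⊖-upper {γ} {γ′} s = ≡.subst (λ k → Swap z (γ ⊖ε suc z) (γ′ ⊖ε k)) (σ-upper z) (Swap-⊖ε (suc z) s)
      alt-E-pair is A (suc (suc d)) = mkAlt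
        (λ s → ≈-trans (+-cong (regroup _) (regroup _)) (≈-trans (+-interchange _ _ _ _)
          (0+0 (≈-trans (+-interchange _ _ _ _) (0+0 (anti (A (suc (suc d))) s) (anti (A d) (both s))))
            (≈-trans (+-congˡ (+-comm _ _)) (≈-trans (+-interchange _ _ _ _)
              (0+0 (anti (A (suc d)) (Swap-⊖-upper s)) (anti (A (suc d)) (Swap-⊖-lower s))))))))
        (λ f → ≈-trans (regroup _) (0+0 (0+0 (fixed (A (suc (suc d))) f) (fixed (A d) (Swap⇒Fixed (both (Fixed⇒Swap f)))))
          (≈-trans (+-comm _ _) (anti (A (suc d)) (Swap-⊖-lower (Fixed⇒Swap f))))))
        where
        Swap-⊖-lower : ∀ {γ γ′} → Swap z γ γ′ → Swap z (γ ⊖ε z) (γ′ ⊖ε suc z)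
        Swap-⊖-lower {γ} {γ′} s = ≡.subst (λ k → Swap z (γ ⊖ε z) (γ′ ⊖ε k)) (σ-lower z) (Swap-⊖ε z s)
        Swap-⊖-upper : ∀ {γ γ′} → Swap z γ γ′ → Swap z (γ ⊖ε suc z) (γ′ ⊖ε z)
        Swap-⊖-upper {γ} {γ′} s = ≡.subst (λ k → Swap z (γ ⊖ε suc z) (γ′ ⊖ε k)) (σ-upper z) (Swap-⊖ε (suc z) s)
        both : ∀ {γ γ′} → Swap z γ γ′ → Swap z (γ ⊖ε z ⊖ε suc z) (γ′ ⊖ε z ⊖ε suc z)
        both {γ} {γ′} s = Swap-cong (≡.subst (λ k → Swap z (γ ⊖ε z ⊖ε suc z) (γ′ ⊖ε suc z ⊖ε k)) (σ-upper z) (Swap-⊖ε (suc z) (Swap-⊖-lower s)))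
          (⊖ε-comm γ′ (suc z) z)
        regroup : ∀ γ → E (z ∷ suc z ∷ is) (suc (suc d)) F γ ≈
          (E is (suc (suc d)) F γ + E is d F (γ ⊖ε z ⊖ε suc z)) + (E is (suc d) F (γ ⊖ε suc z) + E is (suc d) F (γ ⊖ε z))
        regroup γ = ≈-trans (+-congˡ (+-comm _ _)) (+-interchange _ _ _ _)

    -- The two rows lie both inside or both outside the index set unless `suc z` is `m`; this is the
    -- one exchange that is lost.
    alt-E-upTo : ∀ {z F} → Ext F → Alt z F → ∀ m → suc z ℕ.< m ⊎ m ℕ.≤ z → ∀ d → Alt z (E (upTo m) d F)
    alt-E-upTo {z} Fe A m (inj₂ m≤z) = alt-E-untouched A (upTo m) λ i∈ →
      σ-other z (ℕₚ.<⇒≢ (ℕₚ.<-≤-trans (∈-upTo⁻ i∈) m≤z)) (ℕₚ.<⇒≢ (ℕₚ.<-≤-trans (∈-upTo⁻ i∈) (ℕₚ.m≤n⇒m≤1+n m≤z)))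
    alt-E-upTo {z} {F} Fe A m (inj₁ sz<m) d = mkAlt
      (λ s → ≈-trans (+-cong (E-↭ Fe perm d _) (E-↭ Fe perm d _)) (anti A′ s))
      (λ f → ≈-trans (E-↭ Fe perm d _) (fixed A′ f))
      where
      q? = λ i → ¬? ((i ≟ z) ⊎-dec (i ≟ suc z))
      rest = filter q? (upTo m)
      A′ : Alt z (E (z ∷ suc z ∷ rest) d F)
      A′ = alt-E-pair A rest (alt-E-untouched A rest λ i∈ → let _ , ne = ∈-filter⁻ q? {xs = upTo m} i∈ in
             σ-other z (ne ∘ inj₁) (ne ∘ inj₂)) d
      perm : upTo m ↭ z ∷ suc z ∷ rest
      perm = unique-set⇒↭ (Uniqueₚ.upTo⁺ m)
        ((ℕₚ.<⇒≢ (ℕₚ.n<1+n z) All.∷ All.tabulate (λ i∈ e → proj₂ (∈-filter⁻ q? {xs = upTo m} i∈) (inj₁ (≡.sym e))))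
         ∷ All.tabulate (λ i∈ e → proj₂ (∈-filter⁻ q? {xs = upTo m} i∈) (inj₂ (≡.sym e)))
         ∷ Uniqueₚ.filter⁺ q? (Uniqueₚ.upTo⁺ m))
        to from
        where
        to : ∀ {i} → i ∈ upTo m → i ∈ z ∷ suc z ∷ rest
        to {i} i∈ with i ≟ z | i ≟ suc z
        ... | yes e | _     = here e
        ... | no _  | yes e = there (here e)
        ... | no a  | no b  = there (there (∈-filter⁺ q? i∈ [ a , b ]′))
        from : ∀ {i} → i ∈ z ∷ suc z ∷ rest → i ∈ upTo m
        from (here refl)         = ∈-upTo⁺ (ℕₚ.<-trans (ℕₚ.n<1+n _) sz<m)
        from (there (here refl)) = ∈-upTo⁺ sz<m
        from (there (there i∈))  = proj₁ (∈-filter⁻ q? i∈)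

-- Straightening with mirrors: climbing a path of the root ideal.

module RootStraightening where
  open import Algebra.Bundles using (CommutativeRing)
  open import Data.Nat as ℕ using (ℕ; zero; suc; s≤s; s≤s⁻¹; _≤?_; _≟_)
  open import Data.Integer as ℤ using (ℤ; +_)
  open import Data.Integer.Tactic.RingSolver using (solve-∀)
  open import Data.List.Relation.Binary.Permutation.Propositional using (_↭_; ↭-sym)
  open import Data.List.Relation.Unary.Any using (here; there)
  open import Data.List.Relation.Unary.AllPairs using (_∷_)
  open Determinants
  open RaisingOperators

  -- A set of roots is described by the first column c i of each row i < ℓ.
  module Rows (ℓ : ℕ) where

    InRoots : (ℕ → ℕ) → Root → Set
    InRoots c (i , j) = c i ℕ.≤ j

    inRoots? : ∀ c α → Dec (InRoots c α)
    inRoots? c (i , j) = c i ≤? j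

    roots : (ℕ → ℕ) → List Root
    roots c = filter (inRoots? c) (cartesianProduct (upTo ℓ) (upTo ℓ))

    roots-unique : ∀ c → Unique (roots c)
    roots-unique c = Uniqueₚ.filter⁺ (inRoots? c) (Uniqueₚ.cartesianProduct⁺ (Uniqueₚ.upTo⁺ ℓ) (Uniqueₚ.upTo⁺ ℓ))

    ∈-roots⁺ : ∀ {c i j} → i ℕ.< ℓ → j ℕ.< ℓ → c i ℕ.≤ j → (i , j) ∈ roots c
    ∈-roots⁺ {c} i<ℓ j<ℓ le = ∈-filter⁺ (inRoots? c) (∈-cartesianProduct⁺ (∈-upTo⁺ i<ℓ) (∈-upTo⁺ j<ℓ)) le

    ∈-roots⁻ : ∀ {c i j} → (i , j) ∈ roots c → i ℕ.< ℓ × j ℕ.< ℓ × c i ℕ.≤ j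
    ∈-roots⁻ {c} m with ∈-filter⁻ (inRoots? c) {xs = cartesianProduct (upTo ℓ) (upTo ℓ)} m
    ... | m′ , le with ∈-cartesianProduct⁻ (upTo ℓ) (upTo ℓ) m′
    ... | a , b = ∈-upTo⁻ a , ∈-upTo⁻ b , le

  upd : (ℕ → ℕ) → ℕ → ℕ → ℕ → ℕ
  upd c ρ v r with r ≟ ρ
  ... | yes _ = v
  ... | no  _ = c r

  upd-≡ : ∀ c ρ v {r} → r ≡ ρ → upd c ρ v r ≡ v
  upd-≡ c ρ v {r} e with r ≟ ρ
  ... | yes _ = refl
  ... | no ne = ⊥-elim (ne e)

  upd-≢ : ∀ c ρ v {r} → r ≢ ρ → upd c ρ v r ≡ c r
  upd-≢ c ρ v {r} ne with r ≟ ρ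
  ... | yes e = ⊥-elim (ne e)
  ... | no _  = refl

  ⊕-other : ∀ γ {i j r} → i ≢ r → j ≢ r → (γ ⊕ (i , j)) r ≡ γ r
  ⊕-other γ {i} {j} {r} a b rewrite δ-≢ a | δ-≢ b = ≡.trans (ℤₚ.+-identityʳ _) (ℤₚ.+-identityʳ _)

  ⊕-source : ∀ γ {i j} → j ≢ i → (γ ⊕ (i , j)) i ≡ γ i ℤ.+ + 1
  ⊕-source γ {i} {j} b rewrite δ-≡ (refl {x = i}) | δ-≢ b = ℤₚ.+-identityʳ _

  ⊕-target : ∀ γ {i j} → i ≢ j → (γ ⊕ (i , j)) j ≡ γ j ℤ.- + 1
  ⊕-target γ {i} {j} b rewrite δ-≡ (refl {x = j}) | δ-≢ b = ≡.cong (ℤ._- + 1) (ℤₚ.+-identityʳ (γ j))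

  -- The entries at `x` and `suc x` both drop by one, so their difference survives. This makes the
  -- terms vanish that arise when a root is inserted or returned.
  Fixed-⊕ : ∀ {x γ w i} → Fixed x γ → w ≢ x → w ≢ suc x → i ≢ x → i ≢ suc x →
    Fixed x (γ ⊕ (w , suc x) ⊕ (i , x))
  Fixed-⊕ {x} {γ} {w} {i} (mkFixed e) w≢x w≢sx i≢x i≢sx = mkFixed (begin
    (γ′ ⊕ (i , x)) x ℤ.+ + 1 ≡⟨ ≡.cong (ℤ._+ + 1) (⊕-target γ′ i≢x) ⟩
    γ′ x ℤ.- + 1 ℤ.+ + 1     ≡⟨ ≡.cong (λ g → g ℤ.- + 1 ℤ.+ + 1) (⊕-other γ w≢x (λ ())) ⟩
    γ x ℤ.- + 1 ℤ.+ + 1      ≡⟨ identity (γ x) ⟩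
    γ x ℤ.+ + 1 ℤ.- + 1      ≡⟨ ≡.cong (ℤ._- + 1) e ⟩
    γ (suc x) ℤ.- + 1        ≡⟨ ⊕-target γ w≢sx ⟨
    γ′ (suc x)               ≡⟨ ⊕-other γ′ i≢sx (λ ()) ⟨
    (γ′ ⊕ (i , x)) (suc x)   ∎)
    where
    open ≡.≡-Reasoning
    γ′ = γ ⊕ (w , suc x)
    identity : ∀ g → g ℤ.- + 1 ℤ.+ + 1 ≡ g ℤ.+ + 1 ℤ.- + 1
    identity = solve-∀

  module Straightening (R : CommutativeRing 0ℓ 0ℓ) (ℓ : ℕ) where
    open CommutativeRing R hiding (zero) renaming (refl to ≈-refl; sym to ≈-sym; trans to ≈-trans)
    open import Relation.Binary.Reasoning.Setoid setoid
    open Functional R public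
    open Rows ℓ public

    -- sh s G lists the coefficients of tˢ · Σ G n tⁿ.
    sh : ℕ → (ℕ → Carrier) → ℕ → Carrier
    sh zero    G n       = G n
    sh (suc s) G zero    = 0#
    sh (suc s) G (suc n) = sh s G n

    sh-cong : ∀ s {G G′} → (∀ n → G n ≈ G′ n) → ∀ n → sh s G n ≈ sh s G′ n
    sh-cong zero    e n       = e n
    sh-cong (suc s) e zero    = ≈-refl
    sh-cong (suc s) e (suc n) = sh-cong s e n

    sh-0 : ∀ s {G} → (∀ n → G n ≈ 0#) → ∀ n → sh s G n ≈ 0#
    sh-0 zero    e n       = e n
    sh-0 (suc s) e zero    = ≈-refl
    sh-0 (suc s) e (suc n) = sh-0 s e n

    sh-+ : ∀ s G G′ n → sh s (λ n → G n + G′ n) n ≈ sh s G n + sh s G′ n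
    sh-+ zero    G G′ n       = ≈-refl
    sh-+ (suc s) G G′ zero    = ≈-sym (+-identityˡ 0#)
    sh-+ (suc s) G G′ (suc n) = sh-+ s G G′ n

    sh-sh : ∀ s s′ G n → sh s (sh s′ G) n ≈ sh (s ℕ.+ s′) G n
    sh-sh zero    s′ G n       = ≈-refl
    sh-sh (suc s) s′ G zero    = ≈-refl
    sh-sh (suc s) s′ G (suc n) = sh-sh s s′ G n

    module Config (F : Fun) (F-ext : Ext F) where

      HC : (ℕ → ℕ) → ℕ → Weight → Carrier
      HC c = H F (roots c)

      HC-ext : ∀ c n {γ γ′} → γ ≗ γ′ → HC c n γ ≈ HC c n γ′
      HC-ext c n e = H-ext F-ext (roots c) n e

      HC-cong : ∀ {c c′} → (∀ r → r ℕ.< ℓ → c r ≡ c′ r) → ∀ n γ → HC c n γ ≈ HC c′ n γ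
      HC-cong {c} {c′} e n γ = H-↭ F-ext
        (unique-set⇒↭ (roots-unique c) (roots-unique c′) (to e) (to λ r lt → ≡.sym (e r lt))) n γ
        where
        to : ∀ {c c′} → (∀ r → r ℕ.< ℓ → c r ≡ c′ r) → ∀ {α} → α ∈ roots c → α ∈ roots c′
        to e m with ∈-roots⁻ m
        ... | a , b , le = ∈-roots⁺ a b (≡.subst (ℕ._≤ _) (e _ a) le)

      -- H(Ψ;γ) = H(Ψ∖α;γ) + t H(Ψ;γ+ε_α) for the first root α of row ρ.
      remove : ∀ {c ρ x} → ρ ℕ.< ℓ → x ℕ.< ℓ → c ρ ≡ x → ∀ n γ →
        HC c n γ ≈ HC (upd c ρ (suc x)) n γ + sh 1 (λ n → HC c n (γ ⊕ (ρ , x))) n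
      remove {c} {ρ} {x} ρ<ℓ x<ℓ cρ n γ = ≈-trans (H-↭ F-ext perm n γ) (expand n)
        where
        c′ = upd c ρ (suc x)
        c≤c′ : ∀ i → c i ℕ.≤ c′ i
        c≤c′ i with i ≟ ρ
        ... | yes refl = ≡.subst (ℕ._≤ suc x) (≡.sym cρ) (ℕₚ.n≤1+n x)
        ... | no _     = ℕₚ.≤-refl
        ∉ : ∀ {α} → α ∈ roots c′ → (ρ , x) ≢ α
        ∉ m refl with ∈-roots⁻ m
        ... | _ , _ , le = ℕₚ.<-irrefl refl (≡.subst (ℕ._≤ x) (upd-≡ c ρ (suc x) refl) le)
        to : ∀ {α} → α ∈ roots c → α ∈ (ρ , x) ∷ roots c′
        to {i , j} m with ∈-roots⁻ m | i ≟ ρ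
        ... | a , b , le | no ne = there (∈-roots⁺ a b (≡.subst (ℕ._≤ j) (≡.sym (upd-≢ c ρ (suc x) ne)) le))
        ... | a , b , le | yes refl with x ≟ j
        ...   | yes refl = here refl
        ...   | no ne = there (∈-roots⁺ a b (≡.subst (ℕ._≤ j) (≡.sym (upd-≡ c ρ (suc x) refl))
                          (ℕₚ.≤∧≢⇒< (≡.subst (ℕ._≤ j) cρ le) ne)))
        from : ∀ {α} → α ∈ (ρ , x) ∷ roots c′ → α ∈ roots c
        from (here refl) = ∈-roots⁺ ρ<ℓ x<ℓ (ℕₚ.≤-reflexive cρ)
        from (there m) with ∈-roots⁻ m
        ... | a , b , le = ∈-roots⁺ a b (ℕₚ.≤-trans (c≤c′ _) le)
        perm : roots c ↭ (ρ , x) ∷ roots c′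
        perm = unique-set⇒↭ (roots-unique c) (All.tabulate ∉ ∷ roots-unique c′) to from
        expand : ∀ n → H F ((ρ , x) ∷ roots c′) n γ ≈ HC c′ n γ + sh 1 (λ n → HC c n (γ ⊕ (ρ , x))) n
        expand zero    = ≈-sym (+-identityʳ _)
        expand (suc n) = +-congˡ (H-↭ F-ext (↭-sym perm) n _)

      -- A row whose start lies outside the square has no roots, and any later start describes the
      -- same set; the stages of the straightening need one particular description.
      retract : ∀ {c ρ v} → ℓ ℕ.≤ c ρ → c ρ ℕ.≤ v → ∀ n γ → HC c n γ ≈ HC (upd c ρ v) n γ
      retract {c} {ρ} {v} ℓ≤ le n γ = H-↭ F-ext (unique-set⇒↭ (roots-unique c) (roots-unique _) to from) n γ
        where
        to : ∀ {α} → α ∈ roots c → α ∈ roots (upd c ρ v)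
        to {i , j} m with ∈-roots⁻ m
        ... | a , b , c≤j with i ≟ ρ
        ...   | yes refl = ⊥-elim (ℕₚ.<⇒≱ b (ℕₚ.≤-trans ℓ≤ c≤j))
        ...   | no ne = ∈-roots⁺ a b (≡.subst (ℕ._≤ j) (≡.sym (upd-≢ c ρ v ne)) c≤j)
        from : ∀ {α} → α ∈ roots (upd c ρ v) → α ∈ roots c
        from {i , j} m with ∈-roots⁻ m
        ... | a , b , c≤j with i ≟ ρ
        ...   | yes refl = ∈-roots⁺ a b (ℕₚ.≤-trans le c≤j)
        ...   | no ne = ∈-roots⁺ a b c≤j

      -- Since rows `z` and `suc z` start together, the set is invariant under exchanging them as
      -- rows; since no row starts in column `suc z`, every row contains both of the columns `z`,
      -- `suc z` or neither. `far` keeps rows `z` and `suc z` away from these columns.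
      alt-HC : ∀ {c z} → suc z ℕ.< ℓ → Alt z F → c z ≡ c (suc z) → suc z ℕ.< c z →
        (∀ r → r ℕ.< ℓ → c r ≢ suc z) → ∀ n → Alt z (HC c n)
      alt-HC {c} {z} sz<ℓ A wall far ceiling =
        alt-roots F-ext A (roots c) (roots-unique c) closed indep
        where
        z<ℓ : z ℕ.< ℓ
        z<ℓ = ℕₚ.<-trans (ℕₚ.n<1+n z) sz<ℓ
        σ<ℓ : ∀ {i} → i ℕ.< ℓ → σ z i ℕ.< ℓ
        σ<ℓ {i} lt with i ≟ z | i ≟ suc z
        ... | yes _ | _     = sz<ℓ
        ... | no _  | yes _ = z<ℓ
        ... | no _  | no _  = lt
        c-σ : ∀ i → c (σ z i) ≡ c i
        c-σ i with i ≟ z | i ≟ suc z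
        ... | yes refl | _        = ≡.sym wall
        ... | no _     | yes refl = wall
        ... | no _     | no _     = refl
        σ-≤ : ∀ {i j} → i ℕ.< ℓ → c i ℕ.≤ j → c i ℕ.≤ σ z j
        σ-≤ {i} {j} i<ℓ le with j ≟ z | j ≟ suc z
        ... | yes refl | _        = ℕₚ.m≤n⇒m≤1+n le
        ... | no _     | yes refl = s≤s⁻¹ (ℕₚ.≤∧≢⇒< le (ceiling i i<ℓ))
        ... | no _     | no _     = le
        closed : ∀ {α} → α ∈ roots c → σ² z α ∈ roots c
        closed {i , j} m with ∈-roots⁻ m
        ... | a , b , le = ∈-roots⁺ (σ<ℓ a) (σ<ℓ b) (≡.subst (ℕ._≤ _) (≡.sym (c-σ i)) (σ-≤ a le))
        indep : ∀ {α} → α ∈ roots c → ¬ ((proj₁ α ≡ z ⊎ proj₂ α ≡ z) × (proj₁ α ≡ suc z ⊎ proj₂ α ≡ suc z))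
        indep {i , j} m (inj₁ refl , inj₁ ())
        indep {i , j} m (inj₁ refl , inj₂ refl) = ℕₚ.<⇒≱ far (proj₂ (proj₂ (∈-roots⁻ m)))
        indep {i , j} m (inj₂ refl , inj₁ refl) =
          ℕₚ.<⇒≱ far (≡.subst (ℕ._≤ suc z) (≡.sym wall) (ℕₚ.m≤n⇒m≤1+n (proj₂ (proj₂ (∈-roots⁻ m)))))
        indep {i , j} m (inj₂ refl , inj₂ ())

      -- All that is needed for vanishing except the ceiling: a row that starts in column `suc x` is
      -- the only possible obstruction.
      record Wall (c : ℕ → ℕ) (γ : Weight) (x : ℕ) : Set where
        constructor mkWall
        field
          inside : suc x ℕ.< ℓ
          altern : Alt x F
          wall   : c x ≡ c (suc x)
          far    : suc x ℕ.< c x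
          fix    : Fixed x γ

      ceiling-0 : ∀ {c γ x} → Wall c γ x → (∀ r → r ℕ.< ℓ → c r ≢ suc x) → ∀ n → HC c n γ ≈ 0#
      ceiling-0 (mkWall i a w f e) ceil n = fixed (alt-HC i a w f ceil n) e

      -- Row `ρ` is the only obstruction to a ceiling. Removing its first root produces the ceiling
      -- and kills that term, so the term with the factor t survives alone.
      push : ∀ {c γ x ρ} → Wall c γ x → ρ ℕ.< x → c ρ ≡ suc x → (∀ r → r ℕ.< ℓ → c r ≡ suc x → r ≡ ρ) →
        ∀ n → HC c n γ ≈ sh 1 (λ n → HC (upd c ρ x) n (γ ⊕ (ρ , suc x))) n
      push {c} {γ} {x} {ρ} (mkWall i a w f (mkFixed e)) ρ<x cρ uniq n = begin
        HC c n γ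
          ≈⟨ remove ρ<ℓ i cρ n γ ⟩
        HC (upd c ρ (suc (suc x))) n γ + sh 1 (λ n → HC c n γ′) n
          ≈⟨ +-cong (ceiling-0 (mkWall i a (upd-wall _) (upd-far _) (mkFixed e)) ceil₁ n) (sh-cong 1 second n) ⟩
        0# + sh 1 (λ n → HC (upd c ρ x) n γ′) n
          ≈⟨ +-identityˡ _ ⟩
        sh 1 (λ n → HC (upd c ρ x) n γ′) n ∎
        where
        γ′ = γ ⊕ (ρ , suc x)
        x<ℓ = ℕₚ.<-trans (ℕₚ.n<1+n x) i
        ρ<ℓ = ℕₚ.<-trans ρ<x x<ℓ
        ρ≢x : ρ ≢ x
        ρ≢x = ℕₚ.<⇒≢ ρ<x
        ρ≢sx : ρ ≢ suc x
        ρ≢sx = ℕₚ.<⇒≢ (ℕₚ.m<n⇒m<1+n ρ<x)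
        upd-wall : ∀ v → upd c ρ v x ≡ upd c ρ v (suc x)
        upd-wall v = ≡.trans (upd-≢ c ρ v (ρ≢x ∘ ≡.sym)) (≡.trans w (≡.sym (upd-≢ c ρ v (ρ≢sx ∘ ≡.sym))))
        upd-far : ∀ v → suc x ℕ.< upd c ρ v x
        upd-far v = ≡.subst (suc x ℕ.<_) (≡.sym (upd-≢ c ρ v (ρ≢x ∘ ≡.sym))) f
        upd-ceil : ∀ v → v ≢ suc x → ∀ r → r ℕ.< ℓ → upd c ρ v r ≢ suc x
        upd-ceil v v≢ r lt e with r ≟ ρ
        ... | yes _ = v≢ e
        ... | no ne = ne (uniq r lt e)
        ceil₁ = upd-ceil (suc (suc x)) λ ()
        fix₂ : Fixed x (γ′ ⊕ (ρ , x))
        fix₂ = Fixed-⊕ {γ = γ} (mkFixed e) ρ≢x ρ≢sx ρ≢x ρ≢sx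
        restore : ∀ r → r ℕ.< ℓ → upd (upd c ρ x) ρ (suc x) r ≡ c r
        restore r _ with r ≟ ρ
        ... | yes refl = ≡.sym cρ
        ... | no ne    = upd-≢ c ρ x ne
        -- Inserting the root `(ρ , x)` is free. Row `ρ` then contains both columns `x` and `suc x`,
        -- so the additional term has a ceiling and a fixed weight.
        second : ∀ n → HC c n γ′ ≈ HC (upd c ρ x) n γ′
        second n = ≈-sym (begin
          HC (upd c ρ x) n γ′
            ≈⟨ remove ρ<ℓ x<ℓ (upd-≡ c ρ x refl) n γ′ ⟩
          HC (upd (upd c ρ x) ρ (suc x)) n γ′ + sh 1 (λ n → HC (upd c ρ x) n (γ′ ⊕ (ρ , x))) n
            ≈⟨ +-cong (HC-cong restore n γ′)
                 (sh-0 1 (ceiling-0 (mkWall i a (upd-wall x) (upd-far x) fix₂) (upd-ceil x (ℕₚ.<⇒≢ (ℕₚ.n<1+n x)))) n) ⟩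
          HC c n γ′ + 0# ≈⟨ +-identityʳ _ ⟩
          HC c n γ′ ∎)

      -- A `push` with `ρ = suc x′` makes row `suc x′` start in column `x`, as row `x′` does, and
      -- raises its entry by one. Starting from equal entries, this is a wall at `x′`, and the
      -- argument moves up.
      record Mirror (c : ℕ → ℕ) (γ : Weight) (x x′ : ℕ) : Set where
        constructor mkMirror
        field
          below  : suc x′ ℕ.< x
          altern : Alt x′ F
          left   : c x′ ≡ x
          right  : c (suc x′) ≡ suc x
          unique : ∀ r → r ℕ.< ℓ → c r ≡ suc x → r ≡ suc x′
          equal  : γ x′ ≡ γ (suc x′)

      -- Each mirror hands the wall on to the row above; a ceiling at the end makes the whole
      -- expression vanish.
      data Closed (c : ℕ → ℕ) (γ : Weight) (x : ℕ) : ℕ → Set where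
        top : (∀ r → r ℕ.< ℓ → c r ≢ suc x) → Closed c γ x zero
        step : ∀ {x′ C} → Mirror c γ x x′ → Closed c γ x′ C → Closed c γ x (suc C)

      -- An upward path of C mirrors from x to y with a root of row w starting in column y + 1.
      data Open (c : ℕ → ℕ) (γ : Weight) (w y : ℕ) : ℕ → ℕ → Set where
        top : w ℕ.< y → c w ≡ suc y → (∀ r → r ℕ.< ℓ → c r ≡ suc y → r ≡ w) → Open c γ w y y 1
        step : ∀ {x x′ C} → Mirror c γ x x′ → Open c γ w y x′ C → Open c γ w y x (suc C)

      -- A path climbing from `x` reads only the rows up to `x` and the starts in columns up to
      -- `suc x`. A push through a mirror changes neither for the part of the path above it.
      record Agree (c c′ : ℕ → ℕ) (γ γ′ : Weight) (x : ℕ) : Set where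
        constructor mkAgree
        field
          rows   : ∀ r → r ℕ.≤ x → c′ r ≡ c r
          starts : ∀ r → r ℕ.< ℓ → c′ r ℕ.≤ suc x → c′ r ≡ c r
          values : ∀ r → r ℕ.≤ x → γ′ r ≡ γ r

      Agree-≤ : ∀ {c c′ γ γ′ x y} → y ℕ.≤ x → Agree c c′ γ γ′ x → Agree c c′ γ γ′ y
      Agree-≤ le (mkAgree a b v) = mkAgree (λ r p → a r (ℕₚ.≤-trans p le)) (λ r lt p → b r lt (ℕₚ.≤-trans p (s≤s le)))
        (λ r p → v r (ℕₚ.≤-trans p le))

      Mirror-below : ∀ {c γ x x′} → Mirror c γ x x′ → x′ ℕ.≤ x
      Mirror-below m = ℕₚ.<⇒≤ (ℕₚ.<-trans (ℕₚ.n<1+n _) (Mirror.below m))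

      Mirror-agree : ∀ {c c′ γ γ′ x x′} → Agree c c′ γ γ′ x → Mirror c γ x x′ → Mirror c′ γ′ x x′
      Mirror-agree {c} {c′} {γ} {γ′} {x} {x′} (mkAgree a b v) (mkMirror bl al l r u e) = mkMirror bl al
        (≡.trans (a x′ x′≤x) l) (≡.trans (a (suc x′) (ℕₚ.<⇒≤ bl)) r)
        (λ r lt p → u r lt (≡.trans (≡.sym (b r lt (ℕₚ.≤-reflexive p))) p))
        (≡.trans (v x′ x′≤x) (≡.trans e (≡.sym (v (suc x′) (ℕₚ.<⇒≤ bl)))))
        where x′≤x = Mirror-below (mkMirror {c} {γ} bl al l r u e)

      Closed-agree : ∀ {c c′ γ γ′ x C} → Agree c c′ γ γ′ x → Closed c γ x C → Closed c′ γ′ x C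
      Closed-agree ag (top s)   = top λ r lt e → s r lt (≡.trans (≡.sym (Agree.starts ag r lt (ℕₚ.≤-reflexive e))) e)
      Closed-agree ag (step m p) = step (Mirror-agree ag m) (Closed-agree (Agree-≤ (Mirror-below m) ag) p)

      Open-agree : ∀ {c c′ γ γ′ w y x C} → Agree c c′ γ γ′ x → Open c γ w y x C → Open c′ γ′ w y x C
      Open-agree ag (top lt e u) = top lt (≡.trans (Agree.rows ag _ (ℕₚ.<⇒≤ lt)) e)
        (λ r lt p → u r lt (≡.trans (≡.sym (Agree.starts ag r lt (ℕₚ.≤-reflexive p))) p))
      Open-agree ag (step m p) = step (Mirror-agree ag m) (Open-agree (Agree-≤ (Mirror-below m) ag) p)

      Open-top : ∀ {c γ w y x C} → Open c γ w y x C → w ℕ.< y × y ℕ.≤ x × c w ≡ suc y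
      Open-top (top lt e u) = lt , ℕₚ.≤-refl , e
      Open-top (step m p) with Open-top p
      ... | a , b , e = a , ℕₚ.≤-trans b (Mirror-below m) , e

      pushed-agree : ∀ {c γ x x′} → Mirror c γ x x′ → Agree c (upd c (suc x′) x) γ (γ ⊕ (suc x′ , suc x)) x′
      pushed-agree {c} {γ} {x} {x′} m = mkAgree
        (λ r le → upd-≢ c (suc x′) x (ℕₚ.<⇒≢ (s≤s le)))
        (λ r _ le → starts r le)
        (λ r le → ⊕-other γ (ℕₚ.<⇒≢ (s≤s le) ∘ ≡.sym)
          (ℕₚ.<⇒≢ (ℕₚ.≤-<-trans (ℕₚ.≤-trans le (Mirror-below m)) (ℕₚ.n<1+n x)) ∘ ≡.sym))
        where
        starts : ∀ r → upd c (suc x′) x r ℕ.≤ suc x′ → upd c (suc x′) x r ≡ c r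
        starts r le with r ≟ suc x′
        ... | yes _ = ⊥-elim (ℕₚ.<⇒≱ (Mirror.below m) le)
        ... | no _  = refl

      pushed-wall : ∀ {c γ x x′} → Wall c γ x → Mirror c γ x x′ → Wall (upd c (suc x′) x) (γ ⊕ (suc x′ , suc x)) x′
      pushed-wall {c} {γ} {x} {x′} (mkWall i a w f e) (mkMirror bl al l r u q) = mkWall
        (ℕₚ.<-trans bl (ℕₚ.<-trans (ℕₚ.n<1+n x) i)) al
        (≡.trans cx′ (≡.sym (upd-≡ c (suc x′) x refl)))
        (≡.subst (suc x′ ℕ.<_) (≡.sym cx′) bl)
        (mkFixed (≡.trans (≡.cong (ℤ._+ + 1) (≡.trans (⊕-other γ (ℕₚ.<⇒≢ (ℕₚ.n<1+n x′) ∘ ≡.sym) (x≢ ∘ ≡.sym)) q))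
          (≡.sym (⊕-source γ (ℕₚ.<⇒≢ (ℕₚ.<-trans bl (ℕₚ.n<1+n x)) ∘ ≡.sym)))))
        where
        cx′ : upd c (suc x′) x x′ ≡ x
        cx′ = ≡.trans (upd-≢ c (suc x′) x (ℕₚ.<⇒≢ (ℕₚ.n<1+n x′))) l
        x≢ : x′ ≢ suc x
        x≢ = ℕₚ.<⇒≢ (ℕₚ.<-trans (ℕₚ.n<1+n x′) (ℕₚ.<-trans bl (ℕₚ.n<1+n x)))

      closed-0 : ∀ {c γ x C} → Wall c γ x → Closed c γ x C → ∀ n → HC c n γ ≈ 0#
      closed-0 W (top s) n = ceiling-0 W s n
      closed-0 {C = suc C} W (step m p) n = ≈-trans
        (push W (Mirror.below m) (Mirror.right m) (Mirror.unique m) n)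
        (sh-0 1 (closed-0 (pushed-wall W m) (Closed-agree (pushed-agree m) p)) n)

      -- The weights of the successive pushes telescope to one unit gained by `w` and lost by
      -- `suc x`. Once row `w` has moved, every level has a ceiling, so the roots borrowed by the
      -- mirrors can be returned.
      climb : ∀ {c γ w y x C} → Wall c γ x → Open c γ w y x C → ∀ n →
        HC c n γ ≈ sh C (λ n → HC (upd c w y) n (γ ⊕ (w , suc x))) n
      climb W (top lt e u) n = push W lt e u n
      climb {c} {γ} {w} {y} {x} {suc C} W (step {x′ = x′} m p) n = begin
        HC c n γ
          ≈⟨ push W (Mirror.below m) (Mirror.right m) (Mirror.unique m) n ⟩
        sh 1 (λ n → HC c′ n γ′) n
          ≈⟨ sh-cong 1 (climb (pushed-wall W m) (Open-agree (pushed-agree m) p)) n ⟩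
        sh 1 (sh C (λ n → HC (upd c′ w y) n (γ′ ⊕ (w , suc x′)))) n
          ≈⟨ sh-sh 1 C _ n ⟩
        sh (suc C) (λ n → HC (upd c′ w y) n (γ′ ⊕ (w , suc x′))) n
          ≈⟨ sh-cong (suc C) (λ n → ≈-trans (HC-ext (upd c′ w y) n weights) (unmirror n)) n ⟩
        sh (suc C) (λ n → HC (upd c w y) n γ″) n ∎
        where
        c′ = upd c (suc x′) x
        γ′ = γ ⊕ (suc x′ , suc x)
        γ″ = γ ⊕ (w , suc x)
        open Wall W
        ends = Open-top p
        w<y = proj₁ ends
        y≤x′ = proj₁ (proj₂ ends)
        w<x′ = ℕₚ.<-≤-trans w<y y≤x′
        bl = Mirror.below m
        x′<x = ℕₚ.<-trans (ℕₚ.n<1+n x′) bl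
        w<x = ℕₚ.<-trans w<x′ x′<x
        weights : γ′ ⊕ (w , suc x′) ≗ γ″
        weights r = identity (γ r) (δ (suc x′) r) (δ (suc x) r) (δ w r)
          where
          identity : ∀ g a b c → g ℤ.+ a ℤ.- b ℤ.+ c ℤ.- a ≡ g ℤ.+ c ℤ.- b
          identity = solve-∀
        c″ = upd c′ w y
        c″-sx′ : c″ (suc x′) ≡ x
        c″-sx′ = ≡.trans (upd-≢ c′ w y (ℕₚ.<⇒≢ (ℕₚ.m<n⇒m<1+n w<x′) ∘ ≡.sym)) (upd-≡ c (suc x′) x refl)
        c″-other : ∀ {r} → suc x′ ℕ.< r → w ℕ.< r → c″ r ≡ c r
        c″-other p q = ≡.trans (upd-≢ c′ w y (ℕₚ.<⇒≢ q ∘ ≡.sym)) (upd-≢ c (suc x′) x (ℕₚ.<⇒≢ p ∘ ≡.sym))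
        c″-x : c″ x ≡ c x
        c″-x = c″-other bl w<x
        c″-sx : c″ (suc x) ≡ c (suc x)
        c″-sx = c″-other (ℕₚ.m<n⇒m<1+n bl) (ℕₚ.m<n⇒m<1+n w<x)
        ceil : ∀ r → r ℕ.< ℓ → c″ r ≢ suc x
        ceil r lt e with r ≟ w
        ... | yes _ = ℕₚ.<⇒≢ (ℕₚ.≤-<-trans y≤x′ (ℕₚ.<-trans x′<x (ℕₚ.n<1+n x))) e
        ... | no _ with r ≟ suc x′
        ...   | yes _ = ℕₚ.<⇒≢ (ℕₚ.n<1+n x) e
        ...   | no ne = ne (Mirror.unique m r lt e)
        fix′ = Fixed-⊕ fix (ℕₚ.<⇒≢ w<x) (ℕₚ.<⇒≢ (ℕₚ.m<n⇒m<1+n w<x)) (ℕₚ.<⇒≢ bl) (ℕₚ.<⇒≢ (ℕₚ.m<n⇒m<1+n bl))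
        restore : ∀ r → r ℕ.< ℓ → upd c″ (suc x′) (suc x) r ≡ upd c w y r
        restore r _ with r ≟ suc x′
        ... | yes refl = ≡.sym (≡.trans (upd-≢ c w y (ℕₚ.<⇒≢ (ℕₚ.m<n⇒m<1+n w<x′) ∘ ≡.sym)) (Mirror.right m))
        ... | no ne with r ≟ w
        ...   | yes _ = refl
        ...   | no _ = upd-≢ c (suc x′) x ne
        -- Row `suc x′` still holds the borrowed root in column `x`. The term produced by returning
        -- it vanishes, because no row starts in column `suc x` any more.
        unmirror : ∀ n → HC c″ n γ″ ≈ HC (upd c w y) n γ″
        unmirror n = begin
          HC c″ n γ″
            ≈⟨ remove (ℕₚ.<-trans bl x<ℓ) x<ℓ c″-sx′ n γ″ ⟩
          HC (upd c″ (suc x′) (suc x)) n γ″ + sh 1 (λ n → HC c″ n (γ″ ⊕ (suc x′ , x))) n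
            ≈⟨ +-cong (HC-cong restore n γ″) (sh-0 1 (ceiling-0 (mkWall inside altern
                 (≡.trans c″-x (≡.trans wall (≡.sym c″-sx))) (≡.subst (suc x ℕ.<_) (≡.sym c″-x) far) fix′) ceil) n) ⟩
          HC (upd c w y) n γ″ + 0# ≈⟨ +-identityʳ _ ⟩
          HC (upd c w y) n γ″ ∎
          where x<ℓ = ℕₚ.<-trans (ℕₚ.n<1+n x) inside

      private
        Mirror-lower : ∀ {c γ w y v x x′} → w ℕ.< y → y ℕ.≤ x′ → suc x ℕ.< v →
          Mirror c γ x x′ → Mirror (upd c w y) (γ ⊕ (w , v)) x x′
        Mirror-lower {c} {γ} {w} {y} {v} {x} {x′} w<y y≤x′ sx<v (mkMirror bl al l r u e) = mkMirror bl al
          (≡.trans (upd-≢ c w y (w≢x′ ∘ ≡.sym)) l) (≡.trans (upd-≢ c w y (w≢sx′ ∘ ≡.sym)) r) uniq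
          (≡.trans (⊕-other γ w≢x′ (ℕₚ.<⇒≢ (ℕₚ.<-trans x′<sx sx<v) ∘ ≡.sym)) (≡.trans e
            (≡.sym (⊕-other γ w≢sx′ (ℕₚ.<⇒≢ (ℕₚ.<-trans (ℕₚ.m<n⇒m<1+n bl) sx<v) ∘ ≡.sym)))))
          where
          w<x′ = ℕₚ.<-≤-trans w<y y≤x′
          w≢x′ = ℕₚ.<⇒≢ w<x′
          w≢sx′ = ℕₚ.<⇒≢ (ℕₚ.m<n⇒m<1+n w<x′)
          x′<sx = ℕₚ.<-trans (ℕₚ.n<1+n x′) (ℕₚ.m<n⇒m<1+n bl)
          uniq : ∀ r → r ℕ.< ℓ → upd c w y r ≡ suc x → r ≡ suc x′
          uniq r lt p with r ≟ w
          ... | yes _ = ⊥-elim (ℕₚ.<⇒≢ (ℕₚ.≤-<-trans y≤x′ x′<sx) p)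
          ... | no _  = u r lt p

        -- With row `w` moved to column `y`, nothing starts in column `suc y`, and the open end
        -- becomes a ceiling.
        Open⇒Closed : ∀ {c γ w y v x C} → suc x ℕ.< v → Open c γ w y x C → ∃ (Closed (upd c w y) (γ ⊕ (w , v)) x)
        Open⇒Closed {c} {w = w} {y} sx<v (top lt e u) = _ , top ceil
          where
          ceil : ∀ r → r ℕ.< ℓ → upd c w y r ≢ suc y
          ceil r r<ℓ p with r ≟ w
          ... | yes _ = ℕₚ.<⇒≢ (ℕₚ.n<1+n y) p
          ... | no ne = ne (u r r<ℓ p)
        Open⇒Closed sx<v (step m p) = _ , step
          (Mirror-lower (proj₁ (Open-top p)) (proj₁ (proj₂ (Open-top p))) sx<v m)
          (proj₂ (Open⇒Closed (ℕₚ.≤-<-trans (s≤s (Mirror-below m)) sx<v) p))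

      -- Beyond `climb`, the first root of row `suc x` is dropped, which leaves row `suc x` as row
      -- `x` was: its first root is gone and its entry is lowered by one. The discarded term has its
      -- weight unchanged at `x` and `suc x`, and its path is now closed. If the row has no roots,
      -- there is nothing to drop and only the description changes.
      straighten : ∀ {c γ w y x C} → Wall c γ x → Open c γ w y x C → ∀ n →
        HC c n γ ≈ sh C (λ n → HC (upd (upd c w y) (suc x) (suc (c x))) n (γ ⊕ (w , suc x))) n
      straighten {c} {γ} {w} {y} {x} {C} W p n = ≈-trans (climb W p n) (sh-cong C discard n)
        where
        open Wall W
        ends = Open-top p
        w<x = ℕₚ.<-≤-trans (proj₁ ends) (proj₁ (proj₂ ends))
        w≢x = ℕₚ.<⇒≢ w<x
        w≢sx = ℕₚ.<⇒≢ (ℕₚ.m<n⇒m<1+n w<x)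
        c′ = upd c w y
        γ′ = γ ⊕ (w , suc x)
        c′-x : c′ x ≡ c x
        c′-x = upd-≢ c w y (w≢x ∘ ≡.sym)
        c′-sx : c′ (suc x) ≡ c x
        c′-sx = ≡.trans (upd-≢ c w y (w≢sx ∘ ≡.sym)) (≡.sym wall)
        discard : ∀ n → HC c′ n γ′ ≈ HC (upd c′ (suc x) (suc (c x))) n γ′
        discard n with c x ℕ.<? ℓ
        ... | yes lt = begin
          HC c′ n γ′
            ≈⟨ remove inside lt c′-sx n γ′ ⟩
          HC (upd c′ (suc x) (suc (c x))) n γ′ + sh 1 (λ n → HC c′ n (γ′ ⊕ (suc x , c x))) n
            ≈⟨ +-congˡ (sh-cong 1 (λ n → HC-ext c′ n weights) n) ⟩
          HC (upd c′ (suc x) (suc (c x))) n γ′ + sh 1 (λ n → HC c′ n (γ ⊕ (w , c x))) n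
            ≈⟨ +-congˡ (sh-0 1 (closed-0 (mkWall inside altern (≡.trans c′-x (≡.sym c′-sx))
                 (≡.subst (suc x ℕ.<_) (≡.sym c′-x) far) fix′) (proj₂ (Open⇒Closed far p))) n) ⟩
          HC (upd c′ (suc x) (suc (c x))) n γ′ + 0#
            ≈⟨ +-identityʳ _ ⟩
          HC (upd c′ (suc x) (suc (c x))) n γ′ ∎
          where
          weights : γ′ ⊕ (suc x , c x) ≗ γ ⊕ (w , c x)
          weights r = identity (γ r) (δ w r) (δ (suc x) r) (δ (c x) r)
            where
            identity : ∀ g a b c → g ℤ.+ a ℤ.- b ℤ.+ b ℤ.- c ≡ g ℤ.+ a ℤ.- c
            identity = solve-∀
          fix′ : Fixed x (γ ⊕ (w , c x))
          fix′ = mkFixed (≡.trans (≡.cong (ℤ._+ + 1) (⊕-other γ w≢x (ℕₚ.<⇒≢ (ℕₚ.<-trans (ℕₚ.n<1+n x) far) ∘ ≡.sym)))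
            (≡.trans (Fixed.fixes fix) (≡.sym (⊕-other γ w≢sx (ℕₚ.<⇒≢ far ∘ ≡.sym)))))
        ... | no ≮ℓ = retract (ℕₚ.≤-trans (ℕₚ.≮⇒≥ ≮ℓ) (ℕₚ.≤-reflexive (≡.sym c′-sx)))
                        (ℕₚ.m≤n⇒m≤1+n (ℕₚ.≤-reflexive c′-sx)) n γ′

-- Bounce graphs of bounded partitions and the search for a cover at a given row.

module BounceGraphs where
  open import Data.Nat using (ℕ; zero; suc; z≤n; s≤s; s≤s⁻¹; _≟_; _+_; _∸_; _≤_; _<_)
  open import Data.Nat.Induction using (<-wellFounded)
  open import Induction.WellFounded using (Acc; acc)
  open import Relation.Binary.Definitions using (tri<; tri≈; tri>)

  -- Partitions are continued by zeros, so that `down` and its paths may run past row ℓ.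
  record ParFun (k ℓ : ℕ) : Set where
    field
      parts  : ℕ → ℕ
      anti  : ∀ r → parts (suc r) ≤ parts r
      bound : ∀ r → parts r ≤ k
      outside : ∀ r → ℓ ≤ r → parts r ≡ 0

  antitone : (f : ℕ → ℕ) → (∀ r → f (suc r) ≤ f r) → ∀ {r s} → r ≤ s → f s ≤ f r
  antitone f a {r} {s} le = ≡.subst (λ s → f s ≤ f r) (ℕₚ.m+[n∸m]≡n le) (go (s ∸ r))
    where
    go : ∀ d → f (r + d) ≤ f r
    go zero    = ℕₚ.≤-reflexive (≡.cong f (ℕₚ.+-identityʳ r))
    go (suc d) = ℕₚ.≤-trans (≡.subst (λ s → f s ≤ f (r + d)) (≡.sym (ℕₚ.+-suc r d)) (a (r + d))) (go d)

  module Bounce {k ℓ : ℕ} (p : ParFun k ℓ) where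
    open ParFun p public

    -- Row r of Δᵏ starts in column down r.
    down : ℕ → ℕ
    down r = r + (suc k ∸ parts r)

    down-part : ∀ r → down r + parts r ≡ r + suc k
    down-part r = ≡.trans (ℕₚ.+-assoc r _ _) (≡.cong (r +_) (ℕₚ.m∸n+n≡m (ℕₚ.m≤n⇒m≤1+n (bound r))))

    down> : ∀ r → r < down r
    down> r = ≡.subst (suc r ≤_) (≡.cong (r +_) (≡.sym (ℕₚ.+-∸-assoc 1 (bound r))))
      (≡.subst (suc r ≤_) (≡.sym (ℕₚ.+-suc r _)) (s≤s (ℕₚ.m≤m+n r _)))

    down-suc< : ∀ r → down r < down (suc r)
    down-suc< r = s≤s (ℕₚ.+-monoʳ-≤ r (ℕₚ.∸-monoʳ-≤ (suc k) (anti r)))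

    down-mono : ∀ {r s} → r < s → down r < down s
    down-mono {r} {s} lt = ≡.subst (λ s → down r < down s) (ℕₚ.m+[n∸m]≡n lt) (go (s ∸ suc r))
      where
      go : ∀ d → down r < down (suc r + d)
      go zero    = ≡.subst (λ s → down r < down s) (≡.sym (ℕₚ.+-identityʳ (suc r))) (down-suc< r)
      go (suc d) = ℕₚ.<-trans (go d) (≡.subst (λ s → down (suc r + d) < down s) (≡.sym (ℕₚ.+-suc (suc r) d)) (down-suc< (suc r + d)))

    down-mono-≤ : ∀ {r s} → r ≤ s → down r ≤ down s
    down-mono-≤ le with ℕₚ.m≤n⇒m<n∨m≡n le
    ... | inj₁ lt   = ℕₚ.<⇒≤ (down-mono lt)
    ... | inj₂ refl = ℕₚ.≤-refl

    down-cancel-< : ∀ {r s} → down r < down s → r < s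
    down-cancel-< {r} {s} lt with ℕₚ.<-≤-connex r s
    ... | inj₁ r<s = r<s
    ... | inj₂ s≤r = ⊥-elim (ℕₚ.<⇒≱ lt (down-mono-≤ s≤r))

    down-injective : ∀ {r s} → down r ≡ down s → r ≡ s
    down-injective {r} {s} e with ℕₚ.<-cmp r s
    ... | tri< a _ _ = ⊥-elim (ℕₚ.<⇒≢ (down-mono a) e)
    ... | tri≈ _ b _ = b
    ... | tri> _ _ c = ⊥-elim (ℕₚ.<⇒≢ (down-mono c) (≡.sym e))

    down-flat : ∀ r → parts (suc r) ≡ parts r → down (suc r) ≡ suc (down r)
    down-flat r e = ≡.cong (λ x → suc (r + (suc k ∸ x))) e

    flat-down : ∀ r → down (suc r) ≡ suc (down r) → parts (suc r) ≡ parts r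
    flat-down r e = ℕₚ.+-cancelˡ-≡ (suc (down r)) _ _
      (≡.trans (≡.cong (_+ parts (suc r)) (≡.sym e)) (≡.trans (down-part (suc r)) (≡.cong suc (≡.sym (down-part r)))))

    -- As `down` is strictly increasing, `down (suc r)` is squeezed between `suc y` and `suc y`.
    next-row : ∀ {r x y} → down r ≡ y → down x ≡ suc y → x ≡ suc r
    next-row {r} {x} refl e = down-injective (≡.trans e (ℕₚ.≤-antisym (down-suc< r)
      (≡.subst (down (suc r) ≤_) e (down-mono-≤ (down-cancel-< (≡.subst (down r <_) (≡.sym e) (ℕₚ.n<1+n _)))))))

    up? : ∀ r → Dec (∃ λ x → down x ≡ r)
    up? r = map′ (λ (x , _ , e) → x , e) (λ (x , e) → x , ≡.subst (x <_) e (down> x) , e)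
      (ℕₚ.anyUpTo? (λ x → down x ≟ r) r)

    -- The path of the bounce graph climbing from z.
    record Chain (z C : ℕ) (u : ℕ → ℕ) : Set where
      field
        base : u 0 ≡ z
        links : ∀ i → i < C → down (u (suc i)) ≡ u i
        top   : ∀ r → down r ≢ u C

    chain : ∀ z → ∃₂ (Chain z)
    chain z = go z (<-wellFounded z)
      where
      go : ∀ z → Acc _<_ z → ∃₂ (Chain z)
      go z (acc rs) with up? z
      ... | no ¬up = 0 , (λ _ → z) , record { base = refl ; links = λ _ () ; top = λ r e → ¬up (r , e) }
      ... | yes (x , e) with go x (rs (≡.subst (x <_) e (down> x)))
      ... | C , u , ch = suc C , u′ , record { base = refl ; links = links′ ; top = Chain.top ch }
        where
        u′ : ℕ → ℕ
        u′ zero    = z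
        u′ (suc i) = u i
        links′ : ∀ i → i < suc C → down (u′ (suc i)) ≡ u′ i
        links′ zero    _        = ≡.trans (≡.cong down (Chain.base ch)) e
        links′ (suc i) (s≤s lt) = Chain.links ch i lt

    module _ {z C u} (ch : Chain z C u) where
      open Chain ch

      chain-decreasing : ∀ i → i < C → u (suc i) < u i
      chain-decreasing i lt = ≡.subst (u (suc i) <_) (links i lt) (down> (u (suc i)))

      chain-antitone : ∀ {i i′} → i ≤ i′ → i′ ≤ C → u i′ ≤ u i
      chain-antitone {i} {zero}   z≤n _ = ℕₚ.≤-refl
      chain-antitone {i} {suc i′} le lt with ℕₚ.m≤n⇒m<n∨m≡n le
      ... | inj₂ refl = ℕₚ.≤-refl
      ... | inj₁ le′  = ℕₚ.≤-trans (ℕₚ.<⇒≤ (chain-decreasing i′ lt)) (chain-antitone (s≤s⁻¹ le′) (ℕₚ.<⇒≤ lt))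

      chain-≤ : ∀ {i} → i ≤ C → u i ≤ z
      chain-≤ {i} le = ≡.subst (u i ≤_) base (chain-antitone z≤n le)

    chain-unique : ∀ {z C u C′ u′} → Chain z C u → Chain z C′ u′ → ∀ i → i ≤ C → i ≤ C′ × u i ≡ u′ i
    chain-unique ch ch′ zero    _ = z≤n , ≡.trans (Chain.base ch) (≡.sym (Chain.base ch′))
    chain-unique {C′ = C′} {u′} ch ch′ (suc i) lt with chain-unique ch ch′ i (ℕₚ.<⇒≤ lt)
    ... | le , e with ℕₚ.m≤n⇒m<n∨m≡n le
    ... | inj₁ i<C′ = i<C′ , down-injective (≡.trans (Chain.links ch i lt) (≡.trans e (≡.sym (Chain.links ch′ i i<C′))))
    ... | inj₂ refl = ⊥-elim (Chain.top ch′ _ (≡.trans (Chain.links ch i lt) e))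

    chain-length : ∀ {z C u C′ u′} → Chain z C u → Chain z C′ u′ → C ≡ C′
    chain-length ch ch′ = ℕₚ.≤-antisym (proj₁ (chain-unique ch ch′ _ ℕₚ.≤-refl)) (proj₁ (chain-unique ch′ ch _ ℕₚ.≤-refl))

    -- The rows u i , … , u i + j (i ≤ C) below the top of the chain of z and the rows
    -- w , … , w + j - 1 reached from u C + 1 , … , u C + j by climbing once more.
    record Good (z C : ℕ) (u : ℕ → ℕ) (w j : ℕ) : Set where
      field
        ch    : Chain z C u
        path  : ∀ i → i < C → ∀ j′ → j′ ≤ j → down (u (suc i) + j′) ≡ u i + j′
        opens : ∀ j′ → j′ < j → down (w + j′) ≡ suc (u C + j′)
        flat  : ∀ j′ → j′ ≤ j → parts (z + j′) ≡ parts z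
        short : z + j < down z
      open Chain ch public

      -- On the lowest level this is `short`; `down` is monotone and carries each level to the one
      -- below it, which transports the inequality upwards.
      separated : ∀ i → i < C → ∀ j′ → j′ ≤ j → u (suc i) + j′ < u i
      separated zero    lt j′ le = down-cancel-< (begin-strict
        down (u 1 + j′) ≡⟨ path 0 lt j′ le ⟩
        u 0 + j′ ≡⟨ ≡.cong (_+ j′) base ⟩
        z + j′ ≤⟨ ℕₚ.+-monoʳ-≤ z le ⟩
        z + j <⟨ short ⟩
        down z ≡⟨ ≡.cong down base ⟨
        down (u 0) ∎)
        where open ℕₚ.≤-Reasoning
      separated (suc i) lt j′ le = down-cancel-< (begin-strict
        down (u (suc (suc i)) + j′) ≡⟨ path (suc i) lt j′ le ⟩
        u (suc i) + j′ <⟨ separated i (ℕₚ.<-trans (ℕₚ.n<1+n i) lt) j′ le ⟩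
        u i ≡⟨ links i (ℕₚ.<-trans (ℕₚ.n<1+n i) lt) ⟨
        down (u (suc i)) ∎)
        where open ℕₚ.≤-Reasoning

      below-down-top : u C + j < down (u C)
      below-down-top = go C refl
        where
        go : ∀ c → c ≡ C → u C + j < down (u C)
        go zero    refl = ≡.subst₂ (λ a b → a + j < down b) (≡.sym base) (≡.sym base) short
        go (suc c) refl = ≡.subst (u (suc c) + j <_) (≡.sym (links c (ℕₚ.n<1+n c))) (separated c (ℕₚ.n<1+n c) j ℕₚ.≤-refl)

      w-separated : ∀ j′ → j′ < j → w + j′ < u C
      w-separated j′ lt = down-cancel-< (begin-strict
        down (w + j′) ≡⟨ opens j′ lt ⟩
        suc (u C + j′) ≡⟨ ℕₚ.+-suc (u C) j′ ⟨
        u C + suc j′ ≤⟨ ℕₚ.+-monoʳ-≤ (u C) lt ⟩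
        u C + j <⟨ below-down-top ⟩
        down (u C) ∎)
        where open ℕₚ.≤-Reasoning

      u≤z : ∀ {i} → i ≤ C → u i ≤ z
      u≤z = chain-≤ ch

    -- The rows u i , … , u i + g lose a ribbon of height g + 1 for every i ≤ C.
    record IsCover (z C : ℕ) (u : ℕ → ℕ) (w g : ℕ) : Set where
      field
        good : Good z C u w g
        drop : parts (suc (z + g)) < parts z
      open Good good public

    NoRow : ℕ → Set
    NoRow r = ∀ x → down x ≢ r

    -- The block of rows from `z` on is widened while the parts stay equal. A drop of the parts
    -- gives a cover; the other ways to stop are that the block reaches `down z`, that some level
    -- has no row bouncing to its next place, or that the rows are exhausted with part 0. Each of
    -- these makes the straightened term vanish.
    data Outcome (z : ℕ) : Set where
      cover   : ∀ {C u w g} → IsCover z C u w g → Outcome z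
      wrapped : ∀ {C u w j} → Good z C u w j → suc (z + j) < ℓ → parts (suc (z + j)) ≡ parts z →
                suc (z + j) ≡ down z → Outcome z
      blocked : ∀ {C u w j} → Good z C u w j → suc (z + j) < ℓ → parts (suc (z + j)) ≡ parts z → suc (z + j) < down z →
                ∀ i → i ≤ C → (∀ i′ → i′ < i → down (suc (u (suc i′) + j)) ≡ suc (u i′ + j)) →
                NoRow (suc (u i + j)) → Outcome z
      last    : ∀ {C u w j} → Good z C u w j → suc (z + j) ≡ ℓ → parts z ≡ 0 → Outcome z

    private
      Levels : ℕ → (ℕ → ℕ) → ℕ → ℕ → Set
      Levels C u j i = ∀ i′ → i′ < i → down (suc (u (suc i′) + j)) ≡ suc (u i′ + j)

      levels? : ∀ {z C u w j} → Good z C u w j → ∀ i → i ≤ C →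
        Levels C u j i ⊎ ∃ λ i′ → i′ ≤ C × Levels C u j i′ × NoRow (suc (u i′ + j))
      levels? G zero    _  = inj₁ λ _ ()
      levels? {C = C} {u} {j = j} G (suc i) lt with levels? G i (ℕₚ.<⇒≤ lt)
      ... | inj₂ f = inj₂ f
      ... | inj₁ L with up? (suc (u i + j))
      ...   | no ¬up = inj₂ (i , ℕₚ.<⇒≤ lt , L , λ x e → ¬up (x , e))
      ...   | yes (x , e) = inj₁ λ i′ i′<si → extend i′ (ℕₚ.m≤n⇒m<n∨m≡n (s≤s⁻¹ i′<si))
        where
        extend : ∀ i′ → i′ < i ⊎ i′ ≡ i → down (suc (u (suc i′) + j)) ≡ suc (u i′ + j)
        extend i′ (inj₁ lt′) = L i′ lt′
        extend i′ (inj₂ refl) = ≡.trans (≡.cong down (≡.sym (next-row (Good.path G i lt j ℕₚ.≤-refl) e))) e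

      extend-good : ∀ {z C u w j x} → Good z C u w j → parts (suc (z + j)) ≡ parts z → suc (z + j) < down z →
        Levels C u j C → down x ≡ suc (u C + j) → ∃ λ w′ → Good z C u w′ (suc j)
      extend-good {z} {C} {u} {w} {j} {x} G fl sh L e = w′ j refl , record
        { ch = ch ; path = path′ ; opens = opens′ j refl ; flat = flat′ ; short = ≡.subst (_< down z) (≡.sym (ℕₚ.+-suc z j)) sh }
        where
        open Good G
        -- While `j` is 0 no row has been opened and `w` is a placeholder; the first row found takes
        -- its place.
        w′ : ∀ j₁ → j₁ ≡ j → ℕ
        w′ zero    _ = x
        w′ (suc _) _ = w
        split : ∀ {j′} → j′ ≤ suc j → j′ ≤ j ⊎ j′ ≡ suc j
        split le with ℕₚ.m≤n⇒m<n∨m≡n le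
        ... | inj₁ lt = inj₁ (s≤s⁻¹ lt)
        ... | inj₂ e  = inj₂ e
        path′ : ∀ i → i < C → ∀ j′ → j′ ≤ suc j → down (u (suc i) + j′) ≡ u i + j′
        path′ i lt j′ le with split le
        ... | inj₁ le′  = path i lt j′ le′
        ... | inj₂ refl = ≡.trans (≡.cong down (ℕₚ.+-suc _ j)) (≡.trans (L i lt) (≡.sym (ℕₚ.+-suc _ j)))
        flat′ : ∀ j′ → j′ ≤ suc j → parts (z + j′) ≡ parts z
        flat′ j′ le with split le
        ... | inj₁ le′  = flat j′ le′
        ... | inj₂ refl = ≡.trans (≡.cong parts (ℕₚ.+-suc z j)) fl
        opens′ : ∀ j₁ (eq : j₁ ≡ j) j′ → j′ < suc j → down (w′ j₁ eq + j′) ≡ suc (u C + j′)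
        opens′ zero refl zero _ = ≡.trans (≡.cong down (ℕₚ.+-identityʳ x)) e
        opens′ zero refl (suc j′) (s≤s ())
        opens′ (suc j₁) refl j′ lt with ℕₚ.m≤n⇒m<n∨m≡n (s≤s⁻¹ lt)
        ... | inj₁ lt′  = opens j′ lt′
        ... | inj₂ refl = ≡.trans (≡.cong down (≡.trans (ℕₚ.+-suc w j₁)
            (≡.sym (next-row (opens j₁ (ℕₚ.n<1+n j₁)) (≡.trans e (≡.cong suc (ℕₚ.+-suc (u C) j₁))))))) e

      -- `f` is the number of rows left after the block `z`, ..., `z + j`.
      search : ∀ {z C u w j} f → f + suc (z + j) ≡ ℓ → Good z C u w j → Outcome z
      search {z} {j = j} f e G with parts (suc (z + j)) ≟ parts z
      search {z} {j = j} f e G | no ne = cover record { good = G ; drop = ℕₚ.≤∧≢⇒< le ne }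
        where
        le : parts (suc (z + j)) ≤ parts z
        le = antitone parts anti (ℕₚ.m≤n⇒m≤1+n (ℕₚ.m≤m+n z j))
      search {z} {j = j} zero e G | yes fl = last G e (≡.trans (≡.sym fl) (outside _ (ℕₚ.≤-reflexive (≡.sym e))))
      search {z} {C} {u} {j = j} (suc f) e G | yes fl = next
        where
        sz<ℓ : suc (z + j) < ℓ
        sz<ℓ = ≡.subst (suc (z + j) <_) e (s≤s (ℕₚ.m≤n+m _ f))
        next : Outcome z
        next with ℕₚ.m≤n⇒m<n∨m≡n (Good.short G)
        ... | inj₂ eq = wrapped G sz<ℓ fl eq
        ... | inj₁ sh with levels? G C ℕₚ.≤-refl
        ...   | inj₂ (i , le , L , nr) = blocked G sz<ℓ fl sh i le L nr
        ...   | inj₁ L with up? (suc (u C + j))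
        ...     | no ¬up = blocked G sz<ℓ fl sh C ℕₚ.≤-refl L (λ x e → ¬up (x , e))
        ...     | yes (x , eq) = search f (≡.trans (≡.cong (λ y → f + suc y) (ℕₚ.+-suc z j)) (≡.trans (ℕₚ.+-suc f (suc (z + j))) e)) (proj₂ (extend-good G fl sh L eq))

    outcome : ∀ z → z < ℓ → Outcome z
    outcome z z<ℓ with chain z
    ... | C , u , ch = search {w = 0} (ℓ ∸ suc z) (≡.trans (≡.cong (λ x → ℓ ∸ suc z + suc x) (ℕₚ.+-identityʳ z)) (ℕₚ.m∸n+n≡m z<ℓ))
      (record { ch = ch ; path = path′ ; opens = λ _ () ; flat = flat′ ; short = ≡.subst (_< down z) (≡.sym (ℕₚ.+-identityʳ z)) (down> z) })
      where
      path′ : ∀ i → i < C → ∀ j′ → j′ ≤ 0 → down (u (suc i) + j′) ≡ u i + j′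
      path′ i lt zero _ = ≡.trans (≡.cong down (ℕₚ.+-identityʳ _)) (≡.trans (Chain.links ch i lt) (≡.sym (ℕₚ.+-identityʳ _)))
      flat′ : ∀ j′ → j′ ≤ 0 → parts (z + j′) ≡ parts z
      flat′ zero _ = ≡.cong parts (ℕₚ.+-identityʳ z)

    IsCover-positive : ∀ {z C u w g} → IsCover z C u w g → 0 < parts z
    IsCover-positive c = ℕₚ.≤-<-trans z≤n (IsCover.drop c)

    private
      -- A cover ends where the parts drop below `parts z`, so it has to contain all rows already
      -- known to be flat.
      height-≤ : ∀ {z C u w g j} → IsCover z C u w g → parts (suc (z + j)) ≡ parts z → (∀ j′ → j′ ≤ j → parts (z + j′) ≡ parts z) → j < g
      height-≤ {z} {g = g} {j} c e flat′ with ℕₚ.<-≤-connex j g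
      ... | inj₁ lt = lt
      ... | inj₂ le = ⊥-elim (ℕₚ.<⇒≢ (IsCover.drop c) (go (ℕₚ.m≤n⇒m<n∨m≡n le)))
        where
        go : g < j ⊎ g ≡ j → parts (suc (z + g)) ≡ parts z
        go (inj₁ lt)   = ≡.trans (≡.cong parts (≡.sym (ℕₚ.+-suc z g))) (flat′ (suc g) lt)
        go (inj₂ refl) = e

    wrapped⇒¬cover : ∀ {z C u w j C′ u′ w′ g} → Good z C u w j → parts (suc (z + j)) ≡ parts z → suc (z + j) ≡ down z →
      ¬ IsCover z C′ u′ w′ g
    wrapped⇒¬cover {z} {j = j} {g = g} G fl e c = ℕₚ.<⇒≱ (IsCover.short c) (begin
      down z ≡⟨ e ⟨
      suc (z + j) ≡⟨ ℕₚ.+-suc z j ⟨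
      z + suc j ≤⟨ ℕₚ.+-monoʳ-≤ z (height-≤ c fl (Good.flat G)) ⟩
      z + g ∎)
      where open ℕₚ.≤-Reasoning

    -- A cover at `z` climbs the same chain and reaches beyond row `j` of each level, so it would
    -- contain a row bouncing to the place where none does.
    blocked⇒¬cover : ∀ {z C u w j C′ u′ w′ g i} → Good z C u w j → parts (suc (z + j)) ≡ parts z → i ≤ C → NoRow (suc (u i + j)) →
      ¬ IsCover z C′ u′ w′ g
    blocked⇒¬cover {z} {C} {u} {w} {j} {C′} {u′} {w′} {g} {i} G fl i≤C nr c with chain-unique (Good.ch G) (IsCover.ch c) i i≤C
    ... | i≤C′ , e with ℕₚ.m≤n⇒m<n∨m≡n i≤C′
    ... | inj₁ i<C′ = nr (u′ (suc i) + suc j) (≡.trans (IsCover.path c i i<C′ (suc j) (height-≤ c fl (Good.flat G)))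
          (≡.trans (≡.cong (_+ suc j) (≡.sym e)) (ℕₚ.+-suc _ j)))
    ... | inj₂ refl = nr (w′ + j) (≡.trans (IsCover.opens c j (height-≤ c fl (Good.flat G))) (≡.cong (λ x → suc (x + j)) (≡.sym e)))

    Cover : ℕ → Set
    Cover z = ∃₂ λ C u → ∃₂ λ w g → IsCover z C u w g

    cover? : ∀ z → z < ℓ → Dec (Cover z)
    cover? z z<ℓ with outcome z z<ℓ
    ... | cover c = yes (_ , _ , _ , _ , c)
    ... | wrapped G _ fl e = no λ (_ , _ , _ , _ , c) → wrapped⇒¬cover G fl e c
    ... | blocked G _ fl _ i i≤C _ nr = no λ (_ , _ , _ , _ , c) → blocked⇒¬cover G fl i≤C nr c
    ... | last G _ p0 = no λ (_ , _ , _ , _ , c) → ℕₚ.<⇒≢ (IsCover-positive c) (≡.sym p0)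

-- The partition below a cover, and its appearance as the last stage of straightening.

module CoverWeights where
  open import Algebra.Bundles using (CommutativeRing)
  open import Data.Nat as ℕ using (ℕ; zero; suc; z≤n; s≤s; s≤s⁻¹; _≤?_; _<?_; _≟_; pred; _+_; _∸_; _≤_; _<_)
  open import Data.Integer as ℤ using (ℤ; +_)
  open import Data.Integer.Tactic.RingSolver using (solve-∀)
  open import Data.List.Relation.Unary.Any using (here; there)
  open RaisingOperators
  open RootStraightening
  open BounceGraphs

  data View (z w j r : ℕ) : Set where
    inZ : ∀ j′ → j′ ≤ j → r ≡ z + j′ → View z w j r
    inW : ∀ j′ → j′ < j → r ≡ w + j′ → View z w j r
    out : (∀ j′ → j′ ≤ j → r ≢ z + j′) → (∀ j′ → j′ < j → r ≢ w + j′) → View z w j r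

  view : ∀ z w j r → View z w j r
  view z w j r with z ≤? r | (r ∸ z) ≤? j
  ... | yes z≤r | yes le = inZ (r ∸ z) le (≡.sym (ℕₚ.m+[n∸m]≡n z≤r))
  ... | yes z≤r | no nle = go (w ≤? r) ((r ∸ w) <? j)
    where
    notZ : ∀ j′ → j′ ≤ j → r ≢ z + j′
    notZ j′ le refl = nle (≡.subst (_≤ j) (≡.sym (ℕₚ.m+n∸m≡n z j′)) le)
    go : Dec (w ≤ r) → Dec (r ∸ w < j) → View z w j r
    go (yes w≤r) (yes lt) = inW (r ∸ w) lt (≡.sym (ℕₚ.m+[n∸m]≡n w≤r))
    go (yes w≤r) (no nlt) = out notZ (λ { j′ lt refl → nlt (≡.subst (_< j) (≡.sym (ℕₚ.m+n∸m≡n w j′)) lt) })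
    go (no nle)  _        = out notZ (λ { j′ lt refl → nle (ℕₚ.m≤m+n w j′) })
  ... | no nle | _ = go (w ≤? r) ((r ∸ w) <? j)
    where
    notZ : ∀ j′ → j′ ≤ j → r ≢ z + j′
    notZ j′ le refl = nle (ℕₚ.m≤m+n z j′)
    go : Dec (w ≤ r) → Dec (r ∸ w < j) → View z w j r
    go (yes w≤r) (yes lt) = inW (r ∸ w) lt (≡.sym (ℕₚ.m+[n∸m]≡n w≤r))
    go (yes w≤r) (no nlt) = out notZ (λ { j′ lt refl → nlt (≡.subst (_< j) (≡.sym (ℕₚ.m+n∸m≡n w j′)) lt) })
    go (no nle)  _        = out notZ (λ { j′ lt refl → nle (ℕₚ.m≤m+n w j′) })

  toW : (ℕ → ℕ) → Weight
  toW f r = + f r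

  module CoverShape {k ℓ : ℕ} (p : ParFun k ℓ) where
    open Bounce p

    Good-≤ : ∀ {z C u w j j′} → j′ ≤ j → Good z C u w j → Good z C u w j′
    Good-≤ le G = record
      { ch = ch ; path = λ i lt j″ le″ → path i lt j″ (ℕₚ.≤-trans le″ le)
      ; opens = λ j″ lt → opens j″ (ℕₚ.≤-trans lt le) ; flat = λ j″ le″ → flat j″ (ℕₚ.≤-trans le″ le)
      ; short = ℕₚ.≤-<-trans (ℕₚ.+-monoʳ-≤ _ le) short }
      where open Good G

    good-w<z : ∀ {z C u w j} → Good z C u w j → ∀ j′ → j′ < j → w + j′ < z
    good-w<z G j′ lt = ℕₚ.<-≤-trans (Good.w-separated G j′ lt) (Good.u≤z G ℕₚ.≤-refl)

    module Covered {z C u w g} (c : IsCover z C u w g) where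
      open IsCover c

      μ : ℕ → ℕ
      μ r with view z w g r
      ... | inZ _ _ _ = pred (parts r)
      ... | inW _ _ _ = suc (parts r)
      ... | out _ _   = parts r

      w<z : ∀ j → j < g → w + j < z
      w<z = good-w<z good

      w≢z : ∀ {j j′} → j < g → w + j ≢ z + j′
      w≢z {j} {j′} lt e = ℕₚ.<⇒≱ (w<z j lt) (≡.subst (z ≤_) (≡.sym e) (ℕₚ.m≤m+n z j′))

      μ-z : ∀ j → j ≤ g → μ (z + j) ≡ pred (parts (z + j))
      μ-z j le with view z w g (z + j)
      ... | inZ _ _ _   = refl
      ... | inW j′ lt e = ⊥-elim (w≢z lt (≡.sym e))
      ... | out nz _    = ⊥-elim (nz j le refl)

      μ-w : ∀ j → j < g → μ (w + j) ≡ suc (parts (w + j))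
      μ-w j lt with view z w g (w + j)
      ... | inZ j′ le e = ⊥-elim (w≢z lt e)
      ... | inW _ _ _   = refl
      ... | out _ nw    = ⊥-elim (nw j lt refl)

      μ-out : ∀ {r} → (∀ j → j ≤ g → r ≢ z + j) → (∀ j → j < g → r ≢ w + j) → μ r ≡ parts r
      μ-out {r} nz nw with view z w g r
      ... | inZ j le e = ⊥-elim (nz j le e)
      ... | inW j lt e = ⊥-elim (nw j lt e)
      ... | out _ _    = refl

      z+g<ℓ : z + g < ℓ
      z+g<ℓ with ℕₚ.<-≤-connex (z + g) ℓ
      ... | inj₁ lt = lt
      ... | inj₂ le = ⊥-elim (ℕₚ.<⇒≢ (IsCover-positive c) (≡.sym (≡.trans (≡.sym (flat g ℕₚ.≤-refl)) (outside _ le))))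

      positive : ∀ j → j ≤ g → 0 < parts (z + j)
      positive j le = ≡.subst (0 <_) (≡.sym (flat j le)) (IsCover-positive c)

      -- A part equal to `k` bounces to the very next row. Then `w + j` would equal `u C + j`,
      -- although these rows lie above `u C`.
      w-bound : ∀ j → j < g → suc (parts (w + j)) ≤ k
      w-bound j lt = ℕₚ.≤∧≢⇒< (bound _) λ e → ℕₚ.<⇒≱ (w-separated j lt)
        (≡.subst (u C ≤_) (ℕₚ.suc-injective (≡.trans (≡.sym (opens j lt)) (row-k e))) (ℕₚ.m≤m+n (u C) j))
        where
        row-k : parts (w + j) ≡ k → down (w + j) ≡ suc (w + j)
        row-k e = ≡.trans (≡.cong (λ x → w + j + (suc k ∸ x)) e)
          (≡.trans (≡.cong (λ x → w + j + x) (ℕₚ.m+n∸n≡m 1 k)) (ℕₚ.+-comm (w + j) 1))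

      covered : ParFun k ℓ
      covered = record { parts = μ ; anti = anti′ ; bound = bound′ ; outside = outside′ }
        where
        bound′ : ∀ r → μ r ≤ k
        bound′ r with view z w g r
        ... | inZ _ _ _     = ℕₚ.≤-trans ℕₚ.pred[n]≤n (bound r)
        ... | inW j lt refl = w-bound j lt
        ... | out _ _       = bound r
        outside′ : ∀ r → ℓ ≤ r → μ r ≡ 0
        outside′ r le with view z w g r
        ... | inZ j j≤ refl = ⊥-elim (ℕₚ.<⇒≱ (ℕₚ.≤-<-trans (ℕₚ.+-monoʳ-≤ z j≤) z+g<ℓ) le)
        ... | inW j lt refl = ⊥-elim (ℕₚ.<⇒≱ (ℕₚ.<-trans (w<z j lt) (ℕₚ.≤-<-trans (ℕₚ.m≤m+n z g) z+g<ℓ)) le)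
        ... | out _ _       = outside r le
        anti′ : ∀ r → μ (suc r) ≤ μ r
        anti′ r with view z w g r | view z w g (suc r)
        ... | inZ _ _ _ | inZ _ _ _ = ℕₚ.pred-mono-≤ (anti r)
        ... | inZ j le refl | inW j′ lt e =
          ⊥-elim (w≢z lt (≡.trans (≡.sym e) (≡.sym (ℕₚ.+-suc z j))))
        ... | inZ j le refl | out nz _ with ℕₚ.m≤n⇒m<n∨m≡n le
        ...   | inj₁ lt   = ⊥-elim (nz (suc j) lt (≡.sym (ℕₚ.+-suc z j)))
        ...   | inj₂ refl = ℕₚ.≤-trans (ℕₚ.pred-mono-≤ drop) (ℕₚ.pred-mono-≤ (ℕₚ.≤-reflexive (≡.sym (flat g ℕₚ.≤-refl))))
        anti′ r | inW _ _ _ | inZ _ _ _ = ℕₚ.≤-trans ℕₚ.pred[n]≤n (ℕₚ.m≤n⇒m≤1+n (anti r))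
        anti′ r | inW _ _ _ | inW _ _ _ = s≤s (anti r)
        anti′ r | inW _ _ _ | out _ _   = ℕₚ.m≤n⇒m≤1+n (anti r)
        anti′ r | out _ _ | inZ _ _ _ = ℕₚ.≤-trans ℕₚ.pred[n]≤n (anti r)
        anti′ r | out _ nw | inW (suc j) lt e =
          ⊥-elim (nw j (ℕₚ.<-trans (ℕₚ.n<1+n j) lt) (ℕₚ.suc-injective (≡.trans e (ℕₚ.+-suc w j))))
        -- If row `r` had the same part as row `w` below it, then `down r` would be `u C`, against
        -- the end of the chain.
        anti′ r | out _ nw | inW zero lt e = ℕₚ.≤∧≢⇒< (anti r) λ fl → top r (ℕₚ.suc-injective (≡.trans
          (≡.sym (down-flat r fl)) (≡.trans (≡.cong down e) (≡.trans (opens 0 lt) (≡.cong suc (ℕₚ.+-identityʳ (u C)))))))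
        anti′ r | out _ _ | out _ _ = anti r

      -- Losing a box moves the start of a row by one column; this is the root that the
      -- straightening removes. In the same way `down-w` matches the root it inserts.
      down-z : ∀ j → j ≤ g → Bounce.down covered (z + j) ≡ suc (down (z + j))
      down-z j le = ≡.trans (≡.cong (λ x → z + j + (suc k ∸ x)) (μ-z j le)) (shift-pred (parts (z + j)) (positive j le) (bound _))
        where
        shift-pred : ∀ x → 0 < x → x ≤ k → z + j + (suc k ∸ pred x) ≡ suc (z + j + (suc k ∸ x))
        shift-pred (suc x) _ le′ = ≡.trans (≡.cong (λ y → z + j + y) (ℕₚ.+-∸-assoc 1 (ℕₚ.<⇒≤ le′))) (ℕₚ.+-suc (z + j) (k ∸ x))

      down-w : ∀ j → j < g → Bounce.down covered (w + j) ≡ u C + j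
      down-w j lt = ≡.trans (≡.cong (λ x → w + j + (suc k ∸ x)) (μ-w j lt)) (ℕₚ.suc-injective (≡.trans
        (≡.sym (≡.trans (≡.cong (λ x → w + j + x) (ℕₚ.+-∸-assoc 1 (bound (w + j)))) (ℕₚ.+-suc (w + j) _))) (opens j lt)))

      down-out : ∀ {r} → (∀ j → j ≤ g → r ≢ z + j) → (∀ j → j < g → r ≢ w + j) → Bounce.down covered r ≡ down r
      down-out {r} nz nw = ≡.cong (λ x → r + (suc k ∸ x)) (μ-out nz nw)

  module CoverH (R : CommutativeRing 0ℓ 0ℓ) {k ℓ : ℕ} (p : ParFun k ℓ) where
    open CommutativeRing R using (_≈_; 0#; +-congˡ; +-congʳ; +-cong; +-identityʳ; setoid)
      renaming (_+_ to _+R_; refl to ≈-refl; sym to ≈-sym; trans to ≈-trans; Carrier to RCarrier)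
    open Bounce p
    open CoverShape p
    open Straightening R ℓ

    module Stage {z C : ℕ} {u : ℕ → ℕ} {w : ℕ} where

      -- The row starts and the weight after the straightening of rows z , … , z + j.
      rows : ℕ → ℕ → ℕ
      rows zero    = upd down z (suc (down z))
      rows (suc j) = upd (upd (rows j) (w + j) (u C + j)) (suc (z + j)) (suc (rows j (z + j)))

      weight : ℕ → Weight
      weight zero    = toW parts ⊖ε z
      weight (suc j) = weight j ⊕ (w + j , suc (z + j))

      rows-z : ∀ {j} → Good z C u w j → ∀ j′ → j′ ≤ j → rows j (z + j′) ≡ suc (down (z + j′))
      rows-z {zero} G zero le = ≡.trans (upd-≡ down z _ (ℕₚ.+-identityʳ z)) (≡.cong (suc ∘ down) (≡.sym (ℕₚ.+-identityʳ z)))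
      rows-z {suc j} G j′ le with ℕₚ.m≤n⇒m<n∨m≡n le
      ... | inj₂ refl = ≡.trans (upd-≡ _ (suc (z + j)) _ (ℕₚ.+-suc z j))
          (≡.cong suc (≡.trans (rows-z (Good-≤ (ℕₚ.n≤1+n j) G) j ℕₚ.≤-refl)
            (≡.sym (≡.trans (≡.cong down (ℕₚ.+-suc z j)) (down-flat (z + j) (≡.trans (≡.cong parts (≡.sym (ℕₚ.+-suc z j)))
              (≡.trans (Good.flat G (suc j) ℕₚ.≤-refl) (≡.sym (Good.flat G j (ℕₚ.n≤1+n j))))))))))
      ... | inj₁ (s≤s le′) = ≡.trans (upd-≢ _ (suc (z + j)) _ (ℕₚ.<⇒≢ (s≤s (ℕₚ.+-monoʳ-≤ z le′))))
          (≡.trans (upd-≢ _ (w + j) _ (ℕₚ.<⇒≢ (ℕₚ.<-≤-trans (good-w<z G j (ℕₚ.n<1+n j)) (ℕₚ.m≤m+n z j′)) ∘ ≡.sym))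
            (rows-z (Good-≤ (ℕₚ.n≤1+n j) G) j′ le′))

      rows-w : ∀ {j} → Good z C u w j → ∀ j′ → j′ < j → rows j (w + j′) ≡ u C + j′
      rows-w {suc j} G j′ lt = ≡.trans
        (upd-≢ _ (suc (z + j)) _ (ℕₚ.<⇒≢ (ℕₚ.<-≤-trans (good-w<z G j′ lt) (ℕₚ.m≤n⇒m≤1+n (ℕₚ.m≤m+n z j)))))
        (go (ℕₚ.m≤n⇒m<n∨m≡n (s≤s⁻¹ lt)))
        where
        go : j′ < j ⊎ j′ ≡ j → upd (rows j) (w + j) (u C + j) (w + j′) ≡ u C + j′
        go (inj₂ refl) = upd-≡ _ (w + j) _ refl
        go (inj₁ lt′)  = ≡.trans (upd-≢ _ (w + j) _ (ℕₚ.<⇒≢ (ℕₚ.+-monoʳ-< w lt′))) (rows-w (Good-≤ (ℕₚ.n≤1+n j) G) j′ lt′)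

      rows-out : ∀ {j r} → (∀ j′ → j′ ≤ j → r ≢ z + j′) → (∀ j′ → j′ < j → r ≢ w + j′) → rows j r ≡ down r
      rows-out {zero} nz nw = upd-≢ down z _ (λ e → nz 0 z≤n (≡.trans e (≡.sym (ℕₚ.+-identityʳ z))))
      rows-out {suc j} nz nw = ≡.trans (upd-≢ _ _ _ (λ e → nz (suc j) ℕₚ.≤-refl (≡.trans e (≡.sym (ℕₚ.+-suc z j)))))
        (≡.trans (upd-≢ _ _ _ (nw j ℕₚ.≤-refl))
          (rows-out (λ j′ le → nz j′ (ℕₚ.m≤n⇒m≤1+n le)) (λ j′ lt → nw j′ (ℕₚ.m<n⇒m<1+n lt))))

      weight-out : ∀ {j r} → (∀ j′ → j′ ≤ j → r ≢ z + j′) → (∀ j′ → j′ < j → r ≢ w + j′) → weight j r ≡ + parts r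
      weight-out {zero} {r} nz nw = ≡.trans (≡.cong (λ d → + parts r ℤ.- d)
        (δ-≢ (λ e → nz 0 z≤n (≡.trans (≡.sym e) (≡.sym (ℕₚ.+-identityʳ z)))))) (ℤₚ.+-identityʳ _)
      weight-out {suc j} nz nw = ≡.trans
        (⊕-other (weight j) (nw j ℕₚ.≤-refl ∘ ≡.sym) (λ e → nz (suc j) ℕₚ.≤-refl (≡.trans (≡.sym e) (≡.sym (ℕₚ.+-suc z j)))))
        (weight-out (λ j′ le → nz j′ (ℕₚ.m≤n⇒m≤1+n le)) (λ j′ lt → nw j′ (ℕₚ.m<n⇒m<1+n lt)))

      below-z : ∀ {j r} → r < z → ∀ j′ → j′ ≤ j → r ≢ z + j′
      below-z r<z j′ _ = ℕₚ.<⇒≢ (ℕₚ.<-≤-trans r<z (ℕₚ.m≤m+n z j′))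

      after-z : ∀ {j} j′ → j′ ≤ j → suc (z + j) ≢ z + j′
      after-z j′ le = ℕₚ.<⇒≢ (s≤s (ℕₚ.+-monoʳ-≤ z le)) ∘ ≡.sym

      above-w : ∀ {j r} → Good z C u w j → u C ≤ r → ∀ j′ → j′ < j → r ≢ w + j′
      above-w G le j′ lt = ℕₚ.<⇒≢ (ℕₚ.<-≤-trans (Good.w-separated G j′ lt) le) ∘ ≡.sym

      weight-z : ∀ {j} → Good z C u w j → ∀ j′ → j′ ≤ j → weight j (z + j′) ≡ + parts (z + j′) ℤ.- + 1
      weight-z {zero} G zero le = ≡.cong (λ d → + parts (z + 0) ℤ.- d) (δ-≡ (≡.sym (ℕₚ.+-identityʳ z)))
      weight-z {suc j} G j′ le with ℕₚ.m≤n⇒m<n∨m≡n le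
      ... | inj₂ refl = ≡.subst (λ s → weight (suc j) s ≡ + parts s ℤ.- + 1) (≡.sym (ℕₚ.+-suc z j))
          (≡.trans (⊕-target (weight j) (ℕₚ.<⇒≢ (ℕₚ.<-≤-trans (good-w<z G j (ℕₚ.n<1+n j)) (ℕₚ.m≤n⇒m≤1+n (ℕₚ.m≤m+n z j)))))
            (≡.cong (ℤ._- + 1) (weight-out after-z (above-w (Good-≤ (ℕₚ.n≤1+n j) G)
              (ℕₚ.≤-trans (Good.u≤z G ℕₚ.≤-refl) (ℕₚ.m≤n⇒m≤1+n (ℕₚ.m≤m+n z j)))))))
      ... | inj₁ (s≤s le′) = ≡.trans (⊕-other (weight j) (ℕₚ.<⇒≢ (ℕₚ.<-≤-trans (good-w<z G j (ℕₚ.n<1+n j)) (ℕₚ.m≤m+n z j′)))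
            (ℕₚ.<⇒≢ (s≤s (ℕₚ.+-monoʳ-≤ z le′)) ∘ ≡.sym))
          (weight-z (Good-≤ (ℕₚ.n≤1+n j) G) j′ le′)

      weight-w : ∀ {j} → Good z C u w j → ∀ j′ → j′ < j → weight j (w + j′) ≡ + parts (w + j′) ℤ.+ + 1
      weight-w {suc j} G j′ lt = go (ℕₚ.m≤n⇒m<n∨m≡n (s≤s⁻¹ lt))
        where
        w≢ : ∀ {j′} → j′ < suc j → suc (z + j) ≢ w + j′
        w≢ lt = ℕₚ.<⇒≢ (ℕₚ.<-≤-trans (good-w<z G _ lt) (ℕₚ.m≤n⇒m≤1+n (ℕₚ.m≤m+n z j))) ∘ ≡.sym
        go : j′ < j ⊎ j′ ≡ j → weight (suc j) (w + j′) ≡ + parts (w + j′) ℤ.+ + 1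
        go (inj₂ refl) = ≡.trans (⊕-source (weight j) (w≢ (ℕₚ.n<1+n j)))
          (≡.cong (ℤ._+ + 1) (weight-out (below-z (good-w<z G j (ℕₚ.n<1+n j)))
            (λ j″ lt″ → ℕₚ.<⇒≢ (ℕₚ.+-monoʳ-< w lt″) ∘ ≡.sym)))
        go (inj₁ lt′) = ≡.trans (⊕-other (weight j) (ℕₚ.<⇒≢ (ℕₚ.+-monoʳ-< w lt′) ∘ ≡.sym) (w≢ lt))
          (weight-w (Good-≤ (ℕₚ.n≤1+n j) G) j′ lt′)

      -- The rows altered by earlier stages start strictly after this column, for the block of `z`,
      -- or strictly before it, for the block of `w`; so only unaltered rows can start here.
      rows-start : ∀ {j r i} → Good z C u w j → i ≤ C → rows j r ≡ suc (u i + j) →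
        down r ≡ suc (u i + j) × (∀ j′ → j′ ≤ j → r ≢ z + j′)
      rows-start {j} {r} {i} G i≤C e with view z w j r
      ... | out nz nw = ≡.trans (≡.sym (rows-out nz nw)) e , nz
      ... | inZ j′ le refl = ⊥-elim (ℕₚ.<⇒≢ lt (≡.sym (ℕₚ.suc-injective (≡.trans (≡.sym (rows-z G j′ le)) e))))
        where
        lt : u i + j < down (z + j′)
        lt = ℕₚ.≤-<-trans (ℕₚ.+-monoˡ-≤ j (Good.u≤z G i≤C)) (ℕₚ.<-≤-trans (Good.short G) (down-mono-≤ (ℕₚ.m≤m+n z j′)))
      ... | inW j′ lt refl = ⊥-elim (ℕₚ.<⇒≢ lt′ (≡.trans (≡.sym (rows-w G j′ lt)) e))
        where
        lt′ : u C + j′ < suc (u i + j)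
        lt′ = s≤s (ℕₚ.+-mono-≤ (chain-antitone (Good.ch G) i≤C ℕₚ.≤-refl) (ℕₚ.<⇒≤ lt))

    module WithFunctional (F : Fun) (F-ext : Ext F)
      (F-negative : ∀ {γ} r → suc r ≡ ℓ → γ r ℤ.< + 0 → F γ ≈ 0#)
      (m : ℕ) (F-alt : ∀ x → suc x < ℓ → suc x < m ⊎ m ≤ x → Alt x F) where
      open Config F F-ext

      private
        ⊕-< : ∀ γ α r → proj₁ α ≢ r → γ r ℤ.< + 0 → (γ ⊕ α) r ℤ.< + 0
        ⊕-< γ (i , j) r ne lt rewrite δ-≢ ne | ℤₚ.+-identityʳ (γ r) with j ≟ r
        ... | yes _ = ℤₚ.≤-<-trans (ℤₚ.i-j≤i (γ r) (+ 1)) lt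
        ... | no _  rewrite ℤₚ.+-identityʳ (γ r) = lt

      -- Without roots in row `r`, raising operators can only lower its entry, which therefore stays
      -- negative in every term.
      negative-0 : ∀ r → suc r ≡ ℓ → ∀ Ψ → (∀ {α} → α ∈ Ψ → proj₁ α ≢ r) → ∀ n {γ} → γ r ℤ.< + 0 → H F Ψ n γ ≈ 0#
      negative-0 r e []      ok zero    lt = F-negative r e lt
      negative-0 r e []      ok (suc n) lt = ≈-refl
      negative-0 r e (α ∷ Ψ) ok zero    lt = negative-0 r e Ψ (ok ∘ there) zero lt
      negative-0 r e (α ∷ Ψ) ok (suc n) {γ} lt = 0+0 (negative-0 r e Ψ (ok ∘ there) (suc n) lt)
        (negative-0 r e (α ∷ Ψ) ok n (⊕-< γ α r (ok (here refl)) lt))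

      module _ {z C : ℕ} {u : ℕ → ℕ} {w : ℕ} (mark : ∃ λ i₀ → i₀ ≤ C × u i₀ ≡ m) where
        open Stage {z} {C} {u} {w}

        private
          i₀ = proj₁ mark
          i₀≤C = proj₁ (proj₂ mark)
          ui₀≡m = proj₂ (proj₂ mark)

        -- The levels up to i of the climb between stages j and j + 1.
        module Climb {j : ℕ} (G : Good z C u w j) (sz<ℓ : suc (z + j) < ℓ) (fl : parts (suc (z + j)) ≡ parts z)
          (i : ℕ) (i≤C : i ≤ C) (L : ∀ i′ → i′ < i → down (suc (u (suc i′) + j)) ≡ suc (u i′ + j))
          (sh : i ≡ 0 ⊎ suc (z + j) < down z) where
          open Good G hiding (top)

          -- For `i = 0` there is no higher level to separate. This case serves the outcome
          -- `wrapped`, in which `suc (z + j)` equals `down z`.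
          sep : ∀ i′ → i′ < i → suc (u (suc i′) + j) < u i′
          sep i′ lt = [ (λ e → ⊥-elim (ℕₚ.n≮0 (≡.subst (i′ <_) e lt))) , (λ sh′ → go sh′ i′ lt) ]′ sh
            where
            go : suc (z + j) < down z → ∀ i′ → i′ < i → suc (u (suc i′) + j) < u i′
            go sh′ zero lt = down-cancel-< (≡.subst₂ _<_ (≡.sym (≡.trans (L 0 lt) (≡.cong (λ x → suc (x + j)) base)))
              (≡.cong down (≡.sym base)) sh′)
            go sh′ (suc i′) lt = down-cancel-< (≡.subst₂ _<_ (≡.sym (L (suc i′) lt)) (≡.sym (links i′ (ℕₚ.<⇒≤ (ℕₚ.<-≤-trans lt i≤C))))
              (go sh′ i′ (ℕₚ.<⇒≤ lt)))

          alt : ∀ i′ → i′ ≤ i → suc (u i′ + j) < ℓ → Alt (u i′ + j) F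
          alt i′ le lt = F-alt (u i′ + j) lt (side (ℕₚ.≤-<-connex i′ i₀))
            where
            side : i′ ≤ i₀ ⊎ i₀ < i′ → suc (u i′ + j) < m ⊎ m ≤ u i′ + j
            side (inj₁ i′≤i₀) = inj₂ (ℕₚ.≤-trans (≡.subst (_≤ u i′) ui₀≡m (chain-antitone ch i′≤i₀ i₀≤C)) (ℕₚ.m≤m+n _ j))
            side (inj₂ (s≤s {n = i″} i₀≤i″)) = inj₁ (ℕₚ.<-≤-trans (sep i″ le)
              (≡.subst (u i″ ≤_) ui₀≡m (chain-antitone ch i₀≤i″ (ℕₚ.<⇒≤ (ℕₚ.<-≤-trans le i≤C)))))

          -- Row `z + j` has lost its first root and has its entry lowered by one, while row
          -- `suc (z + j)` is untouched. Flatness makes their starts agree and the weight fixed.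
          start-wall : Wall (rows j) (weight j) (z + j)
          start-wall = mkWall sz<ℓ
            (≡.subst (λ x → Alt (x + j) F) base (alt 0 z≤n (≡.subst (λ x → suc (x + j) < ℓ) (≡.sym base) sz<ℓ)))
            (≡.trans rz (≡.sym rsz))
            (≡.subst (suc (z + j) <_) (≡.sym rz) (s≤s (down> (z + j))))
            (mkFixed (≡.trans (≡.cong (ℤ._+ + 1) (weight-z G j ℕₚ.≤-refl)) (≡.trans (cancel (parts (z + j)))
              (≡.trans (≡.cong +_ (≡.trans (flat j ℕₚ.≤-refl) (≡.sym fl))) (≡.sym (weight-out after-z w-out))))))
            where
            w-out = above-w G (ℕₚ.≤-trans (u≤z ℕₚ.≤-refl) (ℕₚ.m≤n⇒m≤1+n (ℕₚ.m≤m+n z j)))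
            rz = rows-z G j ℕₚ.≤-refl
            rsz : rows j (suc (z + j)) ≡ suc (down (z + j))
            rsz = ≡.trans (rows-out after-z w-out) (down-flat (z + j) (≡.trans fl (≡.sym (flat j ℕₚ.≤-refl))))
            cancel : ∀ x → + x ℤ.- + 1 ℤ.+ + 1 ≡ + x
            cancel x = ≡.trans (ℤₚ.+-assoc (+ x) (ℤ.- + 1) (+ 1)) (ℤₚ.+-identityʳ (+ x))

          mirror : ∀ i′ → i′ < i → Mirror (rows j) (weight j) (u i′ + j) (u (suc i′) + j)
          mirror i′ lt = mkMirror
            (ℕₚ.<-≤-trans (sep i′ lt) (ℕₚ.m≤m+n _ j))
            (alt (suc i′) lt (ℕₚ.<-trans (sep i′ lt) (ℕₚ.≤-<-trans ui′≤z z<ℓ)))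
            (≡.trans (rows-out (below-z x<z) x-w) (path i′ i′<C j ℕₚ.≤-refl))
            (≡.trans (rows-out (below-z sx<z) sx-w) (L i′ lt))
            (λ r _ e → down-injective (≡.trans (proj₁ (rows-start G (ℕₚ.<⇒≤ i′<C) e)) (≡.sym (L i′ lt))))
            (≡.trans (weight-out (below-z x<z) x-w) (≡.trans (≡.cong +_ (≡.sym part-eq)) (≡.sym (weight-out (below-z sx<z) sx-w))))
            where
            i′<C = ℕₚ.<-≤-trans lt i≤C
            z<ℓ = ℕₚ.≤-<-trans (ℕₚ.m≤m+n z j) (ℕₚ.<-trans (ℕₚ.n<1+n _) sz<ℓ)
            ui′≤z = u≤z (ℕₚ.<⇒≤ i′<C)
            sx<z = ℕₚ.<-≤-trans (sep i′ lt) ui′≤z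
            x<z = ℕₚ.<-trans (ℕₚ.n<1+n _) sx<z
            uC≤x = ℕₚ.≤-trans (chain-antitone ch i′<C ℕₚ.≤-refl) (ℕₚ.m≤m+n _ j)
            x-w = above-w G uC≤x
            sx-w = above-w G (ℕₚ.m≤n⇒m≤1+n uC≤x)
            part-eq = flat-down (u (suc i′) + j) (≡.trans (L i′ lt) (≡.cong suc (≡.sym (path i′ i′<C j ℕₚ.≤-refl))))

          closed : (∀ r → r < ℓ → rows j r ≢ suc (u i + j)) → ∀ d i′ → d + i′ ≡ i → Closed (rows j) (weight j) (u i′ + j) d
          closed ceil zero    i′ refl = top ceil
          closed ceil (suc d) i′ e    = step (mirror i′ (≡.subst (i′ <_) e (s≤s (ℕₚ.m≤n+m i′ d))))
            (closed ceil d (suc i′) (≡.trans (ℕₚ.+-suc d i′) e))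

          closed-z : (∀ r → r < ℓ → rows j r ≢ suc (u i + j)) → ∀ n → HC (rows j) n (weight j) ≈ 0#
          closed-z ceil = closed-0 start-wall (≡.subst (λ x → Closed (rows j) (weight j) (x + j) i) base
            (closed ceil i 0 (ℕₚ.+-identityʳ i)))

          opened : i ≡ C → Good z C u w (suc j) → ∀ d i′ → d + i′ ≡ i → Open (rows j) (weight j) (w + j) (u C + j) (u i′ + j) (suc d)
          opened refl G′ zero i′ refl = top (ℕₚ.<-≤-trans (Good.w-separated G′ j (ℕₚ.n<1+n j)) (ℕₚ.m≤m+n _ j))
            (≡.trans (rows-out (below-z (good-w<z G′ j (ℕₚ.n<1+n j)))
              (λ j″ lt″ → ℕₚ.<⇒≢ (ℕₚ.+-monoʳ-< w lt″) ∘ ≡.sym)) (Good.opens G′ j (ℕₚ.n<1+n j)))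
            (λ r _ e → down-injective (≡.trans (proj₁ (rows-start G ℕₚ.≤-refl e)) (≡.sym (Good.opens G′ j (ℕₚ.n<1+n j)))))
          opened e₀ G′ (suc d) i′ e = step (mirror i′ (≡.subst (i′ <_) e (s≤s (ℕₚ.m≤n+m i′ d))))
            (opened e₀ G′ d (suc i′) (≡.trans (ℕₚ.+-suc d i′) e))

        -- Every stage climbs `C` mirrors and one open end, which accounts for `suc C` factors t.
        stages : ∀ j → Good z C u w j → z + j < ℓ → ∀ n →
          HC (rows 0) n (weight 0) ≈ sh (j ℕ.* suc C) (λ n → HC (rows j) n (weight j)) n
        stages zero    G lt n = ≈-refl
        stages (suc j) G lt n = ≈-trans (stages j Gj (ℕₚ.<-trans (ℕₚ.n<1+n _) sz<ℓ) n)
          (≈-trans (sh-cong (j ℕ.* suc C) (straighten start-wall open-z) n)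
          (≈-trans (sh-sh (j ℕ.* suc C) (suc C) _ n)
            (≡.subst (λ s → sh (j ℕ.* suc C + suc C) G′ n ≈ sh s G′ n) (ℕₚ.+-comm (j ℕ.* suc C) (suc C)) ≈-refl)))
          where
          G′ = λ n → HC (rows (suc j)) n (weight (suc j))
          Gj = Good-≤ (ℕₚ.n≤1+n j) G
          sz<ℓ = ≡.subst (_< ℓ) (ℕₚ.+-suc z j) lt
          open Climb Gj sz<ℓ (≡.trans (≡.cong parts (≡.sym (ℕₚ.+-suc z j))) (Good.flat G (suc j) ℕₚ.≤-refl)) C ℕₚ.≤-refl
            (λ i′ lt′ → ≡.trans (≡.cong down (≡.sym (ℕₚ.+-suc _ j))) (≡.trans (Good.path G i′ lt′ (suc j) ℕₚ.≤-refl) (ℕₚ.+-suc _ j)))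
            (inj₂ (≡.subst (_< down z) (ℕₚ.+-suc z j) (Good.short G)))
          open-z : Open (rows j) (weight j) (w + j) (u C + j) (z + j) (suc C)
          open-z = ≡.subst (λ x → Open (rows j) (weight j) (w + j) (u C + j) (x + j) (suc C)) (Good.base G)
            (opened refl G C 0 (ℕₚ.+-identityʳ C))

      Marked : ℕ → Set
      Marked z = ∀ {C u} → Chain z C u → ∃ λ i₀ → i₀ ≤ C × u i₀ ≡ m

      truncated : ℕ → ℕ → RCarrier
      truncated z n = HC (upd down z (suc (down z))) n (toW parts ⊖ε z)

      -- In `wrapped`, the removed root of row `z` leaves no row starting in column `down z`; in
      -- `blocked`, the ceiling is on level `i`; in `last`, the last row has entry -1 and no roots.
      not-covered : ∀ {z} → Marked z → z < ℓ → ¬ Cover z → ∀ n → truncated z n ≈ 0#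
      not-covered {z} mk z<ℓ ¬c n with outcome z z<ℓ
      ... | cover c = ⊥-elim (¬c (_ , _ , _ , _ , c))
      ... | wrapped {C} {u} {w} {j} G lt fl e = ≈-trans (stages (mk ch) j G (ℕₚ.<⇒≤ lt) n)
          (sh-0 (j ℕ.* _) (Climb.closed-z (mk ch) G lt fl 0 z≤n (λ _ ()) (inj₁ refl) ceil) n)
        where
        open Good G
        open Stage {z} {C} {u} {w}
        ceil : ∀ r → r < ℓ → rows j r ≢ suc (u 0 + j)
        ceil r _ eq with rows-start G z≤n eq
        ... | d , nz = nz 0 z≤n (≡.trans (down-injective (≡.trans d (≡.trans (≡.cong (λ x → suc (x + j)) base) e)))
                         (≡.sym (ℕₚ.+-identityʳ z)))
      ... | blocked {C} {u} {w} {j} G lt fl sh i i≤C L nr = ≈-trans (stages (mk ch) j G (ℕₚ.<⇒≤ lt) n)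
          (sh-0 (j ℕ.* _) (Climb.closed-z (mk ch) G lt fl i i≤C L (inj₂ sh) (λ r _ e → nr r (proj₁ (rows-start G i≤C e)))) n)
        where
        open Good G
        open Stage {z} {C} {u} {w}
      ... | last {C} {u} {w} {j} G e p0 = ≈-trans (stages (mk ch) j G (≡.subst (z + j <_) e (ℕₚ.n<1+n _)) n)
          (sh-0 (j ℕ.* _) (λ n → negative-0 (z + j) e (roots (rows j)) ok n {weight j} neg) n)
        where
        open Good G
        open Stage {z} {C} {u} {w}
        ok : ∀ {α} → α ∈ roots (rows j) → proj₁ α ≢ z + j
        ok mem refl with ∈-roots⁻ mem
        ... | _ , b , le = ℕₚ.<⇒≱ b (ℕₚ.≤-trans (≡.subst (_≤ suc (down (z + j))) e (s≤s (ℕₚ.<⇒≤ (down> (z + j)))))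
                             (ℕₚ.≤-trans (ℕₚ.≤-reflexive (≡.sym (rows-z G j ℕₚ.≤-refl))) le))
        neg : weight j (z + j) ℤ.< + 0
        neg = ≡.subst (ℤ._< + 0) (≡.sym (≡.trans (weight-z G j ℕₚ.≤-refl)
          (≡.cong (λ x → + x ℤ.- + 1) (≡.trans (flat j ℕₚ.≤-refl) p0)))) ℤ.-<+

      covered-H : ∀ {z C u w g} (c : IsCover z C u w g) → Marked z → ∀ n →
        truncated z n ≈ sh (g ℕ.* suc C) (λ n → HC (Bounce.down (Covered.covered c)) n (toW (Covered.μ c))) n
      covered-H {z} {C} {u} {w} {g} c mk n = ≈-trans (stages (mk ch) g good z+g<ℓ n)
        (sh-cong (g ℕ.* suc C) (λ n → ≈-trans (HC-cong (λ r _ → rows≡ r) n _) (HC-ext _ n weight≡)) n)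
        where
        open IsCover c
        open Covered c
        open Stage {z} {C} {u} {w}
        rows≡ : ∀ r → rows g r ≡ Bounce.down covered r
        rows≡ r = go (view z w g r)
          where
          go : View z w g r → rows g r ≡ Bounce.down covered r
          go (inZ j le refl) = ≡.trans (rows-z good j le) (≡.sym (down-z j le))
          go (inW j lt refl) = ≡.trans (rows-w good j lt) (≡.sym (down-w j lt))
          go (out nz nw)     = ≡.trans (rows-out nz nw) (≡.sym (down-out nz nw))
        weight≡ : weight g ≗ toW μ
        weight≡ r with view z w g r
        ... | inZ j le refl = ≡.trans (weight-z good j le) (minus-pred (parts (z + j)) (positive j le))
          where
          minus-pred : ∀ x → 0 < x → + x ℤ.- + 1 ≡ + pred x
          minus-pred (suc x) _ = refl
        ... | inW j lt refl = ≡.trans (weight-w good j lt) (≡.cong +_ (ℕₚ.+-comm (parts (w + j)) 1))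
        ... | out nz nw = weight-out nz nw

      peel : ∀ {z} → z < ℓ → down z < ℓ → ∀ n →
        HC down n (toW parts ⊖ε z) ≈ truncated z n +R sh 1 (λ n → HC down n (toW parts ⊖ε down z)) n
      peel {z} z<ℓ dz<ℓ n = ≈-trans (remove z<ℓ dz<ℓ refl n _) (+-congˡ (sh-cong 1 (λ n → HC-ext down n weights) n))
        where
        weights : toW parts ⊖ε z ⊕ (z , down z) ≗ toW parts ⊖ε down z
        weights r = ≡.cong (ℤ._- δ (down z) r) (cancel (+ parts r) (δ z r))
          where
          cancel : ∀ g d → g ℤ.- d ℤ.+ d ≡ g
          cancel = solve-∀

      peel-last : ∀ {z} → ℓ ≤ down z → ∀ n → HC down n (toW parts ⊖ε z) ≈ truncated z n
      peel-last {z} le n = retract le (ℕₚ.n≤1+n _) n _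

-- Cores, their hook lengths and the recursion for their rows.

module Cores where
  open import Data.Nat using (ℕ; zero; suc; z≤n; s≤s; s≤s⁻¹; _≤?_; _+_; _∸_; _≤_; _<_; _≤ᵇ_; _<ᵇ_; _≡ᵇ_)
  open import Data.Unit using (tt)
  open import Data.List using (drop)
  open import Data.List.Relation.Unary.Any using (here; there)
  open BounceGraphs

  true⇒T : ∀ {b} → b ≡ true → T b
  true⇒T refl = tt

  T⇒true : ∀ {b} → T b → b ≡ true
  T⇒true {true} _ = refl

  ≤ᵇ⇒≤ : ∀ {m n} → (m ≤ᵇ n) ≡ true → m ≤ n
  ≤ᵇ⇒≤ = ℕₚ.≤ᵇ⇒≤ _ _ ∘ true⇒T

  ≤⇒≤ᵇ : ∀ {m n} → m ≤ n → (m ≤ᵇ n) ≡ true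
  ≤⇒≤ᵇ = T⇒true ∘ ℕₚ.≤⇒≤ᵇ

  <ᵇ⇒< : ∀ {m n} → (m <ᵇ n) ≡ true → m < n
  <ᵇ⇒< = ℕₚ.<ᵇ⇒< _ _ ∘ true⇒T

  <⇒<ᵇ : ∀ {m n} → m < n → (m <ᵇ n) ≡ true
  <⇒<ᵇ = T⇒true ∘ ℕₚ.<⇒<ᵇ

  ≡ᵇ⇒≡ : ∀ {m n} → (m ≡ᵇ n) ≡ true → m ≡ n
  ≡ᵇ⇒≡ = ℕₚ.≡ᵇ⇒≡ _ _ ∘ true⇒T

  ≡⇒≡ᵇ : ∀ {m n} → m ≡ n → (m ≡ᵇ n) ≡ true
  ≡⇒≡ᵇ {m} {n} = T⇒true ∘ ℕₚ.≡⇒≡ᵇ m n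

  ∧-intro : ∀ {a b} → a ≡ true → b ≡ true → a ∧ b ≡ true
  ∧-intro refl refl = refl

  ∧-elim : ∀ {a b} → a ∧ b ≡ true → a ≡ true × b ≡ true
  ∧-elim {a} {b} e = Boolₚ.∧-conicalˡ a b e , Boolₚ.∧-conicalʳ a b e

  ∨-elim : ∀ {a b} → a ∨ b ≡ true → a ≡ true ⊎ b ≡ true
  ∨-elim {true}  e = inj₁ refl
  ∨-elim {false} e = inj₂ e

  ∨-introˡ : ∀ {a b} → a ≡ true → a ∨ b ≡ true
  ∨-introˡ refl = refl

  ∨-introʳ : ∀ {a b} → b ≡ true → a ∨ b ≡ true
  ∨-introʳ {true}  e = refl
  ∨-introʳ {false} e = e

  not-intro : ∀ {a} → a ≢ true → not a ≡ true
  not-intro {true}  ne = ⊥-elim (ne refl)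
  not-intro {false} ne = refl

  not-elim : ∀ {a} → not a ≡ true → a ≢ true
  not-elim {false} _ ()

  ≢true : ∀ {a} → a ≢ true → a ≡ false
  ≢true {true}  ne = ⊥-elim (ne refl)
  ≢true {false} ne = refl

  module _ {A : Set} {p : A → Bool} where
    allᵇ⁻ : ∀ {xs} → allᵇ p xs ≡ true → ∀ {x} → x ∈ xs → p x ≡ true
    allᵇ⁻ {x ∷ xs} e (here refl) = proj₁ (∧-elim e)
    allᵇ⁻ {x ∷ xs} e (there m)   = allᵇ⁻ (proj₂ (∧-elim {p x} e)) m

    allᵇ⁺ : ∀ xs → (∀ {x} → x ∈ xs → p x ≡ true) → allᵇ p xs ≡ true
    allᵇ⁺ []       f = refl
    allᵇ⁺ (x ∷ xs) f = ∧-intro (f (here refl)) (allᵇ⁺ xs (f ∘ there))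

    anyᵇ⁻ : ∀ xs → anyᵇ p xs ≡ true → ∃ λ x → x ∈ xs × p x ≡ true
    anyᵇ⁻ (x ∷ xs) e with ∨-elim {p x} e
    ... | inj₁ px = x , here refl , px
    ... | inj₂ e′ = let y , m , py = anyᵇ⁻ xs e′ in y , there m , py

    anyᵇ⁺ : ∀ {xs x} → x ∈ xs → p x ≡ true → anyᵇ p xs ≡ true
    anyᵇ⁺ (here refl)        px = ∨-introˡ px
    anyᵇ⁺ {y ∷ xs} (there m) px = ∨-introʳ {p y} (anyᵇ⁺ m px)

    ∈-filterᵇ⁻ : ∀ {xs x} → x ∈ filterᵇ p xs → x ∈ xs × p x ≡ true
    ∈-filterᵇ⁻ {xs} m = let m′ , t = ∈-filter⁻ (T? ∘ p) {xs = xs} m in m′ , T⇒true t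

    ∈-filterᵇ⁺ : ∀ {xs x} → x ∈ xs → p x ≡ true → x ∈ filterᵇ p xs
    ∈-filterᵇ⁺ m e = ∈-filter⁺ (T? ∘ p) m (true⇒T e)

  countᵇ-threshold : ∀ (f : ℕ → Bool) g N a → a ≤ N →
    (∀ c → c < N → f (g c) ≡ true → a ≤ c) → (∀ c → c < N → a ≤ c → f (g c) ≡ true) →
    countᵇ f (applyUpTo g N) ≡ N ∸ a
  countᵇ-threshold f g zero    a       le to from = ≡.sym (ℕₚ.0∸n≡0 a)
  countᵇ-threshold f g (suc N) zero    le to from rewrite from 0 (s≤s z≤n) z≤n =
    ≡.cong suc (countᵇ-threshold f (g ∘ suc) N 0 z≤n (λ _ _ _ → z≤n) (λ c lt _ → from (suc c) (s≤s lt) z≤n))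
  countᵇ-threshold f g (suc N) (suc a) (s≤s le) to from
    rewrite ≢true {f (g 0)} (λ e → ℕₚ.n≮0 (to 0 (s≤s z≤n) e)) =
    countᵇ-threshold f (g ∘ suc) N a le (λ c lt e → s≤s⁻¹ (to (suc c) (s≤s lt) e)) (λ c lt le → from (suc c) (s≤s lt) (s≤s le))

  part-outside : ∀ xs r → length xs ≤ r → part xs r ≡ 0
  part-outside []       r       _        = refl
  part-outside (x ∷ xs) (suc r) (s≤s le) = part-outside xs r le

  part-inside : ∀ xs r → 0 < part xs r → r < length xs
  part-inside xs r lt with ℕₚ.<-≤-connex r (length xs)
  ... | inj₁ a = a
  ... | inj₂ b = ⊥-elim (ℕₚ.<⇒≢ lt (≡.sym (part-outside xs r b)))

  part-drop : ∀ d xs i → part (drop d xs) i ≡ part xs (d + i)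
  part-drop zero    xs       i = refl
  part-drop (suc d) []       i = refl
  part-drop (suc d) (x ∷ xs) i = part-drop d xs i

  length-map-upTo : ∀ {A : Set} (f : ℕ → A) n → length (map f (upTo n)) ≡ n
  length-map-upTo f n = ≡.trans (Listₚ.length-map f (upTo n)) (Listₚ.length-upTo n)

  part-map-upTo : ∀ f n r → r < n → part (map f (upTo n)) r ≡ f r
  part-map-upTo f n r lt = go id n r lt
    where
    go : ∀ (g : ℕ → ℕ) n r → r < n → part (map f (applyUpTo g n)) r ≡ f (g r)
    go g (suc n) zero    _        = refl
    go g (suc n) (suc r) (s≤s lt) = go (g ∘ suc) n r lt

  record Partition (κ : List ℕ) : Set where
    field
      weakly   : ∀ r → part κ (suc r) ≤ part κ r
      positive : ∀ r → r < length κ → 0 < part κ r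

    antitoneₚ : ∀ {r s} → r ≤ s → part κ s ≤ part κ r
    antitoneₚ = antitone (part κ) weakly

  Partition-∷ : ∀ {x y xs} → y ≤ x → Partition (y ∷ xs) → Partition (x ∷ y ∷ xs)
  Partition-∷ y≤x P = record
    { weakly = λ { zero → y≤x ; (suc r) → Partition.weakly P r }
    ; positive = λ { zero _ → ℕₚ.<-≤-trans (Partition.positive P 0 (s≤s z≤n)) y≤x ; (suc r) (s≤s lt) → Partition.positive P r lt } }

  isPartition⁻ : ∀ κ → isPartitionᵇ κ ≡ true → Partition κ
  isPartition⁻ []           e = record { weakly = λ _ → z≤n ; positive = λ _ () }
  isPartition⁻ (x ∷ [])     e = record { weakly = λ _ → z≤n ; positive = λ { zero _ → ≤ᵇ⇒≤ e ; (suc r) (s≤s ()) } }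
  isPartition⁻ (x ∷ y ∷ xs) e = Partition-∷ (≤ᵇ⇒≤ (proj₁ (∧-elim {y ≤ᵇ x} e))) (isPartition⁻ (y ∷ xs) (proj₂ (∧-elim {y ≤ᵇ x} e)))

  Partition-tail : ∀ {x xs} → Partition (x ∷ xs) → Partition xs
  Partition-tail P = record { weakly = Partition.weakly P ∘ suc ; positive = λ r lt → Partition.positive P (suc r) (s≤s lt) }

  isPartition⁺ : ∀ κ → Partition κ → isPartitionᵇ κ ≡ true
  isPartition⁺ []           P = refl
  isPartition⁺ (x ∷ [])     P = ≤⇒≤ᵇ (Partition.positive P 0 (s≤s z≤n))
  isPartition⁺ (x ∷ y ∷ xs) P = ∧-intro (≤⇒≤ᵇ (Partition.weakly P 0)) (isPartition⁺ (y ∷ xs) (Partition-tail P))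

  part-injective : ∀ {κ κ′} → (∀ r → r < length κ → 0 < part κ r) → (∀ r → r < length κ′ → 0 < part κ′ r) →
    (∀ r → part κ r ≡ part κ′ r) → κ ≡ κ′
  part-injective {[]}    {[]}     P Q e = refl
  part-injective {[]}    {y ∷ ys} P Q e = ⊥-elim (ℕₚ.<⇒≢ (Q 0 (s≤s z≤n)) (e 0))
  part-injective {x ∷ xs} {[]}    P Q e = ⊥-elim (ℕₚ.<⇒≢ (P 0 (s≤s z≤n)) (≡.sym (e 0)))
  part-injective {x ∷ xs} {y ∷ ys} P Q e = ≡.cong₂ _∷_ (e 0)
    (part-injective (λ r → P (suc r) ∘ s≤s) (λ r → Q (suc r) ∘ s≤s) (e ∘ suc))

  -- For weakly decreasing parts, column lengths and row lengths determine each other; in this form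
  -- legs can be compared with single rows.
  count-legs : ∀ xs → (∀ r → part xs (suc r) ≤ part xs r) → ∀ c i →
    (i < countᵇ (λ x → c <ᵇ x) xs → c < part xs i) × (c < part xs i → i < countᵇ (λ x → c <ᵇ x) xs)
  count-legs []       w c i = (λ ()) , (λ ())
  count-legs (x ∷ xs) w c i with (c <ᵇ x) in eq
  count-legs (x ∷ xs) w c zero    | true = (λ _ → <ᵇ⇒< eq) , (λ _ → s≤s z≤n)
  count-legs (x ∷ xs) w c (suc i) | true =
    (λ lt → proj₁ (count-legs xs (w ∘ suc) c i) (s≤s⁻¹ lt)) , (λ lt → s≤s (proj₂ (count-legs xs (w ∘ suc) c i) lt))
  count-legs (x ∷ xs) w c i       | false =
    (λ lt → ⊥-elim (ℕₚ.<⇒≱ (proj₁ (count-legs xs (w ∘ suc) c 0) (ℕₚ.≤-<-trans z≤n lt)) (ℕₚ.≤-trans (w 0) x≤c))) ,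
    (λ lt → ⊥-elim (ℕₚ.<⇒≱ lt (ℕₚ.≤-trans (antitone (part (x ∷ xs)) w {0} {i} z≤n) x≤c)))
    where
    x≤c : x ≤ c
    x≤c = ℕₚ.≮⇒≥ λ lt → case-⊥ (≡.trans (≡.sym eq) (<⇒<ᵇ lt))
      where
      case-⊥ : false ≡ true → ⊥
      case-⊥ ()

  leg : List ℕ → ℕ → ℕ → ℕ
  leg κ r c = countᵇ (λ x → c <ᵇ x) (drop (suc r) κ)

  leg-spec : ∀ {κ} → Partition κ → ∀ r c i →
    (i < leg κ r c → c < part κ (suc r + i)) × (c < part κ (suc r + i) → i < leg κ r c)
  leg-spec {κ} P r c i =
    (λ lt → ≡.subst (c <_) (part-drop (suc r) κ i) (proj₁ spec lt)) ,
    (λ lt → proj₂ spec (≡.subst (c <_) (≡.sym (part-drop (suc r) κ i)) lt))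
    where
    weak : ∀ i → part (drop (suc r) κ) (suc i) ≤ part (drop (suc r) κ) i
    weak i = ≡.subst₂ _≤_ (≡.trans (≡.cong (part κ) (≡.sym (ℕₚ.+-suc (suc r) i))) (≡.sym (part-drop (suc r) κ (suc i))))
      (≡.sym (part-drop (suc r) κ i)) (Partition.weakly P (suc r + i))
    spec = count-legs (drop (suc r) κ) weak c i

  ∈-boxes⁺ : ∀ {κ r c} → c < part κ r → (r , c) ∈ boxes κ
  ∈-boxes⁺ {κ} {r} {c} lt = ∈-concat⁺′ (∈-map⁺ (r ,_) (∈-upTo⁺ lt))
    (∈-map⁺ (λ r → map (r ,_) (upTo (part κ r))) (∈-upTo⁺ (part-inside κ r (ℕₚ.≤-<-trans z≤n lt))))

  ∈-boxes⁻ : ∀ {κ r c} → (r , c) ∈ boxes κ → c < part κ r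
  ∈-boxes⁻ {κ} {r} {c} m with ∈-concat⁻′ (map (λ r → map (r ,_) (upTo (part κ r))) (upTo (length κ))) m
  ... | _ , m₁ , m₂ with ∈-map⁻ (λ r → map (r ,_) (upTo (part κ r))) m₂
  ... | r′ , _ , refl with ∈-map⁻ (r′ ,_) m₁
  ... | c′ , m₃ , refl = ∈-upTo⁻ m₃

  -- The row lengths K of a (k+1)-core: K r - part r is the length of the row from which
  -- on all boxes of row r have hook length at most k.
  record Core {k ℓ} (p : ParFun k ℓ) (K : ℕ → ℕ) : Set where
    open Bounce p
    field
      recur : ∀ r → K r ≡ parts r + K (down r)
      empty : ∀ r → ℓ ≤ r → K r ≡ 0

  -- A row of a core is determined by the later row to which it bounces, so inductions start at the
  -- empty rows and move towards row 0.
  downward-ind : ∀ ℓ (P : ℕ → Set) → (∀ r → ℓ ≤ r → P r) → (∀ r → r < ℓ → (∀ s → r < s → P s) → P r) → ∀ r → P r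
  downward-ind ℓ P far step r = go ℓ r (ℕₚ.m≤m+n ℓ r)
    where
    go : ∀ d r → ℓ ≤ d + r → P r
    go zero    r le = far r le
    go (suc d) r le with ℕₚ.<-≤-connex r ℓ
    ... | inj₂ ge = far r ge
    ... | inj₁ lt = step r lt λ s r<s → go d s (ℕₚ.≤-trans le (≡.subst (_≤ d + s) (ℕₚ.+-suc d r) (ℕₚ.+-monoʳ-≤ d r<s)))

  module CoreFacts {k ℓ} (p : ParFun k ℓ) where
    open Bounce p

    Core-unique : ∀ {K K′} → Core p K → Core p K′ → ∀ r → K r ≡ K′ r
    Core-unique {K} {K′} C C′ = downward-ind ℓ (λ r → K r ≡ K′ r)
      (λ r le → ≡.trans (Core.empty C r le) (≡.sym (Core.empty C′ r le)))
      (λ r _ IH → ≡.trans (Core.recur C r) (≡.trans (≡.cong (parts r +_) (IH _ (down> r))) (≡.sym (Core.recur C′ r))))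

    private
      -- The first argument is fuel: every bounce advances by at least one row, so `ℓ ∸ r` bounces
      -- lead to the empty rows.
      rowLength : ℕ → ℕ → ℕ
      rowLength zero    r = 0
      rowLength (suc d) r = parts r + rowLength d (down r)

      rowLength-outside : ∀ d r → ℓ ≤ r → rowLength d r ≡ 0
      rowLength-outside zero    r le = refl
      rowLength-outside (suc d) r le = ≡.cong₂ _+_ (outside r le) (rowLength-outside d (down r) (ℕₚ.≤-trans le (ℕₚ.<⇒≤ (down> r))))

      rowLength-stable : ∀ d d′ r → ℓ ≤ d + r → ℓ ≤ d′ + r → rowLength d r ≡ rowLength d′ r
      rowLength-stable zero    d′ r le le′ = ≡.sym (rowLength-outside d′ r le)
      rowLength-stable (suc d) zero r le le′ = rowLength-outside (suc d) r le′
      rowLength-stable (suc d) (suc d′) r le le′ = ≡.cong (parts r +_) (rowLength-stable d d′ (down r) (shift d le) (shift d′ le′))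
        where
        shift : ∀ d → ℓ ≤ suc d + r → ℓ ≤ d + down r
        shift d le = ℕₚ.≤-trans le (≡.subst (_≤ d + down r) (ℕₚ.+-suc d r) (ℕₚ.+-monoʳ-≤ d (down> r)))

    coreRow : ℕ → ℕ
    coreRow = rowLength ℓ

    coreRow-Core : Core p coreRow
    coreRow-Core = record
      { recur = λ r → ≡.trans (rowLength-stable ℓ (suc ℓ) r (ℕₚ.m≤m+n ℓ r) (ℕₚ.m≤n⇒m≤1+n (ℕₚ.m≤m+n ℓ r))) refl
      ; empty = rowLength-outside ℓ }

    module _ {K} (C : Core p K) where
      open Core C

      -- In the recursions for `r` and `suc r` the parts decrease while `down` increases. The rows
      -- reached may be far apart, so monotonicity on all later rows is carried along.
      K-anti : ∀ r → K (suc r) ≤ K r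
      K-anti r = proj₁ (both r)
        where
        mono : ∀ r → (∀ s → r ≤ s → K (suc s) ≤ K s) → ∀ {s s′} → r ≤ s → s ≤ s′ → K s′ ≤ K s
        mono r f {s} {s′} r≤s le = ≡.subst (λ x → K x ≤ K s) (ℕₚ.m+[n∸m]≡n le) (go (s′ ∸ s))
          where
          go : ∀ d → K (s + d) ≤ K s
          go zero    = ℕₚ.≤-reflexive (≡.cong K (ℕₚ.+-identityʳ s))
          go (suc d) = ℕₚ.≤-trans (≡.subst (λ x → K x ≤ K (s + d)) (≡.sym (ℕₚ.+-suc s d)) (f (s + d) (ℕₚ.≤-trans r≤s (ℕₚ.m≤m+n s d)))) (go d)
        both : ∀ r → K (suc r) ≤ K r × (∀ s → r ≤ s → K (suc s) ≤ K s)
        both = downward-ind ℓ (λ r → K (suc r) ≤ K r × (∀ s → r ≤ s → K (suc s) ≤ K s))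
          (λ r le → zero-step r le , λ s r≤s → zero-step s (ℕₚ.≤-trans le r≤s))
          (λ r _ IH → let a = step r (λ s lt → proj₁ (IH s lt)) in a , λ s r≤s → [ (λ lt → proj₁ (IH s lt)) , (λ { refl → a }) ]′ (ℕₚ.m≤n⇒m<n∨m≡n r≤s))
          where
          zero-step : ∀ r → ℓ ≤ r → K (suc r) ≤ K r
          zero-step r le = ≡.subst (_≤ K r) (≡.sym (empty (suc r) (ℕₚ.m≤n⇒m≤1+n le))) z≤n
          step : ∀ r → (∀ s → r < s → K (suc s) ≤ K s) → K (suc r) ≤ K r
          step r IH = ≡.subst₂ _≤_ (≡.sym (recur (suc r))) (≡.sym (recur r))
            (ℕₚ.+-mono-≤ (anti r) (mono (suc r) IH (down> r) (ℕₚ.<⇒≤ (down-suc< r))))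

      K-antitone : ∀ {r s} → r ≤ s → K s ≤ K r
      K-antitone = antitone K K-anti

      K-0 : ∀ r → parts r ≡ 0 → K r ≡ 0
      K-0 = downward-ind ℓ (λ r → parts r ≡ 0 → K r ≡ 0) (λ r le _ → empty r le)
        (λ r _ IH e → ≡.trans (recur r) (≡.trans (≡.cong (_+ K (down r)) e) (IH (down r) (down> r)
          (ℕₚ.n≤0⇒n≡0 (≡.subst (parts (down r) ≤_) e (antitone parts anti (ℕₚ.<⇒≤ (down> r))))))))

      part≤K : ∀ r → parts r ≤ K r
      part≤K r = ≡.subst (parts r ≤_) (≡.sym (recur r)) (ℕₚ.m≤m+n _ _)

    -- κ is the core with 𝔭(κ) = parts.
    record Represents (κ : List ℕ) : Set where
      field
        partition : Partition κ
        core      : Core p (part κ)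

    Represents-unique : ∀ {κ κ′} → Represents κ → Represents κ′ → κ ≡ κ′
    Represents-unique A B = part-injective (Partition.positive (Represents.partition A)) (Partition.positive (Represents.partition B))
      (Core-unique (Represents.core A) (Represents.core B))

    private
      support : ∀ d → (∀ r → d ≤ r → parts r ≡ 0) → ∃ λ n → (∀ r → r < n → 0 < parts r) × (∀ r → n ≤ r → parts r ≡ 0)
      support zero    z = 0 , (λ _ ()) , z
      support (suc d) z with parts d in eq
      ... | zero  = support d λ r le → ℕₚ.n≤0⇒n≡0 (≡.subst (parts r ≤_) eq (antitone parts anti le))
      ... | suc x = suc d , (λ r lt → ℕₚ.<-≤-trans (≡.subst (0 <_) (≡.sym eq) (s≤s z≤n)) (antitone parts anti (s≤s⁻¹ lt))) , z

    abstract
      coreList : List ℕ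
      coreList = map coreRow (upTo (proj₁ (support ℓ outside)))

      coreList-part : ∀ r → part coreList r ≡ coreRow r
      coreList-part r with support ℓ outside
      ... | n , pos , zer with ℕₚ.<-≤-connex r n
      ... | inj₁ lt = part-map-upTo coreRow n r lt
      ... | inj₂ le = ≡.trans (part-outside (map coreRow (upTo n)) r
            (≡.subst (_≤ r) (≡.sym (length-map-upTo coreRow n)) le))
            (≡.sym (K-0 coreRow-Core r (zer r le)))

      coreList-represents : Represents coreList
      coreList-represents = record
        { partition = record
          { weakly = λ r → ≡.subst₂ _≤_ (≡.sym (coreList-part (suc r))) (≡.sym (coreList-part r)) (K-anti coreRow-Core r)
          ; positive = λ r lt → ≡.subst (0 <_) (≡.sym (coreList-part r)) (ℕₚ.<-≤-trans
              (proj₁ (proj₂ (support ℓ outside)) r (≡.subst (r <_) (length-map-upTo coreRow (proj₁ (support ℓ outside))) lt))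
              (part≤K coreRow-Core r)) }
        ; core = record
          { recur = λ r → ≡.trans (coreList-part r) (≡.trans (Core.recur coreRow-Core r) (≡.cong (parts r +_) (≡.sym (coreList-part (down r)))))
          ; empty = λ r le → ≡.trans (coreList-part r) (Core.empty coreRow-Core r le) } }

    module _ {κ} (rep : Represents κ) where
      open Represents rep
      open Partition partition
      open Core core
      private
        K = part κ

        -- row r + (n - λ_r), written as the (k - λ_r)-th row below r
        down′ : ∀ r → suc r + (k ∸ parts r) ≡ down r
        down′ r = ≡.trans (≡.sym (ℕₚ.+-suc r _)) (≡.cong (r +_) (≡.sym (ℕₚ.+-∸-assoc 1 (bound r))))

        Kdown : ∀ r → K (down r) ≡ K r ∸ parts r
        Kdown r = ≡.sym (≡.trans (≡.cong (_∸ parts r) (recur r)) (ℕₚ.m+n∸m≡n (parts r) _))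

      -- The column does not reach row `down r`, which bounds the leg by `k ∸ parts r`; the
      -- remaining boxes of the row number at most `parts r`.
      hook-small : ∀ r c → c < K r → K (down r) ≤ c → hook κ r c ≤ k
      hook-small r c c<K le = begin
        leg κ r c + (K r ∸ c) ≤⟨ ℕₚ.+-mono-≤ leg≤ (ℕₚ.∸-monoʳ-≤ (K r) le) ⟩
        (k ∸ parts r) + (K r ∸ K (down r)) ≡⟨ ≡.cong (k ∸ parts r +_) (≡.trans (≡.cong (K r ∸_) (Kdown r)) (ℕₚ.m∸[m∸n]≡n (part≤K core r))) ⟩
        (k ∸ parts r) + parts r ≡⟨ ℕₚ.m∸n+n≡m (bound r) ⟩
        k ∎
        where
        open ℕₚ.≤-Reasoning
        leg≤ : leg κ r c ≤ k ∸ parts r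
        leg≤ = ℕₚ.≮⇒≥ λ lt → ℕₚ.<⇒≱ (≡.subst (λ x → c < K x) (down′ r) (proj₁ (leg-spec partition r c (k ∸ parts r)) lt)) le

      -- Now the column reaches row `down r`, so the leg gains a box and more than `parts r` boxes
      -- of the row remain. Hook lengths thus jump over `suc k`.
      hook-large : ∀ r c → c < K (down r) → suc k < hook κ r c
      hook-large r c lt = begin-strict
        suc k ≡⟨ ℕₚ.m∸n+n≡m (ℕₚ.m≤n⇒m≤1+n (bound r)) ⟨
        (suc k ∸ parts r) + parts r <⟨ ℕₚ.+-mono-≤-< leg≥ arm ⟩
        leg κ r c + (K r ∸ c) ∎
        where
        open ℕₚ.≤-Reasoning
        leg≥ : suc k ∸ parts r ≤ leg κ r c
        leg≥ = ≡.subst (_≤ leg κ r c) (≡.sym (ℕₚ.+-∸-assoc 1 (bound r)))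
          (proj₂ (leg-spec partition r c (k ∸ parts r)) (≡.subst (λ x → c < K x) (≡.sym (down′ r)) lt))
        arm : parts r < K r ∸ c
        arm = ≡.subst (λ x → parts r < x ∸ c) (≡.sym (recur r))
          (≡.subst (parts r <_) (≡.sym (ℕₚ.+-∸-assoc (parts r) (ℕₚ.<⇒≤ lt)))
            (≡.subst (_< parts r + (K (down r) ∸ c)) (ℕₚ.+-identityʳ _) (ℕₚ.+-monoʳ-< (parts r) (ℕₚ.m<n⇒0<n∸m lt))))

      represents-isCore : isCoreᵇ k κ ≡ true
      represents-isCore = ∧-intro (isPartition⁺ κ partition) (allᵇ⁺ (boxes κ) λ { {r , c} m → not-intro λ e → no-hook r c (∈-boxes⁻ {κ} m) (≡ᵇ⇒≡ e) })
        where
        no-hook : ∀ r c → c < K r → hook κ r c ≢ suc k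
        no-hook r c c<K e with ℕₚ.<-≤-connex c (K (down r))
        ... | inj₁ lt = ℕₚ.<⇒≢ (hook-large r c lt) (≡.sym e)
        ... | inj₂ le = ℕₚ.<⇒≢ (s≤s (hook-small r c c<K le)) e

      represents-pmap : ∀ r → part (pmap k κ) r ≡ parts r
      represents-pmap r with ℕₚ.<-≤-connex r (length κ)
      ... | inj₂ le = ≡.trans (part-outside (pmap k κ) r (≡.subst (_≤ r) (≡.sym (length-map-upTo _ (length κ))) le))
            (≡.sym (ℕₚ.n≤0⇒n≡0 (≡.subst (parts r ≤_) (part-outside κ r le) (part≤K core r))))
      ... | inj₁ lt = ≡.trans (part-map-upTo _ (length κ) r lt) (≡.trans
            (countᵇ-threshold (λ c → hook κ r c ≤ᵇ k) id (K r) (K (down r))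
              (≡.subst (K (down r) ≤_) (≡.sym (recur r)) (ℕₚ.m≤n+m _ (parts r)))
              (λ c _ e → ℕₚ.≮⇒≥ λ c< → ℕₚ.<⇒≱ (ℕₚ.<-trans (ℕₚ.n<1+n k) (hook-large r c c<)) (≤ᵇ⇒≤ e))
              (λ c c<K le → ≤⇒≤ᵇ (hook-small r c c<K le)))
            (≡.trans (≡.cong (K r ∸_) (Kdown r)) (ℕₚ.m∸[m∸n]≡n (part≤K core r))))

  threshold : ∀ {P : ℕ → Set} (P? : ∀ c → Dec (P c)) N → ∃ λ a → a ≤ N × (∀ c → c < a → ¬ P c) × (a < N → P a)
  threshold P? zero = 0 , z≤n , (λ _ ()) , (λ ())
  threshold {P} P? (suc N) with threshold P? N
  ... | a , le , ¬P , Pa with ℕₚ.m≤n⇒m<n∨m≡n le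
  ... | inj₁ lt = a , ℕₚ.m≤n⇒m≤1+n le , ¬P , λ _ → Pa lt
  ... | inj₂ refl with P? N
  ... | yes PN = N , ℕₚ.n≤1+n N , ¬P , λ _ → PN
  ... | no ¬PN = suc N , ℕₚ.≤-refl , (λ c lt → [ ¬P c , (λ { refl → ¬PN }) ]′ (ℕₚ.m≤n⇒m<n∨m≡n (s≤s⁻¹ lt))) , λ lt → ⊥-elim (ℕₚ.n≮n _ lt)

  module FromList {k ℓ} {κ : List ℕ} (isCore : isCoreᵇ k κ ≡ true) (len : length κ ≤ ℓ) where
    private
      P : Partition κ
      P = isPartition⁻ κ (proj₁ (∧-elim isCore))
      open Partition P
      K = part κ

      no-hook : ∀ r c → c < K r → hook κ r c ≢ suc k
      no-hook r c lt e = not-elim (allᵇ⁻ {xs = boxes κ} (proj₂ (∧-elim {isPartitionᵇ κ} isCore)) (∈-boxes⁺ {κ} lt)) (≡⇒≡ᵇ e)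

      leg-anti : ∀ r {c c′} → c ≤ c′ → leg κ r c′ ≤ leg κ r c
      leg-anti r {c} {c′} le = ℕₚ.≮⇒≥ λ lt → ℕₚ.n≮n _ (proj₂ (leg-spec P r c (leg κ r c))
        (ℕₚ.≤-<-trans le (proj₁ (leg-spec P r c′ (leg κ r c)) lt)))

      hook-anti : ∀ r {c c′} → c ≤ c′ → hook κ r c′ ≤ hook κ r c
      hook-anti r le = ℕₚ.+-mono-≤ (leg-anti r le) (ℕₚ.∸-monoʳ-≤ (K r) le)

      q : ℕ → ℕ
      q = part (pmap k κ)

      row : ∀ r → q r ≤ k × K r ≡ q r + K (r + (suc k ∸ q r))
      row r with ℕₚ.<-≤-connex r (length κ)
      ... | inj₂ le = ≡.subst (λ x → x ≤ k × K r ≡ x + K (r + (suc k ∸ x))) (≡.sym q0)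
              (z≤n , ≡.trans (part-outside κ r le) (≡.sym (part-outside κ _ (ℕₚ.≤-trans le (ℕₚ.m≤m+n r _)))))
        where
        q0 : q r ≡ 0
        q0 = part-outside (pmap k κ) r (≡.subst (_≤ r) (≡.sym (length-map-upTo _ (length κ))) le)
      ... | inj₁ lt with threshold (λ c → hook κ r c ≤? k) (K r)
      ... | a , a≤K , big , small = ≡.subst (λ x → x ≤ k × K r ≡ x + K (r + (suc k ∸ x))) (≡.sym qr)
              (b≤k , ≡.trans (≡.sym (ℕₚ.m∸n+n≡m a≤K)) (≡.cong (K r ∸ a +_) (≡.sym (ℕₚ.≤-antisym upper lower))))
        where
        b = K r ∸ a
        qr : q r ≡ b
        qr = ≡.trans (part-map-upTo _ (length κ) r lt) (countᵇ-threshold (λ c → hook κ r c ≤ᵇ k) id (K r) a a≤K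
          (λ c c<K e → ℕₚ.≮⇒≥ λ c<a → big c c<a (≤ᵇ⇒≤ e))
          (λ c c<K a≤c → ≤⇒≤ᵇ (ℕₚ.≤-trans (hook-anti r a≤c) (small (ℕₚ.≤-<-trans a≤c c<K)))))
        hook-a : a < K r → leg κ r a + b ≤ k
        hook-a = small
        b≤k : b ≤ k
        b≤k with ℕₚ.m≤n⇒m<n∨m≡n a≤K
        ... | inj₁ a<K  = ℕₚ.m+n≤o⇒n≤o (leg κ r a) (hook-a a<K)
        ... | inj₂ refl = ≡.subst (_≤ k) (≡.sym (ℕₚ.n∸n≡0 (K r))) z≤n
        down′ : suc r + (k ∸ b) ≡ r + (suc k ∸ b)
        down′ = ≡.trans (≡.sym (ℕₚ.+-suc r _)) (≡.cong (r +_) (≡.sym (ℕₚ.+-∸-assoc 1 b≤k)))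
        upper : K (r + (suc k ∸ b)) ≤ a
        upper with ℕₚ.m≤n⇒m<n∨m≡n a≤K
        ... | inj₂ refl = antitoneₚ (ℕₚ.m≤m+n r _)
        ... | inj₁ a<K = ℕₚ.≮⇒≥ λ a<Kd → ℕₚ.<⇒≱
                (proj₂ (leg-spec P r a (k ∸ b)) (≡.subst (λ x → a < K x) (≡.sym down′) a<Kd))
                (ℕₚ.m+n≤o⇒m≤o∸n (leg κ r a) (hook-a a<K))
        lower : a ≤ K (r + (suc k ∸ b))
        lower = go a refl
          where
          go : ∀ a′ → a′ ≡ a → a′ ≤ K (r + (suc k ∸ b))
          go zero    _    = z≤n
          -- The column just before `a` has a hook longer than `k` and, as κ is a core, different
          -- from `suc k`. The row contributes `suc b` boxes to it, so the leg exceeds `k ∸ b`.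
          go (suc c) refl = ≡.subst (λ x → c < K x) down′ (proj₁ (leg-spec P r c (k ∸ b)) leg>)
            where
            c<K : c < K r
            c<K = a≤K
            big-hook : suc k < leg κ r c + suc b
            big-hook = ≡.subst (suc k <_) (≡.cong (leg κ r c +_) (≡.trans (≡.cong (_∸ c) (≡.sym (ℕₚ.m∸n+n≡m a≤K)))
              (≡.trans (ℕₚ.+-∸-assoc b {suc c} (ℕₚ.n≤1+n c)) (≡.trans (≡.cong (b +_) (ℕₚ.m+n∸n≡m 1 c)) (ℕₚ.+-comm b 1)))))
              (ℕₚ.≤∧≢⇒< (ℕₚ.≰⇒> (big c ℕₚ.≤-refl)) (no-hook r c c<K ∘ ≡.sym))
            leg> : k ∸ b < leg κ r c
            leg> = ℕₚ.+-cancelʳ-< (suc b) _ _ (≡.subst (_< leg κ r c + suc b)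
              (≡.sym (≡.trans (ℕₚ.+-suc (k ∸ b) b) (≡.cong suc (ℕₚ.m∸n+n≡m b≤k)))) big-hook)

      -- If the count grew, row `suc r` would bounce no further than row `r` and would be longer
      -- than row `r`.
      q-anti : ∀ r → q (suc r) ≤ q r
      q-anti r = ℕₚ.≮⇒≥ λ lt → ℕₚ.<⇒≱ lt (ℕₚ.+-cancelʳ-≤ (K (r + (suc k ∸ q r))) _ _ (begin
        q (suc r) + K (r + (suc k ∸ q r))               ≤⟨ ℕₚ.+-monoʳ-≤ (q (suc r)) (antitoneₚ (later lt)) ⟩
        q (suc r) + K (suc r + (suc k ∸ q (suc r)))     ≡⟨ proj₂ (row (suc r)) ⟨
        K (suc r)                                       ≤⟨ weakly r ⟩
        K r                                             ≡⟨ proj₂ (row r) ⟩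
        q r + K (r + (suc k ∸ q r))                     ∎))
        where
        open ℕₚ.≤-Reasoning
        later : q r < q (suc r) → suc r + (suc k ∸ q (suc r)) ≤ r + (suc k ∸ q r)
        later lt = ≡.subst (_≤ r + (suc k ∸ q r)) (ℕₚ.+-suc r _)
          (ℕₚ.+-monoʳ-≤ r (ℕₚ.∸-monoʳ-< lt (ℕₚ.m≤n⇒m≤1+n (proj₁ (row (suc r))))))

    parFun : ParFun k ℓ
    parFun = record { parts = q ; anti = q-anti ; bound = proj₁ ∘ row
      ; outside = λ r le → part-outside (pmap k κ) r (≡.subst (_≤ r) (≡.sym (length-map-upTo _ (length κ))) (ℕₚ.≤-trans len le)) }

    represents : CoreFacts.Represents parFun κ
    represents = record { partition = P ; core = record { recur = proj₂ ∘ row ; empty = λ r le → part-outside κ r (ℕₚ.≤-trans len le) } }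

-- Rows of the core below a cover, compared with those of the core above it.

module CoverCores where
  open import Data.Nat as ℕ using (ℕ; zero; suc; z≤n; s≤s; s≤s⁻¹; _≟_; pred; _+_; _≤_; _<_)
  open import Data.List.Relation.Unary.AllPairs using ([]; _∷_)
  open import Relation.Binary.Definitions using (tri<; tri≈; tri>)
  open RaisingOperators using (unique-set⇒↭)
  open BounceGraphs
  open CoverWeights
  open Cores

  sumTo : ℕ → (ℕ → ℕ) → ℕ
  sumTo zero    f = 0
  sumTo (suc n) f = sumTo n f + f n

  sumTo-cong : ∀ n {f g} → (∀ r → r < n → f r ≡ g r) → sumTo n f ≡ sumTo n g
  sumTo-cong zero    e = refl
  sumTo-cong (suc n) e = ≡.cong₂ _+_ (sumTo-cong n (λ r lt → e r (ℕₚ.m<n⇒m<1+n lt))) (e n (ℕₚ.n<1+n n))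

  sumTo-+ : ∀ n f g → sumTo n (λ r → f r + g r) ≡ sumTo n f + sumTo n g
  sumTo-+ zero    f g = refl
  sumTo-+ (suc n) f g = ≡.trans (≡.cong (_+ (f n + g n)) (sumTo-+ n f g)) (interchange (sumTo n f) (sumTo n g) (f n) (g n))
    where
    open import Algebra.Properties.CommutativeSemigroup ℕₚ.+-commutativeSemigroup using (interchange)

  sumTo-zero : ∀ n {f} → (∀ r → r < n → f r ≡ 0) → sumTo n f ≡ 0
  sumTo-zero zero    e = refl
  sumTo-zero (suc n) e = ≡.cong₂ _+_ (sumTo-zero n (λ r lt → e r (ℕₚ.m<n⇒m<1+n lt))) (e n (ℕₚ.n<1+n n))

  one-at : ℕ → ℕ → ℕ
  one-at a r with a ≟ r
  ... | yes _ = 1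
  ... | no _  = 0

  ind : ℕ → ℕ → ℕ → ℕ
  ind a zero    r = 0
  ind a (suc b) r = ind a b r + one-at (a + b) r

  one-at-≡ : ∀ {a r} → a ≡ r → one-at a r ≡ 1
  one-at-≡ {a} {r} e with a ≟ r
  ... | yes _ = refl
  ... | no ne = ⊥-elim (ne e)

  one-at-≢ : ∀ {a r} → a ≢ r → one-at a r ≡ 0
  one-at-≢ {a} {r} ne with a ≟ r
  ... | yes e = ⊥-elim (ne e)
  ... | no _  = refl

  ind-out : ∀ a b {r} → (∀ j → j < b → r ≢ a + j) → ind a b r ≡ 0
  ind-out a zero    f = refl
  ind-out a (suc b) f = ≡.cong₂ _+_ (ind-out a b (λ j lt → f j (ℕₚ.m<n⇒m<1+n lt))) (one-at-≢ (f b (ℕₚ.n<1+n b) ∘ ≡.sym))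

  ind-in : ∀ a b j → j < b → ind a b (a + j) ≡ 1
  ind-in a (suc b) j lt with ℕₚ.m≤n⇒m<n∨m≡n (s≤s⁻¹ lt)
  ... | inj₁ lt′  = ≡.cong₂ _+_ (ind-in a b j lt′) (one-at-≢ (ℕₚ.<⇒≢ (ℕₚ.+-monoʳ-< a lt′) ∘ ≡.sym))
  ... | inj₂ refl = ≡.cong₂ _+_ (ind-out a b (λ j′ lt′ → ℕₚ.<⇒≢ (ℕₚ.+-monoʳ-< a lt′) ∘ ≡.sym)) (one-at-≡ {a + b} refl)

  sumTo-one-at : ∀ n a → a < n → sumTo n (one-at a) ≡ 1
  sumTo-one-at (suc n) a lt with ℕₚ.m≤n⇒m<n∨m≡n (s≤s⁻¹ lt)
  ... | inj₁ lt′  = ≡.cong₂ _+_ (sumTo-one-at n a lt′) (one-at-≢ (ℕₚ.<⇒≢ lt′))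
  ... | inj₂ refl = ≡.cong₂ _+_ (sumTo-zero n (λ r lt′ → one-at-≢ (ℕₚ.<⇒≢ lt′ ∘ ≡.sym))) (one-at-≡ {n} refl)

  sumTo-ind : ∀ n a b → (∀ j → j < b → a + j < n) → sumTo n (ind a b) ≡ b
  sumTo-ind n a zero    le = sumTo-zero n (λ _ _ → refl)
  sumTo-ind n a (suc b) le = ≡.trans (sumTo-+ n (ind a b) (one-at (a + b)))
    (≡.trans (≡.cong₂ _+_ (sumTo-ind n a b (λ j lt → le j (ℕₚ.m<n⇒m<1+n lt))) (sumTo-one-at n (a + b) (le b (ℕₚ.n<1+n b))))
      (ℕₚ.+-comm b 1))

  sumTo-suc : ∀ n f → sumTo (suc n) f ≡ f 0 + sumTo n (f ∘ suc)
  sumTo-suc zero    f = ≡.sym (ℕₚ.+-identityʳ (f 0))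
  sumTo-suc (suc n) f = ≡.trans (≡.cong (_+ f (suc n)) (sumTo-suc n f)) (ℕₚ.+-assoc (f 0) _ _)

  sum-parts : ∀ xs n → length xs ≤ n → sum xs ≡ sumTo n (part xs)
  sum-parts []       n       _        = ≡.sym (sumTo-zero n (λ _ _ → refl))
  sum-parts (x ∷ xs) (suc n) (s≤s le) = ≡.trans (≡.cong (x +_) (sum-parts xs n le)) (≡.sym (sumTo-suc n (part (x ∷ xs))))

  module CoverCore {k ℓ : ℕ} (p : ParFun k ℓ) {z C u w g} (c : Bounce.IsCover p z C u w g)
    {K T : ℕ → ℕ} (KC : Core p K) (TC : Core (CoverShape.Covered.covered p c) T) where
    open Bounce p
    open CoverShape p
    open IsCover c
    open Covered c
    open CoreFacts p

    InLevel : ℕ → Set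
    InLevel r = ∃ λ i → i ≤ C × ∃ λ j → j ≤ g × r ≡ u i + j

    inLevel? : ∀ r → Dec (InLevel r)
    inLevel? r = map′
      (λ (i , lt , j , lt′ , e) → i , s≤s⁻¹ lt , j , s≤s⁻¹ lt′ , e)
      (λ (i , le , j , le′ , e) → i , s≤s le , j , s≤s le′ , e)
      (ℕₚ.anyUpTo? (λ i → ℕₚ.anyUpTo? (λ j → r ≟ u i + j) (suc g)) (suc C))

    level-< : ∀ {i i′} → i < i′ → i′ ≤ C → ∀ j → j ≤ g → u i′ + j < u i
    level-< {i} {suc i′} (s≤s i≤i′) i′<C j le =
      ℕₚ.<-≤-trans (separated i′ i′<C j le) (chain-antitone ch i≤i′ (ℕₚ.<⇒≤ i′<C))

    level-unique : ∀ {i i′ j j′} → i ≤ C → i′ ≤ C → j ≤ g → j′ ≤ g → u i + j ≡ u i′ + j′ → i ≡ i′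
    level-unique {i} {i′} {j} {j′} a b le le′ e with ℕₚ.<-cmp i i′
    ... | tri≈ _ eq _ = eq
    ... | tri< lt _ _ =
      ⊥-elim (ℕₚ.<⇒≢ (ℕₚ.<-≤-trans (level-< lt b j′ le′) (ℕₚ.m≤m+n (u i) j)) (≡.sym e))
    ... | tri> _ _ gt =
      ⊥-elim (ℕₚ.<⇒≢ (ℕₚ.<-≤-trans (level-< gt a j le) (ℕₚ.m≤m+n (u i′) j′)) e)

    private
      level≤ : ∀ {i j} → i ≤ C → j ≤ g → u i + j ≤ z + g
      level≤ a b = ℕₚ.+-mono-≤ (u≤z a) b

      beyond : ∀ {r} → z + g < r → ¬ InLevel r
      beyond lt (i , a , j , b , refl) = ℕₚ.<⇒≱ lt (level≤ a b)

      down-z-beyond : ∀ {j} → j ≤ g → z + g < down (z + j)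
      down-z-beyond le = ℕₚ.<-≤-trans short (down-mono-≤ (ℕₚ.m≤m+n z _))

      level-down : ∀ {i j} → i < C → j ≤ g → ∀ {r} → r ≡ u (suc i) + j → Bounce.down covered r ≡ u i + j × μ r ≡ parts r
      level-down {i} {j} i<C le {r} refl = ≡.trans (down-out nz nw) (path i i<C j le) , μ-out nz nw
        where
        r<z = ℕₚ.<-≤-trans (separated i i<C j le) (u≤z (ℕₚ.<⇒≤ i<C))
        nz : ∀ j′ → j′ ≤ g → r ≢ z + j′
        nz j′ _ = ℕₚ.<⇒≢ (ℕₚ.<-≤-trans r<z (ℕₚ.m≤m+n z j′))
        nw : ∀ j′ → j′ < g → r ≢ w + j′
        nw j′ lt = ℕₚ.<⇒≢ (ℕₚ.<-≤-trans (w-separated j′ lt)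
          (ℕₚ.≤-trans (chain-antitone ch i<C ℕₚ.≤-refl) (ℕₚ.m≤m+n _ j))) ∘ ≡.sym

      -- This describes ribbons: within a level, consecutive rows of the skew shape share exactly
      -- the column `T r`, while the bottom row of a level shares none with the row beneath it.
      record Rows (r : ℕ) : Set where
        field
          same  : ¬ InLevel r → T r ≡ K r
          inner : ∀ i j → i ≤ C → j < g → r ≡ u i + j → suc (T r) ≡ K (suc r)
          bottom : ∀ i → i ≤ C → r ≡ u i + g → K (suc r) ≤ T r × T r < K r

      rows : ∀ r → Rows r
      rows = downward-ind ℓ Rows far step
        where
        far : ∀ r → ℓ ≤ r → Rows r
        far r le = record
          { same  = λ _ → ≡.trans (Core.empty TC r le) (≡.sym (Core.empty KC r le))
          ; inner = λ { i j a b refl → ⊥-elim (ℕₚ.<⇒≱ (ℕₚ.≤-<-trans (level≤ a (ℕₚ.<⇒≤ b)) z+g<ℓ) le) }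
          ; bottom = λ { i a refl → ⊥-elim (ℕₚ.<⇒≱ (ℕₚ.≤-<-trans (level≤ a ℕₚ.≤-refl) z+g<ℓ) le) } }
        step : ∀ r → r < ℓ → (∀ s → r < s → Rows s) → Rows r
        step r _ IH = record { same = same′ ; inner = inner′ ; bottom = last′ }
          where
          open ≡.≡-Reasoning
          T-rec = Core.recur TC
          K-rec = Core.recur KC
          -- The part is one smaller and the bounce goes one row further, to a row after all levels,
          -- where the two cores already agree.
          T-z : ∀ j → j ≤ g → r ≡ z + j → suc (T r) ≡ parts r + K (suc (down r))
          T-z j le refl = begin
            suc (T (z + j)) ≡⟨ ≡.cong suc (T-rec (z + j)) ⟩
            suc (μ (z + j) + T (Bounce.down covered (z + j))) ≡⟨ ≡.cong₂ (λ a b → suc (a + T b)) (μ-z j le) (down-z j le) ⟩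
            suc (pred (parts (z + j))) + T (suc (down (z + j)))
              ≡⟨ ≡.cong₂ _+_ (ℕₚ.suc-pred _ {{ℕ.>-nonZero (positive j le)}})
                   (Rows.same (IH _ (ℕₚ.m<n⇒m<1+n (down> (z + j)))) (beyond (ℕₚ.m<n⇒m<1+n (down-z-beyond le)))) ⟩
            parts (z + j) + K (suc (down (z + j))) ∎
          r≡z : ∀ {j} → r ≡ u 0 + j → r ≡ z + j
          r≡z {j} e = ≡.trans e (≡.cong (_+ j) base)
          inner′ : ∀ i j → i ≤ C → j < g → r ≡ u i + j → suc (T r) ≡ K (suc r)
          inner′ zero j _ lt e = begin
            suc (T r) ≡⟨ T-z j (ℕₚ.<⇒≤ lt) (r≡z e) ⟩
            parts r + K (suc (down r)) ≡⟨ ≡.cong₂ _+_ (≡.sym fl) (≡.cong K (≡.sym (down-flat r fl))) ⟩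
            parts (suc r) + K (down (suc r)) ≡⟨ K-rec (suc r) ⟨
            K (suc r) ∎
            where
            fl : parts (suc r) ≡ parts r
            fl = ≡.subst (λ x → parts (suc x) ≡ parts x) (≡.sym (r≡z e)) (≡.trans (≡.cong parts (≡.sym (ℕₚ.+-suc z j)))
              (≡.trans (flat (suc j) lt) (≡.sym (flat j (ℕₚ.<⇒≤ lt)))))
          inner′ (suc i) j i<C lt e with level-down i<C (ℕₚ.<⇒≤ lt) e
          ... | d , m = begin
            suc (T r) ≡⟨ ≡.cong suc (T-rec r) ⟩
            suc (μ r + T (Bounce.down covered r)) ≡⟨ ≡.cong₂ (λ a b → suc (a + T b)) m d ⟩
            suc (parts r + T (u i + j)) ≡⟨ ℕₚ.+-suc (parts r) _ ⟨
            parts r + suc (T (u i + j))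
              ≡⟨ ≡.cong (parts r +_) (Rows.inner (IH _ r<d) i j (ℕₚ.<⇒≤ i<C) lt refl) ⟩
            parts r + K (suc (u i + j)) ≡⟨ ≡.cong₂ _+_ (≡.sym fl) (≡.cong K (≡.sym dsr)) ⟩
            parts (suc r) + K (down (suc r)) ≡⟨ K-rec (suc r) ⟨
            K (suc r) ∎
            where
            dr : down r ≡ u i + j
            dr = ≡.trans (≡.cong down e) (path i i<C j (ℕₚ.<⇒≤ lt))
            r<d = ≡.subst (r <_) dr (down> r)
            dsr : down (suc r) ≡ suc (u i + j)
            dsr = ≡.trans (≡.cong down (≡.trans (≡.cong suc e) (≡.sym (ℕₚ.+-suc _ j)))) (≡.trans (path i i<C (suc j) lt) (ℕₚ.+-suc _ j))
            fl = flat-down r (≡.trans dsr (≡.cong suc (≡.sym dr)))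
          last′ : ∀ i → i ≤ C → r ≡ u i + g → K (suc r) ≤ T r × T r < K r
          last′ zero _ e = s≤s⁻¹ (≡.subst₂ _≤_ (≡.cong suc (≡.sym (K-rec (suc r)))) (≡.sym Tr)
                (ℕₚ.+-mono-≤ part< (K-antitone KC (down-suc< r)))) ,
              ≡.subst₂ _≤_ (≡.sym Tr) (≡.sym (K-rec r)) (ℕₚ.+-monoʳ-≤ (parts r) (K-antitone KC (ℕₚ.n≤1+n _)))
            where
            Tr = T-z g ℕₚ.≤-refl (r≡z e)
            part< : parts (suc r) < parts r
            part< = ≡.subst (λ x → parts (suc x) < parts x) (≡.sym (r≡z e)) (ℕₚ.<-≤-trans drop (ℕₚ.≤-reflexive (≡.sym (flat g ℕₚ.≤-refl))))
          last′ (suc i) i<C e with level-down i<C ℕₚ.≤-refl e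
          ... | d , m = ≡.subst₂ _≤_ (≡.sym (K-rec (suc r))) (≡.sym Tr)
                (ℕₚ.+-mono-≤ (anti r) (ℕₚ.≤-trans (K-antitone KC (≡.subst (λ x → suc x ≤ down (suc r)) dr (down-suc< r))) (proj₁ IHi))) ,
              ≡.subst₂ _<_ (≡.sym Tr) (≡.sym (≡.trans (K-rec r) (≡.cong (λ x → parts r + K x) dr))) (ℕₚ.+-monoʳ-< (parts r) (proj₂ IHi))
            where
            dr : down r ≡ u i + g
            dr = ≡.trans (≡.cong down e) (path i i<C g ℕₚ.≤-refl)
            r<d = ≡.subst (r <_) dr (down> r)
            IHi = Rows.bottom (IH _ r<d) i (ℕₚ.<⇒≤ i<C) refl
            Tr : T r ≡ parts r + T (u i + g)
            Tr = ≡.trans (T-rec r) (≡.cong₂ (λ a b → a + T b) m d)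
          same′ : ¬ InLevel r → T r ≡ K r
          same′ ¬L = go (view z w g r)
            where
            go : View z w g r → T r ≡ K r
            go (inZ j le e) = ⊥-elim (¬L (0 , z≤n , j , le , ≡.trans e (≡.cong (_+ j) (≡.sym base))))
            -- The additional box makes up for the new bounce: row `u C + j` of the smaller core is
            -- one shorter than row `suc (u C + j)` of the larger, where the row used to land.
            go (inW j lt refl) = begin
              T r ≡⟨ T-rec r ⟩
              μ r + T (Bounce.down covered r) ≡⟨ ≡.cong₂ (λ a b → a + T b) (μ-w j lt) (down-w j lt) ⟩
              suc (parts r) + T (u C + j) ≡⟨ ℕₚ.+-suc (parts r) _ ⟨
              parts r + suc (T (u C + j))
                ≡⟨ ≡.cong (parts r +_) (Rows.inner (IH _ (ℕₚ.<-≤-trans (w-separated j lt) (ℕₚ.m≤m+n _ j))) C j ℕₚ.≤-refl lt refl) ⟩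
              parts r + K (suc (u C + j)) ≡⟨ ≡.cong (λ x → parts r + K x) (opens j lt) ⟨
              parts r + K (down r) ≡⟨ K-rec r ⟨
              K r ∎
            go (out nz nw) = begin
              T r ≡⟨ T-rec r ⟩
              μ r + T (Bounce.down covered r) ≡⟨ ≡.cong₂ (λ a b → a + T b) (μ-out nz nw) (down-out nz nw) ⟩
              parts r + T (down r) ≡⟨ ≡.cong (parts r +_) (Rows.same (IH (down r) (down> r)) ¬D) ⟩
              parts r + K (down r) ≡⟨ K-rec r ⟨
              K r ∎
              where
              -- An unaltered row bouncing into a level would lie on the level above; on the top
              -- level it would prolong the chain or be one of the rows opened from `w`.
              ¬D : ¬ InLevel (down r)
              ¬D (i , a , j , b , e) with ℕₚ.m≤n⇒m<n∨m≡n a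
              ... | inj₁ i<C = ¬L (suc i , i<C , j , b , down-injective (≡.trans e (≡.sym (path i i<C j b))))
              ¬D (i , a , zero , b , e) | inj₂ refl = top r (≡.trans e (ℕₚ.+-identityʳ _))
              ¬D (i , a , suc j , b , e) | inj₂ refl = nw j b (down-injective (≡.trans e (≡.trans (ℕₚ.+-suc _ j) (≡.sym (opens j b)))))

    same-outside : ∀ {r} → ¬ InLevel r → T r ≡ K r
    same-outside = Rows.same (rows _)

    inner-row : ∀ {i j} → i ≤ C → j < g → suc (T (u i + j)) ≡ K (suc (u i + j))
    inner-row a b = Rows.inner (rows _) _ _ a b refl

    last-row : ∀ {i} → i ≤ C → K (suc (u i + g)) ≤ T (u i + g) × T (u i + g) < K (u i + g)
    last-row a = Rows.bottom (rows _) _ a refl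

    bottom-z : suc (T (z + g)) ≡ parts (z + g) + K (suc (down (z + g)))
    bottom-z = ≡.trans (≡.cong suc (Core.recur TC (z + g)))
      (≡.trans (≡.cong₂ (λ a b → suc (a + T b)) (μ-z g ℕₚ.≤-refl) (down-z g ℕₚ.≤-refl))
        (≡.cong₂ _+_ (ℕₚ.suc-pred _ {{ℕ.>-nonZero (positive g ℕₚ.≤-refl)}})
          (same-outside (beyond (ℕₚ.m<n⇒m<1+n (down-z-beyond ℕₚ.≤-refl))))))

    bottom-suc : ∀ {i} → i < C → T (u (suc i) + g) ≡ parts (u (suc i) + g) + T (u i + g)
    bottom-suc i<C = let d , m = level-down i<C ℕₚ.≤-refl refl in
      ≡.trans (Core.recur TC _) (≡.cong₂ (λ a b → a + T b) m d)

    level-row-< : ∀ {i j} → i ≤ C → j ≤ g → T (u i + j) < K (u i + j)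
    level-row-< a b with ℕₚ.m≤n⇒m<n∨m≡n b
    ... | inj₂ refl = proj₂ (last-row a)
    ... | inj₁ lt   = ≡.subst (_≤ K _) (≡.sym (inner-row a lt)) (K-anti KC _)

    T≤K : ∀ r → T r ≤ K r
    T≤K r with inLevel? r
    ... | no ¬L = ℕₚ.≤-reflexive (same-outside ¬L)
    ... | yes (i , a , j , b , refl) = ℕₚ.<⇒≤ (level-row-< a b)

    -- The `suc g` rows of the block of `z` lose a box and the `g` rows of the block of `w` gain
    -- one; adding indicators to both sides avoids truncated subtraction.
    covered-size : suc (sumTo ℓ μ) ≡ sumTo ℓ parts
    covered-size = ℕₚ.+-cancelʳ-≡ g _ _ (begin
      suc (sumTo ℓ μ) + g ≡⟨ ℕₚ.+-suc (sumTo ℓ μ) g ⟨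
      sumTo ℓ μ + suc g ≡⟨ ≡.cong (sumTo ℓ μ +_) (sumTo-ind ℓ z (suc g) (λ j lt → ℕₚ.≤-<-trans (ℕₚ.+-monoʳ-≤ z (s≤s⁻¹ lt)) z+g<ℓ)) ⟨
      sumTo ℓ μ + sumTo ℓ (ind z (suc g)) ≡⟨ sumTo-+ ℓ μ _ ⟨
      sumTo ℓ (λ r → μ r + ind z (suc g) r) ≡⟨ sumTo-cong ℓ (λ r _ → pointwise r (view z w g r)) ⟩
      sumTo ℓ (λ r → parts r + ind w g r) ≡⟨ sumTo-+ ℓ parts _ ⟩
      sumTo ℓ parts + sumTo ℓ (ind w g) ≡⟨ ≡.cong (sumTo ℓ parts +_) (sumTo-ind ℓ w g (λ j lt → ℕₚ.<-trans (w<z j lt) (ℕₚ.≤-<-trans (ℕₚ.m≤m+n z g) z+g<ℓ))) ⟩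
      sumTo ℓ parts + g ∎)
      where
      open ≡.≡-Reasoning
      pointwise : ∀ r → View z w g r → μ r + ind z (suc g) r ≡ parts r + ind w g r
      pointwise r (inZ j le refl) = begin
        μ r + ind z (suc g) r ≡⟨ ≡.cong₂ _+_ (μ-z j le) (ind-in z (suc g) j (s≤s le)) ⟩
        pred (parts r) + 1 ≡⟨ ≡.trans (ℕₚ.+-comm _ 1) (ℕₚ.suc-pred _ {{ℕ.>-nonZero (positive j le)}}) ⟩
        parts r ≡⟨ ℕₚ.+-identityʳ _ ⟨
        parts r + 0 ≡⟨ ≡.cong (parts r +_) (ind-out w g (λ j′ lt → w≢z lt ∘ ≡.sym)) ⟨
        parts r + ind w g r ∎
      pointwise r (inW j lt refl) = ≡.trans
        (≡.cong₂ _+_ (μ-w j lt) (ind-out z (suc g) (λ j′ lt′ → w≢z lt)))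
        (≡.trans (≡.trans (ℕₚ.+-identityʳ _) (ℕₚ.+-comm 1 _)) (≡.cong (parts r +_) (≡.sym (ind-in w g j lt))))
      pointwise r (out nz nw) = ≡.cong₂ _+_ (μ-out nz nw)
        (≡.trans (ind-out z (suc g) (λ j lt → nz j (s≤s⁻¹ lt))) (≡.sym (ind-out w g nw)))

-- Connected components of the skew shape of a cover: marks and spin.

module CoverRibbons where
  open import Data.Nat using (ℕ; zero; suc; z≤n; s≤s; s≤s⁻¹; _≤?_; _+_; _∸_; _*_; _≤_; _<_; _≤ᵇ_; _≡ᵇ_; _⊓_; _⊔_)
  open import Data.Nat.ListAction.Properties using (sum-↭)
  open import Data.List.Relation.Binary.Permutation.Propositional using (_↭_; ↭-sym)
  open import Data.List.Relation.Binary.Permutation.Propositional.Properties using (map⁺; filter-↭)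
  open import Data.List.Relation.Unary.Any using (here; there)
  open import Data.List.Relation.Unary.AllPairs as AllPairs using (AllPairs; []; _∷_)
  open RaisingOperators using (unique-set⇒↭)
  open BounceGraphs
  open CoverWeights
  open Cores
  open CoverCores

  boxEq⇒≡ : ∀ {x y} → boxEqᵇ x y ≡ true → x ≡ y
  boxEq⇒≡ {r , c} {r′ , c′} e = ≡.cong₂ _,_ (≡ᵇ⇒≡ (proj₁ (∧-elim e))) (≡ᵇ⇒≡ (proj₂ (∧-elim {r ≡ᵇ r′} e)))

  ≡⇒boxEq : ∀ {x y} → x ≡ y → boxEqᵇ x y ≡ true
  ≡⇒boxEq {r , c} refl = ∧-intro (≡⇒≡ᵇ {r} refl) (≡⇒≡ᵇ {c} refl)

  length-filterᵇ-mono : ∀ {A : Set} {p q : A → Bool} B → (∀ {x} → x ∈ B → p x ≡ true → q x ≡ true) →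
    length (filterᵇ p B) ≤ length (filterᵇ q B)
  length-filterᵇ-mono []      f = z≤n
  length-filterᵇ-mono {p = p} {q} (x ∷ B) f with p x in px | q x in qx
  ... | true  | true  = s≤s (length-filterᵇ-mono B (f ∘ there))
  ... | true  | false = ⊥-elim (contra (≡.trans (≡.sym qx) (f (here refl) px)))
    where contra : ¬ (false ≡ true)
          contra ()
  ... | false | true  = ℕₚ.m≤n⇒m≤1+n (length-filterᵇ-mono B (f ∘ there))
  ... | false | false = length-filterᵇ-mono B (f ∘ there)

  length-filterᵇ-≤ : ∀ {A : Set} {p q : A → Bool} B → (∀ {x} → x ∈ B → p x ≡ true → q x ≡ true) →
    length (filterᵇ q B) ≤ length (filterᵇ p B) → ∀ {x} → x ∈ B → q x ≡ true → p x ≡ true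
  length-filterᵇ-≤ {p = p} {q} (x ∷ B) f le {y} m qy with p x in px | q x in qx
  ... | true | false = ⊥-elim (contra (≡.trans (≡.sym qx) (f (here refl) px)))
    where contra : ¬ (false ≡ true)
          contra ()
  ... | true | true = go m
    where
    go : y ∈ x ∷ B → p y ≡ true
    go (here refl) = px
    go (there m′)  = length-filterᵇ-≤ B (f ∘ there) (s≤s⁻¹ le) m′ qy
  ... | false | true = ⊥-elim (ℕₚ.<⇒≱ le (length-filterᵇ-mono B (f ∘ there)))
  ... | false | false = go m
    where
    go : y ∈ x ∷ B → p y ≡ true
    go (here refl) = ⊥-elim (contra (≡.trans (≡.sym qx) qy))
      where contra : ¬ (false ≡ true)
            contra ()
    go (there m′)  = length-filterᵇ-≤ B (f ∘ there) le m′ qy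

  length-filterᵇ-≤-length : ∀ {A : Set} (p : A → Bool) B → length (filterᵇ p B) ≤ length B
  length-filterᵇ-≤-length p B = Listₚ.length-filter (T? ∘ p) B

  length-filterᵇ-full : ∀ {A : Set} {p : A → Bool} B → length B ≤ length (filterᵇ p B) → ∀ {x} → x ∈ B → p x ≡ true
  length-filterᵇ-full {p = p} (x ∷ B) le {y} m with p x in px
  ... | false = ⊥-elim (ℕₚ.<⇒≱ le (length-filterᵇ-≤-length p B))
  ... | true = go m
    where
    go : y ∈ x ∷ B → p y ≡ true
    go (here refl) = px
    go (there m′)  = length-filterᵇ-full B (s≤s⁻¹ le) m′

  iterN-suc : ∀ {A : Set} n (f : A → A) a → iterN (suc n) f a ≡ f (iterN n f a)
  iterN-suc zero    f a = refl
  iterN-suc (suc n) f a = iterN-suc n f (f a)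

  module Component (B : List Box) (b : Box) (b∈B : b ∈ B) where

    private
      S : ℕ → List Box
      S t = iterN t (stepᵇ B) (b ∷ [])

      R : ℕ → Box → Bool
      R t y = anyᵇ (λ x → boxEqᵇ x y ∨ adjᵇ x y) (S t)

      S-suc : ∀ t → S (suc t) ≡ filterᵇ (R t) B
      S-suc t = iterN-suc t (stepᵇ B) (b ∷ [])

      S⊆B : ∀ t {x} → x ∈ S t → x ∈ B
      S⊆B zero    (here refl) = b∈B
      S⊆B (suc t) m = proj₁ (∈-filterᵇ⁻ {p = R t} {xs = B} (≡.subst (_ ∈_) (S-suc t) m))

      grow : ∀ t {x y} → x ∈ S t → y ∈ B → x ≡ y ⊎ adjᵇ x y ≡ true → y ∈ S (suc t)
      grow t {x} {y} m y∈B e = ≡.subst (y ∈_) (≡.sym (S-suc t)) (∈-filterᵇ⁺ {p = R t} y∈B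
        (anyᵇ⁺ {p = λ x → boxEqᵇ x y ∨ adjᵇ x y} m ([ (λ eq → ∨-introˡ (≡⇒boxEq eq)) , ∨-introʳ {boxEqᵇ x y} ]′ e)))

      S⊆S : ∀ t {x} → x ∈ S t → x ∈ S (suc t)
      S⊆S t m = grow t m (S⊆B t m) (inj₁ refl)

      b∈S : ∀ t → b ∈ S t
      b∈S zero    = here refl
      b∈S (suc t) = S⊆S t (b∈S t)

      Stable : ℕ → Set
      Stable t = ∀ y → y ∈ S (suc t) → y ∈ S t

      stable-suc : ∀ t → Stable t → Stable (suc t)
      stable-suc t st y m with ∈-filterᵇ⁻ {p = R (suc t)} {xs = B} (≡.subst (y ∈_) (S-suc (suc t)) m)
      ... | y∈B , e with anyᵇ⁻ {p = λ x → boxEqᵇ x y ∨ adjᵇ x y} (S (suc t)) e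
      ... | x , x∈S , e′ = grow t (st x x∈S) y∈B ([ inj₁ ∘ boxEq⇒≡ , inj₂ ]′ (∨-elim {boxEqᵇ x y} e′))

      -- as long as the sets grow, each step adds a box
      size-or-stable : ∀ t → Stable (suc t) ⊎ suc t ≤ length (S (suc t))
      size-or-stable zero = inj₂ (length-pos (b∈S 1))
        where
        length-pos : ∀ {xs : List Box} → b ∈ xs → 1 ≤ length xs
        length-pos (here _)  = s≤s z≤n
        length-pos (there _) = s≤s z≤n
      size-or-stable (suc t) with size-or-stable t
      ... | inj₁ st = inj₁ (stable-suc (suc t) st)
      ... | inj₂ le with length (S (suc (suc t))) ≤? length (S (suc t))
      ...   | no nle = inj₂ (ℕₚ.≤-<-trans le (ℕₚ.≰⇒> nle))
      ...   | yes shrink = inj₁ (stable-suc (suc t) λ y m →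
                let y∈B , e = ∈-filterᵇ⁻ {p = R (suc t)} {xs = B} (≡.subst (y ∈_) (S-suc (suc t)) m) in
                ≡.subst (y ∈_) (≡.sym (S-suc t)) (∈-filterᵇ⁺ {p = R t} y∈B (length-filterᵇ-≤ {p = R t} {R (suc t)} B mono
                  (≡.subst₂ (λ a c → length a ≤ length c) (S-suc (suc t)) (S-suc t) shrink) y∈B e)))
        where
        mono : ∀ {x} → x ∈ B → R t x ≡ true → R (suc t) x ≡ true
        mono {x} x∈B e = proj₂ (∈-filterᵇ⁻ {p = R (suc t)} {xs = B} (≡.subst (x ∈_) (S-suc (suc t))
          (S⊆S (suc t) (≡.subst (x ∈_) (≡.sym (S-suc t)) (∈-filterᵇ⁺ {p = R t} x∈B e)))))

      stable-end : ∀ N → N ≡ length B → Stable N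
      stable-end zero e = ⊥-elim (empty b∈B e)
        where
        empty : ∀ {xs : List Box} → b ∈ xs → 0 ≢ length xs
        empty (here _)  ()
        empty (there _) ()
      stable-end (suc t) e with size-or-stable t
      ... | inj₁ st = st
      ... | inj₂ le = λ y m → ≡.subst (y ∈_) (≡.sym (S-suc t)) (∈-filterᵇ⁺ {p = R t} (S⊆B (suc (suc t)) m)
              (length-filterᵇ-full {p = R t} B (≡.subst₂ (λ a c → a ≤ length c) e (S-suc t) le) (S⊆B (suc (suc t)) m)))

    comp⊆ : ∀ {x} → x ∈ comp B b → x ∈ B
    comp⊆ = S⊆B (length B)

    start∈comp : b ∈ comp B b
    start∈comp = b∈S (length B)

    comp-closed : ∀ {x y} → x ∈ comp B b → y ∈ B → adjᵇ x y ≡ true → y ∈ comp B b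
    comp-closed m y∈B e = stable-end (length B) refl _ (grow (length B) m y∈B (inj₂ e))

    comp-invariant : (P : Box → Set) → P b → (∀ {x y} → x ∈ B → y ∈ B → P x → adjᵇ x y ≡ true → P y) →
      ∀ {x} → x ∈ comp B b → P x
    comp-invariant P Pb pres = go (length B)
      where
      go : ∀ t {x} → x ∈ S t → P x
      go zero    (here refl) = Pb
      go (suc t) {y} m with ∈-filterᵇ⁻ {p = R t} {xs = B} (≡.subst (y ∈_) (S-suc t) m)
      ... | y∈B , e with anyᵇ⁻ {p = λ x → boxEqᵇ x y ∨ adjᵇ x y} (S t) e
      ... | x , x∈S , e′ with ∨-elim {boxEqᵇ x y} e′
      ... | inj₁ eq = ≡.subst P (boxEq⇒≡ eq) (go t x∈S)
      ... | inj₂ ad = pres (S⊆B t x∈S) y∈B (go t x∈S) ad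

    -- A component keeps the order of `B`, which is what identifies its first box.
    comp-filter : ∃ λ p → comp B b ≡ filterᵇ p B
    comp-filter = go (length B) refl
      where
      go : ∀ N → N ≡ length B → ∃ λ p → S N ≡ filterᵇ p B
      go (suc t) _ = R t , S-suc t
      go zero e = ⊥-elim (empty b∈B e)
        where
        empty : ∀ {xs : List Box} → b ∈ xs → 0 ≢ length xs
        empty (here _)  ()
        empty (there _) ()

  minRow-spec : ∀ L m → (∀ {x} → x ∈ L → m ≤ proj₁ x) → (∃ λ x → x ∈ L × proj₁ x ≡ m) → minRow L ≡ m
  minRow-spec (x ∷ xs) m lower (y , y∈ , refl) = ℕₚ.≤-antisym (upper y∈) (foldr-≥ xs (lower ∘ there))
    where
    f : Box → ℕ → ℕ
    f b m = proj₁ b ⊓ m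
    foldr-≥ : ∀ ys → (∀ {y′} → y′ ∈ ys → proj₁ y ≤ proj₁ y′) → proj₁ y ≤ foldr f (proj₁ x) ys
    foldr-≥ []       _ = lower (here refl)
    foldr-≥ (y′ ∷ ys) l = ℕₚ.⊓-glb (l (here refl)) (foldr-≥ ys (l ∘ there))
    foldr-≤ : ∀ ys {y′} → y′ ∈ x ∷ ys → foldr f (proj₁ x) ys ≤ proj₁ y′
    foldr-≤ []       (here refl)         = ℕₚ.≤-refl
    foldr-≤ (y₁ ∷ ys) (here refl)         = ℕₚ.≤-trans (ℕₚ.m⊓n≤n (proj₁ y₁) _) (foldr-≤ ys (here refl))
    foldr-≤ (y₁ ∷ ys) (there (here refl)) = ℕₚ.m⊓n≤m (proj₁ y₁) _
    foldr-≤ (y₁ ∷ ys) (there (there m))   = ℕₚ.≤-trans (ℕₚ.m⊓n≤n (proj₁ y₁) _) (foldr-≤ ys (there m))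
    upper : y ∈ x ∷ xs → foldr f (proj₁ x) xs ≤ proj₁ y
    upper = foldr-≤ xs

  maxRow-spec : ∀ L m → (∀ {x} → x ∈ L → proj₁ x ≤ m) → (∃ λ x → x ∈ L × proj₁ x ≡ m) → maxRow L ≡ m
  maxRow-spec (x ∷ xs) m upper (y , y∈ , refl) = ℕₚ.≤-antisym (foldr-≤ xs (upper ∘ there)) (foldr-≥ xs y∈)
    where
    f : Box → ℕ → ℕ
    f b m = proj₁ b ⊔ m
    foldr-≤ : ∀ ys → (∀ {y′} → y′ ∈ ys → proj₁ y′ ≤ proj₁ y) → foldr f (proj₁ x) ys ≤ proj₁ y
    foldr-≤ []       _ = upper (here refl)
    foldr-≤ (y′ ∷ ys) l = ℕₚ.⊔-lub (l (here refl)) (foldr-≤ ys (l ∘ there))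
    foldr-≥ : ∀ ys {y′} → y′ ∈ x ∷ ys → proj₁ y′ ≤ foldr f (proj₁ x) ys
    foldr-≥ []       (here refl)         = ℕₚ.≤-refl
    foldr-≥ (y₁ ∷ ys) (here refl)         = ℕₚ.≤-trans (foldr-≥ ys (here refl)) (ℕₚ.m≤n⊔m (proj₁ y₁) _)
    foldr-≥ (y₁ ∷ ys) (there (here refl)) = ℕₚ.m≤m⊔n (proj₁ y₁) _
    foldr-≥ (y₁ ∷ ys) (there (there m))   = ℕₚ.≤-trans (foldr-≥ ys (there m)) (ℕₚ.m≤n⊔m (proj₁ y₁) _)

  -- Reading order: the order in which boxes are listed.
  _≺_ : Box → Box → Set
  (r , c) ≺ (r′ , c′) = r < r′ ⊎ (r ≡ r′ × c < c′)

  ≺-irrefl : ∀ {x} → ¬ (x ≺ x)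
  ≺-irrefl (inj₁ lt)       = ℕₚ.n≮n _ lt
  ≺-irrefl (inj₂ (_ , lt)) = ℕₚ.n≮n _ lt

  boxes-sorted : ∀ κ → AllPairs _≺_ (boxes κ)
  boxes-sorted κ = AllPairsₚ.concat⁺
    (Allₚ.map⁺ (All.tabulate λ {r} _ → AllPairsₚ.map⁺ (AllPairsₚ.applyUpTo⁺₁ id (part κ r) λ lt _ → inj₂ (refl , lt))))
    (AllPairsₚ.map⁺ (AllPairsₚ.applyUpTo⁺₁ id (length κ) λ lt _ →
      Allₚ.map⁺ (All.tabulate λ _ → Allₚ.map⁺ (All.tabulate λ _ → inj₁ lt))))

  skew-sorted : ∀ κ τ → AllPairs _≺_ (skew κ τ)
  skew-sorted κ τ = AllPairsₚ.filter⁺ (T? ∘ (λ b → part τ (proj₁ b) ≤ᵇ proj₂ b)) (boxes-sorted κ)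

  ∈-skew⁺ : ∀ {κ τ r c} → part τ r ≤ c → c < part κ r → (r , c) ∈ skew κ τ
  ∈-skew⁺ {κ} {τ} le lt = ∈-filterᵇ⁺ {p = λ b → part τ (proj₁ b) ≤ᵇ proj₂ b} (∈-boxes⁺ {κ} lt) (≤⇒≤ᵇ le)

  ∈-skew⁻ : ∀ {κ τ r c} → (r , c) ∈ skew κ τ → part τ r ≤ c × c < part κ r
  ∈-skew⁻ {κ} {τ} m with ∈-filterᵇ⁻ {p = λ b → part τ (proj₁ b) ≤ᵇ proj₂ b} {xs = boxes κ} m
  ... | m′ , e = ≤ᵇ⇒≤ e , ∈-boxes⁻ {κ} m′

  countᵇ-map : ∀ {A B : Set} (f : A → B) (p : B → Bool) xs → countᵇ p (map f xs) ≡ countᵇ (p ∘ f) xs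
  countᵇ-map f p []       = refl
  countᵇ-map f p (x ∷ xs) with p (f x)
  ... | true  = ≡.cong suc (countᵇ-map f p xs)
  ... | false = countᵇ-map f p xs

  countᵇ-↭ : ∀ {A : Set} (p : A → Bool) {xs ys} → xs ↭ ys → countᵇ p xs ≡ countᵇ p ys
  countᵇ-↭ p perm = ↭-length (filter-↭ (T? ∘ p) perm)

  countᵇ-none : ∀ {A : Set} (p : A → Bool) (g : ℕ → A) N → (∀ c → c < N → p (g c) ≢ true) → countᵇ p (applyUpTo g N) ≡ 0
  countᵇ-none p g zero    f = refl
  countᵇ-none p g (suc N) f rewrite ≢true (f 0 (s≤s z≤n)) = countᵇ-none p (g ∘ suc) N (λ c → f (suc c) ∘ s≤s)

  countᵇ-initial : ∀ {A : Set} (p : A → Bool) (g : ℕ → A) N a → a ≤ N →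
    (∀ c → c < N → p (g c) ≡ true → c < a) → (∀ c → c < a → p (g c) ≡ true) → countᵇ p (applyUpTo g N) ≡ a
  countᵇ-initial p g N       zero    le to from = countᵇ-none p g N (λ c lt e → ℕₚ.n≮0 (to c lt e))
  countᵇ-initial p g (suc N) (suc a) (s≤s le) to from rewrite from 0 (s≤s z≤n) =
    ≡.cong suc (countᵇ-initial p (g ∘ suc) N a le (λ c lt e → s≤s⁻¹ (to (suc c) (s≤s lt) e)) (λ c lt → from (suc c) (s≤s lt)))

  sum-applyUpTo-const : ∀ {A : Set} (f : A → ℕ) (g : ℕ → A) N v → (∀ i → i < N → f (g i) ≡ v) → sum (map f (applyUpTo g N)) ≡ N * v
  sum-applyUpTo-const f g zero    v e = refl
  sum-applyUpTo-const f g (suc N) v e = ≡.cong₂ _+_ (e 0 (s≤s z≤n)) (sum-applyUpTo-const f (g ∘ suc) N v (λ i → e (suc i) ∘ s≤s))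

  private
    adj-cases : ∀ {r c r′ c′} → adjᵇ (r , c) (r′ , c′) ≡ true → r ≡ r′ ⊎ (c ≡ c′ × (suc r ≡ r′ ⊎ suc r′ ≡ r))
    adj-cases {r} {c} {r′} {c′} e with ∨-elim {(r ≡ᵇ r′) ∧ ((suc c ≡ᵇ c′) ∨ (suc c′ ≡ᵇ c))} e
    ... | inj₁ h = inj₁ (≡ᵇ⇒≡ (proj₁ (∧-elim h)))
    ... | inj₂ v with ∧-elim {c ≡ᵇ c′} v
    ...   | ec , er = inj₂ (≡ᵇ⇒≡ ec , [ inj₁ ∘ ≡ᵇ⇒≡ , inj₂ ∘ ≡ᵇ⇒≡ ]′ (∨-elim {suc r ≡ᵇ r′} er))

    adj-right : ∀ r c → adjᵇ (r , c) (r , suc c) ≡ true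
    adj-right r c = ∨-introˡ (∧-intro (≡⇒≡ᵇ {r} refl) (∨-introˡ (≡⇒≡ᵇ {suc c} refl)))

    adj-left : ∀ r c → adjᵇ (r , suc c) (r , c) ≡ true
    adj-left r c = ∨-introˡ (∧-intro (≡⇒≡ᵇ {r} refl) (∨-introʳ {suc (suc c) ≡ᵇ c} (≡⇒≡ᵇ {suc c} refl)))

    adj-down : ∀ r c → adjᵇ (r , c) (suc r , c) ≡ true
    adj-down r c = ∨-introʳ {(r ≡ᵇ suc r) ∧ ((suc c ≡ᵇ c) ∨ (suc c ≡ᵇ c))} (∧-intro (≡⇒≡ᵇ {c} refl) (∨-introˡ (≡⇒≡ᵇ {suc r} refl)))

    adj-up : ∀ r c → adjᵇ (suc r , c) (r , c) ≡ true
    adj-up r c = ∨-introʳ {(suc r ≡ᵇ r) ∧ ((suc c ≡ᵇ c) ∨ (suc c ≡ᵇ c))}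
      (∧-intro (≡⇒≡ᵇ {c} refl) (∨-introʳ {suc (suc r) ≡ᵇ r} (≡⇒≡ᵇ {suc r} refl)))

  module CoverComponents {k ℓ : ℕ} (p : ParFun k ℓ) {z C u w g} (c : Bounce.IsCover p z C u w g) {κ τ : List ℕ}
    (κ-rep : CoreFacts.Represents p κ) (τ-rep : CoreFacts.Represents (CoverShape.Covered.covered p c) τ) where
    open Bounce p
    open IsCover c
    private
      K = part κ
      T′ = part τ
      KC = CoreFacts.Represents.core κ-rep
      TC = CoreFacts.Represents.core τ-rep
      T-antitone : ∀ {r s} → r ≤ s → T′ s ≤ T′ r
      T-antitone = Partition.antitoneₚ (CoreFacts.Represents.partition τ-rep)
    open CoverCore p c KC TC

    B : List Box
    B = skew κ τ

    OnLevel : ℕ → Box → Set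
    OnLevel i (r , _) = ∃ λ j → j ≤ g × r ≡ u i + j

    box-level : ∀ {r c} → (r , c) ∈ B → InLevel r
    box-level {r} m with inLevel? r
    ... | yes L = L
    ... | no ¬L with ∈-skew⁻ {κ} {τ} m
    ... | le , lt = ⊥-elim (ℕₚ.<⇒≱ lt (≡.subst (_≤ _) (same-outside ¬L) le))

    private
      -- Below the bottom row of a level there is no box in the same column, so a step down stays on
      -- the level.
      next-row-on-level : ∀ {i r c} → i ≤ C → OnLevel i (r , c) → (r , c) ∈ B → (suc r , c) ∈ B → OnLevel i (suc r , c)
      next-row-on-level {i} a (j , b , refl) m m′ with ℕₚ.m≤n⇒m<n∨m≡n b
      ... | inj₁ lt = suc j , lt , ≡.sym (ℕₚ.+-suc _ j)
      ... | inj₂ refl = ⊥-elim (ℕₚ.<⇒≱ (proj₂ (∈-skew⁻ {κ} {τ} m′)) (ℕₚ.≤-trans (proj₁ (last-row a)) (proj₁ (∈-skew⁻ {κ} {τ} m))))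

      adjacent-on-level : ∀ {i} → i ≤ C → ∀ {x y} → x ∈ B → y ∈ B → OnLevel i x → adjᵇ x y ≡ true → OnLevel i y
      adjacent-on-level a {r , c} {r′ , c′} x∈ y∈ L ad with adj-cases {r} {c} {r′} {c′} ad
      ... | inj₁ refl = L
      ... | inj₂ (refl , inj₁ refl) = next-row-on-level a L x∈ y∈
      -- A step up is a step down seen from the other box; uniqueness of levels then identifies the
      -- two.
      adjacent-on-level {i} a {r , c} {r′ , c′} x∈ y∈ (j , b , e) ad | inj₂ (refl , inj₂ refl) with box-level y∈
      ... | i′ , a′ , L′@(j′ , b′ , e′) with next-row-on-level a′ L′ y∈ x∈
      ... | j″ , b″ , e″ = ≡.subst (λ i → OnLevel i (r′ , c)) (level-unique a′ a b″ b (≡.trans (≡.sym e″) e)) L′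

    firstBox : ℕ → Box
    firstBox i = u i , T′ (u i)

    u0∈ : ∀ {i j} → i ≤ C → j ≤ g → (u i + j , T′ (u i + j)) ∈ B
    u0∈ a b = ∈-skew⁺ {κ} {τ} ℕₚ.≤-refl (level-row-< a b)

    module Connected {b : Box} (b∈B : b ∈ B) {i} (i≤C : i ≤ C) (L : OnLevel i b) where
      open Component B b b∈B

      private
        row-right : ∀ {r c} d → (r , c) ∈ comp B b → c + d < K r → (r , c + d) ∈ comp B b
        row-right {r} {c} zero    m lt = ≡.subst (λ x → (r , x) ∈ comp B b) (≡.sym (ℕₚ.+-identityʳ c)) m
        row-right {r} {c} (suc d) m lt = ≡.subst (λ x → (r , x) ∈ comp B b) (≡.sym (ℕₚ.+-suc c d))
          (comp-closed (row-right d m (ℕₚ.<-trans (ℕₚ.n<1+n _) lt′))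
            (∈-skew⁺ {κ} {τ} (ℕₚ.≤-trans (proj₁ (∈-skew⁻ {κ} {τ} (comp⊆ m))) (ℕₚ.m≤n⇒m≤1+n (ℕₚ.m≤m+n c d))) lt′) (adj-right r (c + d)))
          where lt′ = ≡.subst (_< K r) (ℕₚ.+-suc c d) lt

        row-left : ∀ {r} d c → (r , d + c) ∈ comp B b → T′ r ≤ c → (r , c) ∈ comp B b
        row-left zero    c m le = m
        row-left {r} (suc d) c m le = row-left d c (comp-closed m
          (∈-skew⁺ {κ} {τ} (ℕₚ.≤-trans le (ℕₚ.m≤n+m c d)) (ℕₚ.<-trans (ℕₚ.n<1+n _) (proj₂ (∈-skew⁻ {κ} {τ} (comp⊆ m))))) (adj-left r (d + c))) le

        whole-row : ∀ {r c c′} → (r , c) ∈ comp B b → T′ r ≤ c′ → c′ < K r → (r , c′) ∈ comp B b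
        whole-row {r} {c} {c′} m le lt with ℕₚ.≤-total c c′
        ... | inj₁ c≤ = ≡.subst (λ x → (r , x) ∈ comp B b) (ℕₚ.m+[n∸m]≡n c≤)
                (row-right (c′ ∸ c) m (≡.subst (_< K r) (≡.sym (ℕₚ.m+[n∸m]≡n c≤)) lt))
        ... | inj₂ ≤c = row-left (c ∸ c′) c′ (≡.subst (λ x → (r , x) ∈ comp B b) (≡.sym (ℕₚ.m∸n+n≡m ≤c)) m) le

        Row : ℕ → Set
        Row j = ∃ λ c → (u i + j , c) ∈ comp B b

        -- The unique column common to two consecutive rows of a level is what links them.
        shared : ∀ {j} → j < g → (u i + j , T′ (u i + j)) ∈ B × (suc (u i + j) , T′ (u i + j)) ∈ B
        shared {j} lt = u0∈ i≤C (ℕₚ.<⇒≤ lt) ,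
          ∈-skew⁺ {κ} {τ} (T-antitone (ℕₚ.n≤1+n _)) (ℕₚ.≤-reflexive (inner-row i≤C lt))

        row-down : ∀ {j} → j < g → Row j → Row (suc j)
        row-down {j} lt (_ , m) = _ , ≡.subst (λ r → (r , T′ (u i + j)) ∈ comp B b) (≡.sym (ℕₚ.+-suc (u i) j))
          (comp-closed (whole-row m (proj₁ s₁) (proj₂ s₁)) (proj₂ (shared lt)) (adj-down (u i + j) (T′ (u i + j))))
          where s₁ = ∈-skew⁻ {κ} {τ} (proj₁ (shared lt))

        row-up : ∀ {j} → j < g → Row (suc j) → Row j
        row-up {j} lt (c , m) = _ , comp-closed
          (whole-row (≡.subst (λ r → (r , c) ∈ comp B b) (ℕₚ.+-suc (u i) j) m) (proj₁ s₁) (proj₂ s₁)) (proj₁ (shared lt)) (adj-up (u i + j) (T′ (u i + j)))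
          where s₁ = ∈-skew⁻ {κ} {τ} (proj₂ (shared lt))

        top-row : ∀ j → j ≤ g → Row j → Row 0
        top-row zero    le R = R
        top-row (suc j) lt R = top-row j (ℕₚ.<⇒≤ lt) (row-up lt R)

        any-row : Row 0 → ∀ j → j ≤ g → Row j
        any-row R zero    le = R
        any-row R (suc j) lt = row-down lt (any-row R j (ℕₚ.<⇒≤ lt))

        start-row : Row 0
        start-row = let j , le , e = L in top-row j le (proj₂ b , ≡.subst (λ r → (r , proj₂ b) ∈ comp B b) e start∈comp)

      comp-complete : ∀ {x} → x ∈ B → OnLevel i x → x ∈ comp B b
      comp-complete {r , c} m (j , le , refl) = let s = ∈-skew⁻ {κ} {τ} m in whole-row (proj₂ (any-row start-row j le)) (proj₁ s) (proj₂ s)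

      comp-sound : ∀ {x} → x ∈ comp B b → x ∈ B × OnLevel i x
      comp-sound m = comp⊆ m , comp-invariant (OnLevel i) L (adjacent-on-level i≤C) m

      private
        first∈ : firstBox i ∈ B
        first∈ = ≡.subst (λ r → (r , T′ r) ∈ B) (ℕₚ.+-identityʳ (u i)) (u0∈ i≤C z≤n)

        first-level : OnLevel i (firstBox i)
        first-level = 0 , z≤n , ≡.sym (ℕₚ.+-identityʳ _)

        not-before-first : ∀ {x} → x ∈ B → OnLevel i x → ¬ (x ≺ firstBox i)
        not-before-first m (j , le , refl) (inj₁ lt) = ℕₚ.<⇒≱ lt (ℕₚ.m≤m+n (u i) j)
        not-before-first m (j , le , refl) (inj₂ (e , lt)) = ℕₚ.<⇒≱ lt (≡.subst (λ r → T′ r ≤ _) e (proj₁ (∈-skew⁻ {κ} {τ} m)))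

        -- A component is counted at its first box; in reading order this is the leftmost box of its
        -- top row, which occurs once per level.
        head-first : ∀ L′ → AllPairs _≺_ L′ → (∀ {x} → x ∈ L′ → x ∈ B × OnLevel i x) → firstBox i ∈ L′ →
          (firstIsᵇ L′ b ≡ true → b ≡ firstBox i) × (b ≡ firstBox i → firstIsᵇ L′ b ≡ true)
        head-first (x ∷ xs) (x≺ ∷ _) sound m = (λ e → ≡.trans (≡.sym (boxEq⇒≡ e)) x≡) , (λ e → ≡⇒boxEq (≡.trans x≡ (≡.sym e)))
          where
          x≡ : x ≡ firstBox i
          x≡ = go m
            where
            go : firstBox i ∈ x ∷ xs → x ≡ firstBox i
            go (here e)   = ≡.sym e
            go (there m′) = let x∈ , Lx = sound (here refl) in ⊥-elim (not-before-first x∈ Lx (All.lookup x≺ m′))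

        sorted : AllPairs _≺_ (comp B b)
        sorted = let q , e = comp-filter in ≡.subst (AllPairs _≺_) (≡.sym e) (AllPairsₚ.filter⁺ (T? ∘ q) (skew-sorted κ τ))

      first-spec : (firstIsᵇ (comp B b) b ≡ true → b ≡ firstBox i) × (b ≡ firstBox i → firstIsᵇ (comp B b) b ≡ true)
      first-spec = head-first (comp B b) sorted comp-sound (comp-complete first∈ first-level)

      comp-minRow : minRow (comp B b) ≡ u i
      comp-minRow = minRow-spec (comp B b) (u i) (λ m → let _ , j , _ , e = comp-sound m in ≡.subst (u i ≤_) (≡.sym e) (ℕₚ.m≤m+n (u i) j))
        (firstBox i , comp-complete first∈ first-level , refl)

      comp-height : height (comp B b) ∸ 1 ≡ g
      comp-height = ≡.trans (≡.cong₂ (λ a b → suc a ∸ b ∸ 1)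
          (maxRow-spec (comp B b) (u i + g)
            (λ m → let _ , j , le , e = comp-sound m in ≡.subst (_≤ u i + g) (≡.sym e) (ℕₚ.+-monoʳ-≤ (u i) le))
            (_ , comp-complete (u0∈ i≤C ℕₚ.≤-refl) (g , ℕₚ.≤-refl , refl) , refl))
          comp-minRow)
        (≡.cong (_∸ 1) (≡.trans (≡.cong (_∸ u i) (≡.sym (ℕₚ.+-suc (u i) g))) (ℕₚ.m+n∸m≡n (u i) (suc g))))

    private
      first∈B : ∀ {i} → i ≤ C → firstBox i ∈ B
      first∈B {i} a = ≡.subst (λ r → (r , T′ r) ∈ B) (ℕₚ.+-identityʳ (u i)) (u0∈ a z≤n)

      first-on : ∀ i → OnLevel i (firstBox i)
      first-on i = 0 , z≤n , ≡.sym (ℕₚ.+-identityʳ _)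

      firsts : List Box
      firsts = applyUpTo firstBox (suc C)

      firsts-unique : Unique firsts
      firsts-unique = Uniqueₚ.applyUpTo⁺₁ firstBox (suc C) λ {i} {i′} lt lt′ e → ℕₚ.<⇒≢
        (≡.subst (_< u i) (ℕₚ.+-identityʳ (u i′)) (level-< lt (s≤s⁻¹ lt′) 0 z≤n)) (≡.sym (≡.cong proj₁ e))

      firsts-↭ : filterᵇ (λ b → firstIsᵇ (comp B b) b) B ↭ firsts
      firsts-↭ = unique-set⇒↭
        (Uniqueₚ.filter⁺ (T? ∘ λ b → firstIsᵇ (comp B b) b) (AllPairs.map (λ { lt refl → ≺-irrefl lt }) (skew-sorted κ τ)))
        firsts-unique to from
        where
        to : ∀ {x} → x ∈ filterᵇ (λ b → firstIsᵇ (comp B b) b) B → x ∈ firsts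
        to {x} m with ∈-filterᵇ⁻ {p = λ b → firstIsᵇ (comp B b) b} {xs = B} m
        ... | x∈ , e with box-level x∈
        ... | i , a , L = ≡.subst (_∈ firsts) (≡.sym (proj₁ (Connected.first-spec x∈ a L) e)) (∈-applyUpTo⁺ firstBox (s≤s a))
        from : ∀ {x} → x ∈ firsts → x ∈ filterᵇ (λ b → firstIsᵇ (comp B b) b) B
        from m with ∈-applyUpTo⁻ firstBox m
        ... | i , lt , refl = ∈-filterᵇ⁺ {p = λ b → firstIsᵇ (comp B b) b} (first∈B (s≤s⁻¹ lt))
          (proj₂ (Connected.first-spec (first∈B (s≤s⁻¹ lt)) (s≤s⁻¹ lt) (first-on i)) refl)

      components-↭ : components B ↭ map (comp B) firsts
      components-↭ = map⁺ (comp B) firsts-↭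

      minRow-first : ∀ {i} → i ≤ C → minRow (comp B (firstBox i)) ≡ u i
      minRow-first {i} a = Connected.comp-minRow (first∈B a) a (first-on i)

    mark-spec : ∀ r → (anyᵇ (λ D → suc (minRow D) ≡ᵇ r) (components B) ≡ true → ∃ λ i → i ≤ C × suc (u i) ≡ r) ×
                      ((∃ λ i → i ≤ C × suc (u i) ≡ r) → anyᵇ (λ D → suc (minRow D) ≡ᵇ r) (components B) ≡ true)
    mark-spec r = to , from
      where
      P = λ D → suc (minRow D) ≡ᵇ r
      to : anyᵇ P (components B) ≡ true → ∃ λ i → i ≤ C × suc (u i) ≡ r
      to e with anyᵇ⁻ {p = P} (components B) e
      ... | D , D∈ , eD with ∈-map⁻ (comp B) (∈-resp-↭ components-↭ D∈)
      ... | b , b∈ , refl with ∈-applyUpTo⁻ firstBox b∈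
      ... | i , lt , refl = i , s≤s⁻¹ lt , ≡.trans (≡.cong suc (≡.sym (minRow-first (s≤s⁻¹ lt)))) (≡ᵇ⇒≡ eD)
      from : (∃ λ i → i ≤ C × suc (u i) ≡ r) → anyᵇ P (components B) ≡ true
      from (i , a , refl) = anyᵇ⁺ {p = P} (∈-resp-↭ (↭-sym components-↭) (∈-map⁺ (comp B) (∈-applyUpTo⁺ firstBox (s≤s a))))
        (≡⇒≡ᵇ (≡.cong suc (minRow-first a)))

    -- All `suc C` components have height `suc g`. Levels are numbered from the lowest, so the
    -- components below the mark on level `i₀` are exactly the `i₀` preceding ones.
    spin-spec : ∀ {i₀} → i₀ ≤ C → spin τ (suc (u i₀)) κ ≡ suc C * g + i₀
    spin-spec {i₀} i₀≤C = ≡.cong₂ _+_ heights below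
      where
      heights : sum (map (λ D → height D ∸ 1) (components B)) ≡ suc C * g
      heights = ≡.trans (sum-↭ (map⁺ (λ D → height D ∸ 1) components-↭))
        (≡.trans (≡.cong sum (≡.sym (Listₚ.map-∘ firsts)))
          (sum-applyUpTo-const (λ b → height (comp B b) ∸ 1) firstBox (suc C) g
            (λ i lt → Connected.comp-height (first∈B (s≤s⁻¹ lt)) (s≤s⁻¹ lt) (first-on i))))
      P = λ D → suc (u i₀) ≤ᵇ minRow D
      below : countᵇ P (components B) ≡ i₀
      below = ≡.trans (countᵇ-↭ P components-↭) (≡.trans (countᵇ-map (comp B) P firsts)
        (countᵇ-initial (P ∘ comp B) firstBox (suc C) i₀ (ℕₚ.m≤n⇒m≤1+n i₀≤C)
          (λ i lt e → ℕₚ.≰⇒> λ i₀≤i → ℕₚ.<⇒≱ (≡.subst (u i₀ <_) (minRow-first (s≤s⁻¹ lt)) (≤ᵇ⇒≤ e)) (chain-antitone ch i₀≤i (s≤s⁻¹ lt)))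
          (λ i lt → ≤⇒≤ᵇ (≡.subst (u i₀ <_) (≡.sym (minRow-first (ℕₚ.<⇒≤ (ℕₚ.<-≤-trans lt i₀≤C))))
            (≡.subst (_< u i) (ℕₚ.+-identityʳ _) (level-< lt i₀≤C 0 z≤n))))))

-- Bead sequences and the greedy search for a bead that can be moved.

module BeadSequences where
  open import Data.Nat using (ℕ; zero; suc; z≤n; s≤s; s≤s⁻¹; _≤?_; _≟_; _+_; _∸_; _*_; _≤_; _<_)
  open import Data.Nat.Tactic.RingSolver using (solve-∀)
  open import Relation.Binary.Definitions using (tri<; tri≈; tri>)

  bit : Bool → ℕ
  bit true  = 1
  bit false = 0

  count : (ℕ → Bool) → ℕ → ℕ
  count p zero    = bit (p 0)
  count p (suc y) = count p y + bit (p (suc y))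

  module Beads (Y : ℕ → ℕ) (Y-suc : ∀ s → Y s < Y (suc s)) where

    Y-mono : ∀ {s s′} → s < s′ → Y s < Y s′
    Y-mono {s} {s′} lt = ≡.subst (λ x → Y s < Y x) (ℕₚ.m+[n∸m]≡n lt) (go (s′ ∸ suc s))
      where
      go : ∀ d → Y s < Y (suc s + d)
      go zero    = ≡.subst (λ x → Y s < Y x) (≡.sym (ℕₚ.+-identityʳ (suc s))) (Y-suc s)
      go (suc d) = ℕₚ.<-trans (go d) (≡.subst (λ x → Y (suc s + d) < Y x) (≡.sym (ℕₚ.+-suc (suc s) d)) (Y-suc (suc s + d)))

    Y-mono-≤ : ∀ {s s′} → s ≤ s′ → Y s ≤ Y s′
    Y-mono-≤ le with ℕₚ.m≤n⇒m<n∨m≡n le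
    ... | inj₁ lt   = ℕₚ.<⇒≤ (Y-mono lt)
    ... | inj₂ refl = ℕₚ.≤-refl

    Y-cancel : ∀ {s s′} → Y s < Y s′ → s < s′
    Y-cancel {s} {s′} lt with ℕₚ.<-≤-connex s s′
    ... | inj₁ a = a
    ... | inj₂ b = ⊥-elim (ℕₚ.<⇒≱ lt (Y-mono-≤ b))

    Y-injective : ∀ {s s′} → Y s ≡ Y s′ → s ≡ s′
    Y-injective {s} {s′} e with ℕₚ.<-cmp s s′
    ... | tri< a _ _ = ⊥-elim (ℕₚ.<⇒≢ (Y-mono a) e)
    ... | tri≈ _ b _ = b
    ... | tri> _ _ c = ⊥-elim (ℕₚ.<⇒≢ (Y-mono c) (≡.sym e))

    s≤Y : ∀ s → s ≤ Y s
    s≤Y zero    = z≤n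
    s≤Y (suc s) = ℕₚ.≤-<-trans (s≤Y s) (Y-suc s)

    bead? : ∀ y → Dec (∃ λ s → Y s ≡ y)
    bead? y = map′ (λ (s , _ , e) → s , e) (λ (s , e) → s , s≤s (≡.subst (s ≤_) e (s≤Y s)) , e)
      (ℕₚ.anyUpTo? (λ s → Y s ≟ y) (suc y))

    bead : ℕ → Bool
    bead y = does (bead? y)

    bead⁻ : ∀ {y} → bead y ≡ true → ∃ λ s → Y s ≡ y
    bead⁻ {y} e = invert (bead? y) e
      where
      invert : ∀ {P : Set} (d : Dec P) → does d ≡ true → P
      invert (yes a) _ = a

    bead⁺ : ∀ {y} s → Y s ≡ y → bead y ≡ true
    bead⁺ {y} s e = dec-true (bead? y) (s , e)

    private module Count (p : ℕ → Bool) (p⁻ : ∀ {y} → p y ≡ true → ∃ λ s → Y s ≡ y) (p⁺ : ∀ {y} s → Y s ≡ y → p y ≡ true) where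
      contra : ¬ (false ≡ true)
      contra ()

      count-spec : ∀ y → (∀ s → s < count p y → Y s ≤ y) × (∀ s → Y s ≤ y → s < count p y)
      count-spec zero with p 0 in e₀
      ... | false = (λ _ ()) , λ s le → ⊥-elim (contra (≡.trans (≡.sym e₀) (p⁺ s (ℕₚ.n≤0⇒n≡0 le))))
      ... | true = to , from
        where
        s₀ = proj₁ (p⁻ e₀)
        e = proj₂ (p⁻ e₀)
        s₀≡0 : s₀ ≡ 0
        s₀≡0 = ℕₚ.n≤0⇒n≡0 (≡.subst (s₀ ≤_) e (s≤Y s₀))
        to : ∀ s → s < 1 → Y s ≤ 0
        to zero _ = ℕₚ.≤-reflexive (≡.trans (≡.cong Y (≡.sym s₀≡0)) e)
        to (suc s) (s≤s ())
        from : ∀ s → Y s ≤ 0 → s < 1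
        from s le = s≤s (ℕₚ.≤-trans (s≤Y s) le)
      count-spec (suc y) with count-spec y | p (suc y) in e₀
      ... | to , from | false = (λ s lt → ℕₚ.m≤n⇒m≤1+n (to s (≡.subst (s <_) (ℕₚ.+-identityʳ _) lt))) ,
            (λ s le → ≡.subst (s <_) (≡.sym (ℕₚ.+-identityʳ _)) (from s (s≤s⁻¹ (ℕₚ.≤∧≢⇒< le λ e → contra (≡.trans (≡.sym e₀) (p⁺ s e))))))
      ... | to , from | true = to′ , from′
        where
        c = count p y
        s₀ = proj₁ (p⁻ e₀)
        e = proj₂ (p⁻ e₀)
        s₀≡c : s₀ ≡ c
        s₀≡c with ℕₚ.<-cmp s₀ c
        ... | tri≈ _ eq _ = eq
        ... | tri< lt _ _ = ⊥-elim (ℕₚ.<⇒≱ (ℕₚ.≤-reflexive (≡.sym e)) (to s₀ lt))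
        ... | tri> _ _ gt = ⊥-elim (ℕₚ.n≮n c (from c (s≤s⁻¹ (≡.subst (Y c <_) e (Y-mono gt)))))
        to′ : ∀ s → s < c + 1 → Y s ≤ suc y
        to′ s lt with ℕₚ.m≤n⇒m<n∨m≡n (s≤s⁻¹ (≡.subst (s <_) (ℕₚ.+-comm c 1) lt))
        ... | inj₁ lt′  = ℕₚ.m≤n⇒m≤1+n (to s lt′)
        ... | inj₂ refl = ℕₚ.≤-reflexive (≡.trans (≡.cong Y (≡.sym s₀≡c)) e)
        from′ : ∀ s → Y s ≤ suc y → s < c + 1
        from′ s le = ≡.subst (s <_) (ℕₚ.+-comm 1 c) (s≤s (≡.subst (s ≤_) s₀≡c
          (ℕₚ.≮⇒≥ λ lt → ℕₚ.<⇒≱ (Y-mono lt) (≡.subst (Y s ≤_) (≡.sym e) le))))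

    open Count bead bead⁻ bead⁺ public using (count-spec)

  first-below : ∀ {P : ℕ → Set} (P? : ∀ c → Dec (P c)) N → (∃ λ a → a < N × P a × (∀ c → c < a → ¬ P c)) ⊎ (∀ c → c < N → ¬ P c)
  first-below P? zero = inj₂ λ _ ()
  first-below P? (suc N) with first-below P? N
  ... | inj₁ (a , lt , Pa , min) = inj₁ (a , ℕₚ.m<n⇒m<1+n lt , Pa , min)
  ... | inj₂ none with P? N
  ... | yes PN = inj₁ (N , ℕₚ.n<1+n N , PN , none)
  ... | no ¬PN = inj₂ λ c lt → [ none c , (λ { refl → ¬PN }) ]′ (ℕₚ.m≤n⇒m<n∨m≡n (s≤s⁻¹ lt))

  last-below : ∀ {P : ℕ → Set} (P? : ∀ c → Dec (P c)) N → (∃ λ a → a < N × P a) → ∃ λ a → a < N × P a × (∀ c → a < c → c < N → ¬ P c)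
  last-below P? zero    (_ , () , _)
  last-below P? (suc N) (a , lt , Pa) with P? N
  ... | yes PN = N , ℕₚ.n<1+n N , PN , λ c a<c c<N → ⊥-elim (ℕₚ.<⇒≱ a<c (s≤s⁻¹ c<N))
  ... | no ¬PN with last-below P? N (a , [ id , (λ { refl → ⊥-elim (¬PN Pa) }) ]′ (ℕₚ.m≤n⇒m<n∨m≡n (s≤s⁻¹ lt)) , Pa)
  ... | b , lt′ , Pb , max = b , ℕₚ.m<n⇒m<1+n lt′ , Pb ,
        λ c b<c c<N → [ max c b<c , (λ { refl → ¬PN }) ]′ (ℕₚ.m≤n⇒m<n∨m≡n (s≤s⁻¹ c<N))

  -- `p` and `q` stand for the beads of the larger and the smaller core, and position 0 for the row
  -- where they first differ. A period is `n` positions; position `t` of level `i` is `x i t`.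
  module Greedy (n′ : ℕ) (p q : ℕ → Bool)
    (p-flush : ∀ y → p y ≡ true → p (suc n′ + y) ≡ true) (q-flush : ∀ y → q y ≡ true → q (suc n′ + y) ≡ true)
    (p0 : p 0 ≡ true) (q0 : q 0 ≡ false)
    (dominated : ∀ y → count q y ≤ count p y)
    (end : ℕ) (equal-end : ∀ y → end ≤ y → count p y ≤ count q y) where

    private
      n = suc n′
      cp = count p
      cq = count q

      x : ℕ → ℕ → ℕ
      x i t = i * n + t

      x-suc : ∀ i t → x (suc i) t ≡ n + x i t
      x-suc i t = ℕₚ.+-assoc n (i * n) t

      x-+ : ∀ i t → x i (suc t) ≡ suc (x i t)
      x-+ i t = ℕₚ.+-suc (i * n) t

      p-x : ∀ i t → p (x i t) ≡ true → p (x (suc i) t) ≡ true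
      p-x i t e = ≡.subst (λ y → p y ≡ true) (≡.sym (x-suc i t)) (p-flush (x i t) e)

      p-x0 : ∀ i → p (x i 0) ≡ true
      p-x0 zero    = p0
      p-x0 (suc i) = p-x i 0 (p-x0 i)

    -- D y > 0 for the difference D of the counting functions of p and q.
    Pos : ℕ → Set
    Pos y = cq y < cp y

    -- As `p` is flush, this says that the runner of position `t` begins on level `suc i`.
    Gap : ℕ → ℕ → Set
    Gap i t = p (x i t) ≡ false × p (x (suc i) t) ≡ true

    private
      Gap? : ∀ i t → Dec (Gap i t)
      Gap? i t with p (x i t) Boolₚ.≟ false | p (x (suc i) t) Boolₚ.≟ true
      ... | yes a | yes b = yes (a , b)
      ... | no ¬a | _     = no (¬a ∘ proj₁)
      ... | _     | no ¬b = no (¬b ∘ proj₂)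

      ¬Gap⇒≡ : ∀ i t → ¬ Gap i t → p (x i t) ≡ p (x (suc i) t)
      ¬Gap⇒≡ i t ng with p (x i t) in e | p (x (suc i) t) in e′
      ... | true  | true  = refl
      ... | false | false = refl
      ... | false | true  = ⊥-elim (ng (refl , refl))
      ... | true  | false = ≡.trans (≡.sym (p-x i t e)) e′

      -- D at the end of the window is smaller than at its beginning, with the subtractions cleared.
      Drops : ℕ → ℕ → Set
      Drops j s = cp (x j s) + cq (x j 0) < cp (x j 0) + cq (x j s)

      -- The reason why the window stops at `s`. In the second case it fills a period, and its end
      -- is the beginning of the next level.
      Border : ℕ → ℕ → Set
      Border j s = Drops j s ⊎ (s ≡ n × Pos (x j n))

      record LevelState (j s : ℕ) : Set where
        field
          s>0   : 0 < s
          s≤n   : s ≤ n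
          pos   : ∀ i → i ≤ j → ∀ t → t < s → Pos (x i t)
          nogap : ∀ i → i < j → ∀ t → t < s → ¬ Gap i t
          border : Border j s

      -- Without gaps, `p` shows the same pattern of beads on both levels and hence the same
      -- increments.
      cp-shift : ∀ j t → (∀ t′ → t′ ≤ t → ¬ Gap j t′) → cp (x (suc j) t) + cp (x j 0) ≡ cp (x (suc j) 0) + cp (x j t)
      cp-shift j zero    ng = refl
      cp-shift j (suc t) ng = begin
        cp (x (suc j) (suc t)) + cp (x j 0)
          ≡⟨ ≡.cong (λ y → cp y + cp (x j 0)) (x-+ (suc j) t) ⟩
        cp (x (suc j) t) + bit (p (suc (x (suc j) t))) + cp (x j 0)
          ≡⟨ ≡.cong₂ (λ a b → a + b + cp (x j 0)) refl (≡.cong bit (≡.trans (≡.cong p (≡.sym (x-+ (suc j) t)))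
               (≡.trans (≡.sym (¬Gap⇒≡ j (suc t) (ng (suc t) ℕₚ.≤-refl))) (≡.cong p (x-+ j t))))) ⟩
        cp (x (suc j) t) + b + cp (x j 0)
          ≡⟨ comm₁ (cp (x (suc j) t)) b _ ⟩
        cp (x (suc j) t) + cp (x j 0) + b
          ≡⟨ ≡.cong (_+ b) (cp-shift j t (λ t′ le → ng t′ (ℕₚ.m≤n⇒m≤1+n le))) ⟩
        cp (x (suc j) 0) + cp (x j t) + b
          ≡⟨ ℕₚ.+-assoc (cp (x (suc j) 0)) _ _ ⟩
        cp (x (suc j) 0) + cp (suc (x j t))
          ≡⟨ ≡.cong (λ y → cp (x (suc j) 0) + cp y) (x-+ j t) ⟨
        cp (x (suc j) 0) + cp (x j (suc t)) ∎
        where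
        open ≡.≡-Reasoning
        b = bit (p (suc (x j t)))
        comm₁ : ∀ a b c → a + b + c ≡ a + c + b
        comm₁ = solve-∀

      -- `q` is flush, so each of its beads reappears one level on and its increments can only grow.
      cq-shift : ∀ j t → cq (x (suc j) 0) + cq (x j t) ≤ cq (x (suc j) t) + cq (x j 0)
      cq-shift j zero    = ℕₚ.≤-refl
      cq-shift j (suc t) = begin
        cq (x (suc j) 0) + cq (x j (suc t))
          ≡⟨ ≡.cong (λ y → cq (x (suc j) 0) + cq y) (x-+ j t) ⟩
        cq (x (suc j) 0) + (cq (x j t) + b)
          ≡⟨ ℕₚ.+-assoc (cq (x (suc j) 0)) _ b ⟨
        cq (x (suc j) 0) + cq (x j t) + b
          ≤⟨ ℕₚ.+-mono-≤ (cq-shift j t) b≤b′ ⟩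
        cq (x (suc j) t) + cq (x j 0) + b′
          ≡⟨ comm₁ (cq (x (suc j) t)) (cq (x j 0)) b′ ⟩
        cq (x (suc j) t) + b′ + cq (x j 0)
          ≡⟨ ≡.cong (λ y → cq y + cq (x j 0)) (x-+ (suc j) t) ⟨
        cq (x (suc j) (suc t)) + cq (x j 0) ∎
        where
        open ℕₚ.≤-Reasoning
        b = bit (q (suc (x j t)))
        b′ = bit (q (suc (x (suc j) t)))
        comm₁ : ∀ a b c → a + b + c ≡ a + c + b
        comm₁ = solve-∀
        bit-mono : ∀ {a b} → (a ≡ true → b ≡ true) → bit a ≤ bit b
        bit-mono {false} f = z≤n
        bit-mono {true}  f rewrite f refl = ℕₚ.≤-refl
        b≤b′ : b ≤ b′
        b≤b′ = bit-mono λ e → ≡.subst (λ y → q y ≡ true)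
          (≡.trans (ℕₚ.+-suc n (x j t)) (≡.cong suc (≡.sym (x-suc j t)))) (q-flush _ e)

      -- By `cp-shift` and `cq-shift`, the increment of D over the window does not grow from one
      -- level to the next, so a drop is inherited.
      drops-suc : ∀ {j s} → Drops j s → (∀ t → t ≤ s → ¬ Gap j t) → Drops (suc j) s
      drops-suc {j} {s} d ng = ℕₚ.+-cancelʳ-< (cp (x j 0) + cq (x j 0)) _ _ (begin-strict
        (b′ + y) + (a + c)  ≡⟨ e₁ b′ y a c ⟩
        (b′ + a) + (y + c)  ≡⟨ ≡.cong (_+ (y + c)) (cp-shift j s ng) ⟩
        (b + a′) + (y + c)  ≡⟨ e₂ b a′ y c ⟩
        (a′ + c) + (b + y)  <⟨ ℕₚ.+-monoˡ-< (b + y) d ⟩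
        (a + c′) + (b + y)  ≡⟨ e₃ a c′ b y ⟩
        (a + b) + (y + c′)  ≤⟨ ℕₚ.+-monoʳ-≤ (a + b) (cq-shift j s) ⟩
        (a + b) + (y′ + c)  ≡⟨ e₄ a b y′ c ⟩
        (b + y′) + (a + c)  ∎)
        where
        open ℕₚ.≤-Reasoning
        a = cp (x j 0)
        a′ = cp (x j s)
        b = cp (x (suc j) 0)
        b′ = cp (x (suc j) s)
        c = cq (x j 0)
        c′ = cq (x j s)
        y = cq (x (suc j) 0)
        y′ = cq (x (suc j) s)
        e₁ : ∀ b′ y a c → (b′ + y) + (a + c) ≡ (b′ + a) + (y + c)
        e₁ = solve-∀
        e₂ : ∀ b a′ y c → (b + a′) + (y + c) ≡ (a′ + c) + (b + y)
        e₂ = solve-∀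
        e₃ : ∀ a c′ b y → (a + c′) + (b + y) ≡ (a + b) + (y + c′)
        e₃ = solve-∀
        e₄ : ∀ a b y′ c → (a + b) + (y′ + c) ≡ (b + y′) + (a + c)
        e₄ = solve-∀

      -- D is never negative, so a value from which it drops is positive.
      drops⇒pos : ∀ {j s} → Drops j s → Pos (x j 0)
      drops⇒pos {j} {s} d = ℕₚ.+-cancelʳ-< (cq (x j s)) _ _ (begin-strict
        cq (x j 0) + cq (x j s) ≡⟨ ℕₚ.+-comm (cq (x j 0)) _ ⟩
        cq (x j s) + cq (x j 0) ≤⟨ ℕₚ.+-monoˡ-≤ _ (dominated (x j s)) ⟩
        cp (x j s) + cq (x j 0) <⟨ d ⟩
        cp (x j 0) + cq (x j s) ∎)
        where open ℕₚ.≤-Reasoning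

      x-n : ∀ j → x j n ≡ x (suc j) 0
      x-n j = ≡.trans (ℕₚ.+-comm (j * n) n) (≡.sym (ℕₚ.+-identityʳ (n + j * n)))

      -- The window is cut where D first vanishes; as D is positive at the start, that place is
      -- itself a drop.
      shrink : ∀ j s → s ≤ n → Pos (x j 0) → 0 < s → (Border j s ⊎ (s ≡ n)) →
        ∃ λ s′ → 0 < s′ × s′ ≤ s × (∀ t → t < s′ → Pos (x j t)) × Border j s′
      shrink j s s≤n pos0 s>0 bd with first-below (λ t → cp (x j t) ≤? cq (x j t)) (suc s)
      ... | inj₁ (zero , _ , le , _) = ⊥-elim (ℕₚ.<⇒≱ pos0 le)
      ... | inj₁ (suc t , lt , le , min) = suc t , s≤s z≤n , s≤s⁻¹ lt , (λ t′ lt′ → ℕₚ.≰⇒> (min t′ lt′)) ,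
              inj₁ (≡.subst (_< cp (x j 0) + cq (x j (suc t))) (ℕₚ.+-comm (cq (x j 0)) _) (ℕₚ.+-mono-<-≤ pos0 le))
      ... | inj₂ none = s , s>0 , ℕₚ.≤-refl , (λ t lt → ℕₚ.≰⇒> (none t (ℕₚ.m<n⇒m<1+n lt))) ,
              [ id , (λ e → inj₂ (e , ≡.subst (λ t → Pos (x j t)) e (ℕₚ.≰⇒> (none s (ℕₚ.n<1+n s))))) ]′ bd

    -- Moving one bead per level to position `e` from an earlier position of the window lowers the
    -- count of `p` by one in between, which `pos` permits. By `gap` the place is free on level `j`
    -- and occupied on the next level, so the runner remains flush.
    record Found : Set where
      field
        j e   : ℕ
        e>0   : 0 < e
        e<n   : e < n
        gap   : Gap j e
        nogap : ∀ i → i ≤ j → ∀ t → t < e → ¬ Gap i t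
        pos   : ∀ i → i ≤ j → ∀ t → t < e → Pos (x i t)

    private
      search : ∀ f j s → end ≤ f + j → LevelState j s → Found
      search f j s fuel L with first-below (Gap? j) (suc s)
      search f j s fuel L | inj₁ (zero , _ , g , _) = ⊥-elim (contra (≡.trans (≡.sym (p-x0 j)) (proj₁ g)))
        where contra : ¬ (true ≡ false)
              contra ()
      search f j s fuel L | inj₁ (suc t , lt , g , min) = record
        { j = j ; e = suc t ; e>0 = s≤s z≤n
        -- Position `n` of a level is position 0 of the next, which always holds a bead and
        -- therefore is no gap.
        ; e<n = ℕₚ.≤∧≢⇒< (ℕₚ.≤-trans (s≤s⁻¹ lt) (LevelState.s≤n L))
            (λ { refl → contra (≡.trans (≡.sym (≡.trans (≡.cong p (x-n j)) (p-x0 (suc j)))) (proj₁ g)) })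
        ; gap = g
        ; nogap = λ i le t′ lt′ → [ (λ i<j → LevelState.nogap L i i<j t′ (ℕₚ.<-≤-trans lt′ (s≤s⁻¹ lt))) , (λ { refl → min t′ lt′ }) ]′ (ℕₚ.m≤n⇒m<n∨m≡n le)
        ; pos = λ i le t′ lt′ → LevelState.pos L i le t′ (ℕₚ.<-≤-trans lt′ (s≤s⁻¹ lt)) }
        where contra : ¬ (true ≡ false)
              contra ()
      -- A level begins at `j * n`, which is at least `j`; when the fuel is gone this lies beyond
      -- `end`, where D is no longer positive.
      search zero j s fuel L | inj₂ none = ⊥-elim (ℕₚ.<⇒≱ (LevelState.pos L j ℕₚ.≤-refl 0 (LevelState.s>0 L))
        (equal-end _ (ℕₚ.≤-trans fuel (ℕₚ.≤-trans (ℕₚ.m≤m*n j n) (ℕₚ.m≤m+n (j * n) 0)))))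
      search (suc f) j s fuel L | inj₂ none = go (LevelState.border L)
        where
        ng : ∀ t → t ≤ s → ¬ Gap j t
        ng t le = none t (s≤s le)
        next : Pos (x (suc j) 0) → (Border (suc j) s ⊎ (s ≡ n)) → Found
        next pos0 bd with shrink (suc j) s (LevelState.s≤n L) pos0 (LevelState.s>0 L) bd
        ... | s′ , s′>0 , s′≤s , pos′ , bd′ = search f (suc j) s′ (≡.subst (end ≤_) (≡.sym (ℕₚ.+-suc f j)) fuel) record
          { s>0 = s′>0 ; s≤n = ℕₚ.≤-trans s′≤s (LevelState.s≤n L)
          ; pos = λ i le t lt → [ (λ i<sj → LevelState.pos L i (s≤s⁻¹ i<sj) t (ℕₚ.<-≤-trans lt s′≤s)) , (λ { refl → pos′ t lt }) ]′ (ℕₚ.m≤n⇒m<n∨m≡n le)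
          ; nogap = λ i lt t lt′ → [ (λ i<j → LevelState.nogap L i i<j t (ℕₚ.<-≤-trans lt′ s′≤s)) ,
                      (λ { refl → ng t (ℕₚ.<⇒≤ (ℕₚ.<-≤-trans lt′ s′≤s)) }) ]′ (ℕₚ.m≤n⇒m<n∨m≡n (s≤s⁻¹ lt))
          ; border = bd′ }
        go : Border j s → Found
        go (inj₁ d) = next (drops⇒pos {suc j} {s} d′) (inj₁ (inj₁ d′))
          where d′ = drops-suc {j} {s} d ng
        go (inj₂ (e , pn)) = next (≡.subst Pos (x-n j) pn) (inj₂ e)

      pos-start : Pos (x 0 0)
      pos-start rewrite p0 | q0 = s≤s z≤n

    found : Found
    found with shrink 0 n ℕₚ.≤-refl pos-start (s≤s z≤n) (inj₂ refl)
    ... | s , s>0 , s≤n , pos , bd = search end 0 s (ℕₚ.m≤m+n end 0) record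
      { s>0 = s>0 ; s≤n = s≤n ; pos = λ { zero _ → pos } ; nogap = λ _ () ; border = bd }

-- Construction of a cover between two nested cores.

module CoverExistence where
  open import Data.Nat as ℕ using (ℕ; zero; suc; z≤n; s≤s; s≤s⁻¹; _<?_; pred; _+_; _∸_; _*_; _≤_; _<_)
  open import Data.Nat.Tactic.RingSolver using (solve-∀)
  open BounceGraphs
  open CoverWeights
  open Cores
  open CoverCores
  open BeadSequences

  -- Beads of the rows r₀ + s of a core, at their distance below position A - r₀.
  module BeadRows {k ℓ : ℕ} (p : ParFun k ℓ) {K : ℕ → ℕ} (KC : Core p K) (r₀ A : ℕ) (K≤A : K r₀ ≤ A) where
    open Bounce p
    open CoreFacts p
    private n = suc k

    Y : ℕ → ℕ
    Y s = (A + s) ∸ K (r₀ + s)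

    K≤ : ∀ s → K (r₀ + s) ≤ A
    K≤ s = ℕₚ.≤-trans (K-antitone KC (ℕₚ.m≤m+n r₀ s)) K≤A

    Y-eq : ∀ s → Y s + K (r₀ + s) ≡ A + s
    Y-eq s = ℕₚ.m∸n+n≡m (ℕₚ.≤-trans (K≤ s) (ℕₚ.m≤m+n A s))

    Y-suc : ∀ s → Y s < Y (suc s)
    Y-suc s = ℕₚ.+-cancelʳ-≤ (K (r₀ + s)) _ _ (begin
      suc (Y s) + K (r₀ + s) ≡⟨ ≡.cong suc (Y-eq s) ⟩
      suc (A + s) ≡⟨ ℕₚ.+-suc A s ⟨
      A + suc s ≡⟨ Y-eq (suc s) ⟨
      Y (suc s) + K (r₀ + suc s) ≤⟨ ℕₚ.+-monoʳ-≤ (Y (suc s)) (K-antitone KC (ℕₚ.+-monoʳ-≤ r₀ (ℕₚ.n≤1+n s))) ⟩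
      Y (suc s) + K (r₀ + s) ∎)
      where open ℕₚ.≤-Reasoning

    next : ℕ → ℕ
    next s = s + (n ∸ parts (r₀ + s))

    down-next : ∀ s → down (r₀ + s) ≡ r₀ + next s
    down-next s = ℕₚ.+-assoc r₀ s _

    next-parts : ∀ s → next s + parts (r₀ + s) ≡ s + n
    next-parts s = ≡.trans (ℕₚ.+-assoc s _ _) (≡.cong (s +_) (ℕₚ.m∸n+n≡m (ℕₚ.m≤n⇒m≤1+n (bound (r₀ + s)))))

    -- The recursion for the rows of a core, restated for beads: bouncing adds one period.
    Y-next : ∀ s → Y (next s) ≡ n + Y s
    Y-next s = ℕₚ.+-cancelʳ-≡ (K (r₀ + next s) + x) _ _ (begin
      Y (next s) + (Kd + x)  ≡⟨ ℕₚ.+-assoc (Y (next s)) Kd x ⟨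
      Y (next s) + Kd + x    ≡⟨ ≡.cong (_+ x) (Y-eq (next s)) ⟩
      A + next s + x         ≡⟨ ℕₚ.+-assoc A (next s) x ⟩
      A + (next s + x)       ≡⟨ ≡.cong (A +_) (next-parts s) ⟩
      A + (s + n)            ≡⟨ ℕₚ.+-assoc A s n ⟨
      A + s + n              ≡⟨ ≡.cong (_+ n) (Y-eq s) ⟨
      Y s + K (r₀ + s) + n   ≡⟨ ≡.cong (λ a → Y s + a + n) (≡.trans (Core.recur KC (r₀ + s)) (≡.cong (λ r → x + K r) (down-next s))) ⟩
      Y s + (x + Kd) + n     ≡⟨ rearrange (Y s) x Kd n ⟩
      n + Y s + (Kd + x)     ∎)
      where
      open ≡.≡-Reasoning
      x = parts (r₀ + s)
      Kd = K (r₀ + next s)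
      rearrange : ∀ a b c d → a + (b + c) + d ≡ d + a + (c + b)
      rearrange = solve-∀

    open Beads Y Y-suc public

    bead-flush : ∀ y → bead y ≡ true → bead (n + y) ≡ true
    bead-flush y e = let s , eq = bead⁻ e in bead⁺ (next s) (≡.trans (Y-next s) (≡.cong (n +_) eq))

  module Classify {k ℓ : ℕ} (p q : ParFun k ℓ) {K T : ℕ → ℕ} (KC : Core p K) (TC : Core q T)
    (T≤K : ∀ r → T r ≤ K r) (r₀ : ℕ) (same : ∀ r → r < r₀ → T r ≡ K r) (T<K : T r₀ < K r₀) where

    private
      n = suc k
      A = K r₀
      module YK = BeadRows p KC r₀ A ℕₚ.≤-refl
      module YT = BeadRows q TC r₀ A (T≤K r₀)
    open Bounce p
    open CoreFacts p
    open YK using (Y; Y-eq; next; down-next; next-parts; Y-next; Y-mono; Y-mono-≤; Y-cancel; Y-injective; s≤Y; bead; bead⁻; bead⁺)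

    private
      dominated-rows : ∀ s → Y s ≤ YT.Y s
      dominated-rows s = ℕₚ.∸-monoʳ-≤ (A + s) (T≤K (r₀ + s))

      p0 : bead 0 ≡ true
      p0 = bead⁺ 0 (≡.trans (≡.cong₂ _∸_ (ℕₚ.+-identityʳ A) (≡.cong K (ℕₚ.+-identityʳ r₀))) (ℕₚ.n∸n≡0 A))

      q0 : YT.bead 0 ≡ false
      q0 with YT.bead 0 in e
      ... | false = refl
      ... | true with YT.bead⁻ e
      ... | s , eq = ⊥-elim (ℕₚ.<⇒≱ (ℕₚ.≤-<-trans (CoreFacts.K-antitone q TC (ℕₚ.m≤m+n r₀ s)) T<K)
              (≡.subst (A ≤_) (≡.trans (≡.sym (YT.Y-eq s)) (≡.cong (_+ T (r₀ + s)) eq)) (ℕₚ.m≤m+n A s)))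

      dominated : ∀ y → count YT.bead y ≤ count bead y
      dominated y = ℕₚ.≮⇒≥ λ lt → ℕₚ.n≮n _ (proj₂ (YK.count-spec y) (count bead y)
        (ℕₚ.≤-trans (dominated-rows _) (proj₁ (YT.count-spec y) (count bead y) lt)))

      -- At most `suc s` beads of the larger core lie up to `y`, and the smaller core has strictly
      -- fewer there, so its bead `s` lies beyond.
      pos-row : ∀ {y} → count YT.bead y < count bead y → ∀ s → y < Y (suc s) → y < YT.Y s
      pos-row {y} ps s lt = ℕₚ.≰⇒> λ le → ℕₚ.<⇒≱ lt (proj₁ (YK.count-spec y) (suc s)
        (ℕₚ.≤-<-trans (proj₂ (YT.count-spec y) s le) ps))

      end : ∀ y → A + ℓ ≤ y → count bead y ≤ count YT.bead y
      end y le = ℕₚ.≮⇒≥ λ lt → far lt (ℕₚ.<-≤-connex s ℓ)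
        where
        s = count YT.bead y
        far : s < count bead y → s < ℓ ⊎ ℓ ≤ s → ⊥
        far lt side = ℕₚ.n≮n s (proj₂ (YT.count-spec y) s (YT≤y side))
          where
          YT≤y : s < ℓ ⊎ ℓ ≤ s → YT.Y s ≤ y
          YT≤y (inj₁ s<ℓ) = ℕₚ.≤-trans (ℕₚ.m∸n≤m (A + s) (T (r₀ + s))) (ℕₚ.≤-trans (ℕₚ.+-monoʳ-≤ A (ℕₚ.<⇒≤ s<ℓ)) le)
          YT≤y (inj₂ ℓ≤s) = ≡.subst (_≤ y) (≡.cong (A + s ∸_) (≡.trans (Core.empty KC _ ge) (≡.sym (Core.empty TC _ ge))))
            (proj₁ (YK.count-spec y) s lt)
            where ge = ℕₚ.≤-trans ℓ≤s (ℕₚ.m≤n+m s r₀)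

      module G = Greedy k bead YT.bead YK.bead-flush YT.bead-flush p0 q0 dominated (A + ℓ) end
      abstract
        found : G.Found
        found = G.found
      open G.Found found

      x : ℕ → ℕ → ℕ
      x i t = i * n + t

      x-suc : ∀ i t → x (suc i) t ≡ n + x i t
      x-suc i t = ℕₚ.+-assoc n (i * n) t

      -- No row bounces to this bead, so a runner of the larger core starts with it.
      Top : ℕ → Set
      Top c = ∃ λ s → Y s ≡ c × NoRow (r₀ + s)

      top? : ∀ c → Dec (Top c)
      top? c with YK.bead? c
      ... | no nb = no λ (s , e , _) → nb (s , e)
      ... | yes (s , e) with up? (r₀ + s)
      ...   | yes (y , d) = no λ (s′ , e′ , nr) → nr y (≡.trans d (≡.cong (r₀ +_) (Y-injective (≡.trans e (≡.sym e′)))))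
      ...   | no nu = yes (s , e , λ y d → nu (y , d))

      -- Above row r₀ the two cores agree, so a bead of K over r₀ would put a bead of T at row r₀ of K.
      top-0 : NoRow r₀
      top-0 y d = contradict (ℕₚ.<-≤-connex y′ r₀)
        where
        module Q = Bounce q
        y<r₀ : y < r₀
        y<r₀ = ≡.subst (y <_) d (down> y)
        y′ = Q.down y
        level : T y′ + r₀ ≡ A + y′
        level = ℕₚ.+-cancelʳ-≡ (parts y + Q.parts y) _ _ (begin
          T y′ + r₀ + (parts y + Q.parts y) ≡⟨ e₁ (T y′) r₀ (parts y) (Q.parts y) ⟩
          (Q.parts y + T y′) + (r₀ + parts y) ≡⟨ ≡.cong₂ _+_ (≡.sym (Core.recur TC y)) (≡.cong (_+ parts y) (≡.sym d)) ⟩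
          T y + (down y + parts y) ≡⟨ ≡.cong₂ _+_ (≡.trans (same y y<r₀) (≡.trans (Core.recur KC y) (≡.cong (λ a → parts y + K a) d)))
                                        (≡.trans (down-part y) (≡.sym (Q.down-part y))) ⟩
          (parts y + A) + (y′ + Q.parts y) ≡⟨ e₂ (parts y) A y′ (Q.parts y) ⟩
          A + y′ + (parts y + Q.parts y) ∎)
          where
          open ≡.≡-Reasoning
          e₁ : ∀ a b c d → a + b + (c + d) ≡ (d + a) + (b + c)
          e₁ = solve-∀
          e₂ : ∀ a b c d → (a + b) + (c + d) ≡ b + c + (a + d)
          e₂ = solve-∀
        contradict : y′ < r₀ ⊎ r₀ ≤ y′ → ⊥
        contradict (inj₁ lt) = ℕₚ.<⇒≢ (ℕₚ.+-mono-≤-< (≡.subst (A ≤_) (≡.sym (same y′ lt)) (K-antitone KC (ℕₚ.<⇒≤ lt))) lt) (≡.sym level)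
        contradict (inj₂ ge) = ℕₚ.<⇒≢ (ℕₚ.+-mono-<-≤ (ℕₚ.≤-<-trans (CoreFacts.K-antitone q TC ge) T<K) ge) level

      abstract
        -- The bead to be moved starts the last runner before `e`. Every bead strictly between `o`
        -- and `e` on level 0 is then reached by some row, and these rows form the block of `w` in a
        -- cover.
        highest : ∃ λ o → o < e × Top o × (∀ c → o < c → c < e → ¬ Top c)
        highest = last-below top? e (0 , e>0 , 0 ,
          ≡.trans (≡.cong₂ _∸_ (ℕₚ.+-identityʳ A) (≡.cong K (ℕₚ.+-identityʳ r₀))) (ℕₚ.n∸n≡0 A) ,
          ≡.subst NoRow (≡.sym (ℕₚ.+-identityʳ r₀)) top-0)

      o = proj₁ highest
      o<e = proj₁ (proj₂ highest)
      o-top = proj₁ (proj₂ (proj₂ highest))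
      above-o = proj₂ (proj₂ (proj₂ highest))

      S : ℕ → ℕ
      S zero    = proj₁ o-top
      S (suc i) = next (S i)

      Y-S : ∀ i → Y (S i) ≡ x i o
      Y-S zero    = proj₁ (proj₂ o-top)
      Y-S (suc i) = ≡.trans (Y-next (S i)) (≡.trans (≡.cong (n +_) (Y-S i)) (≡.sym (x-suc i o)))

      x-o<e : ∀ i → x i o < x i e
      x-o<e i = ℕₚ.+-monoʳ-< (i * n) o<e

      Y-S+ : ∀ i j′ → x i o ≤ Y (S i + j′)
      Y-S+ i j′ = ≡.subst (_≤ Y (S i + j′)) (Y-S i) (Y-mono-≤ (ℕₚ.m≤m+n (S i) j′))

      -- This is the absence of gaps before `e`: inside the windows, a bead is preceded by a bead on
      -- its runner.
      level-bead : ∀ i → i ≤ j → ∀ b → i * n ≤ b → b < x i e → bead (n + b) ≡ true → bead b ≡ true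
      level-bead i i≤j b ge lt eq with bead b in eb
      ... | true = refl
      ... | false = ⊥-elim (nogap i i≤j t t<e
              ( ≡.trans (≡.cong bead x≡b) eb
              , ≡.trans (≡.cong bead (≡.trans (x-suc i t) (≡.cong (n +_) x≡b))) eq))
        where
        t = b ∸ i * n
        x≡b : x i t ≡ b
        x≡b = ℕₚ.m+[n∸m]≡n ge
        t<e : t < e
        t<e = ℕₚ.+-cancelˡ-< (i * n) _ _ (≡.subst (_< x i e) (≡.sym x≡b) lt)

      window : ∀ {i b} → x i o ≤ b → i * n ≤ b
      window le = ℕₚ.≤-trans (ℕₚ.m≤m+n _ o) le

      no-bead-between : ∀ i → i ≤ j → ∀ s b → x i o ≤ Y s → Y s < b → b < Y (suc s) → b < x i e → bead (n + b) ≢ true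
      no-bead-between i i≤j s b ge lo hi lt eq with bead⁻ (level-bead i i≤j b (window {i} (ℕₚ.≤-trans ge (ℕₚ.<⇒≤ lo))) lt eq)
      ... | s′ , refl = ℕₚ.<⇒≱ (Y-cancel lo) (s≤s⁻¹ (Y-cancel hi))

      split-bead : ∀ {s} → n ≤ Y s → bead (n + (Y s ∸ n)) ≡ true
      split-bead {s} le = bead⁺ s (≡.sym (ℕₚ.m+[n∸m]≡n le))

      <-split : ∀ {a b} → n + a < b → a < b ∸ n
      <-split {a} {b} lt = ℕₚ.+-cancelˡ-< n _ _ (≡.subst (n + a <_) (≡.sym (ℕₚ.m+[n∸m]≡n (ℕₚ.≤-trans (ℕₚ.m≤m+n n a) (ℕₚ.<⇒≤ lt)))) lt)

      split-< : ∀ {a b} → n ≤ b → b < n + a → b ∸ n < a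
      split-< {a} {b} le lt = ℕₚ.+-cancelˡ-< n _ _ (≡.subst (_< n + a) (≡.sym (ℕₚ.m+[n∸m]≡n le)) lt)

      -- No runner begins inside the windows, so no new bead appears between the images of two
      -- consecutive beads, and consecutive rows bounce to consecutive rows.
      follow : ∀ i → i ≤ j → ∀ j′ → Y (S i + j′) < x i e → next (S i + j′) ≡ S (suc i) + j′
      follow i i≤j zero    lt = ≡.trans (≡.cong next (ℕₚ.+-identityʳ (S i))) (≡.sym (ℕₚ.+-identityʳ _))
      follow i i≤j (suc j′) lt = ≡.trans (≡.cong next (ℕₚ.+-suc (S i) j′)) (≡.trans (≡.sym eq) (≡.sym (ℕₚ.+-suc (S (suc i)) j′)))
        where
        s = S i + j′
        v = S (suc i) + j′
        lt′ : Y (suc s) < x i e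
        lt′ = ≡.subst (λ a → Y a < x i e) (ℕₚ.+-suc (S i) j′) lt
        IH : next s ≡ v
        IH = follow i i≤j j′ (ℕₚ.<-trans (YK.Y-suc s) lt′)
        Yv : Y v ≡ n + Y s
        Yv = ≡.trans (≡.cong Y (≡.sym IH)) (Y-next s)
        v<next : v < next (suc s)
        v<next = Y-cancel (≡.subst₂ _<_ (≡.sym Yv) (≡.sym (Y-next (suc s))) (ℕₚ.+-monoʳ-< n (YK.Y-suc s)))
        eq : suc v ≡ next (suc s)
        eq with ℕₚ.m≤n⇒m<n∨m≡n v<next
        ... | inj₂ e′ = e′
        ... | inj₁ lt₂ = ⊥-elim (no-bead-between i i≤j s (Y (suc v) ∸ n) (Y-S+ i j′) (<-split lo) (split-< n≤ hi)
                (ℕₚ.<-trans (split-< n≤ hi) lt′) (split-bead {suc v} n≤))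
          where
          lo : n + Y s < Y (suc v)
          lo = ≡.subst (_< Y (suc v)) Yv (YK.Y-suc v)
          hi : Y (suc v) < n + Y (suc s)
          hi = ≡.subst (Y (suc v) <_) (Y-next (suc s)) (Y-mono lt₂)
          n≤ = ℕₚ.≤-trans (ℕₚ.m≤m+n n (Y s)) (ℕₚ.<⇒≤ lo)

      Y-follow : ∀ i → i ≤ j → ∀ j′ → Y (S i + j′) < x i e → Y (S (suc i) + j′) ≡ n + Y (S i + j′)
      Y-follow i i≤j j′ lt = ≡.trans (≡.cong Y (≡.sym (follow i i≤j j′ lt))) (Y-next _)

      -- The converse transport; together with `lower-level` it shows that the windows of all levels
      -- contain equally many beads from `o` on.
      lift-level : ∀ i → i < j → ∀ j′ → Y (S (suc i) + j′) < x (suc i) e → Y (S i + j′) < x i e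
      lift-level i i<j zero    lt = ≡.subst (_< x i e) (≡.sym (≡.trans (≡.cong Y (ℕₚ.+-identityʳ (S i))) (Y-S i))) (x-o<e i)
      lift-level i i<j (suc j′) lt = ≡.subst (λ a → Y a < x i e) (≡.sym (ℕₚ.+-suc (S i) j′)) (ℕₚ.≤-<-trans (Y-mono-≤ s<s′) (≡.subst (_< x i e) (≡.sym Ys′) b<))
        where
        i≤j = ℕₚ.<⇒≤ i<j
        s = S i + j′
        v = S (suc i) + j′
        lt′ : Y (suc v) < x (suc i) e
        lt′ = ≡.subst (λ a → Y a < x (suc i) e) (ℕₚ.+-suc (S (suc i)) j′) lt
        IH : Y s < x i e
        IH = lift-level i i<j j′ (ℕₚ.<-trans (YK.Y-suc v) lt′)
        lo : n + Y s < Y (suc v)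
        lo = ≡.subst (_< Y (suc v)) (Y-follow i i≤j j′ IH) (YK.Y-suc v)
        n≤ = ℕₚ.≤-trans (ℕₚ.m≤m+n n (Y s)) (ℕₚ.<⇒≤ lo)
        b = Y (suc v) ∸ n
        b< : b < x i e
        b< = split-< n≤ (≡.subst (Y (suc v) <_) (x-suc i e) lt′)
        bd = bead⁻ (level-bead i i≤j b (window {i} (ℕₚ.≤-trans (Y-S+ i j′) (ℕₚ.<⇒≤ (<-split lo)))) b< (split-bead {suc v} n≤))
        Ys′ = proj₂ bd
        s<s′ : s < proj₁ bd
        s<s′ = Y-cancel (≡.subst (Y s <_) (≡.sym Ys′) (<-split lo))

      lower-level : ∀ i → i ≤ j → ∀ j′ → Y (S i + j′) < x i e → Y (S (suc i) + j′) < x (suc i) e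
      lower-level i i≤j j′ lt = ≡.subst₂ _<_ (≡.sym (Y-follow i i≤j j′ lt)) (≡.sym (x-suc i e)) (ℕₚ.+-monoʳ-< n lt)

      to-bottom : ∀ d i → d + i ≡ j → ∀ j′ → Y (S i + j′) < x i e → Y (S j + j′) < x j e
      to-bottom zero    i refl j′ lt = lt
      to-bottom (suc d) i eq   j′ lt = to-bottom d (suc i) (≡.trans (ℕₚ.+-suc d i) eq) j′
        (lower-level i (≡.subst (i ≤_) eq (ℕₚ.m≤n⇒m≤1+n (ℕₚ.m≤n+m i d))) j′ lt)

      from-bottom : ∀ d i → d + i ≡ j → ∀ j′ → Y (S j + j′) < x j e → Y (S i + j′) < x i e
      from-bottom zero    i refl j′ lt = lt
      from-bottom (suc d) i eq   j′ lt = lift-level i (≡.subst (i <_) eq (s≤s (ℕₚ.m≤n+m i d))) j′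
        (from-bottom d (suc i) (≡.trans (ℕₚ.+-suc d i) eq) j′ lt)

      abstract
        -- `g` is the number of beads strictly between `o` and `e` on level `j`; each of them is a
        -- row crossed by the moved bead.
        height-search : ∃ λ g → g < suc (x j e) × Y (S j + g) < x j e × (∀ c → g < c → c < suc (x j e) → ¬ (Y (S j + c) < x j e))
        height-search = last-below (λ c → Y (S j + c) <? x j e) (suc (x j e))
          (0 , s≤s z≤n , ≡.subst (_< x j e) (≡.sym (≡.trans (≡.cong Y (ℕₚ.+-identityʳ (S j))) (Y-S j))) (x-o<e j))

      g = proj₁ height-search
      g-below : Y (S j + g) < x j e
      g-below = proj₁ (proj₂ (proj₂ height-search))

      g-above : x j e ≤ Y (S j + suc g)
      g-above = ℕₚ.≮⇒≥ (proj₂ (proj₂ (proj₂ height-search)) (suc g) (ℕₚ.n<1+n g)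
        (s≤s (ℕₚ.≤-<-trans (ℕₚ.≤-trans (ℕₚ.m≤n+m g (S j)) (s≤Y (S j + g))) g-below)))

      inside : ∀ i → i ≤ j → ∀ j′ → j′ ≤ g → Y (S i + j′) < x i e
      inside i i≤j j′ le = from-bottom (j ∸ i) i (ℕₚ.m∸n+n≡m i≤j) j′ (ℕₚ.≤-<-trans (Y-mono-≤ (ℕₚ.+-monoʳ-≤ (S j) le)) g-below)

      outside-level : ∀ i → i ≤ j → x i e ≤ Y (S i + suc g)
      outside-level i i≤j = ℕₚ.≮⇒≥ λ lt → ℕₚ.<⇒≱ (to-bottom (j ∸ i) i (ℕₚ.m∸n+n≡m i≤j) (suc g) lt) g-above

      -- On level `suc j` the bead at `e` follows directly after the image of row `S j + g`: a bead
      -- in between would have a predecessor on level `j`, where there is no room.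
      gap-row : Y (S (suc j) + suc g) ≡ x (suc j) e
      gap-row with bead⁻ (proj₂ gap)
      ... | y , Yy = ℕₚ.≤-antisym (≡.subst (Y (S (suc j) + suc g) ≤_) Yy (Y-mono-≤ v<y))
              (ℕₚ.≮⇒≥ λ lt → no-bead-between j ℕₚ.≤-refl (S j + g) (Y (S (suc j) + suc g) ∸ n) (Y-S+ j g) (<-split lo)
                (ℕₚ.<-≤-trans (b< lt) (≡.subst (λ a → x j e ≤ Y a) (ℕₚ.+-suc (S j) g) g-above)) (b< lt) (split-bead {S (suc j) + suc g} n≤))
        where
        Yv : Y (S (suc j) + g) ≡ n + Y (S j + g)
        Yv = Y-follow j ℕₚ.≤-refl g g-below
        lo : n + Y (S j + g) < Y (S (suc j) + suc g)
        lo = ≡.subst₂ _<_ Yv (≡.cong Y (≡.sym (ℕₚ.+-suc (S (suc j)) g))) (YK.Y-suc _)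
        n≤ = ℕₚ.≤-trans (ℕₚ.m≤m+n n _) (ℕₚ.<⇒≤ lo)
        b< : Y (S (suc j) + suc g) < x (suc j) e → Y (S (suc j) + suc g) ∸ n < x j e
        b< lt = split-< n≤ (≡.subst (Y (S (suc j) + suc g) <_) (x-suc j e) lt)
        v<y : S (suc j) + suc g ≤ y
        v<y = ≡.subst (_≤ y) (≡.sym (ℕₚ.+-suc (S (suc j)) g)) (Y-cancel (≡.subst₂ _<_ (≡.sym Yv) (≡.trans (≡.sym (x-suc j e)) (≡.sym Yy))
          (ℕₚ.+-monoʳ-< n g-below)))

      -- Covers number the levels from the lowest, the search from the highest.
      u : ℕ → ℕ
      u i = r₀ + S (j ∸ i)

      z = u 0

      suc-j∸ : ∀ {i} → i < j → suc (j ∸ suc i) ≡ j ∸ i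
      suc-j∸ {i} lt = ≡.sym (ℕₚ.+-∸-assoc 1 lt)

      down-level : ∀ i → i ≤ j → ∀ j′ → j′ ≤ g → down (r₀ + S i + j′) ≡ r₀ + S (suc i) + j′
      down-level i i≤j j′ le = ≡.trans (≡.cong down (ℕₚ.+-assoc r₀ (S i) j′)) (≡.trans (down-next (S i + j′))
        (≡.trans (≡.cong (r₀ +_) (follow i i≤j j′ (inside i i≤j j′ le))) (≡.sym (ℕₚ.+-assoc r₀ (S (suc i)) j′))))

      up-exists : ∀ j′ → j′ < g → ∃ λ y → down y ≡ suc (u j + j′)
      up-exists j′ lt with up? (r₀ + (S 0 + suc j′))
      ... | yes (y , d) = y , ≡.trans d (≡.trans (≡.cong (r₀ +_) (ℕₚ.+-suc (S 0) j′)) (≡.trans (ℕₚ.+-suc r₀ _)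
              (≡.cong suc (≡.trans (≡.sym (ℕₚ.+-assoc r₀ (S 0) j′)) (≡.cong (λ a → r₀ + S a + j′) (≡.sym (ℕₚ.n∸n≡0 j)))))))
      ... | no nu = ⊥-elim (above-o (Y (S 0 + suc j′))
              (≡.subst (_< Y (S 0 + suc j′)) (Y-S 0) (Y-mono (ℕₚ.m<m+n (S 0) (s≤s z≤n))))
              (inside 0 z≤n (suc j′) lt) (S 0 + suc j′ , refl , λ y d → nu (y , d)))

      w-row : ∀ g₁ → g₁ ≡ g → ℕ
      w-row zero     _ = 0
      w-row (suc g₁) e = proj₁ (up-exists 0 (≡.subst (0 <_) e (s≤s z≤n)))

      opens-w : ∀ g₁ (e : g₁ ≡ g) j′ → j′ < g → down (w-row g₁ e + j′) ≡ suc (u j + j′)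
      opens-w zero     eq j′ lt = ⊥-elim (ℕₚ.n≮0 (≡.subst (j′ <_) (≡.sym eq) lt))
      opens-w (suc g₁) eq zero lt = ≡.trans (≡.cong down (ℕₚ.+-identityʳ _))
        (proj₂ (up-exists 0 (≡.subst (0 <_) eq (s≤s z≤n))))
      opens-w (suc g₁) eq (suc j′) lt with up-exists (suc j′) lt
      ... | y , d = ≡.trans (≡.cong down (≡.trans (ℕₚ.+-suc _ j′)
              (≡.sym (next-row (opens-w (suc g₁) eq j′ (ℕₚ.<-trans (ℕₚ.n<1+n j′) lt)) (≡.trans d (≡.cong suc (ℕₚ.+-suc (u j) j′))))))) d

      flat-z : ∀ j′ → j′ ≤ g → parts (z + j′) ≡ parts z
      flat-z zero     _  = ≡.cong parts (ℕₚ.+-identityʳ z)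
      flat-z (suc j′) lt = ≡.trans (≡.cong parts (ℕₚ.+-suc z j′)) (≡.trans (flat-down (z + j′) (begin
        down (suc (z + j′)) ≡⟨ ≡.cong down (ℕₚ.+-suc z j′) ⟨
        down (z + suc j′) ≡⟨ down-level j ℕₚ.≤-refl (suc j′) lt ⟩
        r₀ + S (suc j) + suc j′ ≡⟨ ℕₚ.+-suc _ j′ ⟩
        suc (r₀ + S (suc j) + j′) ≡⟨ ≡.cong suc (down-level j ℕₚ.≤-refl j′ (ℕₚ.<⇒≤ lt)) ⟨
        suc (down (z + j′)) ∎)) (flat-z j′ (ℕₚ.<⇒≤ lt)))
        where open ≡.≡-Reasoning

      -- Because `e < n`, the beads of the block lie within one period of the bead of `z`.
      short-z : z + g < down z
      short-z = ≡.subst₂ _<_ (≡.sym (ℕₚ.+-assoc r₀ (S j) g)) (≡.sym (down-next (S j))) (ℕₚ.+-monoʳ-< r₀ (Y-cancel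
        (ℕₚ.<-≤-trans g-below (≡.subst (x j e ≤_) (≡.sym (Y-S (suc j))) (≡.subst (x j e ≤_) (≡.sym (x-suc j o))
          (≡.subst (_≤ n + x j o) (ℕₚ.+-comm e (j * n)) (ℕₚ.+-mono-≤ (ℕₚ.<⇒≤ e<n) (ℕₚ.m≤m+n (j * n) o))))))))

      -- With equal parts, the row after the block would bounce to the bead at `e` on level `suc j`.
      -- Its own bead would then be at `e` on level `j`, which is empty.
      drop-z : parts (suc (z + g)) < parts z
      drop-z = ≡.subst (parts (suc (z + g)) <_) (flat-z g ℕₚ.≤-refl) (ℕₚ.≤∧≢⇒< (anti (z + g)) λ fl →
        ℕₚ.<⇒≢ strict (≡.trans (≡.sym gap-row) (≡.trans (≡.cong Y (same-row fl)) (Y-next _))))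
        where
        strict : x (suc j) e < n + Y (S j + suc g)
        strict = ≡.subst (_< n + Y (S j + suc g)) (≡.sym (x-suc j e)) (ℕₚ.+-monoʳ-< n (ℕₚ.≤∧≢⇒< g-above λ eq →
          contra (≡.trans (≡.sym (proj₁ gap)) (bead⁺ _ (≡.sym eq)))))
          where contra : ¬ (false ≡ true)
                contra ()
        same-row : parts (suc (z + g)) ≡ parts (z + g) → S (suc j) + suc g ≡ next (S j + suc g)
        same-row fl = ℕₚ.+-cancelˡ-≡ r₀ _ _ (begin
          r₀ + (S (suc j) + suc g) ≡⟨ ≡.trans (≡.sym (ℕₚ.+-assoc r₀ _ (suc g))) (ℕₚ.+-suc _ g) ⟩
          suc (r₀ + S (suc j) + g) ≡⟨ ≡.cong suc (down-level j ℕₚ.≤-refl g ℕₚ.≤-refl) ⟨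
          suc (down (z + g)) ≡⟨ down-flat (z + g) fl ⟨
          down (suc (z + g)) ≡⟨ ≡.cong down (≡.trans (≡.sym (ℕₚ.+-suc z g)) (ℕₚ.+-assoc r₀ (S j) (suc g))) ⟩
          down (r₀ + (S j + suc g)) ≡⟨ down-next _ ⟩
          r₀ + next (S j + suc g) ∎)
          where open ≡.≡-Reasoning

      isCover : IsCover z j u (w-row g refl) g
      isCover = record
        { good = record
          { ch = record
            { base  = refl
            ; links = λ i lt → ≡.trans (down-next _) (≡.cong (λ a → r₀ + S a) (suc-j∸ lt))
            ; top   = λ r d → proj₂ (proj₂ o-top) r (≡.trans d (≡.cong (λ a → r₀ + S a) (ℕₚ.n∸n≡0 j))) }
          ; path  = λ i lt j′ le → ≡.trans (down-level (j ∸ suc i) (ℕₚ.m∸n≤m j (suc i)) j′ le) (≡.cong (λ a → r₀ + S a + j′) (suc-j∸ lt))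
          ; opens = opens-w g refl
          ; flat  = flat-z
          ; short = short-z }
        ; drop = drop-z }

    private module _ {T₁ : ℕ → ℕ} (T₁C : Core (CoverShape.Covered.covered p isCover) T₁) where
      private
        module CC = CoverCore p isCover KC T₁C

        row-eq : ∀ i j′ → r₀ + S i + j′ ≡ r₀ + (S i + j′)
        row-eq i j′ = ℕₚ.+-assoc r₀ (S i) j′

        T-row : ∀ s v → v ≤ YT.Y s → T (r₀ + s) + v ≤ A + s
        T-row s v le = ≡.subst (T (r₀ + s) + v ≤_) (≡.trans (ℕₚ.+-comm (T (r₀ + s)) _) (YT.Y-eq s)) (ℕₚ.+-monoʳ-≤ (T (r₀ + s)) le)

        pos-window : ∀ i → i ≤ j → ∀ y → x i o ≤ y → y < x i e → count YT.bead y < count bead y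
        pos-window i i≤j y ge lt = ≡.subst (λ y → count YT.bead y < count bead y) x≡y
          (pos i i≤j (y ∸ i * n) (ℕₚ.+-cancelˡ-< (i * n) _ _ (≡.subst (_< x i e) (≡.sym x≡y) lt)))
          where
          x≡y : x i (y ∸ i * n) ≡ y
          x≡y = ℕₚ.m+[n∸m]≡n (window {i} ge)

        inner-≤ : ∀ i → i ≤ j → ∀ j′ → j′ < g → suc (T (r₀ + (S i + j′))) ≤ K (suc (r₀ + (S i + j′)))
        inner-≤ i i≤j j′ lt = ≡.subst (λ a → suc (T (r₀ + s)) ≤ K a) (ℕₚ.+-suc r₀ s) (ℕₚ.+-cancelʳ-≤ (Y (suc s)) _ _ (begin
          suc (T (r₀ + s)) + Y (suc s) ≤⟨ s≤s (T-row s (Y (suc s)) below) ⟩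
          suc (A + s) ≡⟨ ℕₚ.+-suc A s ⟨
          A + suc s ≡⟨ ≡.trans (ℕₚ.+-comm (K (r₀ + suc s)) _) (Y-eq (suc s)) ⟨
          K (r₀ + suc s) + Y (suc s) ∎))
          where
          open ℕₚ.≤-Reasoning
          s = S i + j′
          y = pred (Y (suc s))
          suc-y : suc y ≡ Y (suc s)
          suc-y = ℕₚ.suc-pred (Y (suc s)) {{ℕ.>-nonZero (ℕₚ.≤-<-trans z≤n (YK.Y-suc s))}}
          below : Y (suc s) ≤ YT.Y s
          below = ≡.subst (_≤ YT.Y s) suc-y (pos-row (pos-window i i≤j y
            (ℕₚ.≤-trans (Y-S+ i j′) (s≤s⁻¹ (≡.subst (Y s <_) (≡.sym suc-y) (YK.Y-suc s))))
            (ℕₚ.<-trans (≡.subst (y <_) suc-y (ℕₚ.n<1+n y)) (≡.subst (λ a → Y a < x i e) (ℕₚ.+-suc (S i) j′) (inside i i≤j (suc j′) lt))))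
            s (≡.subst (y <_) suc-y (ℕₚ.n<1+n y)))

        bottom-≤ : ∀ i → i ≤ j → T (r₀ + (S i + g)) + x i e ≤ A + (S i + g)
        bottom-≤ i i≤j = T-row s (x i e) (≡.subst (_≤ YT.Y s) suc-y (pos-row
            (pos-window i i≤j y (s≤s⁻¹ (≡.subst (x i o <_) (≡.sym suc-y) (x-o<e i))) (≡.subst (y <_) suc-y (ℕₚ.n<1+n y)))
            s (ℕₚ.<-≤-trans (≡.subst (y <_) suc-y (ℕₚ.n<1+n y)) (≡.subst (λ a → x i e ≤ Y a) (ℕₚ.+-suc (S i) g) (outside-level i i≤j)))))
          where
          s = S i + g
          y = pred (x i e)
          suc-y : suc y ≡ x i e
          suc-y = ℕₚ.suc-pred (x i e) {{ℕ.>-nonZero (ℕₚ.≤-<-trans z≤n (x-o<e i))}}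

        next-eq : ∀ i → i ≤ j → S (suc i) + g + parts (r₀ + (S i + g)) ≡ S i + g + n
        next-eq i i≤j = ≡.trans (≡.cong (_+ parts (r₀ + (S i + g))) (≡.sym (follow i i≤j g (inside i i≤j g ℕₚ.≤-refl)))) (next-parts (S i + g))

        -- The bottom row of each level holds the moved bead, now at `e`. On the lowest level this
        -- is one period before the bead of `gap-row`; higher levels follow by the recursion.
        bottom-value : ∀ i′ → i′ ≤ j → T₁ (u i′ + g) + x (j ∸ i′) e ≡ A + (S (j ∸ i′) + g)
        bottom-value zero _ = ℕₚ.suc-injective (ℕₚ.+-cancelʳ-≡ n _ _ (begin
          suc (T₁ (z + g)) + x j e + n ≡⟨ e₁ (suc (T₁ (z + g))) (x j e) n ⟩
          suc (T₁ (z + g)) + (n + x j e) ≡⟨ ≡.cong₂ _+_ CC.bottom-z (≡.sym (x-suc j e)) ⟩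
          parts (z + g) + K (suc (down (z + g))) + x (suc j) e
            ≡⟨ ≡.cong₂ (λ a b → parts a + K b + x (suc j) e) (row-eq j g) row ⟩
          P + K (r₀ + (S (suc j) + suc g)) + x (suc j) e
            ≡⟨ ≡.trans (ℕₚ.+-assoc P _ _) (≡.cong (P +_) (≡.trans (≡.cong (K (r₀ + (S (suc j) + suc g)) +_) (≡.sym gap-row))
                 (≡.trans (ℕₚ.+-comm (K (r₀ + (S (suc j) + suc g))) _) (Y-eq (S (suc j) + suc g))))) ⟩
          P + (A + (S (suc j) + suc g)) ≡⟨ e₂ P A (S (suc j)) g ⟩
          suc (A + (S (suc j) + g + P)) ≡⟨ ≡.cong (λ a → suc (A + a)) (next-eq j ℕₚ.≤-refl) ⟩
          suc (A + (S j + g + n)) ≡⟨ ≡.cong suc (ℕₚ.+-assoc A _ n) ⟨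
          suc (A + (S j + g)) + n ∎))
          where
          open ≡.≡-Reasoning
          P = parts (r₀ + (S j + g))
          e₁ : ∀ a b c → a + b + c ≡ a + (c + b)
          e₁ = solve-∀
          e₂ : ∀ p a s g → p + (a + (s + suc g)) ≡ suc (a + (s + g + p))
          e₂ = solve-∀
          row : suc (down (z + g)) ≡ r₀ + (S (suc j) + suc g)
          row = ≡.trans (≡.cong suc (down-level j ℕₚ.≤-refl g ℕₚ.≤-refl))
            (≡.trans (≡.cong suc (row-eq (suc j) g)) (≡.trans (≡.sym (ℕₚ.+-suc r₀ _)) (≡.cong (r₀ +_) (≡.sym (ℕₚ.+-suc _ g)))))
        bottom-value (suc i′) lt = ℕₚ.+-cancelʳ-≡ n _ _ (begin
          T₁ (u (suc i′) + g) + x i e + n ≡⟨ e₁ (T₁ (u (suc i′) + g)) (x i e) n ⟩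
          T₁ (u (suc i′) + g) + (n + x i e) ≡⟨ ≡.cong₂ _+_ (CC.bottom-suc lt) (≡.sym (x-suc i e)) ⟩
          parts (u (suc i′) + g) + T₁ (u i′ + g) + x (suc i) e
            ≡⟨ ≡.trans (ℕₚ.+-assoc (parts (u (suc i′) + g)) _ _) (≡.cong₂ (λ a b → parts a + b) (row-eq i g) (begin
                 T₁ (u i′ + g) + x (suc i) e ≡⟨ ≡.cong (λ a → T₁ (u i′ + g) + x a e) (suc-j∸ lt) ⟩
                 T₁ (u i′ + g) + x (j ∸ i′) e ≡⟨ bottom-value i′ (ℕₚ.<⇒≤ lt) ⟩
                 A + (S (j ∸ i′) + g) ≡⟨ ≡.cong (λ a → A + (S a + g)) (suc-j∸ lt) ⟨
                 A + (S (suc i) + g) ∎)) ⟩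
          P + (A + (S (suc i) + g)) ≡⟨ e₂ P A (S (suc i) + g) ⟩
          A + (S (suc i) + g + P) ≡⟨ ≡.cong (A +_) (next-eq i (ℕₚ.m∸n≤m j (suc i′))) ⟩
          A + (S i + g + n) ≡⟨ ℕₚ.+-assoc A _ n ⟨
          A + (S i + g) + n ∎)
          where
          open ≡.≡-Reasoning
          i = j ∸ suc i′
          P = parts (r₀ + (S i + g))
          e₁ : ∀ a b c → a + b + c ≡ a + (c + b)
          e₁ = solve-∀
          e₂ : ∀ p a s → p + (a + s) ≡ a + (s + p)
          e₂ = solve-∀

      -- Moving the beads from `o` to `e` takes one bead from the counts of the larger core just on
      -- the windows between, where by `pos` it was strictly ahead.
      contained : ∀ r → T r ≤ T₁ r
      contained r with CC.inLevel? r
      ... | no ¬L = ≡.subst (T r ≤_) (≡.sym (CC.same-outside ¬L)) (T≤K r)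
      ... | yes (i′ , a , j′ , b , refl) with ℕₚ.m≤n⇒m<n∨m≡n b
      ...   | inj₁ lt = s≤s⁻¹ (≡.subst (suc (T (u i′ + j′)) ≤_) (≡.sym (CC.inner-row a lt))
                (≡.subst (λ v → suc (T v) ≤ K (suc v)) (≡.sym (row-eq (j ∸ i′) j′)) (inner-≤ (j ∸ i′) (ℕₚ.m∸n≤m j i′) j′ lt)))
      ...   | inj₂ refl = ℕₚ.+-cancelʳ-≤ (x (j ∸ i′) e) _ _ (ℕₚ.≤-trans
                (≡.subst (λ v → T v + x (j ∸ i′) e ≤ A + (S (j ∸ i′) + g)) (≡.sym (row-eq (j ∸ i′) g)) (bottom-≤ (j ∸ i′) (ℕₚ.m∸n≤m j i′)))
                (ℕₚ.≤-reflexive (≡.sym (bottom-value i′ a))))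

    abstract
      cover-above : ∃₂ λ z C → ∃₂ λ u w → ∃₂ λ g (c : IsCover z C u w g) →
        ∀ {T₁ : ℕ → ℕ} → Core (CoverShape.Covered.covered p c) T₁ → ∀ r → T r ≤ T₁ r
      cover-above = z , j , u , w-row g refl , g , isCover , contained

-- Strong covers classified and listed by their mark.

module StrongCovers where
  open import Data.Nat as ℕ using (ℕ; zero; suc; z≤n; s≤s; s≤s⁻¹; _<?_; _≟_; pred; _+_; _∸_; _*_; _≤_; _<_; _≤ᵇ_; _≡ᵇ_)
  open import Data.List.Relation.Unary.Any using (here; there)
  open import Data.List.Relation.Unary.AllPairs using (AllPairs; []; _∷_)
  open BounceGraphs
  open CoverWeights
  open Cores
  open CoverCores
  open CoverRibbons
  open BeadSequences
  open CoverExistence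

  open CoreFacts using (Represents; coreList; coreList-represents; Represents-unique; represents-isCore; represents-pmap)
  open Represents using (partition; core)

  module _ {k ℓ : ℕ} where

    covered : ∀ (p : ParFun k ℓ) {z} → Bounce.Cover p z → ParFun k ℓ
    covered p (_ , _ , _ , _ , c) = CoverShape.Covered.covered p c

    size : ParFun k ℓ → ℕ
    size p = sumTo ℓ (ParFun.parts p)

    represents-length : ∀ {p : ParFun k ℓ} {κ} → Represents p κ → length κ ≤ ℓ
    represents-length {p} {κ} rep = ℕₚ.≮⇒≥ λ lt →
      ℕₚ.<⇒≢ (Partition.positive (partition rep) ℓ lt) (≡.sym (Core.empty (core rep) ℓ ℕₚ.≤-refl))

    represents-size : ∀ {p : ParFun k ℓ} {κ} → Represents p κ → sizeP k κ ≡ size p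
    represents-size {p} {κ} rep = ≡.trans
      (sum-parts (pmap k κ) ℓ (≡.subst (_≤ ℓ) (≡.sym (length-map-upTo _ (length κ))) (represents-length rep)))
      (sumTo-cong ℓ (λ r _ → represents-pmap p rep r))

    represents-parts : ∀ {p q : ParFun k ℓ} {κ} → Represents p κ → Represents q κ → ∀ r → ParFun.parts p r ≡ ParFun.parts q r
    represents-parts {p} {q} rp rq r = ≡.trans (≡.sym (represents-pmap p rp r)) (represents-pmap q rq r)

    module _ {p q : ParFun k ℓ} {κ τ} (κ-rep : Represents p κ) (τ-rep : Represents q τ) (τ⊆κ : ∀ r → part τ r ≤ part κ r) where

      abstract
        cover-between : τ ≢ κ → ∃₂ λ z (c : Bounce.Cover p z) → ∀ r → part τ r ≤ part (coreList (covered p c)) r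
        cover-between ne with first-below (λ r → ¬? (part τ r ≟ part κ r)) ℓ
        ... | inj₂ none = ⊥-elim (ne (part-injective (Partition.positive (partition τ-rep)) (Partition.positive (partition κ-rep)) same))
          where
          same : ∀ r → part τ r ≡ part κ r
          same r with ℕₚ.<-≤-connex r ℓ | part τ r ≟ part κ r
          ... | _ | yes e = e
          ... | inj₁ lt | no ne = ⊥-elim (none r lt ne)
          ... | inj₂ ge | no _  = ≡.trans (Core.empty (core τ-rep) r ge) (≡.sym (Core.empty (core κ-rep) r ge))
        ... | inj₁ (r₀ , _ , diff , min) = below cover-above
          where
          same : ∀ r → r < r₀ → part τ r ≡ part κ r
          same r lt with part τ r ≟ part κ r
          ... | yes e = e
          ... | no ne = ⊥-elim (min r lt ne)
          open Classify p q (core κ-rep) (core τ-rep) τ⊆κ r₀ same (ℕₚ.≤∧≢⇒< (τ⊆κ r₀) diff)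
          below : (∃₂ λ z C → ∃₂ λ u w → ∃₂ λ g (c : Bounce.IsCover p z C u w g) →
              ∀ {T₁ : ℕ → ℕ} → Core (CoverShape.Covered.covered p c) T₁ → ∀ r → part τ r ≤ T₁ r) →
            ∃₂ λ z (c : Bounce.Cover p z) → ∀ r → part τ r ≤ part (coreList (covered p c)) r
          below (z , C , u , w , g , c , le) = z , (C , u , w , g , c) , le (core (coreList-represents (CoverShape.Covered.covered p c)))

    covered-size : ∀ (p : ParFun k ℓ) {z} (c : Bounce.Cover p z) → suc (size (covered p c)) ≡ size p
    covered-size p (_ , _ , _ , _ , c) =
      CoverCore.covered-size p c (core (coreList-represents p)) (core (coreList-represents (CoverShape.Covered.covered p c)))

    -- A cover of `p` that still contains τ has size one less. Either it is τ, or the induction, on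
    -- a bound for the size, applies to it.
    size-strict : ∀ N {p q : ParFun k ℓ} {κ τ} → size p ≤ N → Represents p κ → Represents q τ → (∀ r → part τ r ≤ part κ r) →
      τ ≢ κ → size q < size p
    size-strict N {p} {q} {κ} {τ} le κ-rep τ-rep τ⊆κ ne with cover-between κ-rep τ-rep τ⊆κ ne
    ... | z , c , τ⊆κ₁ with Listₚ-≟ τ (coreList (covered p c))
      where
      open import Data.List.Properties using (≡-dec)
      Listₚ-≟ = ≡-dec _≟_
    ... | yes refl = ≡.subst₂ _<_ (sumTo-cong ℓ (λ r _ → represents-parts (coreList-represents (covered p c)) τ-rep r))
          (covered-size p c) (ℕₚ.n<1+n _)
    size-strict zero {p} le κ-rep τ-rep τ⊆κ ne | z , c , τ⊆κ₁ | no _ =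
      ⊥-elim (ℕₚ.n≮0 (≡.subst (_≤ 0) (≡.sym (covered-size p c)) le))
    size-strict (suc N) {p} le κ-rep τ-rep τ⊆κ ne | z , c , τ⊆κ₁ | no ne′ =
      ℕₚ.<-trans (size-strict N (s≤s⁻¹ (≡.subst (_≤ suc N) (≡.sym (covered-size p c)) le)) (coreList-represents (covered p c)) τ-rep τ⊆κ₁ ne′)
        (ℕₚ.≤-reflexive (covered-size p c))

    -- The mark r (1-based) sits on one of the ribbons removed by the cover.
    MarkOf : ∀ (p : ParFun k ℓ) {z} → Bounce.Cover p z → ℕ → Set
    MarkOf p (C , u , _) r = ∃ λ i → i ≤ C × suc (u i) ≡ r

    contained⁻ : ∀ {τ κ} → containedᵇ τ κ ≡ true → ∀ r → part τ r ≤ part κ r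
    contained⁻ {τ} {κ} e r with ℕₚ.<-≤-connex r (length τ)
    ... | inj₁ lt = ≤ᵇ⇒≤ (allᵇ⁻ {p = λ r → part τ r ≤ᵇ part κ r} {xs = upTo (length τ)} (proj₂ (∧-elim {length τ ≤ᵇ length κ} e)) (∈-upTo⁺ lt))
    ... | inj₂ ge = ≡.subst (_≤ part κ r) (≡.sym (part-outside τ r ge)) z≤n

    contained⁺ : ∀ {τ κ} → Partition τ → (∀ r → part τ r ≤ part κ r) → containedᵇ τ κ ≡ true
    contained⁺ {τ} {κ} P le = ∧-intro (≤⇒≤ᵇ len) (allᵇ⁺ (upTo (length τ)) λ {r} _ → ≤⇒≤ᵇ (le r))
      where
      len : length τ ≤ length κ
      len = ℕₚ.≮⇒≥ λ lt → ℕₚ.<⇒≢ (ℕₚ.<-≤-trans (Partition.positive P (length κ) lt) (le (length κ))) (≡.sym (part-outside κ _ ℕₚ.≤-refl))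

    strong⁺ : ∀ {p : ParFun k ℓ} {κ τ z} (c : Bounce.Cover p z) → Represents p κ → Represents (covered p c) τ → ∀ {r} → MarkOf p c r →
      strongMarkedCoverᵇ k τ r κ ≡ true
    strong⁺ {p} {κ} {τ} c@(_ , _ , _ , _ , ic) κ-rep τ-rep {r} mk = ∧-intro (represents-isCore (covered p c) τ-rep)
      (∧-intro (represents-isCore p κ-rep)
      (∧-intro (contained⁺ {τ} {κ} (partition τ-rep) (CoverCore.T≤K p ic (core κ-rep) (core τ-rep)))
      (∧-intro (≡⇒≡ᵇ (≡.trans (≡.cong suc (represents-size τ-rep)) (≡.trans (covered-size p c) (≡.sym (represents-size κ-rep)))))
        (proj₂ (CoverComponents.mark-spec p ic κ-rep τ-rep r) mk))))

    abstract
      fromList : ∀ {κ} → isCoreᵇ k κ ≡ true → length κ ≤ ℓ → ∃ λ (q : ParFun k ℓ) → Represents q κ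
      fromList {κ} c len = FromList.parFun {κ = κ} c len , FromList.represents {κ = κ} c len

      -- The intermediate cover contains τ and has the same size, so by `size-strict` it is τ.
      size-cover : ∀ {p q : ParFun k ℓ} {κ τ} → Represents p κ → Represents q τ → (∀ r → part τ r ≤ part κ r) → suc (size q) ≡ size p →
        ∃₂ λ z (c : Bounce.Cover p z) → Represents (covered p c) τ
      size-cover {p} {q} {κ} {τ} κ-rep τ-rep τ⊆κ sizes = conclude (cover-between κ-rep τ-rep τ⊆κ τ≢κ)
        where
        τ≢κ : τ ≢ κ
        τ≢κ refl = ℕₚ.<⇒≢ (ℕₚ.≤-reflexive sizes) (sumTo-cong ℓ (λ r _ → represents-parts τ-rep κ-rep r))
        conclude : (∃₂ λ z (c : Bounce.Cover p z) → ∀ r → part τ r ≤ part (coreList (covered p c)) r) →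
          ∃₂ λ z (c : Bounce.Cover p z) → Represents (covered p c) τ
        conclude (z , c , τ⊆) with ≡-dec _≟_ τ (coreList (covered p c))
          where open import Data.List.Properties using (≡-dec)
        ... | yes eq = z , c , ≡.subst (Represents (covered p c)) (≡.sym eq) (coreList-represents (covered p c))
        ... | no ne = ⊥-elim (ℕₚ.<⇒≢ (size-strict _ ℕₚ.≤-refl (coreList-represents (covered p c)) τ-rep τ⊆ ne)
                (ℕₚ.suc-injective (≡.trans sizes (≡.sym (covered-size p c)))))

      private
        strong-parts : ∀ τ r κ → strongMarkedCoverᵇ k τ r κ ≡ true →
          isCoreᵇ k τ ≡ true × (∀ r → part τ r ≤ part κ r) × length τ ≤ length κ × suc (sizeP k τ) ≡ sizeP k κ ×
          anyᵇ (λ C → suc (minRow C) ≡ᵇ r) (components (skew κ τ)) ≡ true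
        strong-parts τ r κ e with ∧-elim {isCoreᵇ k τ} e
        ... | c , e₁ with ∧-elim {isCoreᵇ k κ} e₁
        ... | _ , e₂ with ∧-elim {containedᵇ τ κ} e₂
        ... | cont , e₃ with ∧-elim {suc (sizeP k τ) ≡ᵇ sizeP k κ} e₃
        ... | sz , mk = c , contained⁻ {τ} {κ} cont , ≤ᵇ⇒≤ {length τ} {length κ} (proj₁ (∧-elim {length τ ≤ᵇ length κ} cont)) ,
              ≡ᵇ⇒≡ {suc (sizeP k τ)} {sizeP k κ} sz , mk

      strong⁻ : ∀ {p : ParFun k ℓ} {κ τ r} → Represents p κ → strongMarkedCoverᵇ k τ r κ ≡ true →
        ∃₂ λ z (c : Bounce.Cover p z) → Represents (covered p c) τ × MarkOf p c r
      strong⁻ {p} {κ} {τ} {r} κ-rep e with strong-parts τ r κ e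
      ... | c , τ⊆κ , len , sz , mk with fromList {τ} c (ℕₚ.≤-trans len (represents-length κ-rep))
      ... | q , τ-rep with size-cover κ-rep τ-rep τ⊆κ (≡.trans (≡.cong suc (≡.sym (represents-size τ-rep))) (≡.trans sz (represents-size κ-rep)))
      ... | z , c@(C , u , w , g , ic) , τ-rep′ = z , c , τ-rep′ , proj₁ (CoverComponents.mark-spec p ic κ-rep τ-rep′ r) mk

    strong-spin : ∀ {p : ParFun k ℓ} {κ τ z} (c : Bounce.Cover p z) → Represents p κ → Represents (covered p c) τ →
      ∀ {i} → i ≤ proj₁ c → spin τ (suc (proj₁ (proj₂ c) i)) κ ≡ suc (proj₁ c) * proj₁ (proj₂ (proj₂ (proj₂ c))) + i
    strong-spin {p} (_ , _ , _ , _ , ic) κ-rep τ-rep = CoverComponents.spin-spec p ic κ-rep τ-rep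

    module CoverList (p : ParFun k ℓ) where
      open Bounce p

      IsCover-height : ∀ {z C u w g C′ u′ w′ g′} → IsCover z C u w g → IsCover z C′ u′ w′ g′ → g ≡ g′
      IsCover-height {z} c c′ = ℕₚ.≤-antisym (go c c′) (go c′ c)
        where
        go : ∀ {C u w g C′ u′ w′ g′} → IsCover z C u w g → IsCover z C′ u′ w′ g′ → g ≤ g′
        go {g = g} {g′ = g′} c c′ = ℕₚ.≮⇒≥ λ lt → ℕₚ.<⇒≢ (IsCover.drop c′)
          (≡.trans (≡.cong parts (≡.sym (ℕₚ.+-suc z g′))) (IsCover.flat c (suc g′) lt))

      -- The row `z` fixes the chain, the run of equal parts fixes the height, and injectivity of
      -- `down` fixes the rows that gain a box.
      covered-unique : ∀ {z} (c c′ : Cover z) → ∀ r → ParFun.parts (covered p c) r ≡ ParFun.parts (covered p c′) r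
      covered-unique {z} (C , u , w , g , c) (C′ , u′ , w′ , g′ , c′) r with IsCover-height c c′
      ... | refl = go (view z w g r)
        where
        module M = CoverShape.Covered p c
        module M′ = CoverShape.Covered p c′
        top≡ : u C ≡ u′ C′
        top≡ = ≡.trans (proj₂ (chain-unique (IsCover.ch c) (IsCover.ch c′) C ℕₚ.≤-refl)) (≡.cong u′ (chain-length (IsCover.ch c) (IsCover.ch c′)))
        w≡ : ∀ {j} → j < g → w + j ≡ w′ + j
        w≡ {j} lt = down-injective (≡.trans (IsCover.opens c j lt) (≡.trans (≡.cong (λ x → suc (x + j)) top≡) (≡.sym (IsCover.opens c′ j lt))))
        go : View z w g r → M.μ r ≡ M′.μ r
        go (inZ j le refl) = ≡.trans (M.μ-z j le) (≡.sym (M′.μ-z j le))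
        go (inW j lt refl) = ≡.trans (M.μ-w j lt) (≡.trans (≡.cong (λ x → suc (parts x)) (w≡ lt))
          (≡.trans (≡.sym (M′.μ-w j lt)) (≡.cong M′.μ (≡.sym (w≡ lt)))))
        go (out nz nw) = ≡.trans (M.μ-out nz nw) (≡.sym (M′.μ-out nz (λ j lt e → nw j lt (≡.trans e (≡.sym (w≡ lt))))))

      represents-resp : ∀ {q q′ : ParFun k ℓ} {κ} → (∀ r → ParFun.parts q r ≡ ParFun.parts q′ r) → Represents q κ → Represents q′ κ
      represents-resp {q} {q′} {κ} e rep = record { partition = partition rep ; core = record
        { recur = λ r → ≡.trans (Core.recur (core rep) r) (≡.cong (λ x → x + part κ (r + (suc k ∸ x))) (e r))
        ; empty = Core.empty (core rep) } }

      covered-row : ∀ {z} (c : Cover z) → ParFun.parts (covered p c) z < parts z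
      covered-row {z} (_ , _ , _ , _ , c) = ≡.subst (_< parts z)
        (≡.sym (≡.trans (≡.cong M.μ (≡.sym (ℕₚ.+-identityʳ z))) (≡.trans (M.μ-z 0 z≤n) (≡.cong (pred ∘ parts) (ℕₚ.+-identityʳ z)))))
        (ℕₚ.≤-reflexive (ℕₚ.suc-pred (parts z) {{ℕ.>-nonZero (IsCover-positive c)}}))
        where module M = CoverShape.Covered p c

      covered-above : ∀ {z r} (c : Cover z) → r < z → parts r ≤ ParFun.parts (covered p c) r
      covered-above {z} {r} (_ , _ , w , g , c) lt = go (view z w g r)
        where
        module M = CoverShape.Covered p c
        go : View z w g r → parts r ≤ M.μ r
        go (inZ j le refl)  = ⊥-elim (ℕₚ.<⇒≱ lt (ℕₚ.m≤m+n z j))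
        go (inW j lt′ refl) = ≡.subst (parts r ≤_) (≡.sym (M.μ-w j lt′)) (ℕₚ.n≤1+n _)
        go (out nz nw)      = ℕₚ.≤-reflexive (≡.sym (M.μ-out nz nw))

      -- Starting at the marked row, this visits every row that can be the `z` of a cover with that
      -- mark; the first argument is fuel.
      walk : ℕ → ℕ → List (ParFun k ℓ)
      walk zero    z = []
      walk (suc f) z with z <? ℓ
      ... | no _ = []
      ... | yes lt with cover? z lt
      ...   | yes c = covered p c ∷ walk f (down z)
      ...   | no _  = walk f (down z)

      ∈-walk⁻ : ∀ f z {q} → q ∈ walk f z → ∃₂ λ z′ (c : Cover z′) → z ≤ z′ × q ≡ covered p c
      ∈-walk⁻ (suc f) z m with z <? ℓ
      ... | yes lt with cover? z lt
      ∈-walk⁻ (suc f) z (here refl) | yes lt | yes c = z , c , ℕₚ.≤-refl , refl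
      ∈-walk⁻ (suc f) z (there m)   | yes lt | yes c =
        let z′ , c′ , le , e = ∈-walk⁻ f (down z) m in z′ , c′ , ℕₚ.≤-trans (ℕₚ.<⇒≤ (down> z)) le , e
      ∈-walk⁻ (suc f) z m | yes lt | no _ =
        let z′ , c′ , le , e = ∈-walk⁻ f (down z) m in z′ , c′ , ℕₚ.≤-trans (ℕₚ.<⇒≤ (down> z)) le , e

      Distinct : ParFun k ℓ → ParFun k ℓ → Set
      Distinct q q′ = ∃ λ r → ParFun.parts q r ≢ ParFun.parts q′ r

      -- A cover at `z` shortens row `z`; a cover at a later row of the walk never does.
      walk-distinct : ∀ f z → AllPairs Distinct (walk f z)
      walk-distinct zero    z = []
      walk-distinct (suc f) z with z <? ℓ
      ... | no _ = []
      ... | yes lt with cover? z lt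
      ...   | no _  = walk-distinct f (down z)
      ...   | yes c = All.tabulate (λ m → differ (∈-walk⁻ f (down z) m)) ∷ walk-distinct f (down z)
        where
        differ : ∀ {q} → (∃₂ λ z′ (c′ : Cover z′) → down z ≤ z′ × q ≡ covered p c′) → Distinct (covered p c) q
        differ (z′ , c′ , le , refl) = z , λ e → ℕₚ.<⇒≱ (covered-row c)
          (≡.subst (parts z ≤_) (≡.sym e) (covered-above c′ (ℕₚ.<-≤-trans (down> z) le)))

      -- Here `i` counts the bounces from `m` to `z`, which is the number of ribbons below the mark.
      Through : ℕ → ℕ → ℕ → Set
      Through m i z = ∀ {C u} → Chain z C u → i ≤ C × u i ≡ m

      through-start : ∀ m → Through m 0 m
      through-start m ch = z≤n , Chain.base ch

      through-down : ∀ {m i z} → Through m i z → Through m (suc i) (down z)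
      through-down {m} {i} {z} th {zero}  ch = ⊥-elim (Chain.top ch z (≡.sym (Chain.base ch)))
      through-down {m} {i} {z} th {suc C} {u} ch = let le , e = th above in s≤s le , e
        where
        above : Chain z C (u ∘ suc)
        above = record { base = down-injective (≡.trans (Chain.links ch 0 (s≤s z≤n)) (Chain.base ch))
          ; links = λ i lt → Chain.links ch (suc i) (s≤s lt) ; top = Chain.top ch }

      ∈-walk-marked : ∀ f {m i} z → Through m i z → ∀ {q} → q ∈ walk f z → ∃₂ λ z′ (c : Cover z′) → q ≡ covered p c × MarkOf p c (suc m)
      ∈-walk-marked (suc f) z th m with z <? ℓ
      ... | yes lt with cover? z lt
      ∈-walk-marked (suc f) {i = i} z th (here refl) | yes lt | yes c@(_ , _ , _ , _ , ic) =
        let le , e = th (IsCover.ch ic) in z , c , refl , i , le , ≡.cong suc e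
      ∈-walk-marked (suc f) z th (there m) | yes lt | yes c = ∈-walk-marked f (down z) (through-down th) m
      ∈-walk-marked (suc f) z th m | yes lt | no _ = ∈-walk-marked f (down z) (through-down th) m

      walk-head : ∀ f {z} (c : Cover z) → z < ℓ → ∃ λ q → q ∈ walk (suc f) z × (∀ r → ParFun.parts q r ≡ ParFun.parts (covered p c) r)
      walk-head f {z} c z<ℓ with z <? ℓ
      ... | no nlt = ⊥-elim (nlt z<ℓ)
      ... | yes lt with cover? z lt
      ...   | yes c₁ = _ , here refl , covered-unique c₁ c
      ...   | no nc  = ⊥-elim (nc c)

      walk-tail : ∀ f {z} → z < ℓ → ∀ {q} → q ∈ walk f (down z) → q ∈ walk (suc f) z
      walk-tail f {z} z<ℓ m with z <? ℓ
      ... | no nlt = ⊥-elim (nlt z<ℓ)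
      ... | yes lt with cover? z lt
      ...   | yes _ = there m
      ...   | no _  = m

      ∈-walk⁺ : ∀ f {z′} (c : Cover z′) → z′ < ℓ → ∀ i → i ≤ proj₁ c → ℓ ≤ f + proj₁ (proj₂ c) i →
        ∃ λ q → q ∈ walk f (proj₁ (proj₂ c) i) × (∀ r → ParFun.parts q r ≡ ParFun.parts (covered p c) r)
      ∈-walk⁺ zero c@(C , u , _ , _ , ic) lt i le fuel =
        ⊥-elim (ℕₚ.<⇒≱ (ℕₚ.≤-<-trans (IsCover.u≤z ic le) lt) fuel)
      ∈-walk⁺ (suc f) {z′} c@(C , u , w , g , ic) lt zero le fuel =
        ≡.subst (λ z → ∃ λ q → q ∈ walk (suc f) z × (∀ r → ParFun.parts q r ≡ ParFun.parts (covered p c) r))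
          (≡.sym (IsCover.base ic)) (walk-head f c lt)
      ∈-walk⁺ (suc f) {z′} c@(C , u , w , g , ic) lt (suc i) le fuel = lift
        (∈-walk⁺ f c lt i (ℕₚ.<⇒≤ le) (ℕₚ.≤-trans fuel (≡.subst (_≤ f + u i) (ℕₚ.+-suc f _)
          (ℕₚ.+-monoʳ-≤ f (≡.subst (u (suc i) <_) d (down> (u (suc i))))))))
        where
        d = IsCover.links ic i le
        lift : (∃ λ q → q ∈ walk f (u i) × (∀ r → ParFun.parts q r ≡ ParFun.parts (covered p c) r)) →
          ∃ λ q → q ∈ walk (suc f) (u (suc i)) × (∀ r → ParFun.parts q r ≡ ParFun.parts (covered p c) r)
        lift (q , m , e) = q , walk-tail f (ℕₚ.≤-<-trans (IsCover.u≤z ic le) lt) (≡.subst (λ x → q ∈ walk f x) (≡.sym d) m) , e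

      covers : ℕ → List (ParFun k ℓ)
      covers m = walk ℓ m

      covers-sound : ∀ {m q} → q ∈ covers m → strongMarkedCoverᵇ k (coreList q) (suc m) (coreList p) ≡ true
      covers-sound {m} mem with ∈-walk-marked ℓ m (through-start m) mem
      ... | z , c , refl , mk = strong⁺ c (coreList-represents p) (coreList-represents (covered p c)) mk

      covers-complete : ∀ {m τ} → strongMarkedCoverᵇ k τ (suc m) (coreList p) ≡ true → ∃ λ q → q ∈ covers m × τ ≡ coreList q
      covers-complete {m} {τ} e with strong⁻ {p} {coreList p} {τ} {suc m} (coreList-represents p) e
      ... | z , c@(C , u , w , g , ic) , rep , i , le , refl with ∈-walk⁺ ℓ c (ℕₚ.≤-<-trans (ℕₚ.m≤m+n z g) (CoverShape.Covered.z+g<ℓ p ic)) i le (ℕₚ.m≤m+n ℓ _)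
      ... | q , mem , same = q , mem , Represents-unique q (represents-resp (λ r → ≡.sym (same r)) rep) (coreList-represents q)

      strong-mark-positive : ∀ {τ r} → strongMarkedCoverᵇ k τ r (coreList p) ≡ true → ∃ λ m → r ≡ suc m × m < ℓ
      strong-mark-positive {τ} {r} e with strong⁻ {p} {coreList p} {τ} {r} (coreList-represents p) e
      ... | z , c@(C , u , w , g , ic) , _ , i , le , refl = u i , refl ,
          ℕₚ.≤-<-trans (IsCover.u≤z ic le) (ℕₚ.≤-<-trans (ℕₚ.m≤m+n z g) (CoverShape.Covered.z+g<ℓ p ic))

-- The functional given by the determinants, and the translation of the definitions into it.

module SchurFunctionals where
  open import Algebra.Bundles using (CommutativeRing)
  open import Data.Nat as ℕ using (ℕ; zero; suc; z≤n; s≤s; s≤s⁻¹; _≟_; _∸_; _≤ᵇ_; _<ᵇ_; _≡ᵇ_)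
  open import Data.Integer as ℤ using (ℤ; +_; -[1+_])
  open import Data.Integer.Tactic.RingSolver using (solve-∀)
  open import Data.Vec using (Vec; []; _∷_; lookup; updateAt)
  open import Data.List.Relation.Binary.Permutation.Propositional using (_↭_; prep; swap; trans; refl)
  open import Data.List.Relation.Unary.Any using (here; there)
  open import Data.List.Relation.Unary.AllPairs using ([]; _∷_)
  open Determinants
  open RaisingOperators
  open RootStraightening
  open BounceGraphs
  open CoverWeights
  open Cores

  module SchurFunctional (R : CommutativeRing 0ℓ 0ℓ) (h : ℕ → CommutativeRing.Carrier R) (ℓ : ℕ) where
    open CommutativeRing R hiding (zero) renaming (refl to ≈-refl; sym to ≈-sym; trans to ≈-trans)
    open Determinant R h using (rowDet; rowDet-swap; rowDet-equal; rowDet-zero; det-cong)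
    open Sym R h
    open Straightening R ℓ

    row : Weight → ℕ → Fin ℓ → Carrier
    row γ i j = hZ ((γ i ℤ.+ + toℕ j) ℤ.- + i)

    schur : Fun
    schur γ = rowDet ℓ (row γ)

    schur-ext : Ext schur
    schur-ext e = det-cong ℓ _ _ λ i j → reflexive (≡.cong (λ x → hZ ((x ℤ.+ + toℕ j) ℤ.- + toℕ i)) (e (toℕ i)))

    schur-alt : ∀ z → suc z ℕ.< ℓ → Alt z schur
    schur-alt z sz<ℓ = mkAlt
      (λ {γ} {γ′} s → rowDet-swap z ℓ (row γ) (row γ′) sz<ℓ
        (λ b → reflexive (≡.cong hZ (≡.trans (id₁ (γ z) (+ toℕ b) (+ z)) (≡.cong (λ x → x ℤ.+ + toℕ b ℤ.- + suc z) (≡.sym (Swap.upper s))))))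
        (λ b → reflexive (≡.cong hZ (≡.trans (≡.cong (λ x → x ℤ.+ + toℕ b ℤ.- + suc z) (≡.sym (Swap.lower s))) (≡.sym (id₁ (γ′ z) (+ toℕ b) (+ z))))))
        (λ i a b′ b → reflexive (≡.cong (λ x → hZ (x ℤ.+ + toℕ b ℤ.- + i)) (≡.sym (Swap.other s i a b′)))))
      (λ {γ} f → rowDet-equal z ℓ (row γ) sz<ℓ
        (λ b → reflexive (≡.cong hZ (≡.trans (id₁ (γ z) (+ toℕ b) (+ z)) (≡.cong (λ x → x ℤ.+ + toℕ b ℤ.- + suc z) (Fixed.fixes f))))))
      where
      id₁ : ∀ g b z → g ℤ.+ b ℤ.- z ≡ g ℤ.+ + 1 ℤ.+ b ℤ.- (+ 1 ℤ.+ z)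
      id₁ = solve-∀

    -- In the last row no column index exceeds the row index, so a negative entry makes all the
    -- indices of h negative.
    schur-negative : ∀ {γ} r → suc r ≡ ℓ → γ r ℤ.< + 0 → schur γ ≈ 0#
    schur-negative {γ} r e lt = rowDet-zero r ℓ (row γ) (≡.subst (r ℕ.<_) e (ℕₚ.n<1+n r)) λ b →
      hZ-negative (ℤₚ.<-≤-trans {j = + toℕ b ℤ.- + r}
        (≡.subst₂ ℤ._<_ (≡.sym (ℤₚ.+-assoc (γ r) (+ toℕ b) _)) (ℤₚ.+-identityˡ _) (ℤₚ.+-monoˡ-< (+ toℕ b ℤ.- + r) lt))
        (ℤₚ.i≤j⇒i-j≤0 (ℤ.+≤+ (s≤s⁻¹ (≡.subst (toℕ b ℕ.<_) (≡.sym e) (Finₚ.toℕ<n b))))))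
      where
      hZ-negative : ∀ {x} → x ℤ.< + 0 → hZ x ≈ 0#
      hZ-negative {+ _} (ℤ.+<+ ())
      hZ-negative { -[1+ _ ]} _ = ≈-refl

    E-negative : ∀ is d {F} r → (∀ {γ} → γ r ℤ.< + 0 → F γ ≈ 0#) → ∀ {γ} → γ r ℤ.< + 0 → E is d F γ ≈ 0#
    E-negative []       zero    r neg lt = neg lt
    E-negative []       (suc d) r neg lt = ≈-refl
    E-negative (i ∷ is) zero    r neg lt = E-negative is zero r neg lt
    E-negative (i ∷ is) (suc d) r neg {γ} lt = 0+0 (E-negative is (suc d) r neg lt) (E-negative is d r neg below)
      where
      below : (γ ⊖ε i) r ℤ.< + 0
      below with i ≟ r
      ... | yes _ = ℤₚ.≤-<-trans (ℤₚ.i-j≤i (γ r) (+ 1)) lt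
      ... | no _  rewrite ℤₚ.+-identityʳ (γ r) = lt

    Extends : Weight → Vec ℤ ℓ → Set
    Extends γ v = ∀ i → γ (toℕ i) ≡ lookup v i

    toRoot : Fin ℓ × Fin ℓ → Root
    toRoot (i , j) = toℕ i , toℕ j

    private
      -- `Hc` adds a multiple of a root at once, `H` one copy at a time; this iteration mediates
      -- between them.
      pow : ℕ → Root → Weight → Weight
      pow zero    α γ = γ
      pow (suc a) α γ = pow a α (γ ⊕ α)

      pow-value : ∀ a i j γ r → pow a (i , j) γ r ≡ γ r ℤ.+ + a ℤ.* δ i r ℤ.- + a ℤ.* δ j r
      pow-value zero    i j γ r = identity (γ r) (δ i r) (δ j r)
        where
        identity : ∀ g a b → g ≡ g ℤ.+ + 0 ℤ.* a ℤ.- + 0 ℤ.* b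
        identity = solve-∀
      pow-value (suc a) i j γ r = ≡.trans (pow-value a i j (γ ⊕ (i , j)) r) (identity (+ a) (γ r) (δ i r) (δ j r))
        where
        identity : ∀ n g a b → g ℤ.+ a ℤ.- b ℤ.+ n ℤ.* a ℤ.- n ℤ.* b ≡ g ℤ.+ (+ 1 ℤ.+ n) ℤ.* a ℤ.- (+ 1 ℤ.+ n) ℤ.* b
        identity = solve-∀

      lookup-add : ∀ (v : Vec ℤ ℓ) i x r → lookup (updateAt v i (λ y → y ℤ.+ x)) r ≡ lookup v r ℤ.+ x ℤ.* δ (toℕ i) (toℕ r)
      lookup-add v i x r with i Finₚ.≟ r
      ... | yes refl = ≡.trans (Vecₚ.lookup∘updateAt i v) (≡.cong (λ d → lookup v i ℤ.+ d)
            (≡.sym (≡.trans (≡.cong (x ℤ.*_) (δ-≡ {toℕ i} refl)) (ℤₚ.*-identityʳ x))))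
      ... | no ne = ≡.trans (Vecₚ.lookup∘updateAt′ r i (ne ∘ ≡.sym) v) (≡.trans (≡.sym (ℤₚ.+-identityʳ _))
            (≡.cong (λ d → lookup v r ℤ.+ d) (≡.sym (≡.trans (≡.cong (x ℤ.*_) (δ-≢ (ne ∘ Finₚ.toℕ-injective))) (ℤₚ.*-zeroʳ x)))))

      shift-extends : ∀ a i j {γ v} → Extends γ v → Extends (pow a (toRoot (i , j)) γ) (shift a i j v)
      shift-extends a i j {γ} {v} ext r = ≡.sym (begin
        lookup (shift a i j v) r ≡⟨ lookup-add (updateAt v i (λ y → y ℤ.+ + a)) j (ℤ.- + a) r ⟩
        lookup (updateAt v i (λ y → y ℤ.+ + a)) r ℤ.+ (ℤ.- + a) ℤ.* δ (toℕ j) (toℕ r)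
          ≡⟨ ≡.cong₂ ℤ._+_ (≡.trans (lookup-add v i (+ a) r) (≡.cong (ℤ._+ + a ℤ.* δ (toℕ i) (toℕ r)) (≡.sym (ext r))))
               (≡.sym (ℤₚ.neg-distribˡ-* (+ a) _)) ⟩
        γ (toℕ r) ℤ.+ + a ℤ.* δ (toℕ i) (toℕ r) ℤ.- + a ℤ.* δ (toℕ j) (toℕ r)
          ≡⟨ pow-value a (toℕ i) (toℕ j) γ (toℕ r) ⟨
        pow a (toRoot (i , j)) γ (toℕ r) ∎)
        where open ≡.≡-Reasoning

      sumRange-suc : ∀ n f → sumRange (suc n) f ≈ f 0 + sumRange n (f ∘ suc)
      sumRange-suc zero    f = +-comm _ _
      sumRange-suc (suc n) f = ≈-trans (+-congʳ (sumRange-suc n f)) (+-assoc _ _ _)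

    Hc-H : ∀ Ψ n {γ v} → Extends γ v → Hc Ψ n v ≈ H schur (map toRoot Ψ) n γ
    Hc-H []      zero    ext = det-cong ℓ _ _ λ i j → reflexive (≡.cong (λ x → hZ ((x ℤ.+ + toℕ j) ℤ.- + toℕ i)) (≡.sym (ext i)))
    Hc-H []      (suc n) ext = ≈-refl
    Hc-H ((i , j) ∷ Ψ) n {γ} {v} ext = go n (λ a → shift a i j v) γ (λ a → shift-extends a i j {γ} {v} ext)
      where
      -- The recursion of `H` moves `γ`, while the summands of `Hc` keep referring to the original
      -- vector; hence the arbitrary family `vs`.
      go : ∀ n (vs : ℕ → Vec ℤ ℓ) γ → (∀ a → Extends (pow a (toRoot (i , j)) γ) (vs a)) →
        sumRange (suc n) (λ a → Hc Ψ (n ∸ a) (vs a)) ≈ H schur (toRoot (i , j) ∷ map toRoot Ψ) n γ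
      go zero    vs γ ex = ≈-trans (+-identityˡ _) (Hc-H Ψ zero (ex 0))
      go (suc n) vs γ ex = ≈-trans (sumRange-suc (suc n) (λ a → Hc Ψ (suc n ∸ a) (vs a)))
        (+-cong (Hc-H Ψ (suc n) (ex 0)) (go n (vs ∘ suc) (γ ⊕ toRoot (i , j)) (ex ∘ suc)))

    downOf : ℕ → (ℕ → ℕ) → ℕ → ℕ
    downOf k f r = r ℕ.+ (suc k ∸ f r)

    allPairs-product : ∀ {A B : Set} (xs : List A) (ys : List B) → concat (map (λ i → map (i ,_) ys) xs) ≡ cartesianProduct xs ys
    allPairs-product []       ys = refl
    allPairs-product (x ∷ xs) ys = ≡.cong (map (x ,_) ys ++_) (allPairs-product xs ys)

    -- The condition k + i < μ_i + j says that column j is at or after the start of row i. It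
    -- implies i < j because μ_i is at most k.
    Δk-roots : ∀ {k} {v : Vec ℕ ℓ} {f} → (∀ i → f (toℕ i) ≡ lookup v i) → (∀ r → f r ℕ.≤ k) →
      map toRoot (Δk k v) ↭ roots (downOf k f)
    Δk-roots {k} {v} {f} ext bound = unique-set⇒↭
      (Uniqueₚ.map⁺ (λ e → ≡.cong₂ _,_ (Finₚ.toℕ-injective (≡.cong proj₁ e)) (Finₚ.toℕ-injective (≡.cong proj₂ e)))
        (Uniqueₚ.filter⁺ (T? ∘ cond) (≡.subst (λ xs → Data.List.Relation.Unary.Unique.Propositional.Unique xs)
          (≡.sym (allPairs-product (allFin ℓ) (allFin ℓ))) (Uniqueₚ.cartesianProduct⁺ (Uniqueₚ.allFin⁺ ℓ) (Uniqueₚ.allFin⁺ ℓ)))))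
      (roots-unique _) to from
      where
      import Data.List.Relation.Unary.Unique.Propositional
      cond : Fin ℓ × Fin ℓ → Bool
      cond p = (toℕ (proj₁ p) <ᵇ toℕ (proj₂ p)) ∧ ((k ℕ.+ toℕ (proj₁ p)) <ᵇ (lookup v (proj₁ p) ℕ.+ toℕ (proj₂ p)))
      start⁺ : ∀ {i j x} → x ℕ.≤ k → k ℕ.+ i ℕ.< x ℕ.+ j → i ℕ.+ (suc k ∸ x) ℕ.≤ j
      start⁺ {i} {j} {x} le lt = ℕₚ.+-cancelʳ-≤ x _ _ (≡.subst₂ ℕ._≤_
        (≡.sym (≡.trans (ℕₚ.+-assoc i _ x) (≡.trans (≡.cong (i ℕ.+_) (ℕₚ.m∸n+n≡m (ℕₚ.m≤n⇒m≤1+n le)))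
          (≡.trans (ℕₚ.+-suc i k) (≡.cong suc (ℕₚ.+-comm i k)))))) (ℕₚ.+-comm x j) lt)
      start⁻ : ∀ {i j x} → x ℕ.≤ k → i ℕ.+ (suc k ∸ x) ℕ.≤ j → k ℕ.+ i ℕ.< x ℕ.+ j
      start⁻ {i} {j} {x} le lt = ≡.subst₂ ℕ._≤_
        (≡.trans (ℕₚ.+-assoc i _ x) (≡.trans (≡.cong (i ℕ.+_) (ℕₚ.m∸n+n≡m (ℕₚ.m≤n⇒m≤1+n le)))
          (≡.trans (ℕₚ.+-suc i k) (≡.cong suc (ℕₚ.+-comm i k))))) (ℕₚ.+-comm j x) (ℕₚ.+-monoˡ-≤ x lt)
      above : ∀ {i j x} → x ℕ.≤ k → i ℕ.+ (suc k ∸ x) ℕ.≤ j → i ℕ.< j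
      above {i} {j} {x} le lt = ℕₚ.<-≤-trans (ℕₚ.m<m+n i (ℕₚ.m<n⇒0<n∸m (s≤s le))) lt
      to : ∀ {α} → α ∈ map toRoot (Δk k v) → α ∈ roots (downOf k f)
      to m with ∈-map⁻ toRoot m
      ... | (i , j) , m′ , refl with ∈-filterᵇ⁻ {p = cond} {xs = allPairs ℓ} m′
      ... | _ , e = ∈-roots⁺ (Finₚ.toℕ<n i) (Finₚ.toℕ<n j) (start⁺ (bound (toℕ i))
            (≡.subst (λ x → k ℕ.+ toℕ i ℕ.< x ℕ.+ toℕ j) (≡.sym (ext i)) (<ᵇ⇒< (proj₂ (∧-elim {toℕ i <ᵇ toℕ j} e)))))
      from : ∀ {α} → α ∈ roots (downOf k f) → α ∈ map toRoot (Δk k v)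
      from {a , b} m with ∈-roots⁻ m
      ... | a< , b< , le = ≡.subst (_∈ map toRoot (Δk k v)) (≡.cong₂ _,_ (Finₚ.toℕ-fromℕ< a<) (Finₚ.toℕ-fromℕ< b<))
        (∈-map⁺ toRoot (∈-filterᵇ⁺ {p = cond} (≡.subst ((i , j) ∈_) (≡.sym (allPairs-product (allFin ℓ) (allFin ℓ)))
          (∈-cartesianProduct⁺ (∈-allFin i) (∈-allFin j)))
          (∧-intro (<⇒<ᵇ (≡.subst₂ ℕ._<_ (≡.sym ea) (≡.sym eb) (above (bound a) le)))
            (<⇒<ᵇ (≡.subst₂ (λ x y → k ℕ.+ x ℕ.< y) (≡.sym ea) (≡.cong₂ ℕ._+_ (≡.trans (≡.cong f (≡.sym ea)) (ext i)) (≡.sym eb)) (start⁻ (bound a) le))))))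
        where
        i = Fin.fromℕ< a<
        j = Fin.fromℕ< b<
        ea = Finₚ.toℕ-fromℕ< a<
        eb = Finₚ.toℕ-fromℕ< b<

    Hc-roots : ∀ {k} {v : Vec ℕ ℓ} {f} → (∀ i → f (toℕ i) ≡ lookup v i) → (∀ r → f r ℕ.≤ k) →
      ∀ n {γ w} → Extends γ w → Hc (Δk k v) n w ≈ H schur (roots (downOf k f)) n γ
    Hc-roots {k} {v} ext bound n {γ} {w} ex = ≈-trans (Hc-H (Δk k v) n {γ} {w} ex) (H-↭ schur-ext (Δk-roots {v = v} ext bound) n γ)

    sumList-++ : ∀ {A : Set} (f : A → Carrier) xs ys → sumList (map f (xs ++ ys)) ≈ sumList (map f xs) + sumList (map f ys)
    sumList-++ f []       ys = ≈-sym (+-identityˡ _)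
    sumList-++ f (x ∷ xs) ys = ≈-trans (+-congˡ (sumList-++ f xs ys)) (≈-sym (+-assoc _ _ _))

    sumList-cong : ∀ {A : Set} {f g : A → Carrier} xs → (∀ {x} → x ∈ xs → f x ≈ g x) → sumList (map f xs) ≈ sumList (map g xs)
    sumList-cong []       e = ≈-refl
    sumList-cong (x ∷ xs) e = +-cong (e (here refl)) (sumList-cong xs (e ∘ there))

    sumList-↭ : ∀ {A : Set} (f : A → Carrier) {xs ys} → xs ↭ ys → sumList (map f xs) ≈ sumList (map f ys)
    sumList-↭ f refl         = ≈-refl
    sumList-↭ f (prep x p)   = +-congˡ (sumList-↭ f p)
    sumList-↭ f (swap x y p) = ≈-trans (≈-sym (+-assoc _ _ _)) (≈-trans (+-cong (+-comm _ _) (sumList-↭ f p)) (+-assoc _ _ _))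
    sumList-↭ f (trans p q)  = ≈-trans (sumList-↭ f p) (sumList-↭ f q)

    module _ {A : Set} (f : A → Carrier) where
      sumList-split : ∀ (P Q Q′ : A → Bool) xs →
        (∀ {x} → x ∈ xs → (P x ≡ false × Q x ≡ false × Q′ x ≡ false) ⊎ (P x ≡ true × Q x ≡ true × Q′ x ≡ false) ⊎ (P x ≡ true × Q x ≡ false × Q′ x ≡ true)) →
        sumList (map f (filterᵇ P xs)) ≈ sumList (map f (filterᵇ Q xs)) + sumList (map f (filterᵇ Q′ xs))
      sumList-split P Q Q′ []       c = ≈-sym (+-identityˡ 0#)
      sumList-split P Q Q′ (x ∷ xs) c with c (here refl) | sumList-split P Q Q′ xs (c ∘ there)
      ... | inj₁ (a , b , b′)        | IH rewrite a | b | b′ = IH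
      ... | inj₂ (inj₁ (a , b , b′)) | IH rewrite a | b | b′ = ≈-trans (+-congˡ IH) (≈-sym (+-assoc _ _ _))
      ... | inj₂ (inj₂ (a , b , b′)) | IH rewrite a | b | b′ = ≈-trans (+-congˡ (≈-trans IH (+-comm _ _))) (≈-trans (≈-sym (+-assoc _ _ _)) (+-comm _ _))

      sumList-none : ∀ (P : A → Bool) xs → (∀ {x} → x ∈ xs → P x ≡ false) → sumList (map f (filterᵇ P xs)) ≈ 0#
      sumList-none P []       e = ≈-refl
      sumList-none P (x ∷ xs) e rewrite e (here refl) = sumList-none P xs (e ∘ there)

      sumList-filter-cong : ∀ (P Q : A → Bool) xs → (∀ x → P x ≡ Q x) → sumList (map f (filterᵇ P xs)) ≈ sumList (map f (filterᵇ Q xs))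
      sumList-filter-cong P Q []       e = ≈-refl
      sumList-filter-cong P Q (x ∷ xs) e rewrite e x with Q x
      ... | true  = +-congˡ (sumList-filter-cong P Q xs e)
      ... | false = sumList-filter-cong P Q xs e

    sumList-map-filter : ∀ {A B : Set} (f : B → Carrier) (g : A → B) (P : B → Bool) xs →
      sumList (map f (filterᵇ P (map g xs))) ≈ sumList (map (f ∘ g) (filterᵇ (P ∘ g) xs))
    sumList-map-filter f g P []       = ≈-refl
    sumList-map-filter f g P (x ∷ xs) with P (g x)
    ... | true  = +-congˡ (sumList-map-filter f g P xs)
    ... | false = sumList-map-filter f g P xs

    -- γ - ε_S, the entries of S being numbered from a.
    subtract : ∀ {l} → ℕ → Vec Bool l → Weight → Weight
    subtract a []          γ = γ
    subtract a (true ∷ S)  γ = subtract (suc a) S (γ ⊖ε a)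
    subtract a (false ∷ S) γ = subtract (suc a) S γ

    interval : ℕ → ℕ → List ℕ
    interval a zero    = []
    interval a (suc m) = a ∷ interval (suc a) m

    interval-applyUpTo : ∀ a m f → (∀ i → f i ≡ a ℕ.+ i) → interval a m ≡ applyUpTo f m
    interval-applyUpTo a zero    f e = refl
    interval-applyUpTo a (suc m) f e = ≡.cong₂ _∷_ (≡.sym (≡.trans (e 0) (ℕₚ.+-identityʳ a)))
      (interval-applyUpTo (suc a) m (f ∘ suc) (λ i → ≡.trans (e (suc i)) (ℕₚ.+-suc a i)))

    private
      allᵇ-tabulate-suc : ∀ {l} (p : Fin (suc l) → Bool) → allᵇ p (allFin (suc l)) ≡ p fzero ∧ allᵇ (p ∘ fsuc) (allFin l)
      allᵇ-tabulate-suc {l} p = ≡.cong (λ xs → p fzero ∧ foldr _∧_ true xs)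
        (≡.trans (Listₚ.map-tabulate fsuc p) (≡.sym (Listₚ.map-tabulate id (p ∘ fsuc))))

      subsetOf-zero : ∀ {l} (S : Vec Bool l) → subsetOfᵇ 0 (false ∷ S) ≡ subsetOfᵇ 0 S
      subsetOf-zero {l} S = allᵇ-tabulate-suc {l} (λ i → not (lookup (false ∷ S) i) ∨ (suc (toℕ i) ≤ᵇ 0))

      subsetOf-suc : ∀ {l} m b (S : Vec Bool l) → subsetOfᵇ (suc m) (b ∷ S) ≡ subsetOfᵇ m S
      subsetOf-suc {l} m b S = ≡.trans (allᵇ-tabulate-suc {l} (λ i → not (lookup (b ∷ S) i) ∨ (suc (toℕ i) ≤ᵇ suc m)))
        (≡.cong (_∧ subsetOfᵇ m S) (head b))
        where
        head : ∀ b → not b ∨ true ≡ true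
        head true  = refl
        head false = refl

    -- The first entry of `S` decides whether ε_a is subtracted; the bound `m` shrinks with the
    -- vector, and at 0 no further entry may be chosen.
    subset-sum : ∀ (G : Fun) {l} m d a γ → m ℕ.≤ l →
      sumList (map (λ S → G (subtract a S γ)) (filterᵇ (λ S → (card S ≡ᵇ d) ∧ subsetOfᵇ m S) (allSubsets l))) ≈ E (interval a m) d G γ
    subset-sum G {zero}  zero zero    a γ le = +-identityʳ _
    subset-sum G {zero}  zero (suc d) a γ le = ≈-refl
    subset-sum G {suc l} m d a γ le = ≈-trans (reflexive (≡.cong (λ xs → sumList (map f xs)) (Listₚ.filter-++ (T? ∘ P) (map (true ∷_) (allSubsets l)) _)))
      (≈-trans (sumList-++ f (filterᵇ P (map (true ∷_) (allSubsets l))) _)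
        (≈-trans (+-cong (sumList-map-filter f (true ∷_) P (allSubsets l)) (sumList-map-filter f (false ∷_) P (allSubsets l)))
          (split m d le)))
      where
      P : ∀ {l} → Vec Bool l → Bool
      P S = (card S ≡ᵇ d) ∧ subsetOfᵇ m S
      f : Vec Bool (suc l) → Carrier
      f S = G (subtract a S γ)
      withFirst : ℕ → ℕ → Carrier
      withFirst m d = sumList (map (f ∘ (true ∷_)) (filterᵇ (λ S → (suc (card S) ≡ᵇ d) ∧ subsetOfᵇ m (true ∷ S)) (allSubsets l)))
      withoutFirst : ℕ → ℕ → Carrier
      withoutFirst m d = sumList (map (f ∘ (false ∷_)) (filterᵇ (λ S → (card S ≡ᵇ d) ∧ subsetOfᵇ m (false ∷ S)) (allSubsets l)))
      ∧-false : ∀ b → b ∧ false ≡ false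
      ∧-false true  = refl
      ∧-false false = refl
      split : ∀ m d → m ℕ.≤ suc l → withFirst m d + withoutFirst m d ≈ E (interval a m) d G γ
      split zero d le = ≈-trans (+-cong
          (sumList-none (f ∘ (true ∷_)) _ (allSubsets l) (λ {S} _ → ∧-false (suc (card S) ≡ᵇ d)))
          (≈-trans (sumList-filter-cong (f ∘ (false ∷_)) _ _ (allSubsets l) (λ S → ≡.cong ((card S ≡ᵇ d) ∧_) (subsetOf-zero S)))
            (subset-sum G {l} zero d (suc a) γ z≤n)))
        (+-identityˡ _)
      split (suc m) zero (s≤s le) = ≈-trans (+-cong
          (sumList-none (f ∘ (true ∷_)) _ (allSubsets l) (λ _ → refl))
          (≈-trans (sumList-filter-cong (f ∘ (false ∷_)) _ _ (allSubsets l) (λ S → ≡.cong ((card S ≡ᵇ 0) ∧_) (subsetOf-suc m false S)))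
            (subset-sum G {l} m zero (suc a) γ le)))
        (+-identityˡ _)
      split (suc m) (suc d) (s≤s le) = ≈-trans (+-cong
          (≈-trans (sumList-filter-cong (f ∘ (true ∷_)) _ _ (allSubsets l) (λ S → ≡.cong ((card S ≡ᵇ d) ∧_) (subsetOf-suc m true S)))
            (subset-sum G {l} m d (suc a) (γ ⊖ε a) le))
          (≈-trans (sumList-filter-cong (f ∘ (false ∷_)) _ _ (allSubsets l) (λ S → ≡.cong ((card S ≡ᵇ suc d) ∧_) (subsetOf-suc m false S)))
            (subset-sum G {l} m (suc d) (suc a) γ le)))
        (+-comm _ _)

-- Enumeration of vertical strong marked tableaux by their last step.

module VerticalTableaux where
  open import Data.Nat as ℕ using (ℕ; zero; suc; z≤n; s≤s; s≤s⁻¹; _∸_; _≤ᵇ_; _<ᵇ_; _≡ᵇ_; _≤_; _<_)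
  open import Data.Integer using (+_)
  open import Data.Vec as Vec using (Vec; []; _∷_; lookup)
  open import Data.List.Relation.Binary.Permutation.Propositional using (_↭_)
  open import Data.List.Relation.Unary.Any using (here; there)
  open import Data.List.Relation.Unary.AllPairs as AllPairs using (AllPairs; []; _∷_)
  open RaisingOperators
  open RootStraightening
  open BounceGraphs
  open CoverWeights
  open Cores
  open CoverRibbons
  open StrongCovers
  open SchurFunctionals

  open CoreFacts using (Represents; coreList; coreList-represents; Represents-unique; represents-isCore; represents-pmap)

  Step : Set
  Step = ℕ × List ℕ

  append : Step → Tab → Tab
  append s (κ , st) = κ , st ∷ʳ s

  append-injective : ∀ {s T T′} → append s T ≡ append s T′ → T ≡ T′
  append-injective {T = _ , st} {_ , st′} e = ≡.cong₂ _,_ (≡.cong proj₁ e) (Listₚ.∷ʳ-injectiveˡ st st′ (≡.cong proj₂ e))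

  finalOf : Tab → List ℕ
  finalOf (κ , st) = finalShape κ st

  chainOK-append : ∀ k κ₀ st r κ → chainOKᵇ k κ₀ (st ∷ʳ (r , κ)) ≡ chainOKᵇ k κ₀ st ∧ strongMarkedCoverᵇ k (finalShape κ₀ st) r κ
  chainOK-append k κ₀ []              r κ = Boolₚ.∧-identityʳ _
  chainOK-append k κ₀ ((r′ , κ′) ∷ st) r κ = ≡.trans (≡.cong (strongMarkedCoverᵇ k κ₀ r′ κ′ ∧_) (chainOK-append k κ′ st r κ))
    (≡.sym (Boolₚ.∧-assoc (strongMarkedCoverᵇ k κ₀ r′ κ′) _ _))

  final-append : ∀ κ₀ st r κ → finalShape κ₀ (st ∷ʳ (r , κ)) ≡ κ
  final-append κ₀ []              r κ = refl
  final-append κ₀ ((_ , κ′) ∷ st) r κ = final-append κ′ st r κ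

  spin-append : ∀ κ₀ st r κ → spinChain κ₀ (st ∷ʳ (r , κ)) ≡ spinChain κ₀ st ℕ.+ spin (finalShape κ₀ st) r κ
  spin-append κ₀ []               r κ = ℕₚ.+-identityʳ _
  spin-append κ₀ ((r′ , κ′) ∷ st) r κ = ≡.trans (≡.cong (spin κ₀ r′ κ′ ℕ.+_) (spin-append κ′ st r κ)) (≡.sym (ℕₚ.+-assoc (spin κ₀ r′ κ′) _ _))

  extend-below : ∀ {x y r xs} → x < y → (∀ {z} → z ∈ y ∷ xs → z < r) → ∀ {z} → z ∈ x ∷ y ∷ xs → z < r
  extend-below x<y below (here refl) = ℕₚ.<-trans x<y (below (here refl))
  extend-below x<y below (there m)   = below m

  strictInc-append⁻ : ∀ xs r → strictIncᵇ (xs ∷ʳ r) ≡ true → strictIncᵇ xs ≡ true × (∀ {x} → x ∈ xs → x < r)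
  strictInc-append⁻ []           r e = refl , λ ()
  strictInc-append⁻ (x ∷ [])     r e = refl , λ { (here refl) → <ᵇ⇒< (proj₁ (∧-elim {x <ᵇ r} e)) }
  strictInc-append⁻ (x ∷ y ∷ xs) r e =
    ∧-intro (proj₁ (∧-elim {x <ᵇ y} e)) (proj₁ (strictInc-append⁻ (y ∷ xs) r (proj₂ (∧-elim {x <ᵇ y} e)))) ,
    extend-below (<ᵇ⇒< {x} {y} (proj₁ (∧-elim {x <ᵇ y} e))) (proj₂ (strictInc-append⁻ (y ∷ xs) r (proj₂ (∧-elim {x <ᵇ y} e))))

  strictInc-append⁺ : ∀ xs r → strictIncᵇ xs ≡ true → (∀ {x} → x ∈ xs → x < r) → strictIncᵇ (xs ∷ʳ r) ≡ true
  strictInc-append⁺ []           r e below = refl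
  strictInc-append⁺ (x ∷ [])     r e below = ∧-intro (<⇒<ᵇ (below (here refl))) refl
  strictInc-append⁺ (x ∷ y ∷ xs) r e below = let x<y , e′ = ∧-elim {x <ᵇ y} e in
    ∧-intro x<y (strictInc-append⁺ (y ∷ xs) r e′ (below ∘ there))

  final-core : ∀ k κ₀ st → isCoreᵇ k κ₀ ≡ true → chainOKᵇ k κ₀ st ≡ true → isCoreᵇ k (finalShape κ₀ st) ≡ true
  final-core k κ₀ []              c e = c
  final-core k κ₀ ((r , κ) ∷ st) c e = final-core k κ st
    (proj₁ (∧-elim {isCoreᵇ k κ} (proj₂ (∧-elim {isCoreᵇ k κ₀} (proj₁ e₁))))) (proj₂ e₁)
    where e₁ = ∧-elim {strongMarkedCoverᵇ k κ₀ r κ} e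

  listEq⇒≡ : ∀ xs ys → listEqᵇ xs ys ≡ true → xs ≡ ys
  listEq⇒≡ []       []       e = refl
  listEq⇒≡ (x ∷ xs) (y ∷ ys) e = let a , b = ∧-elim {x ≡ᵇ y} e in ≡.cong₂ _∷_ (≡ᵇ⇒≡ a) (listEq⇒≡ xs ys b)

  listEq-part : ∀ xs ys → length xs ≡ length ys → (∀ r → part xs r ≡ part ys r) → listEqᵇ xs ys ≡ true
  listEq-part []       []       l e = refl
  listEq-part (x ∷ xs) (y ∷ ys) l e = ∧-intro (≡⇒≡ᵇ (e 0)) (listEq-part xs ys (ℕₚ.suc-injective l) (e ∘ suc))

  part-pad : ∀ xs n r → part (xs ++ replicate n 0) r ≡ part xs r
  part-pad (x ∷ xs) n       zero    = refl
  part-pad (x ∷ xs) n       (suc r) = part-pad xs n r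
  part-pad []       zero    r       = refl
  part-pad []       (suc n) zero    = refl
  part-pad []       (suc n) (suc r) = part-pad [] n r

  part-toList : ∀ {l} (v : Vec ℕ l) i → part (Vec.toList v) (toℕ i) ≡ lookup v i
  part-toList (x ∷ v) fzero    = refl
  part-toList (x ∷ v) (fsuc i) = part-toList v i

  module Tableaux (k ℓ : ℕ) where

    -- Marks increase, so the last mark is the largest: either all marks are at most `m`, or the
    -- last one is `suc m` and the earlier ones are at most `m`. This is the same recursion as for
    -- subsets.
    tabs : ℕ → ParFun k ℓ → ℕ → List Tab
    tabs zero    p m       = (coreList p , []) ∷ []
    tabs (suc d) p zero    = []
    tabs (suc d) p (suc m) = tabs (suc d) p m ++
      concat (map (λ q → map (append (suc m , coreList p)) (tabs d q m)) (CoverList.covers p m))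

    record Valid (d : ℕ) (p : ParFun k ℓ) (m : ℕ) (T : Tab) : Set where
      field
        steps : length (proj₂ T) ≡ d
        start : isCoreᵇ k (proj₁ T) ≡ true
        chain : chainOKᵇ k (proj₁ T) (proj₂ T) ≡ true
        inc   : strictIncᵇ (marks T) ≡ true
        final : finalOf T ≡ coreList p
        below : ∀ {r} → r ∈ marks T → r ≤ m
    open Valid

    ∈-concat-map⁻ : ∀ {A B : Set} (f : A → List B) xs {y} → y ∈ concat (map f xs) → ∃ λ x → x ∈ xs × y ∈ f x
    ∈-concat-map⁻ f xs m with ∈-concat⁻′ (map f xs) m
    ... | ys , y∈ , ys∈ with ∈-map⁻ f ys∈
    ... | x , x∈ , refl = x , x∈ , y∈

    marks-append : ∀ st (s : Step) → map proj₁ (st ∷ʳ s) ≡ map proj₁ st ∷ʳ proj₁ s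
    marks-append st s = Listₚ.map-++ proj₁ st (s ∷ [])

    append-valid : ∀ {d p q m T} → Valid d q m T → q ∈ CoverList.covers p m → Valid (suc d) p (suc m) (append (suc m , coreList p) T)
    append-valid {d} {p} {q} {m} {κ₀ , st} V q∈ = record
      { steps = ≡.trans (Listₚ.length-++ st) (≡.trans (ℕₚ.+-comm _ 1) (≡.cong suc (steps V)))
      ; start = start V
      ; chain = ≡.trans (chainOK-append k κ₀ st (suc m) (coreList p)) (∧-intro (chain V)
          (≡.subst (λ τ → strongMarkedCoverᵇ k τ (suc m) (coreList p) ≡ true) (≡.sym (final V)) (CoverList.covers-sound p q∈)))
      ; inc = ≡.trans (≡.cong strictIncᵇ (marks-append st _)) (strictInc-append⁺ (map proj₁ st) (suc m) (inc V) (s≤s ∘ below V))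
      ; final = final-append κ₀ st (suc m) (coreList p)
      ; below = λ r∈ → [ ℕₚ.m≤n⇒m≤1+n ∘ below V , (λ { (here refl) → ℕₚ.≤-refl }) ]′
          (∈-++⁻ (map proj₁ st) (≡.subst (_ ∈_) (marks-append st (suc m , coreList p)) r∈)) }

    tabs-valid : ∀ d p m {T} → T ∈ tabs d p m → Valid d p m T
    tabs-valid zero    p m (here refl) = record
      { steps = refl ; start = represents-isCore p (coreList-represents p) ; chain = refl ; inc = refl ; final = refl ; below = λ () }
    tabs-valid (suc d) p (suc m) T∈ with ∈-++⁻ (tabs (suc d) p m) T∈
    ... | inj₁ T∈′ = let V = tabs-valid (suc d) p m T∈′ in record
          { steps = steps V ; start = start V ; chain = chain V ; inc = inc V ; final = final V ; below = ℕₚ.m≤n⇒m≤1+n ∘ below V }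
    ... | inj₂ T∈′ with ∈-concat-map⁻ (λ q → map (append (suc m , coreList p)) (tabs d q m)) (CoverList.covers p m) T∈′
    ... | q , q∈ , T∈″ with ∈-map⁻ (append (suc m , coreList p)) T∈″
    ... | T′ , T′∈ , refl = append-valid (tabs-valid d q m T′∈) q∈

    valid-tabs : ∀ d p m {T} → Valid d p m T → T ∈ tabs d p m
    valid-tabs zero p m {κ₀ , []} V = here (≡.cong (_, []) (final V))
    valid-tabs zero p m {κ₀ , _ ∷ _} V with steps V
    ... | ()
    valid-tabs (suc d) p m {κ₀ , st} V with initLast st
    valid-tabs (suc d) p m {κ₀ , .[]} V | [] with steps V
    ... | ()
    valid-tabs (suc d) p m {κ₀ , .(st ∷ʳ (r , κ))} V | st ∷ʳ′ (r , κ) = go m (below V last∈)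
      where
      κ≡ : κ ≡ coreList p
      κ≡ = ≡.trans (≡.sym (final-append κ₀ st r κ)) (final V)
      chain′ = ∧-elim {chainOKᵇ k κ₀ st} (≡.trans (≡.sym (chainOK-append k κ₀ st r κ)) (chain V))
      inc′ = strictInc-append⁻ (map proj₁ st) r (≡.trans (≡.sym (≡.cong strictIncᵇ (marks-append st (r , κ)))) (inc V))
      last∈ : r ∈ map proj₁ (st ∷ʳ (r , κ))
      last∈ = ∈-map⁺ proj₁ (∈-++⁺ʳ st (here refl))
      strong : strongMarkedCoverᵇ k (finalShape κ₀ st) r (coreList p) ≡ true
      strong = ≡.subst (λ κ → strongMarkedCoverᵇ k (finalShape κ₀ st) r κ ≡ true) κ≡ (proj₂ chain′)
      go : ∀ m → r ≤ m → (κ₀ , st ∷ʳ (r , κ)) ∈ tabs (suc d) p m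
      -- Marks are 1-based, so 0 is never a mark.
      go zero r≤0 with CoverList.strong-mark-positive p {finalShape κ₀ st} {r} strong
      ... | _ , refl , _ with r≤0
      ... | ()
      go (suc m) r≤ with ℕₚ.m≤n⇒m<n∨m≡n r≤
      ... | inj₁ lt = ∈-++⁺ˡ (go m (s≤s⁻¹ lt))
      ... | inj₂ refl with CoverList.covers-complete p {m} {finalShape κ₀ st} strong
      ... | q , q∈ , eq = ∈-++⁺ʳ (tabs (suc d) p m) (∈-concat⁺′
            (≡.subst (λ κ → (κ₀ , st ∷ʳ (suc m , κ)) ∈ map (append (suc m , coreList p)) (tabs d q m)) (≡.sym κ≡)
              (∈-map⁺ (append (suc m , coreList p)) (valid-tabs d q m V′)))
            (∈-map⁺ (λ q → map (append (suc m , coreList p)) (tabs d q m)) q∈))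
        where
        V′ : Valid d q m (κ₀ , st)
        V′ = record
          { steps = ℕₚ.suc-injective (≡.trans (≡.sym (≡.trans (Listₚ.length-++ st) (ℕₚ.+-comm _ 1))) (steps V))
          ; start = start V ; chain = proj₁ chain′ ; inc = proj₁ inc′ ; final = eq ; below = λ r∈ → s≤s⁻¹ (proj₂ inc′ r∈) }

    -- The two parts differ in whether `suc m` is a mark; within the second part, different covers
    -- lead to different shapes before the last step.
    tabs-unique : ∀ d p m → Unique (tabs d p m)
    tabs-unique zero    p m       = [] ∷ []
    tabs-unique (suc d) p zero    = []
    tabs-unique (suc d) p (suc m) = Uniqueₚ.++⁺ (tabs-unique (suc d) p m)
      (Uniqueₚ.concat⁺
        (Allₚ.map⁺ (All.tabulate λ {q} _ → Uniqueₚ.map⁺ append-injective (tabs-unique d q m)))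
        (AllPairsₚ.map⁺ (AllPairs.map disjoint (CoverList.walk-distinct p ℓ m))))
      (λ (a , b) → ℕₚ.<⇒≱ (ℕₚ.n<1+n m) (below (tabs-valid (suc d) p m a) (marked b)))
      where
      disjoint : ∀ {q q′} → CoverList.Distinct p q q′ → ∀ {T} →
        ¬ (T ∈ map (append (suc m , coreList p)) (tabs d q m) × T ∈ map (append (suc m , coreList p)) (tabs d q′ m))
      disjoint {q} {q′} (r , ne) (a , b) with ∈-map⁻ (append (suc m , coreList p)) a | ∈-map⁻ (append (suc m , coreList p)) b
      ... | T₁ , a′ , refl | T₂ , b′ , e with append-injective {T = T₁} {T₂} e
      ... | refl = ne (represents-parts {p = q} {q = q′} (coreList-represents q)
            (≡.subst (Represents q′) (≡.trans (≡.sym (final (tabs-valid d q′ m b′))) (final (tabs-valid d q m a′))) (coreList-represents q′)) r)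
      marked : ∀ {T} → T ∈ concat (map (λ q → map (append (suc m , coreList p)) (tabs d q m)) (CoverList.covers p m)) → suc m ∈ marks T
      marked T∈ with ∈-concat-map⁻ (λ q → map (append (suc m , coreList p)) (tabs d q m)) (CoverList.covers p m) T∈
      ... | q , q∈ , T∈′ with ∈-map⁻ (append (suc m , coreList p)) T∈′
      ... | (κ₀ , st) , _ , refl = ∈-map⁺ proj₁ (∈-++⁺ʳ st (here refl))

    module _ (λ′ : Vec ℕ ℓ) (bounded : ∀ i → lookup λ′ i ≤ k) (decreasing : ∀ i j → i ≤ᶠ j → lookup λ′ j ≤ lookup λ′ i) where

      private
        rows : ℕ → ℕ
        rows = part (Vec.toList λ′)

        rows-inside : ∀ {r} (lt : r < ℓ) → rows r ≡ lookup λ′ (Fin.fromℕ< lt)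
        rows-inside lt = ≡.trans (≡.cong rows (≡.sym (Finₚ.toℕ-fromℕ< lt))) (part-toList λ′ (Fin.fromℕ< lt))

        rows-outside : ∀ r → ℓ ≤ r → rows r ≡ 0
        rows-outside r le = part-outside (Vec.toList λ′) r (≡.subst (_≤ r) (≡.sym (Vecₚ.length-toList λ′)) le)

      ofVec : ParFun k ℓ
      ofVec = record { parts = rows ; anti = anti′ ; bound = bound′ ; outside = rows-outside }
        where
        anti′ : ∀ r → rows (suc r) ≤ rows r
        anti′ r with ℕₚ.<-≤-connex (suc r) ℓ
        ... | inj₂ ge = ≡.subst (_≤ rows r) (≡.sym (rows-outside (suc r) ge)) z≤n
        ... | inj₁ lt = ≡.subst₂ _≤_ (≡.sym (rows-inside lt)) (≡.sym (rows-inside lt′))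
                (decreasing (Fin.fromℕ< lt′) (Fin.fromℕ< lt)
                  (≡.subst₂ _≤_ (≡.sym (Finₚ.toℕ-fromℕ< lt′)) (≡.sym (Finₚ.toℕ-fromℕ< lt)) (ℕₚ.n≤1+n r)))
          where lt′ = ℕₚ.<-trans (ℕₚ.n<1+n r) lt
        bound′ : ∀ r → rows r ≤ k
        bound′ r with ℕₚ.<-≤-connex r ℓ
        ... | inj₂ ge = ≡.subst (_≤ k) (≡.sym (rows-outside r ge)) z≤n
        ... | inj₁ lt = ≡.subst (_≤ k) (≡.sym (rows-inside lt)) (bounded _)

      private
        p = ofVec

        zeros : List ℕ → List ℕ
        zeros xs = replicate (ℓ ∸ length xs) 0

        -- Equality after padding bounds the length by ℓ, so κ is represented by a partition with ℓ
        -- rows, which determines it.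
        padEq⇒core : ∀ {κ} → isCoreᵇ k κ ≡ true → padEqᵇ (pmap k κ) λ′ ≡ true → κ ≡ coreList p
        padEq⇒core {κ} c e = conclude (fromList {κ = κ} c len)
          where
          eq : pmap k κ ++ zeros (pmap k κ) ≡ Vec.toList λ′
          eq = listEq⇒≡ (pmap k κ ++ zeros (pmap k κ)) (Vec.toList λ′) e
          len : length κ ≤ ℓ
          len = ≡.subst₂ _≤_ (length-map-upTo _ (length κ)) (≡.trans (≡.cong length eq) (Vecₚ.length-toList λ′))
            (≡.subst (length (pmap k κ) ≤_) (≡.sym (Listₚ.length-++ (pmap k κ))) (ℕₚ.m≤m+n _ _))
          conclude : (∃ λ (q : ParFun k ℓ) → Represents q κ) → κ ≡ coreList p
          conclude (q , rep) = Represents-unique p (CoverList.represents-resp p {q = q} {q′ = p} same rep) (coreList-represents p)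
            where
            same : ∀ r → ParFun.parts q r ≡ rows r
            same r = ≡.trans (≡.sym (represents-pmap q rep r))
              (≡.trans (≡.sym (part-pad (pmap k κ) (ℓ ∸ length (pmap k κ)) r)) (≡.cong (λ xs → part xs r) eq))

        core⇒padEq : padEqᵇ (pmap k (coreList p)) λ′ ≡ true
        core⇒padEq = listEq-part (xs ++ zeros xs) (Vec.toList λ′)
          (≡.trans (Listₚ.length-++ xs {zeros xs}) (≡.trans (≡.cong (length xs ℕ.+_) (Listₚ.length-replicate (ℓ ∸ length xs)))
            (≡.trans (ℕₚ.m+[n∸m]≡n (≡.subst (_≤ ℓ) (≡.sym (length-map-upTo _ (length (coreList p)))) (represents-length (coreList-represents p))))
              (≡.sym (Vecₚ.length-toList λ′)))))
          (λ r → ≡.trans (part-pad xs (ℓ ∸ length xs) r) (represents-pmap p (coreList-represents p) r))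
          where xs = pmap k (coreList p)

      -- The bound ℓ on the marks comes from the last one, which marks a row of the core of the
      -- given partition; the others are smaller.
      VSMT⇒valid : ∀ d T → isVSMTᵇ k d λ′ T ≡ true → Valid d p ℓ T
      VSMT⇒valid d (κ₀ , st) e = record
        { steps = ≡ᵇ⇒≡ (proj₁ e₁) ; start = proj₁ e₂ ; chain = proj₁ e₃ ; inc = proj₁ e₄ ; final = fin ; below = below′ st (initLast st) (proj₁ e₃) (proj₁ e₄) fin }
        where
        e₁ = ∧-elim {length st ≡ᵇ d} e
        e₂ = ∧-elim {isCoreᵇ k κ₀} (proj₂ e₁)
        e₃ = ∧-elim {chainOKᵇ k κ₀ st} (proj₂ e₂)
        e₄ = ∧-elim {strictIncᵇ (map proj₁ st)} (proj₂ e₃)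
        fin : finalShape κ₀ st ≡ coreList p
        fin = padEq⇒core (final-core k κ₀ st (proj₁ e₂) (proj₁ e₃)) (proj₂ e₄)
        below′ : ∀ st → Data.List.InitLast st → chainOKᵇ k κ₀ st ≡ true → strictIncᵇ (map proj₁ st) ≡ true → finalShape κ₀ st ≡ coreList p →
          ∀ {r} → r ∈ map proj₁ st → r ≤ ℓ
        below′ .[] [] _ _ _ ()
        below′ .(st ∷ʳ (r , κ)) (st ∷ʳ′ (r , κ)) c i f {r′} r′∈ with
          CoverList.strong-mark-positive p {finalShape κ₀ st} {r} (≡.subst (λ κ → strongMarkedCoverᵇ k (finalShape κ₀ st) r κ ≡ true)
            (≡.trans (≡.sym (final-append κ₀ st r κ)) f)
            (proj₂ (∧-elim {chainOKᵇ k κ₀ st} (≡.trans (≡.sym (chainOK-append k κ₀ st r κ)) c))))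
        ... | m , refl , m<ℓ with ∈-++⁻ (map proj₁ st) (≡.subst (r′ ∈_) (marks-append st (suc m , κ)) r′∈)
        ... | inj₂ (here refl) = m<ℓ
        ... | inj₁ r′∈′ = ℕₚ.<⇒≤ (ℕₚ.<-≤-trans
                (proj₂ (strictInc-append⁻ (map proj₁ st) (suc m) (≡.trans (≡.sym (≡.cong strictIncᵇ (marks-append st (suc m , κ)))) i)) r′∈′) m<ℓ)

      valid⇒VSMT : ∀ d T {m} → Valid d p m T → isVSMTᵇ k d λ′ T ≡ true
      valid⇒VSMT d (κ₀ , st) V = ∧-intro (≡⇒≡ᵇ (steps V)) (∧-intro (start V) (∧-intro (chain V) (∧-intro (inc V)
        (≡.subst (λ κ → padEqᵇ (pmap k κ) λ′ ≡ true) (≡.sym (final V)) core⇒padEq))))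

      tabs-enum : ∀ d → EnumVSMT k d λ′ (tabs d p ℓ)
      tabs-enum d = tabs-unique d p ℓ , λ T → (λ m → valid⇒VSMT d T (tabs-valid d p ℓ m)) , (λ e → valid-tabs d p ℓ (VSMT⇒valid d T e))

      enum-↭ : ∀ d L → EnumVSMT k d λ′ L → ∀ m → filterᵇ (marksInᵇ m) L ↭ tabs d p m
      enum-↭ d L (u , spec) m = unique-set⇒↭ (Uniqueₚ.filter⁺ (T? ∘ marksInᵇ m) u) (tabs-unique d p m)
        (λ {T} T∈ → let T∈L , e = ∈-filterᵇ⁻ {p = marksInᵇ m} {xs = L} T∈ ; V = VSMT⇒valid d T (proj₁ (spec T) T∈L) in
          valid-tabs d p m record
            { steps = steps V ; start = start V ; chain = chain V ; inc = inc V ; final = final V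
            ; below = λ r∈ → ≤ᵇ⇒≤ (allᵇ⁻ {p = λ r → r ≤ᵇ m} e r∈) })
        (λ {T} T∈ → let V = tabs-valid d p m T∈ in
          ∈-filterᵇ⁺ {p = marksInᵇ m} (proj₂ (spec T) (valid⇒VSMT d T V)) (allᵇ⁺ (marks T) λ r∈ → ≤⇒≤ᵇ (below V r∈)))

-- The expansion by induction on the number of marks, and both identities.

module Expansions where
  open import Algebra.Bundles using (CommutativeRing)
  open import Data.Nat as ℕ using (ℕ; zero; suc; s≤s; s≤s⁻¹; _<?_; _∸_; _≤ᵇ_; _≡ᵇ_; _≤_; _<_)
  open import Data.Integer as ℤ using (ℤ; +_)
  open import Data.Vec using (Vec; []; _∷_; lookup; tabulate)
  open import Data.List.Relation.Binary.Permutation.Propositional using (_↭_)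
  open import Data.List.Relation.Unary.Any using (here; there)
  open import Data.List.Relation.Unary.AllPairs using ([]; _∷_)
  open RaisingOperators
  open RootStraightening
  open BounceGraphs
  open CoverWeights
  open Cores
  open StrongCovers
  open SchurFunctionals
  open VerticalTableaux

  open CoreFacts using (Represents; coreList; coreList-represents; represents-pmap)

  module Expansion (R : CommutativeRing 0ℓ 0ℓ) (h : ℕ → CommutativeRing.Carrier R) (k ℓ : ℕ) where
    open CommutativeRing R hiding (zero) renaming (refl to ≈-refl; sym to ≈-sym; trans to ≈-trans)
    open import Algebra.Properties.Ring ring using (+-cancelʳ; +-identityˡ-unique)
    open Sym R h using (Hc; sumList)
    open SchurFunctional R h ℓ
    open Straightening R ℓ
    open Tableaux k ℓ

    sh-sumList : ∀ {A : Set} s (g : A → ℕ → Carrier) xs n → sh s (λ n → sumList (map (λ x → g x n) xs)) n ≈ sumList (map (λ x → sh s (g x) n) xs)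
    sh-sumList s g []       n = sh-0 s (λ _ → ≈-refl) n
    sh-sumList s g (x ∷ xs) n = ≈-trans (sh-+ s (g x) _ n) (+-congˡ (sh-sumList s g xs n))

    sh-if : ∀ s G n → (if s ≤ᵇ n then G (n ∸ s) else 0#) ≈ sh s G n
    sh-if zero    G n       = ≈-refl
    sh-if (suc s) G zero    = ≈-refl
    sh-if (suc zero)    G (suc n) = ≈-refl
    sh-if (suc (suc s)) G (suc n) = sh-if (suc s) G n

    down : ParFun k ℓ → ℕ → ℕ
    down p = Bounce.down p

    weightOf : ParFun k ℓ → Weight
    weightOf p = toW (ParFun.parts p)

    -- By `H-E`, this is the coefficient of the sum over the `d`-element sets of rows below `m`, as
    -- a single value of `H`.
    X : ℕ → ParFun k ℓ → ℕ → ℕ → Carrier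
    X d p m n = H (E (upTo m) d schur) (roots (down p)) n (weightOf p)

    kSchur : Tab → ℕ → Carrier
    kSchur T = kSchurCoeff R h k (insideV ℓ k T)

    term : ℕ → Tab → Carrier
    term n T = sh (spinT T) (kSchur T) n

    kSchur-core : ∀ p n → kSchur (coreList p , []) n ≈ X 0 p 0 n
    kSchur-core p n = Hc-roots {v = insideV ℓ k (coreList p , [])} (λ i → ≡.sym (value i)) (ParFun.bound p) n
      (λ i → ≡.trans (≡.cong +_ (≡.sym (value i))) (≡.sym (Vecₚ.lookup-map i (λ x → + x) (insideV ℓ k (coreList p , [])))))
      where
      value : ∀ i → lookup (insideV ℓ k (coreList p , [])) i ≡ ParFun.parts p (toℕ i)
      value i = ≡.trans (Vecₚ.lookup∘tabulate (part (pmap k (coreList p)) ∘ toℕ) i) (represents-pmap p (coreList-represents p) (toℕ i))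

    X-zero : ∀ p m n → X 0 p m n ≈ X 0 p 0 n
    X-zero p m n = H-cong (λ γ → E-zero (upTo m) schur γ) (roots (down p)) n _

    upTo-suc : ∀ m → upTo (suc m) ↭ m ∷ upTo m
    upTo-suc m = unique-set⇒↭ (Uniqueₚ.upTo⁺ (suc m))
      (All.tabulate (λ i∈ e → ℕₚ.<⇒≢ (∈-upTo⁻ i∈) (≡.sym e)) ∷ Uniqueₚ.upTo⁺ m)
      (λ i∈ → [ there ∘ ∈-upTo⁺ , here ]′ (ℕₚ.m≤n⇒m<n∨m≡n (s≤s⁻¹ (∈-upTo⁻ i∈))))
      (λ { (here refl) → ∈-upTo⁺ (ℕₚ.n<1+n m) ; (there i∈) → ∈-upTo⁺ (ℕₚ.m<n⇒m<1+n (∈-upTo⁻ i∈)) })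

    X-suc : ∀ d p m n → X (suc d) p (suc m) n ≈ X (suc d) p m n + H (E (upTo m) d schur) (roots (down p)) n (weightOf p ⊖ε m)
    X-suc d p m n = ≈-trans (H-cong (λ γ → E-↭ schur-ext (upTo-suc m) (suc d) γ) (roots (down p)) n _)
      (H-+ (E-ext (upTo m) d schur-ext) m (roots (down p)) n _)

    module _ (p : ParFun k ℓ) (d m : ℕ) where
      private
        F = E (upTo m) d schur
      open Bounce p hiding (down)
      open CoverH R p using (module WithFunctional)
      open WithFunctional F (E-ext (upTo m) d schur-ext)
        (λ r e lt → E-negative (upTo m) d {schur} r (λ {γ} → schur-negative {γ} r e) lt) m
        (λ x sx<ℓ side → alt-E-upTo schur-ext (schur-alt x sx<ℓ) m side d)
      open CoverList p

      private
        κ = coreList p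
        contribution : ParFun k ℓ → ℕ → Carrier
        contribution q n = sh (spin (coreList q) (suc m) κ) (X d q m) n
        G : ℕ → ℕ → Carrier
        G z n = H F (roots (down p)) n (weightOf p ⊖ε z)

        walk-empty : ∀ f {z} → ℓ ≤ z → walk f z ≡ []
        walk-empty zero        le = refl
        walk-empty (suc f) {z} le with z <? ℓ
        ... | yes lt = ⊥-elim (ℕₚ.<⇒≱ lt le)
        ... | no _   = refl

      -- After `i` peelings the factor is t to the power `i`. Each visited row contributes its
      -- cover, where straightening adds `g * suc C` to the exponent and completes the spin, or
      -- nothing.
      walk-sum : ∀ f {i} z → Through m i z → z < ℓ → ℓ ≤ f ℕ.+ z → ∀ n →
        sh i (G z) n ≈ sumList (map (λ q → contribution q n) (walk f z))
      walk-sum zero    z th z<ℓ fuel n = ⊥-elim (ℕₚ.<⇒≱ z<ℓ fuel)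
      walk-sum (suc f) {i} z th z<ℓ fuel n = ≈-trans (peeled (ℕₚ.<-≤-connex (down p z) ℓ)) (head (z <? ℓ))
        where
        rest = sumList (map (λ q → contribution q n) (walk f (down p z)))
        marked : Marked z
        marked ch = i , th ch
        peeled : down p z < ℓ ⊎ ℓ ≤ down p z → sh i (G z) n ≈ sh i (truncated z) n + rest
        peeled (inj₁ lt) = ≈-trans (sh-cong i (peel z<ℓ lt) n) (≈-trans (sh-+ i (truncated z) (sh 1 (G (down p z))) n)
          (+-congˡ (≈-trans (sh-sh i 1 (G (down p z)) n)
            (≈-trans (reflexive (≡.cong (λ s → sh s (G (down p z)) n) (ℕₚ.+-comm i 1)))
              (walk-sum f (down p z) (through-down th) lt
                (ℕₚ.≤-trans fuel (≡.subst (_≤ f ℕ.+ down p z) (ℕₚ.+-suc f z) (ℕₚ.+-monoʳ-≤ f (down> z)))) n)))))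
        peeled (inj₂ ge) = ≈-trans (sh-cong i (peel-last ge) n) (≈-trans (≈-sym (+-identityʳ _))
          (+-congˡ (reflexive (≡.cong (λ qs → sumList (map (λ q → contribution q n) qs)) (≡.sym (walk-empty f ge))))))
        first : (c : Cover z) → sh i (truncated z) n ≈ contribution (covered p c) n
        first c@(C , u , w , g , ic) = ≈-trans (sh-cong i (covered-H ic marked) n) (≈-trans (sh-sh i (g ℕ.* suc C) _ n)
          (reflexive (≡.cong (λ s → sh s (X d (covered p c) m) n) (≡.sym spin≡))))
          where
          level = th (IsCover.ch ic)
          spin≡ : spin (coreList (covered p c)) (suc m) κ ≡ i ℕ.+ g ℕ.* suc C
          spin≡ = ≡.trans (≡.cong (λ r → spin (coreList (covered p c)) (suc r) κ) (≡.sym (proj₂ level)))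
            (≡.trans (strong-spin {p = p} c (coreList-represents p) (coreList-represents (covered p c)) (proj₁ level))
              (≡.trans (ℕₚ.+-comm _ i) (≡.cong (i ℕ.+_) (ℕₚ.*-comm (suc C) g))))
        head : Dec (z < ℓ) → sh i (truncated z) n + rest ≈ sumList (map (λ q → contribution q n) (walk (suc f) z))
        head _ with z <? ℓ
        ... | no nlt = ⊥-elim (nlt z<ℓ)
        ... | yes lt with cover? z lt
        ...   | yes c = +-congʳ (first c)
        ...   | no nc = ≈-trans (+-congʳ (sh-0 i (not-covered marked z<ℓ nc) n)) (+-identityˡ _)

      covers-sum : m < ℓ → ∀ n → G m n ≈ sumList (map (λ q → contribution q n) (covers m))
      covers-sum m<ℓ n = walk-sum ℓ m (through-start m) m<ℓ (ℕₚ.m≤m+n ℓ m) n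

    sumList-concat : ∀ {A B : Set} (f : B → Carrier) (g : A → List B) xs →
      sumList (map f (concat (map g xs))) ≈ sumList (map (λ x → sumList (map f (g x))) xs)
    sumList-concat f g []       = ≈-refl
    sumList-concat f g (x ∷ xs) = ≈-trans (sumList-++ f (g x) _) (+-congˡ (sumList-concat f g xs))

    -- A cover `q` turns its term into `X d q m`, with one element fewer and the same functional;
    -- this is how `tabs` recurses.
    expansion : ∀ d p m → m ≤ ℓ → ∀ n → X d p m n ≈ sumList (map (term n) (tabs d p m))
    expansion zero    p m       le n = ≈-trans (X-zero p m n) (≈-trans (≈-sym (kSchur-core p n)) (≈-sym (+-identityʳ _)))
    expansion (suc d) p zero    le n = H-0 (roots (down p)) n _
    expansion (suc d) p (suc m) lt n = ≈-trans (X-suc d p m n) (≈-trans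
      (+-cong (expansion (suc d) p m (ℕₚ.<⇒≤ lt) n) (≈-trans (covers-sum p d m lt n) (≈-trans
        (sumList-cong (CoverList.covers p m) (λ {q} _ → last-step q))
        (≈-sym (sumList-concat (term n) extend (CoverList.covers p m))))))
      (≈-sym (sumList-++ (term n) (tabs (suc d) p m) _)))
      where
      s = (suc m , coreList p)
      extend : ParFun k ℓ → List Tab
      extend q = map (append s) (tabs d q m)
      last-step : ∀ q → sh (spin (coreList q) (suc m) (coreList p)) (X d q m) n ≈ sumList (map (term n) (extend q))
      last-step q = ≈-trans (sh-cong σq (expansion d q m (ℕₚ.<⇒≤ lt)) n)
        (≈-trans (sh-sumList σq (λ T n → term n T) (tabs d q m) n)
        (≈-trans (sumList-cong (tabs d q m) (λ {T} T∈ → ≈-trans (sh-sh σq (spinT T) (kSchur T) n)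
          (reflexive (≡.cong (λ x → sh x (kSchur T) n) (≡.sym (spin≡ T T∈))))))
        (reflexive (≡.cong sumList (Listₚ.map-∘ (tabs d q m))))))
        where
        σq = spin (coreList q) (suc m) (coreList p)
        spin≡ : ∀ T → T ∈ tabs d q m → spinT (append s T) ≡ σq ℕ.+ spinT T
        spin≡ (κ₀ , st) T∈ = ≡.trans (spin-append κ₀ st (suc m) (coreList p))
          (≡.trans (≡.cong (λ τ → spinChain κ₀ st ℕ.+ spin τ (suc m) (coreList p)) (Valid.final (tabs-valid d q m T∈)))
            (ℕₚ.+-comm _ σq))

    subtract-before : ∀ {l} a (S : Vec Bool l) γ {r} → r < a → subtract a S γ r ≡ γ r
    subtract-before a []          γ lt = refl
    subtract-before a (false ∷ S) γ lt = subtract-before (suc a) S γ (ℕₚ.m<n⇒m<1+n lt)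
    subtract-before a (true ∷ S)  γ lt = ≡.trans (subtract-before (suc a) S (γ ⊖ε a) (ℕₚ.m<n⇒m<1+n lt))
      (⊖ε-other γ (ℕₚ.<⇒≢ lt ∘ ≡.sym))
      where
      ⊖ε-other : ∀ γ {i r} → i ≢ r → (γ ⊖ε i) r ≡ γ r
      ⊖ε-other γ ne = ≡.trans (≡.cong (λ d → γ _ ℤ.- d) (δ-≢ ne)) (ℤₚ.+-identityʳ _)
        where import Data.Integer.Properties as ℤₚ

    subtract-minusEps : ∀ {l} a (v : Vec ℕ l) (S : Vec Bool l) γ → (∀ i → γ (a ℕ.+ toℕ i) ≡ + lookup v i) →
      ∀ i → subtract a S γ (a ℕ.+ toℕ i) ≡ lookup (minusEps v S) i
    subtract-minusEps a (x ∷ v) (false ∷ S) γ e fzero = ≡.trans (≡.cong (subtract (suc a) S γ) (ℕₚ.+-identityʳ a))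
      (≡.trans (subtract-before (suc a) S γ (ℕₚ.n<1+n a)) (≡.trans (≡.cong γ (≡.sym (ℕₚ.+-identityʳ a))) (e fzero)))
    subtract-minusEps a (x ∷ v) (true ∷ S) γ e fzero = ≡.trans (≡.cong (subtract (suc a) S (γ ⊖ε a)) (ℕₚ.+-identityʳ a))
      (≡.trans (subtract-before (suc a) S (γ ⊖ε a) (ℕₚ.n<1+n a))
        (≡.cong₂ ℤ._-_ (≡.trans (≡.cong γ (≡.sym (ℕₚ.+-identityʳ a))) (e fzero)) (δ-≡ {a} refl)))
    subtract-minusEps a (x ∷ v) (false ∷ S) γ e (fsuc i) = ≡.trans (≡.cong (subtract (suc a) S γ) (ℕₚ.+-suc a (toℕ i)))
      (subtract-minusEps (suc a) v S γ (λ i → ≡.trans (≡.cong γ (≡.sym (ℕₚ.+-suc a (toℕ i)))) (e (fsuc i))) i)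
    subtract-minusEps a (x ∷ v) (true ∷ S) γ e (fsuc i) = ≡.trans (≡.cong (subtract (suc a) S (γ ⊖ε a)) (ℕₚ.+-suc a (toℕ i)))
      (subtract-minusEps (suc a) v S (γ ⊖ε a) (λ i → ≡.trans
        (≡.trans (≡.cong (λ d → γ (suc a ℕ.+ toℕ i) ℤ.- d) (δ-≢ (ℕₚ.<⇒≢ (s≤s (ℕₚ.m≤m+n a (toℕ i)))))) (ℤₚ.+-identityʳ _))
        (≡.trans (≡.cong γ (≡.sym (ℕₚ.+-suc a (toℕ i)))) (e (fsuc i)))) i)
      where import Data.Integer.Properties as ℤₚ

    module _ (λ′ : Vec ℕ ℓ) (bounded : ∀ i → lookup λ′ i ≤ k) (decreasing : ∀ i j → i ≤ᶠ j → lookup λ′ j ≤ lookup λ′ i) where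
      open Sides R h
      private
        p = ofVec λ′ bounded decreasing

        coefficient : ℕ → Vec Bool ℓ → Carrier
        coefficient n S = Hc (Δk k λ′) n (minusEps λ′ S)

      lhs1-X : ∀ d m n → m ≤ ℓ → lhs1 k λ′ d m n ≈ X d p m n
      lhs1-X d m n le = ≈-trans
        (sumList-cong (filterᵇ (λ S → (card S ≡ᵇ d) ∧ subsetOfᵇ m S) (allSubsets ℓ)) (λ {S} _ →
          Hc-roots {v = λ′} (part-toList λ′) (ParFun.bound p) n {subtract 0 S (weightOf p)} {minusEps λ′ S}
            (subtract-minusEps 0 λ′ S (weightOf p) (λ i → ≡.cong +_ (part-toList λ′ i)))))
        (≈-trans (subset-sum (H schur (roots (down p)) n) m d 0 (weightOf p) le)
        (≈-trans (reflexive (≡.cong (λ is → E is d (H schur (roots (down p)) n) (weightOf p)) (interval-applyUpTo 0 m id (λ _ → refl))))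
          (≈-sym (H-E schur-ext (upTo m) d (roots (down p)) n (weightOf p)))))

      rhs1-X : ∀ d L → EnumVSMT k d λ′ L → ∀ m n → m ≤ ℓ → rhs1 ℓ k L m n ≈ X d p m n
      rhs1-X d L enum m n le = ≈-trans (sumList-↭ (rhsTerm ℓ k n) (enum-↭ λ′ bounded decreasing d L enum m))
        (≈-trans (sumList-cong (tabs d p m) (λ {T} _ → sh-if (spinT T) (kSchur T) n)) (≈-sym (expansion d p m le n)))

      equation₁ : ∀ d L → EnumVSMT k d λ′ L → ∀ m n → m ≤ ℓ → lhs1 k λ′ d m n ≈ rhs1 ℓ k L m n
      equation₁ d L enum m n le = ≈-trans (lhs1-X d m n le) (≈-sym (rhs1-X d L enum m n le))

      -- The sets (resp. marks) bounded by m + 1 either have maximum m + 1 or are bounded by m.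
      private
        false≢true : ¬ (false ≡ true)
        false≢true ()

        Split : Bool → Bool → Bool → Set
        Split P Q Q′ = (P ≡ false × Q ≡ false × Q′ ≡ false) ⊎ (P ≡ true × Q ≡ true × Q′ ≡ false) ⊎ (P ≡ true × Q ≡ false × Q′ ≡ true)

        split-intro : ∀ {P A Q′} → (Q′ ≡ true → P ≡ true) → (Q′ ≡ true → A ≡ false) → (P ≡ true → A ≡ false → Q′ ≡ true) → Split P (A ∧ P) Q′
        split-intro {false} {A} {false} f g h = inj₁ (refl , Boolₚ.∧-zeroʳ A , refl)
        split-intro {false} {A} {true}  f g h = ⊥-elim (false≢true (f refl))
        split-intro {true} {true}  {false} f g h = inj₂ (inj₁ (refl , refl , refl))
        split-intro {true} {true}  {true}  f g h = ⊥-elim (false≢true (≡.sym (g refl)))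
        split-intro {true} {false} {false} f g h = ⊥-elim (false≢true (h refl refl))
        split-intro {true} {false} {true}  f g h = inj₂ (inj₂ (refl , refl , refl))

        ∧-split : ∀ b {P Q Q′} → Split P Q Q′ → Split (b ∧ P) (b ∧ Q) (b ∧ Q′)
        ∧-split true  s = s
        ∧-split false _ = inj₁ (refl , refl , refl)

        ≤-pred-≢ : ∀ {x m} → x ≤ suc m → x ≢ suc m → x ≤ m
        ≤-pred-≢ le ne = s≤s⁻¹ (ℕₚ.≤∧≢⇒< le ne)

        subset-split : ∀ m (S : Vec Bool ℓ) → Split (subsetOfᵇ (suc m) S) (maxIsᵇ (suc m) S) (subsetOfᵇ m S)
        subset-split m S = split-intro
          (λ e → allᵇ⁺ {p = bounded-by (suc m)} (allFin ℓ) λ {i} i∈ → mono i (allᵇ⁻ {p = bounded-by m} e i∈))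
          (λ e → ≢true λ e′ → let i , i∈ , q = anyᵇ⁻ {p = hits} (allFin ℓ) e′ ; Si , eq = ∧-elim {lookup S i} q in
            ℕₚ.n≮n m (≡.subst (_≤ m) (≡ᵇ⇒≡ eq) (bound-of m i Si (allᵇ⁻ {p = bounded-by m} e i∈))))
          (λ e no-hit → allᵇ⁺ {p = bounded-by m} (allFin ℓ) λ {i} i∈ → below i (allᵇ⁻ {p = bounded-by (suc m)} e i∈)
            (λ Si eq → false≢true (≡.trans (≡.sym no-hit) (anyᵇ⁺ {p = hits} i∈ (∧-intro Si (≡⇒≡ᵇ eq))))))
          where
          bounded-by : ℕ → Fin ℓ → Bool
          bounded-by m i = not (lookup S i) ∨ (suc (toℕ i) ≤ᵇ m)
          hits : Fin ℓ → Bool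
          hits i = lookup S i ∧ (suc (toℕ i) ≡ᵇ suc m)
          bound-of : ∀ m i → lookup S i ≡ true → bounded-by m i ≡ true → suc (toℕ i) ≤ m
          bound-of m i Si e = ≤ᵇ⇒≤ ([ (λ n → ⊥-elim (not-elim n Si)) , id ]′ (∨-elim {not (lookup S i)} e))
          introduce : ∀ m i → (lookup S i ≡ true → suc (toℕ i) ≤ m) → bounded-by m i ≡ true
          introduce m i f with lookup S i
          ... | false = refl
          ... | true  = ≤⇒≤ᵇ (f refl)
          mono : ∀ i → bounded-by m i ≡ true → bounded-by (suc m) i ≡ true
          mono i e = introduce (suc m) i λ Si → ℕₚ.m≤n⇒m≤1+n (bound-of m i Si e)
          below : ∀ i → bounded-by (suc m) i ≡ true → (lookup S i ≡ true → suc (toℕ i) ≢ suc m) → bounded-by m i ≡ true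
          below i e ne = introduce m i λ Si → ≤-pred-≢ (bound-of (suc m) i Si e) (ne Si)

        marks-split : ∀ m T → Split (marksInᵇ (suc m) T) (marksMaxᵇ (suc m) T) (marksInᵇ m T)
        marks-split m T = split-intro
          (λ e → allᵇ⁺ {p = λ r → r ≤ᵇ suc m} (marks T) λ {r} r∈ → ≤⇒≤ᵇ (ℕₚ.m≤n⇒m≤1+n (bound-of m e r∈)))
          (λ e → ≢true λ e′ → let r , r∈ , q = anyᵇ⁻ {p = λ r → r ≡ᵇ suc m} (marks T) e′ in
            ℕₚ.n≮n m (≡.subst (_≤ m) (≡ᵇ⇒≡ {r} {suc m} q) (bound-of m e r∈)))
          (λ e no-hit → allᵇ⁺ {p = λ r → r ≤ᵇ m} (marks T) λ {r} r∈ → ≤⇒≤ᵇ (≤-pred-≢ (bound-of (suc m) e r∈)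
            (λ eq → false≢true (≡.trans (≡.sym no-hit) (anyᵇ⁺ {p = λ r → r ≡ᵇ suc m} r∈ (≡⇒≡ᵇ {r} {suc m} eq))))))
          where
          bound-of : ∀ m → marksInᵇ m T ≡ true → ∀ {r} → r ∈ marks T → r ≤ m
          bound-of m e {r} r∈ = ≤ᵇ⇒≤ {r} {m} (allᵇ⁻ {p = λ r → r ≤ᵇ m} e r∈)

      equation₂ : ∀ d L → EnumVSMT k d λ′ L → ∀ m n → m < ℓ → lhs2 k λ′ d (suc m) n ≈ rhs2 ℓ k L (suc m) n
      equation₂ d L enum m n lt = +-cancelʳ (lhs1 k λ′ d m n) _ _ (≈-trans
        (≈-sym (sumList-split (coefficient n) (λ S → (card S ≡ᵇ d) ∧ subsetOfᵇ (suc m) S) (λ S → (card S ≡ᵇ d) ∧ maxIsᵇ (suc m) S)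
          (λ S → (card S ≡ᵇ d) ∧ subsetOfᵇ m S) (allSubsets ℓ) (λ {S} _ → ∧-split (card S ≡ᵇ d) (subset-split m S))))
        (≈-trans (equation₁ d L enum (suc m) n lt)
        (≈-trans (sumList-split (rhsTerm ℓ k n) (marksInᵇ (suc m)) (marksMaxᵇ (suc m)) (marksInᵇ m) L (λ {T} _ → marks-split m T))
          (+-congˡ (≈-sym (equation₁ d L enum m n (ℕₚ.<⇒≤ lt)))))))

open import Data.Nat using (ℕ; suc; s≤s; _≤_)
open import Data.Vec using (Vec; lookup)
open import Algebra.Bundles using (CommutativeRing)
open Expansions using (module Expansion)
open VerticalTableaux using (module Tableaux)

theorem9p3 : (k ℓ : ℕ) → 1 ≤ k → 1 ≤ ℓ →
    (λ′ : Vec ℕ ℓ) → (∀ i → lookup λ′ i ≤ k) → (∀ i j → i ≤ᶠ j → lookup λ′ j ≤ lookup λ′ i) →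
    (d m : ℕ) → 1 ≤ m → m ≤ ℓ →
    (∃ λ (L : List Tab) → EnumVSMT k d λ′ L) ×
    (∀ (L : List Tab) → EnumVSMT k d λ′ L →
    (R : CommutativeRing 0ℓ 0ℓ) (h : ℕ → CommutativeRing.Carrier R) (n : ℕ) →
    CommutativeRing._≈_ R (Sides.lhs1 R h k λ′ d m n) (Sides.rhs1 R h ℓ k L m n) ×
    CommutativeRing._≈_ R (Sides.lhs2 R h k λ′ d m n) (Sides.rhs2 R h ℓ k L m n))
theorem9p3 k ℓ _ _ λ′ bounded decreasing d (suc m) (s≤s _) m<ℓ =
  (_ , Tableaux.tabs-enum k ℓ λ′ bounded decreasing d) ,
  λ L enum R h n → let open Expansion R h k ℓ in
    equation₁ λ′ bounded decreasing d L enum (suc m) n m<ℓ , equation₂ λ′ bounded decreasing d L enum m n m<ℓ
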